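{- Fix an integer $m\ge1$. For $g\ge0$, $n\ge1$, let $C^{(m)}_{g,n}$ be the number of rooted $m$-constellations of genus $g$ with $n$ star vertices. Then for all $g\ge 0$ and $n\ge1$, \[ \binom{n}{2}C^{(m)}_{g,n}=\sum_{\substack{n_1+n_2=n\\ n_1,n_2\geq 1\\ g_1+g_2+g^*=g}} n_1\binom{(m-1)n_2+2-2g_2}{2g^*+2}C^{(m)}_{g_1,n_1}C^{(m)}_{g_2,n_2}, \] where $g_1,g_2,g^*$ range over nonnegative integers.
   Context: A map is a connected multigraph embedded in a compact oriented surface such that the complement of the graph is a disjoint union of open disks (faces), considered up to orientation-preserving homeomorphism; its genus is the genus of the surface. An $m$-constellation is a map with two kinds of vertices: colored vertices, each carrying a color in $\{1,\dots,m\}$, and star vertices; every edge joins a star vertex to a colored vertex, every star vertex has degree $m$ and its neighbors have colors $1,2,\dots,m$ in clockwise cyclic order. An $m$-constellation is rooted if one star vertex is distinguished. -}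

module Defs where

open import Data.Bool.Base using (Bool; true; false; _∧_; _∨_; not; if_then_else_)
open import Data.Nat.Base using (ℕ; zero; suc; _+_; _*_; _∸_; _≤ᵇ_; _≡ᵇ_; _!; _/_; _%_)
open import Data.Nat.DivMod using (m%n<n)
open import Data.Nat.Properties using (_!≢0)
open import Data.Nat.Combinatorics using (_C_)
open import Data.Fin.Base using (Fin; toℕ; fromℕ<)
open import Data.Fin.Properties using (_≟_)
open import Data.Product.Base using (_×_; _,_; proj₁; proj₂)
open import Data.Vec.Base using (Vec; []; _∷_; lookup)
open import Data.List.Base using (List; []; _∷_; [_]; map; concatMap; filterᵇ; length; allFin; upTo; cartesianProduct)
open import Data.Bool.ListAction using (all; any)
open import Data.Nat.ListAction using (sum)
open import Relation.Nullary.Decidable.Core using (⌊_⌋)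

iter : {A : Set} → (A → A) → ℕ → A → A
iter f zero x = x
iter f (suc j) x = f (iter f j x)

vecsOver : {A : Set} → List A → (k : ℕ) → List (Vec A k)
vecsOver xs zero = [ [] ]
vecsOver xs (suc k) = concatMap (λ x → map (x ∷_) (vecsOver xs k)) xs

-- Number of cycles of a permutation f of a finite set with N elements,
-- enumerated by the list xs and injectively keyed into ℕ by `key`:
-- the number of elements x that are the key-minimum of their orbit
-- (orbits have length ≤ N, so j = 1..N suffices).
cycles : {A : Set} → List A → (A → ℕ) → ℕ → (A → A) → ℕ
cycles xs key N f =
  length (filterᵇ (λ x → all (λ j → key x ≤ᵇ key (iter f (suc j) x)) (upTo N)) xs)

_==_ : ∀ {n} → Fin n → Fin n → Bool
i == j = ⌊ i ≟ j ⌋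

-- Labelled m-constellations with n star vertices.
--
-- Star vertices are labelled by Fin n, edges are the pairs (s , i) with
-- s : Fin n a star vertex and i : Fin m the colour of its neighbour.
-- The clockwise rotation at star vertex s is (s , i) ↦ (s , i+1 mod m).
-- A colour-i vertex is a cycle of a permutation τ i of Fin n giving the
-- clockwise rotation of edges of colour i around colour-i vertices
-- (s , i) ↦ (τ i s , i).  Thus a labelled m-constellation is a tuple
-- τ : Vec (Perm (Fin n)) m which is connected.

next : ∀ {m} → Fin m → Fin m
next {suc k} i = fromℕ< (m%n<n (suc (toℕ i)) (suc k))

Tuple : ℕ → ℕ → Set
Tuple m n = Vec (Vec (Fin n) n) m

allTuples : (m n : ℕ) → List (Tuple m n)
allTuples m n = vecsOver (vecsOver (allFin n) n) m

isPerm : ∀ {n} → Vec (Fin n) n → Bool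
isPerm {n} v = all (λ i → all (λ j → not (lookup v i == lookup v j) ∨ (i == j)) (allFin n)) (allFin n)

τ : ∀ {m n} → Tuple m n → Fin m → Fin n → Fin n
τ t i s = lookup (lookup t i) s

reach : ∀ {m n} → Tuple m n → Fin n → ℕ → Fin n → Bool
reach t r zero s = r == s
reach {m} {n} t r (suc k) s =
  reach t r k s ∨ any (λ i → any (λ s' → reach t r k s' ∧ (τ t i s' == s)) (allFin n)) (allFin m)

isConnected : ∀ {m n} → Tuple m n → Bool
isConnected {m} {n} t = all (λ r → all (λ s → reach t r n s) (allFin n)) (allFin n)

Edge : ℕ → ℕ → Set
Edge m n = Fin n × Fin m

allEdges : (m n : ℕ) → List (Edge m n)
allEdges m n = cartesianProduct (allFin n) (allFin m)

edgeKey : ∀ {m n} → Edge m n → ℕ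
edgeKey {m} (s , i) = toℕ s * m + toℕ i

-- face permutation: rotation at colored vertex followed by rotation at star vertex
faceπ : ∀ {m n} → Tuple m n → Edge m n → Edge m n
faceπ t (s , i) = (τ t i s , next i)

#coloredVertices : ∀ {m n} → Tuple m n → ℕ
#coloredVertices {m} {n} t = sum (map (λ i → cycles (allFin n) toℕ n (τ t i)) (allFin m))

#faces : ∀ {m n} → Tuple m n → ℕ
#faces {m} {n} t = cycles (allEdges m n) edgeKey (n * m) (faceπ t)

-- Euler's formula V - E + F = 2 - 2g, i.e. V + F + 2g = E + 2,
-- with V = n + #colored vertices, E = n*m.
hasGenus : ∀ {m n} → ℕ → Tuple m n → Bool
hasGenus {m} {n} g t = (n + #coloredVertices t + #faces t + 2 * g) ≡ᵇ (n * m + 2)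

isConstellation : ∀ {m n} → ℕ → Tuple m n → Bool
isConstellation g t = all isPerm (Data.Vec.Base.toList t) ∧ isConnected t ∧ hasGenus g t
  where import Data.Vec.Base

labelledCount : (m g n : ℕ) → ℕ
labelledCount m g n = length (filterᵇ (isConstellation g) (allTuples m n))

-- C^{(m)}_{g,n}: rooted constellations (root = a star vertex).  Since an
-- automorphism fixing a star vertex is trivial, each rooted constellation
-- corresponds to exactly (n-1)! labellings with the root labelled 0.
C[_]_,_ : (m g n : ℕ) → ℕ
C[ m ] g , n = labelledCount m g n / ((n ∸ 1) !)
  where instance _ = (n ∸ 1) !≢0

rhs : (m g n : ℕ) → ℕ
rhs m g n =
  sum (map (λ k → let n₁ = suc k ; n₂ = n ∸ n₁ in
    sum (map (λ g₁ →
      sum (map (λ g₂ → let g* = (g ∸ g₁) ∸ g₂ in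
        n₁ * ((((m ∸ 1) * n₂ + 2) ∸ 2 * g₂) C (2 * g* + 2))
           * (C[ m ] g₁ , n₁) * (C[ m ] g₂ , n₂))
        (upTo (suc (g ∸ g₁)))))
      (upTo (suc g))))
    (upTo (n ∸ 1)))

{-# OPTIONS --safe #-}
module Submission where

-- Give every cycle of the permutations of a constellation, and every face, one
-- of N colours.  Let Z_N be the exponential generating function, in the number
-- n of star vertices, of all coloured m-tuples of permutations of n points,
-- connected or not.
--
-- Z_N is a determinant.  For a permutation σ let p_σ be the power sum polynomial
-- in x_1, …, x_N given by the cycle type of σ, and let a be the Vandermonde
-- determinant.  The sum of all transpositions acts on a·p_σ by a second order
-- operator diagonal on monomials, hence the Jucys–Murphy elements act by
-- X_k = Σ_i x_i (x_i ∂_i + 1)^k.  Since Σ_τ N^{cycles τ} τ is the product of the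
-- elements N + J_k, one gets Z_N as the value of exp(z X_m) a at x = (1, …, 1)
-- divided by a, that is the determinant of
--   b_{ij}(z) = Σ_n ((j+n)!/j!)^m C(j+n, i) z^n/n!,     0 ≤ i, j < N.
-- As d/dz shifts the columns and z d/dz the rows of b, the Desnanot–Jacobi
-- identity is the Toda equation, with D = z d/dz,
--   Z_N D²Z_N − (D Z_N)² = z N^{m+1} Z_{N+1} Z_{N−1}.
--
-- By the exponential formula D Z_N = g_N Z_N where g_N counts rooted connected
-- tuples, and the logarithmic derivative of the Toda equation reads
--   D²g_N − D g_N = (g_{N+1} + g_{N−1} − 2 g_N) D g_N.
-- Both sides are polynomials in N, the exponent of N being the number of
-- vertices and faces; comparing coefficients gives the recursion, the second
-- difference producing the binomial coefficients of even index.

-- Dividing by the Vandermonde determinant a and then setting x = (1, ..., 1), where a vanishes, is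
-- the obstacle in writing Z_N as a determinant. Both are done at once by pairing with ∏ C(α_i, i)
-- (`binomials`), that is by ∏ ∂_i^i / i! at that point: a vanishes there to exactly this total
-- order, so a·p is sent to p(1, ..., 1). Polynomials are therefore kept as functionals on test
-- functions φ of the exponent, and operators are transposed onto φ: x_i shifts φ, x_i ∂_i
-- multiplies it by an exponent. The divided differences produced by the transpositions are given by
-- explicit polynomials `cutPoly`, so no polynomial is ever divided. Likewise a polynomial in N is a
-- functional N^e ↦ φ(e), and fixing the genus is a choice of φ. To sort the right side by genus, V
-- - E + F must be even and at most 2; this is obtained by induction from the recursion itself,
-- tested on the indicator of failure, not from topology. Everything stays in ℤ: common factors are
-- cancelled, and division by (n - 1)! becomes a list of representatives of the labelled
-- constellations under relabelling.

open import Defs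
open import Level using (0ℓ)
open import Function.Base using (_∘_; id)
open import Data.Bool.Base using (Bool; true; false; _∧_; _∨_; not; T; if_then_else_)
import Data.Bool.Properties as Boolₚ
open import Data.Unit.Base using (⊤; tt)
open import Data.Empty using (⊥; ⊥-elim)
open import Data.Nat.Base as ℕ using (ℕ; zero; suc; _≤_; _<_; z≤n; s≤s; _∸_; _!)
import Data.Nat.Properties as ℕₚ
open import Data.Nat.Combinatorics using (_C_; nC1≡n; k>n⇒nCk≡0; nCk+nC[k+1]≡[n+1]C[k+1])
import Data.Nat.Tactic.RingSolver as ℕ-Solver
open import Data.Nat.DivMod using (n%n≡0; m<n⇒m%n≡m; m*n/n≡m)
open import Data.Integer.Base as ℤ using (ℤ; 0ℤ; 1ℤ; -_; _+_; _*_; _-_; _^_) renaming (+_ to pos; -[1+_] to negsuc)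
import Data.Integer.Properties as ℤₚ
import Data.Integer.Tactic.RingSolver as ℤ-Solver
open import Data.Fin.Base using (Fin; zero; suc; toℕ; combine; remQuot)
import Data.Fin.Properties as Finₚ
open import Data.Product.Base using (Σ-syntax; _×_; _,_; proj₁; proj₂)
open import Data.Sum.Base using (_⊎_; inj₁; inj₂)
open import Data.Vec.Base as Vec using (Vec; []; _∷_; lookup; tabulate; _[_]≔_)
import Data.Vec.Properties as Vecₚ
open import Data.List.Base as List using (List; []; _∷_; [_]; _++_; map; concatMap; filterᵇ; length; allFin; upTo; cartesianProduct)
import Data.List.Properties as Listₚ
open import Data.List.Membership.Propositional using (_∈_; _∉_)
import Data.List.Membership.Propositional.Properties as ∈ₚ
open import Data.List.Relation.Unary.Any using (here; there)
open import Data.List.Relation.Unary.All as All using (All; []; _∷_)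
open import Data.List.Relation.Unary.Unique.Propositional using (Unique; []; _∷_)
open import Data.List.Relation.Unary.Unique.Propositional.Properties using (allFin⁺)
open import Data.Bool.ListAction using (all; any)
open import Data.Nat.ListAction using (sum)
open import Relation.Nullary using (¬_; Dec; yes; no; contradiction)
open import Relation.Nullary.Decidable using (⌊_⌋; _×-dec_; ¬?; decidable-stable)
open import Relation.Binary.PropositionalEquality using (_≡_; _≢_; refl; sym; trans; cong; cong₂; subst; module ≡-Reasoning)
open import Relation.Binary.Definitions using (DecidableEquality)
open import Data.Product.Properties using () renaming (≡-dec to ×-≡-dec)
open import Algebra.Bundles using (CommutativeRing)
import Algebra.Properties.Ring as RingProperties
import Relation.Binary.Reasoning.Setoid as SetoidReasoning

-- Finite sums and enumerations

module RingSum (R : CommutativeRing 0ℓ 0ℓ) where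
  private module R = CommutativeRing R
  open SetoidReasoning R.setoid
  open RingProperties R.ring

  ∑ : ∀ {A : Set} → List A → (A → R.Carrier) → R.Carrier
  ∑ [] f = R.0#
  ∑ (x ∷ xs) f = f x R.+ ∑ xs f

  syntax ∑ xs (λ x → e) = ∑[ x ∈ xs ] e
  infix 5 ∑

  +-interchange : ∀ a b c d → (a R.+ b) R.+ (c R.+ d) R.≈ (a R.+ c) R.+ (b R.+ d)
  +-interchange a b c d = begin
    (a R.+ b) R.+ (c R.+ d)  ≈⟨ R.+-assoc a b (c R.+ d) ⟩
    a R.+ (b R.+ (c R.+ d))  ≈⟨ R.+-congˡ (R.+-assoc b c d) ⟨
    a R.+ ((b R.+ c) R.+ d)  ≈⟨ R.+-congˡ (R.+-congʳ (R.+-comm b c)) ⟩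
    a R.+ ((c R.+ b) R.+ d)  ≈⟨ R.+-congˡ (R.+-assoc c b d) ⟩
    a R.+ (c R.+ (b R.+ d))  ≈⟨ R.+-assoc a c (b R.+ d) ⟨
    (a R.+ c) R.+ (b R.+ d)  ∎

  ∑-cong∈ : ∀ {A : Set} (xs : List A) {f g : A → R.Carrier} →
    (∀ {x} → x ∈ xs → f x R.≈ g x) → ∑ xs f R.≈ ∑ xs g
  ∑-cong∈ [] eq = R.refl
  ∑-cong∈ (x ∷ xs) eq = R.+-cong (eq (here refl)) (∑-cong∈ xs (λ p → eq (there p)))

  ∑-cong : ∀ {A : Set} (xs : List A) {f g : A → R.Carrier} →
    (∀ x → f x R.≈ g x) → ∑ xs f R.≈ ∑ xs g
  ∑-cong xs eq = ∑-cong∈ xs (λ {x} _ → eq x)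

  ∑-zero : ∀ {A : Set} (xs : List A) {f : A → R.Carrier} →
    (∀ {x} → x ∈ xs → f x R.≈ R.0#) → ∑ xs f R.≈ R.0#
  ∑-zero [] eq = R.refl
  ∑-zero (x ∷ xs) eq =
    R.trans (R.+-cong (eq (here refl)) (∑-zero xs (λ p → eq (there p)))) (R.+-identityˡ R.0#)

  ∑-+ : ∀ {A : Set} (xs : List A) (f g : A → R.Carrier) →
    ∑ xs (λ x → f x R.+ g x) R.≈ ∑ xs f R.+ ∑ xs g
  ∑-+ [] f g = R.sym (R.+-identityˡ R.0#)
  ∑-+ (x ∷ xs) f g = R.trans (R.+-congˡ (∑-+ xs f g)) (+-interchange _ _ _ _)

  ∑-neg : ∀ {A : Set} (xs : List A) (f : A → R.Carrier) →
    ∑ xs (λ x → R.- f x) R.≈ R.- ∑ xs f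
  ∑-neg [] f = R.sym -0#≈0#
  ∑-neg (x ∷ xs) f = R.trans (R.+-congˡ (∑-neg xs f)) (-‿+-comm _ _)

  ∑-*ˡ : ∀ {A : Set} (xs : List A) (a : R.Carrier) (f : A → R.Carrier) →
    a R.* ∑ xs f R.≈ ∑ xs (λ x → a R.* f x)
  ∑-*ˡ [] a f = R.zeroʳ a
  ∑-*ˡ (x ∷ xs) a f = R.trans (R.distribˡ a _ _) (R.+-congˡ (∑-*ˡ xs a f))

  ∑-*ʳ : ∀ {A : Set} (xs : List A) (a : R.Carrier) (f : A → R.Carrier) →
    ∑ xs f R.* a R.≈ ∑ xs (λ x → f x R.* a)
  ∑-*ʳ xs a f =
    R.trans (R.*-comm _ a) (R.trans (∑-*ˡ xs a f) (∑-cong xs (λ x → R.*-comm a (f x))))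

  ∑-swap : ∀ {A B : Set} (xs : List A) (ys : List B) (f : A → B → R.Carrier) →
    ∑ xs (λ x → ∑ ys (f x)) R.≈ ∑ ys (λ y → ∑ xs (λ x → f x y))
  ∑-swap [] ys f = R.sym (∑-zero ys (λ _ → R.refl))
  ∑-swap (x ∷ xs) ys f =
    R.trans (R.+-congˡ (∑-swap xs ys f)) (R.sym (∑-+ ys (f x) (λ y → ∑ xs (λ x → f x y))))

  ∑-++ : ∀ {A : Set} (xs ys : List A) (f : A → R.Carrier) →
    ∑ (xs ++ ys) f R.≈ ∑ xs f R.+ ∑ ys f
  ∑-++ [] ys f = R.sym (R.+-identityˡ _)
  ∑-++ (x ∷ xs) ys f = R.trans (R.+-congˡ (∑-++ xs ys f)) (R.sym (R.+-assoc _ _ _))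

  ∑-map : ∀ {A B : Set} (xs : List A) (h : A → B) (f : B → R.Carrier) →
    ∑ (map h xs) f R.≈ ∑ xs (λ x → f (h x))
  ∑-map [] h f = R.refl
  ∑-map (x ∷ xs) h f = R.+-congˡ (∑-map xs h f)

  ∑-concatMap : ∀ {A B : Set} (xs : List A) (h : A → List B) (f : B → R.Carrier) →
    ∑ (concatMap h xs) f R.≈ ∑ xs (λ x → ∑ (h x) f)
  ∑-concatMap [] h f = R.refl
  ∑-concatMap (x ∷ xs) h f =
    R.trans (∑-++ (h x) (concatMap h xs) f) (R.+-congˡ (∑-concatMap xs h f))

  ∑-cartesianProduct : ∀ {A B : Set} (xs : List A) (ys : List B) (f : A × B → R.Carrier) →
    ∑ (cartesianProduct xs ys) f R.≈ ∑ xs (λ x → ∑ ys (λ y → f (x , y)))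
  ∑-cartesianProduct [] ys f = R.refl
  ∑-cartesianProduct (x ∷ xs) ys f =
    R.trans (∑-++ (map (x ,_) ys) _ f)
      (R.+-cong (∑-map ys (x ,_) f) (∑-cartesianProduct xs ys f))

  ∑-const : ∀ {A : Set} (xs : List A) (a : R.Carrier) → ∑ xs (λ _ → a) R.≈ a R.* ∑ xs (λ _ → R.1#)
  ∑-const xs a =
    R.sym (R.trans (∑-*ˡ xs a (λ _ → R.1#)) (∑-cong xs (λ _ → R.*-identityʳ a)))

open RingSum ℤₚ.+-*-commutativeRing public hiding (+-interchange)

⟨_⟩ : ∀ {P : Set} → Dec P → ℤ
⟨ yes _ ⟩ = 1ℤ
⟨ no _ ⟩ = 0ℤ

⟨⟩-yes : ∀ {P : Set} (d : Dec P) → P → ⟨ d ⟩ ≡ 1ℤ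
⟨⟩-yes (yes _) p = refl
⟨⟩-yes (no ¬p) p = contradiction p ¬p

⟨⟩-no : ∀ {P : Set} (d : Dec P) → ¬ P → ⟨ d ⟩ ≡ 0ℤ
⟨⟩-no (yes p) ¬p = contradiction p ¬p
⟨⟩-no (no _) ¬p = refl

⟨⟩-cong : ∀ {P Q : Set} (d : Dec P) (e : Dec Q) → (P → Q) → (Q → P) → ⟨ d ⟩ ≡ ⟨ e ⟩
⟨⟩-cong (yes p) e f g = sym (⟨⟩-yes e (f p))
⟨⟩-cong (no ¬p) e f g = sym (⟨⟩-no e (λ q → ¬p (g q)))

⟨⟩-× : ∀ {P Q : Set} (d : Dec P) (e : Dec Q) → ⟨ d ×-dec e ⟩ ≡ ⟨ d ⟩ * ⟨ e ⟩
⟨⟩-× (yes _) (yes _) = refl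
⟨⟩-× (yes _) (no _) = refl
⟨⟩-× (no _) (yes _) = refl
⟨⟩-× (no _) (no _) = refl

⟨⟩-*-cong : ∀ {P : Set} (d : Dec P) {x y : ℤ} → (P → x ≡ y) → ⟨ d ⟩ * x ≡ ⟨ d ⟩ * y
⟨⟩-*-cong (yes p) eq = cong (1ℤ *_) (eq p)
⟨⟩-*-cong (no ¬p) eq = refl

ι : Bool → ℤ
ι true = 1ℤ
ι false = 0ℤ

⌊⌋-true : ∀ {P : Set} (d : Dec P) → ⌊ d ⌋ ≡ true → P
⌊⌋-true (yes p) _ = p

true-⌊⌋ : ∀ {P : Set} (d : Dec P) → P → ⌊ d ⌋ ≡ true
true-⌊⌋ (yes _) _ = refl
true-⌊⌋ (no ¬p) p = contradiction p ¬p

ι-⌊⌋ : ∀ {P : Set} (d : Dec P) → ι ⌊ d ⌋ ≡ ⟨ d ⟩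
ι-⌊⌋ (yes _) = refl
ι-⌊⌋ (no _) = refl

length-filterᵇ : ∀ {A : Set} (q : A → Bool) xs → pos (length (filterᵇ q xs)) ≡ ∑[ x ∈ xs ] ι (q x)
length-filterᵇ q [] = refl
length-filterᵇ q (x ∷ xs) with q x
... | true = cong (1ℤ +_) (length-filterᵇ q xs)
... | false = trans (length-filterᵇ q xs) (sym (ℤₚ.+-identityˡ _))

∑-filterᵇ : ∀ {A : Set} (p : A → Bool) (xs : List A) (f : A → ℤ) →
  ∑ (filterᵇ p xs) f ≡ ∑[ x ∈ xs ] ι (p x) * f x
∑-filterᵇ p [] f = refl
∑-filterᵇ p (x ∷ xs) f with p x
... | true = cong₂ _+_ (sym (ℤₚ.*-identityˡ (f x))) (∑-filterᵇ p xs f)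
... | false = trans (∑-filterᵇ p xs f) (sym (ℤₚ.+-identityˡ _))

-- A list enumerates a subset when each of its elements is listed exactly
-- once; counting occurrences by a sum makes changes of variables formal.
record Enumerates {A : Set} (_≟_ : DecidableEquality A) (xs : List A) (P : A → Set) : Set where
  field
    sound : ∀ {x} → x ∈ xs → P x
    once  : ∀ {x} → P x → (∑[ y ∈ xs ] ⟨ y ≟ x ⟩) ≡ 1ℤ

  pick : ∀ {x} → P x → (f : A → ℤ) → (∑[ y ∈ xs ] ⟨ y ≟ x ⟩ * f y) ≡ f x
  pick {x} p f = begin
    (∑[ y ∈ xs ] ⟨ y ≟ x ⟩ * f y)  ≡⟨ ∑-cong xs (λ y → ⟨⟩-*-cong (y ≟ x) (cong f)) ⟩
    (∑[ y ∈ xs ] ⟨ y ≟ x ⟩ * f x)  ≡⟨ ∑-*ʳ xs (f x) _ ⟨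
    (∑[ y ∈ xs ] ⟨ y ≟ x ⟩) * f x  ≡⟨ cong (_* f x) (once p) ⟩
    1ℤ * f x                         ≡⟨ ℤₚ.*-identityˡ (f x) ⟩
    f x                              ∎
    where open ≡-Reasoning

open Enumerates

-- Double counting of the pairs (x , y) with y = `to x`: a row has one such pair by `pick`, a column
-- has one by bijectivity.
reindex : ∀ {A B : Set} {_≟A_ : DecidableEquality A} {_≟B_ : DecidableEquality B}
  {xs : List A} {ys : List B} {P : A → Set} {Q : B → Set} →
  Enumerates _≟A_ xs P → Enumerates _≟B_ ys Q → (to : A → B) →
  (∀ {x} → P x → Q (to x)) →
  (∀ {x x′} → P x → P x′ → to x ≡ to x′ → x ≡ x′) →
  (∀ {y} → Q y → Σ[ x ∈ A ] P x × to x ≡ y) →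
  (g : B → ℤ) → ∑ xs (λ x → g (to x)) ≡ ∑ ys g
reindex {_≟A_ = _≟A_} {_≟B_} {xs} {ys} {P} {Q} ex ey to pq inj surj g = begin
  ∑ xs (λ x → g (to x))
    ≡⟨ ∑-cong∈ xs (λ x∈ → sym (pick ey (pq (sound ex x∈)) g)) ⟩
  ∑ xs (λ x → ∑ ys (λ y → ⟨ y ≟B to x ⟩ * g y))
    ≡⟨ ∑-swap xs ys _ ⟩
  ∑ ys (λ y → ∑ xs (λ x → ⟨ y ≟B to x ⟩ * g y))
    ≡⟨ ∑-cong∈ ys (λ {y} y∈ → trans (sym (∑-*ʳ xs (g y) _)) (cong (_* g y) (fibre (sound ey y∈)))) ⟩
  ∑ ys (λ y → 1ℤ * g y)
    ≡⟨ ∑-cong ys (λ y → ℤₚ.*-identityˡ (g y)) ⟩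
  ∑ ys g ∎
  where
  open ≡-Reasoning
  fibre : ∀ {y} → Q y → ∑ xs (λ x → ⟨ y ≟B to x ⟩) ≡ 1ℤ
  fibre {y} q with surj q
  ... | x₀ , p₀ , refl = trans
    (∑-cong∈ xs (λ {x} x∈ → ⟨⟩-cong (to x₀ ≟B to x) (x ≟A x₀)
      (λ e → inj (sound ex x∈) p₀ (sym e)) (λ { refl → refl })))
    (once ex p₀)

∑-cons : ∀ {A : Set} (xs : List A) (k : ℕ) (f : Vec A (suc k) → ℤ) →
  ∑ (vecsOver xs (suc k)) f ≡ ∑[ x ∈ xs ] ∑[ v ∈ vecsOver xs k ] f (x ∷ v)
∑-cons xs k f = trans (∑-concatMap xs _ f) (∑-cong xs (λ x → ∑-map (vecsOver xs k) (x ∷_) f))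

∑-allFin : ∀ {n} (f : Fin (suc n) → ℤ) → ∑ (allFin (suc n)) f ≡ f zero + ∑ (allFin n) (λ i → f (suc i))
∑-allFin {n} f = cong (f zero +_)
  (trans (cong (λ l → ∑ l f) (sym (Listₚ.map-tabulate id suc))) (∑-map (allFin n) suc f))

allFin-enumerates : ∀ n → Enumerates Finₚ._≟_ (allFin n) (λ _ → ⊤)
allFin-enumerates n .sound _ = tt
allFin-enumerates n .once {x} _ = go x
  where
  go : ∀ {n} (x : Fin n) → ∑ (allFin n) (λ y → ⟨ y Finₚ.≟ x ⟩) ≡ 1ℤ
  go {suc n} zero = trans (∑-allFin {n} (λ y → ⟨ y Finₚ.≟ zero ⟩))
    (cong (_+_ 1ℤ) (∑-zero (allFin n) (λ _ → refl)))
  go {suc n} (suc x) = trans (∑-allFin {n} (λ y → ⟨ y Finₚ.≟ suc x ⟩))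
    (trans (ℤₚ.+-identityˡ _)
      (trans (∑-cong (allFin n) (λ y → ⟨⟩-cong (suc y Finₚ.≟ suc x) (y Finₚ.≟ x) Finₚ.suc-injective (cong suc)))
        (go x)))

∑-pick : ∀ {N} (x : Fin N) y → (∑[ i ∈ allFin N ] ⟨ x Finₚ.≟ i ⟩ * y) ≡ y
∑-pick {N} x y = trans (∑-cong (allFin N) (λ i → cong (_* y) (⟨⟩-cong (x Finₚ.≟ i) (i Finₚ.≟ x) sym sym)))
  (pick (allFin-enumerates N) {x} tt (λ _ → y))

AllV : ∀ {A : Set} → (A → Set) → ∀ {k} → Vec A k → Set
AllV P v = ∀ i → P (lookup v i)

vec-≟ : ∀ {A : Set} → DecidableEquality A → ∀ {k} → DecidableEquality (Vec A k)
vec-≟ _≟_ = Vecₚ.≡-dec _≟_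

vecsOver-enumerates : ∀ {A : Set} {_≟_ : DecidableEquality A} {xs : List A} {P : A → Set} →
  Enumerates _≟_ xs P → ∀ k → Enumerates (vec-≟ _≟_) (vecsOver xs k) (AllV P)
vecsOver-enumerates {A} {_≟_} {xs} {P} e = λ k → record { sound = snd k ; once = onc k }
  where
  snd : ∀ k {v} → v ∈ vecsOver xs k → AllV P v
  snd (suc k) v∈ i with ∈ₚ.∈-concat⁻′ (map (λ x → map (x ∷_) (vecsOver xs k)) xs) v∈
  ... | l , v∈l , l∈ with ∈ₚ.∈-map⁻ _ l∈
  ... | x , x∈ , refl with ∈ₚ.∈-map⁻ _ v∈l
  snd (suc k) v∈ zero | _ , v∈l , l∈ | x , x∈ , refl | w , w∈ , refl = sound e x∈
  snd (suc k) v∈ (suc i) | _ , v∈l , l∈ | x , x∈ , refl | w , w∈ , refl = snd k w∈ i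

  onc : ∀ k {v : Vec A k} → AllV P v → ∑ (vecsOver xs k) (λ w → ⟨ vec-≟ _≟_ w v ⟩) ≡ 1ℤ
  onc zero {[]} p = refl
  onc (suc k) {x ∷ v} p = begin
    ∑ (vecsOver xs (suc k)) (λ w → ⟨ vec-≟ _≟_ w (x ∷ v) ⟩)
      ≡⟨ ∑-cons xs k _ ⟩
    (∑[ y ∈ xs ] ∑[ w ∈ vecsOver xs k ] ⟨ vec-≟ _≟_ (y ∷ w) (x ∷ v) ⟩)
      ≡⟨ ∑-cong xs (λ y → ∑-cong (vecsOver xs k) (λ w → trans
           (⟨⟩-cong _ (y ≟ x ×-dec vec-≟ _≟_ w v) Vecₚ.∷-injective (λ { (refl , refl) → refl }))
           (⟨⟩-× (y ≟ x) (vec-≟ _≟_ w v)))) ⟩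
    (∑[ y ∈ xs ] ∑[ w ∈ vecsOver xs k ] ⟨ y ≟ x ⟩ * ⟨ vec-≟ _≟_ w v ⟩)
      ≡⟨ ∑-cong xs (λ y → trans (sym (∑-*ˡ (vecsOver xs k) ⟨ y ≟ x ⟩ _))
           (trans (cong (⟨ y ≟ x ⟩ *_) (onc k (λ i → p (suc i)))) (ℤₚ.*-identityʳ _))) ⟩
    (∑[ y ∈ xs ] ⟨ y ≟ x ⟩)
      ≡⟨ once e (p zero) ⟩
    1ℤ ∎
    where open ≡-Reasoning

T⇒≡ : ∀ {b} → T b → b ≡ true
T⇒≡ {true} _ = refl

≡⇒T : ∀ {b} → b ≡ true → T b
≡⇒T refl = tt

filterᵇ-enumerates : ∀ {A : Set} {_≟_ : DecidableEquality A} {xs : List A} {P : A → Set} →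
  Enumerates _≟_ xs P → (p : A → Bool) → Enumerates _≟_ (filterᵇ p xs) (λ x → P x × p x ≡ true)
filterᵇ-enumerates {xs = xs} e p .sound {x} x∈ with ∈ₚ.∈-filter⁻ _ x∈
... | x∈xs , px = sound e x∈xs , T⇒≡ px
filterᵇ-enumerates {_≟_ = _≟_} {xs} e p .once {x} (q , eq) = begin
  ∑ (filterᵇ p xs) (λ y → ⟨ y ≟ x ⟩)   ≡⟨ ∑-filterᵇ p xs _ ⟩
  (∑[ y ∈ xs ] ι (p y) * ⟨ y ≟ x ⟩)    ≡⟨ ∑-cong xs (λ y → ℤₚ.*-comm (ι (p y)) _) ⟩
  (∑[ y ∈ xs ] ⟨ y ≟ x ⟩ * ι (p y))    ≡⟨ pick e q _ ⟩
  ι (p x)                               ≡⟨ cong ι eq ⟩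
  1ℤ                                    ∎
  where open ≡-Reasoning

×-≟ : ∀ {A B : Set} → DecidableEquality A → DecidableEquality B → DecidableEquality (A × B)
×-≟ _≟A_ _≟B_ = ×-≡-dec _≟A_ _≟B_

cartesianProduct-enumerates : ∀ {A B : Set} {_≟A_ : DecidableEquality A} {_≟B_ : DecidableEquality B}
  {xs : List A} {ys : List B} {P : A → Set} {Q : B → Set} →
  Enumerates _≟A_ xs P → Enumerates _≟B_ ys Q →
  Enumerates (×-≟ _≟A_ _≟B_) (cartesianProduct xs ys) (λ (x , y) → P x × Q y)
cartesianProduct-enumerates {xs = xs} {ys} ex ey .sound p∈ with ∈ₚ.∈-cartesianProduct⁻ xs ys p∈
... | x∈ , y∈ = sound ex x∈ , sound ey y∈
cartesianProduct-enumerates {_≟A_ = _≟A_} {_≟B_} {xs} {ys} ex ey .once {x , y} (p , q) = begin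
  ∑ (cartesianProduct xs ys) (λ z → ⟨ ×-≟ _≟A_ _≟B_ z (x , y) ⟩)
    ≡⟨ ∑-cartesianProduct xs ys _ ⟩
  (∑[ x′ ∈ xs ] ∑[ y′ ∈ ys ] ⟨ ×-≟ _≟A_ _≟B_ (x′ , y′) (x , y) ⟩)
    ≡⟨ ∑-cong xs (λ x′ → ∑-cong ys (λ y′ → trans
         (⟨⟩-cong _ (x′ ≟A x ×-dec y′ ≟B y) (λ { refl → refl , refl }) (λ { (refl , refl) → refl }))
         (⟨⟩-× (x′ ≟A x) (y′ ≟B y)))) ⟩
  (∑[ x′ ∈ xs ] ∑[ y′ ∈ ys ] ⟨ x′ ≟A x ⟩ * ⟨ y′ ≟B y ⟩)
    ≡⟨ ∑-cong xs (λ x′ → trans (sym (∑-*ˡ ys ⟨ x′ ≟A x ⟩ _))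
         (trans (cong (⟨ x′ ≟A x ⟩ *_) (once ey q)) (ℤₚ.*-identityʳ _))) ⟩
  (∑[ x′ ∈ xs ] ⟨ x′ ≟A x ⟩)
    ≡⟨ once ex p ⟩
  1ℤ ∎
  where open ≡-Reasoning

-- Permutations and colourings as tables

weaken : ∀ {A : Set} {_≟_ : DecidableEquality A} {xs : List A} {P Q : A → Set} →
  (∀ {x} → P x → Q x) → (∀ {x} → Q x → P x) → Enumerates _≟_ xs P → Enumerates _≟_ xs Q
weaken f g e .Enumerates.sound x∈ = f (Enumerates.sound e x∈)
weaken f g e .Enumerates.once q = Enumerates.once e (g q)

all-true⁺ : ∀ {A : Set} (p : A → Bool) (xs : List A) → (∀ {x} → x ∈ xs → p x ≡ true) → all p xs ≡ true
all-true⁺ p [] h = refl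
all-true⁺ p (x ∷ xs) h rewrite h (here refl) = all-true⁺ p xs (λ q → h (there q))

all-true⁻ : ∀ {A : Set} (p : A → Bool) (xs : List A) → all p xs ≡ true → ∀ {x} → x ∈ xs → p x ≡ true
all-true⁻ p (y ∷ xs) h q with p y in eq
all-true⁻ p (y ∷ xs) h (here refl) | true = eq
all-true⁻ p (y ∷ xs) h (there q) | true = all-true⁻ p xs h q

any-true⁺ : ∀ {A : Set} (p : A → Bool) (xs : List A) {x : A} → x ∈ xs → p x ≡ true → any p xs ≡ true
any-true⁺ p (y ∷ xs) (here refl) h rewrite h = refl
any-true⁺ p (y ∷ xs) (there q) h with p y
... | true = refl
... | false = any-true⁺ p xs q h

any-true⁻ : ∀ {A : Set} (p : A → Bool) (xs : List A) → any p xs ≡ true → Σ[ x ∈ A ] p x ≡ true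
any-true⁻ p (y ∷ xs) h with p y in eq
... | true = y , eq
... | false = any-true⁻ p xs h

==⇒≡ : ∀ {n} {i j : Fin n} → (i == j) ≡ true → i ≡ j
==⇒≡ {i = i} {j} h with i Finₚ.≟ j
... | yes p = p

≡⇒== : ∀ {n} {i j : Fin n} → i ≡ j → (i == j) ≡ true
≡⇒== {i = i} {j} h with i Finₚ.≟ j
... | yes p = refl
... | no ¬p = contradiction h ¬p

lookup-ext : ∀ {A : Set} {n} {u v : Vec A n} → (∀ i → lookup u i ≡ lookup v i) → u ≡ v
lookup-ext {u = []} {[]} h = refl
lookup-ext {u = x ∷ u} {y ∷ v} h = cong₂ _∷_ (h zero) (lookup-ext (λ i → h (suc i)))

-- Maps between finite sets, colourings included, are tables; _∙_ is composition.
infixl 8 _∙_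
abstract
  _∙_ : ∀ {A : Set} {n k} → Vec A n → Vec (Fin n) k → Vec A k
  c ∙ σ = Vec.map (lookup c) σ

  lookup-∙ : ∀ {A : Set} {n k} (c : Vec A n) (σ : Vec (Fin n) k) s → lookup (c ∙ σ) s ≡ lookup c (lookup σ s)
  lookup-∙ c σ s = Vecₚ.lookup-map s (lookup c) σ

∙-assoc : ∀ {A : Set} {n k l} (c : Vec A n) (σ : Vec (Fin n) k) (ρ : Vec (Fin k) l) → (c ∙ σ) ∙ ρ ≡ c ∙ (σ ∙ ρ)
∙-assoc c σ ρ = lookup-ext (λ i → trans (lookup-∙ (c ∙ σ) ρ i)
  (trans (lookup-∙ c σ (lookup ρ i)) (sym (trans (lookup-∙ c (σ ∙ ρ) i) (cong (lookup c) (lookup-∙ σ ρ i))))))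

idV : ∀ {n} → Vec (Fin n) n
idV {n} = Vec.allFin n

∙-identityʳ : ∀ {A : Set} {n} (c : Vec A n) → c ∙ idV ≡ c
∙-identityʳ c = lookup-ext (λ i → trans (lookup-∙ c idV i) (cong (lookup c) (Vecₚ.lookup-allFin i)))

∙-identityˡ : ∀ {n k} (σ : Vec (Fin n) k) → idV ∙ σ ≡ σ
∙-identityˡ σ = lookup-ext (λ i → trans (lookup-∙ idV σ i) (Vecₚ.lookup-allFin (lookup σ i)))

-- A record and not a function type, so that σ is inferred from a proof.
record IsPerm {n : ℕ} (σ : Vec (Fin n) n) : Set where
  field injective : ∀ i j → lookup σ i ≡ lookup σ j → i ≡ j

open IsPerm

isPerm⇒IsPerm : ∀ {n} (σ : Vec (Fin n) n) → isPerm σ ≡ true → IsPerm σ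
isPerm⇒IsPerm {n} σ h .injective i j eq with all-true⁻ _ (allFin n) (all-true⁻ _ (allFin n) h (∈ₚ.∈-allFin i)) (∈ₚ.∈-allFin j)
... | r rewrite ≡⇒== eq = ==⇒≡ r

IsPerm⇒isPerm : ∀ {n} (σ : Vec (Fin n) n) → IsPerm σ → isPerm σ ≡ true
IsPerm⇒isPerm {n} σ p = all-true⁺ _ (allFin n) (λ {i} _ → all-true⁺ _ (allFin n) (λ {j} _ → go i j))
  where
  go : ∀ i j → (not (lookup σ i == lookup σ j) ∨ (i == j)) ≡ true
  go i j with lookup σ i == lookup σ j in eq
  ... | true = ≡⇒== (injective p i j (==⇒≡ eq))
  ... | false = refl

_≟ᵛ_ : ∀ {n k} → DecidableEquality (Vec (Fin n) k)
_≟ᵛ_ = vec-≟ Finₚ._≟_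

perms : ∀ n → List (Vec (Fin n) n)
perms n = filterᵇ isPerm (vecsOver (allFin n) n)

cols : ∀ N n → List (Vec (Fin N) n)
cols N n = vecsOver (allFin N) n

cols-enumerates : ∀ N n → Enumerates _≟ᵛ_ (cols N n) (λ _ → ⊤)
cols-enumerates N n = weaken (λ _ → tt) (λ _ _ → tt) (vecsOver-enumerates (allFin-enumerates N) n)

perms-enumerates : ∀ n → Enumerates _≟ᵛ_ (perms n) IsPerm
perms-enumerates n = weaken (λ {σ} (_ , h) → isPerm⇒IsPerm σ h) (λ {σ} p → tt , IsPerm⇒isPerm σ p)
  (filterᵇ-enumerates (cols-enumerates n n) isPerm)

-- Pigeonhole: with y missing from the image, punching out y would inject n + 1 points into n.
perm-surjective : ∀ {n} {σ : Vec (Fin n) n} → IsPerm σ → ∀ y → Σ[ x ∈ Fin n ] lookup σ x ≡ y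
perm-surjective {suc n} {σ} p y with Finₚ.any? (λ x → lookup σ x Finₚ.≟ y)
... | yes r = r
... | no ¬r = contradiction
  (Finₚ.injective⇒≤ {f = λ x → Data.Fin.Base.punchOut {i = y} (λ e → ¬r (x , sym e))}
    (λ {i} {j} e → injective p i j (Finₚ.punchOut-injective (λ e → ¬r (i , sym e)) (λ e → ¬r (j , sym e)) e)))
  ℕₚ.1+n≰n
  where import Data.Fin.Base

inverse : ∀ {n} {σ : Vec (Fin n) n} → IsPerm σ → Vec (Fin n) n
inverse p = tabulate (λ y → proj₁ (perm-surjective p y))

∙-inverseʳ : ∀ {n} {σ : Vec (Fin n) n} (p : IsPerm σ) → σ ∙ inverse p ≡ idV
∙-inverseʳ {σ = σ} p = lookup-ext (λ i → begin
  lookup (σ ∙ inverse p) i         ≡⟨ lookup-∙ σ (inverse p) i ⟩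
  lookup σ (lookup (inverse p) i)  ≡⟨ cong (lookup σ) (Vecₚ.lookup∘tabulate _ i) ⟩
  lookup σ (proj₁ (perm-surjective p i))  ≡⟨ proj₂ (perm-surjective p i) ⟩
  i                                ≡⟨ Vecₚ.lookup-allFin i ⟨
  lookup idV i                     ∎)
  where open ≡-Reasoning

∙-inverseˡ : ∀ {n} {σ : Vec (Fin n) n} (p : IsPerm σ) → inverse p ∙ σ ≡ idV
∙-inverseˡ {σ = σ} p = lookup-ext (λ i → trans (injective p _ _ (begin
  lookup σ (lookup (inverse p ∙ σ) i)  ≡⟨ lookup-∙ σ (inverse p ∙ σ) i ⟨
  lookup (σ ∙ (inverse p ∙ σ)) i       ≡⟨ cong (λ v → lookup v i) (∙-assoc σ (inverse p) σ) ⟨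
  lookup (σ ∙ inverse p ∙ σ) i         ≡⟨ cong (λ v → lookup (v ∙ σ) i) (∙-inverseʳ p) ⟩
  lookup (idV ∙ σ) i                   ≡⟨ cong (λ v → lookup v i) (∙-identityˡ σ) ⟩
  lookup σ i                           ∎)) (sym (Vecₚ.lookup-allFin i)))
  where open ≡-Reasoning

idV-perm : ∀ {n} → IsPerm (idV {n})
idV-perm .injective i j e = trans (sym (Vecₚ.lookup-allFin i)) (trans e (Vecₚ.lookup-allFin j))

∙-perm : ∀ {n} {σ ρ : Vec (Fin n) n} → IsPerm σ → IsPerm ρ → IsPerm (σ ∙ ρ)
∙-perm {σ = σ} {ρ} p q .injective i j e = injective q i j (injective p _ _ (trans (sym (lookup-∙ σ ρ i)) (trans e (lookup-∙ σ ρ j))))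

retract-perm : ∀ {n} {σ ρ : Vec (Fin n) n} → ρ ∙ σ ≡ idV → IsPerm σ
retract-perm {σ = σ} {ρ} h .injective i j e = begin
  i                       ≡⟨ Vecₚ.lookup-allFin i ⟨
  lookup idV i            ≡⟨ cong (λ v → lookup v i) h ⟨
  lookup (ρ ∙ σ) i        ≡⟨ lookup-∙ ρ σ i ⟩
  lookup ρ (lookup σ i)   ≡⟨ cong (lookup ρ) e ⟩
  lookup ρ (lookup σ j)   ≡⟨ lookup-∙ ρ σ j ⟨
  lookup (ρ ∙ σ) j        ≡⟨ cong (λ v → lookup v j) h ⟩
  lookup idV j            ≡⟨ Vecₚ.lookup-allFin j ⟩
  j                       ∎
  where open ≡-Reasoning

cancelʳ : ∀ {A : Set} {n} (c : Vec A n) {σ ρ : Vec (Fin n) n} → σ ∙ ρ ≡ idV → c ∙ σ ∙ ρ ≡ c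
cancelʳ c {σ} {ρ} h = trans (∙-assoc c σ ρ) (trans (cong (c ∙_) h) (∙-identityʳ c))

∙-injective : ∀ {A : Set} {n} {c d : Vec A n} {σ ρ : Vec (Fin n) n} → σ ∙ ρ ≡ idV → c ∙ σ ≡ d ∙ σ → c ≡ d
∙-injective {c = c} {d} {σ} {ρ} h e = trans (sym (cancelʳ c h)) (trans (cong (_∙ ρ) e) (cancelʳ d h))

-- Transpositions and the embedding of S(n) in S(n+1)

swapFin : ∀ {n} → Fin n → Fin n → Fin n → Fin n
swapFin a b s with s Finₚ.≟ a
... | yes _ = b
... | no _ with s Finₚ.≟ b
... | yes _ = a
... | no _ = s

tr : ∀ {n} → Fin n → Fin n → Vec (Fin n) n
tr a b = tabulate (swapFin a b)

swapFin-fst : ∀ {n} (a b : Fin n) → swapFin a b a ≡ b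
swapFin-fst a b with a Finₚ.≟ a
... | yes _ = refl
... | no ¬p = contradiction refl ¬p

swapFin-snd : ∀ {n} (a b : Fin n) → swapFin a b b ≡ a
swapFin-snd a b with b Finₚ.≟ a
... | yes p = p
... | no _ with b Finₚ.≟ b
... | yes _ = refl
... | no ¬p = contradiction refl ¬p

swapFin-other : ∀ {n} {a b s : Fin n} → s ≢ a → s ≢ b → swapFin a b s ≡ s
swapFin-other {a = a} {b} {s} p q with s Finₚ.≟ a
... | yes e = contradiction e p
... | no _ with s Finₚ.≟ b
... | yes e = contradiction e q
... | no _ = refl

swapCases : ∀ {n} (a b : Fin n) (P : Fin n → Set) → P a → P b → (∀ s → s ≢ a → s ≢ b → P s) → ∀ s → P s
swapCases a b P pa pb po s with s Finₚ.≟ a | s Finₚ.≟ b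
... | yes refl | _ = pa
... | no _ | yes refl = pb
... | no p | no q = po s p q

lookup-tr : ∀ {n} (a b s : Fin n) → lookup (tr a b) s ≡ swapFin a b s
lookup-tr a b s = Vecₚ.lookup∘tabulate (swapFin a b) s

swapFin-involutive : ∀ {n} (a b s : Fin n) → swapFin a b (swapFin a b s) ≡ s
swapFin-involutive a b = swapCases a b _
  (trans (cong (swapFin a b) (swapFin-fst a b)) (swapFin-snd a b))
  (trans (cong (swapFin a b) (swapFin-snd a b)) (swapFin-fst a b))
  (λ s p q → trans (cong (swapFin a b) (swapFin-other p q)) (swapFin-other p q))

swapFin-comm : ∀ {n} (a b s : Fin n) → swapFin a b s ≡ swapFin b a s
swapFin-comm a b = swapCases a b _
  (trans (swapFin-fst a b) (sym (swapFin-snd b a)))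
  (trans (swapFin-snd a b) (sym (swapFin-fst b a)))
  (λ s p q → trans (swapFin-other p q) (sym (swapFin-other q p)))

tr-comm : ∀ {n} (a b : Fin n) → tr a b ≡ tr b a
tr-comm a b = Vecₚ.tabulate-cong (swapFin-comm a b)

tr-involutive : ∀ {n} (a b : Fin n) → tr a b ∙ tr a b ≡ idV
tr-involutive a b = lookup-ext (λ s → begin
  lookup (tr a b ∙ tr a b) s  ≡⟨ lookup-∙ (tr a b) (tr a b) s ⟩
  lookup (tr a b) (lookup (tr a b) s)  ≡⟨ cong (lookup (tr a b)) (lookup-tr a b s) ⟩
  lookup (tr a b) (swapFin a b s)  ≡⟨ lookup-tr a b _ ⟩
  swapFin a b (swapFin a b s)  ≡⟨ swapFin-involutive a b s ⟩
  s                            ≡⟨ Vecₚ.lookup-allFin s ⟨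
  lookup idV s                 ∎)
  where open ≡-Reasoning

tr-refl : ∀ {n} (a : Fin n) → tr a a ≡ idV
tr-refl a = lookup-ext (λ s → trans (lookup-tr a a s) (trans (go s) (sym (Vecₚ.lookup-allFin s))))
  where
  go : ∀ s → swapFin a a s ≡ s
  go = swapCases a a _ (swapFin-fst a a) (swapFin-fst a a) (λ s p q → swapFin-other p q)

tr-perm : ∀ {n} (a b : Fin n) → IsPerm (tr a b)
tr-perm a b = retract-perm (tr-involutive a b)

-- Conjugation of a transposition, σ (a b) σ⁻¹ = (σa σb), written without the inverse.
perm-tr : ∀ {n} {σ : Vec (Fin n) n} → IsPerm σ → ∀ a b → σ ∙ tr a b ≡ tr (lookup σ a) (lookup σ b) ∙ σ
perm-tr {σ = σ} p a b = lookup-ext (λ s → begin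
  lookup (σ ∙ tr a b) s        ≡⟨ lookup-∙ σ (tr a b) s ⟩
  lookup σ (lookup (tr a b) s) ≡⟨ cong (lookup σ) (lookup-tr a b s) ⟩
  lookup σ (swapFin a b s)     ≡⟨ go s ⟩
  swapFin (lookup σ a) (lookup σ b) (lookup σ s) ≡⟨ lookup-tr (lookup σ a) (lookup σ b) _ ⟨
  lookup (tr (lookup σ a) (lookup σ b)) (lookup σ s) ≡⟨ lookup-∙ _ σ s ⟨
  lookup (tr (lookup σ a) (lookup σ b) ∙ σ) s ∎)
  where
  open ≡-Reasoning
  go : ∀ s → lookup σ (swapFin a b s) ≡ swapFin (lookup σ a) (lookup σ b) (lookup σ s)
  go = swapCases a b _
    (trans (cong (lookup σ) (swapFin-fst a b)) (sym (swapFin-fst (lookup σ a) (lookup σ b))))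
    (trans (cong (lookup σ) (swapFin-snd a b)) (sym (swapFin-snd (lookup σ a) (lookup σ b))))
    (λ s q r → trans (cong (lookup σ) (swapFin-other q r))
      (sym (swapFin-other (λ e → q (injective p _ _ e)) (λ e → r (injective p _ _ e)))))

-- S(n) as the stabiliser of 0 in S(n+1). The added point is 0, which is also the root in the
-- connected tuples.
lift : ∀ {n} → Vec (Fin n) n → Vec (Fin (suc n)) (suc n)
lift σ = zero ∷ Vec.map suc σ

lookup-lift : ∀ {n} (σ : Vec (Fin n) n) s → lookup (lift σ) (suc s) ≡ suc (lookup σ s)
lookup-lift σ s = Vecₚ.lookup-map s suc σ

lift-∙ : ∀ {n} (σ ρ : Vec (Fin n) n) → lift σ ∙ lift ρ ≡ lift (σ ∙ ρ)
lift-∙ σ ρ = lookup-ext λ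
  { zero → lookup-∙ (lift σ) (lift ρ) zero
  ; (suc s) → begin
      lookup (lift σ ∙ lift ρ) (suc s)        ≡⟨ lookup-∙ (lift σ) (lift ρ) (suc s) ⟩
      lookup (lift σ) (lookup (lift ρ) (suc s)) ≡⟨ cong (lookup (lift σ)) (lookup-lift ρ s) ⟩
      lookup (lift σ) (suc (lookup ρ s))      ≡⟨ lookup-lift σ _ ⟩
      suc (lookup σ (lookup ρ s))             ≡⟨ cong suc (lookup-∙ σ ρ s) ⟨
      suc (lookup (σ ∙ ρ) s)                  ≡⟨ lookup-lift (σ ∙ ρ) s ⟨
      lookup (lift (σ ∙ ρ)) (suc s)           ∎ }
  where open ≡-Reasoning

lift-id : ∀ {n} → lift (idV {n}) ≡ idV
lift-id {n} = cong (zero ∷_) (sym (Vecₚ.tabulate-∘ suc id))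

lift-perm : ∀ {n} {σ : Vec (Fin n) n} → IsPerm σ → IsPerm (lift σ)
lift-perm {σ = σ} p .injective zero zero e = refl
lift-perm {σ = σ} p .injective zero (suc j) e = contradiction (trans e (lookup-lift σ j)) λ ()
lift-perm {σ = σ} p .injective (suc i) zero e = contradiction (trans (sym (lookup-lift σ i)) e) λ ()
lift-perm {σ = σ} p .injective (suc i) (suc j) e =
  cong suc (injective p i j (Finₚ.suc-injective (trans (sym (lookup-lift σ i)) (trans e (lookup-lift σ j)))))

lift-tr : ∀ {n} (a b : Fin n) → lift (tr a b) ≡ tr (suc a) (suc b)
lift-tr a b = lookup-ext λ
  { zero → sym (trans (lookup-tr (suc a) (suc b) zero) (swapFin-other {a = suc a} {suc b} {zero} (λ ()) (λ ())))
  ; (suc s) → trans (lookup-lift (tr a b) s) (trans (cong suc (lookup-tr a b s))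
      (trans (go s) (sym (lookup-tr (suc a) (suc b) (suc s))))) }
  where
  go : ∀ s → suc (swapFin a b s) ≡ swapFin (suc a) (suc b) (suc s)
  go = swapCases a b _
    (trans (cong suc (swapFin-fst a b)) (sym (swapFin-fst (suc a) (suc b))))
    (trans (cong suc (swapFin-snd a b)) (sym (swapFin-snd (suc a) (suc b))))
    (λ s p q → trans (cong suc (swapFin-other p q))
      (sym (swapFin-other (λ e → p (Finₚ.suc-injective e)) (λ e → q (Finₚ.suc-injective e)))))

unlift : ∀ {n} {σ : Vec (Fin (suc n)) (suc n)} → IsPerm σ → lookup σ zero ≡ zero →
  Σ[ ρ ∈ Vec (Fin n) n ] IsPerm ρ × lift ρ ≡ σ
unlift {n} {σ} p h = ρ , ρ-perm , lookup-ext λ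
  { zero → sym h
  ; (suc i) → trans (lookup-lift ρ i) (ρ-suc i) }
  where
  pre : ∀ i → Σ[ j ∈ Fin n ] suc j ≡ lookup σ (suc i)
  pre i with lookup σ (suc i) in eq
  ... | zero = contradiction (injective p zero (suc i) (trans h (sym eq))) λ ()
  ... | suc j = j , refl
  ρ : Vec (Fin n) n
  ρ = tabulate (λ i → proj₁ (pre i))
  ρ-suc : ∀ i → suc (lookup ρ i) ≡ lookup σ (suc i)
  ρ-suc i = trans (cong suc (Vecₚ.lookup∘tabulate _ i)) (proj₂ (pre i))
  ρ-perm : IsPerm ρ
  ρ-perm .injective i j e = Finₚ.suc-injective (injective p (suc i) (suc j) (trans (sym (ρ-suc i)) (trans (cong suc e) (ρ-suc j))))

lift-injective : ∀ {n} {σ ρ : Vec (Fin n) n} → lift σ ≡ lift ρ → σ ≡ ρ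
lift-injective {σ = σ} {ρ} e = lookup-ext (λ i → Finₚ.suc-injective
  (trans (sym (lookup-lift σ i)) (trans (cong (λ v → lookup v (suc i)) e) (lookup-lift ρ i))))

-- Coset decomposition of S(n+1) over S(n): for a permutation ρ the index s is the preimage of 0,
-- and ρ (0 s) fixes 0.
∑-perms-suc : ∀ {n} (f : Vec (Fin (suc n)) (suc n) → ℤ) →
  ∑ (perms (suc n)) f ≡ ∑[ σ ∈ perms n ] ∑[ s ∈ allFin (suc n) ] f (lift σ ∙ tr zero s)
∑-perms-suc {n} f = trans
  (sym (reindex (cartesianProduct-enumerates (perms-enumerates n) (allFin-enumerates (suc n)))
    (perms-enumerates (suc n)) to
    (λ {(σ , s)} (p , _) → ∙-perm (lift-perm p) (tr-perm zero s))
    (λ {(σ , s)} {(σ′ , s′)} (p , _) (p′ , _) → inj p p′) surj f))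
  (∑-cartesianProduct (perms n) (allFin (suc n)) _)
  where
  to : Vec (Fin n) n × Fin (suc n) → Vec (Fin (suc n)) (suc n)
  to (σ , s) = lift σ ∙ tr zero s
  to-s : ∀ σ s → lookup (to (σ , s)) s ≡ zero
  to-s σ s = trans (lookup-∙ (lift σ) (tr zero s) s)
    (cong (lookup (lift σ)) (trans (lookup-tr zero s s) (swapFin-snd zero s)))
  inj : ∀ {σ σ′ s s′} → IsPerm σ → IsPerm σ′ → to (σ , s) ≡ to (σ′ , s′) → (σ , s) ≡ (σ′ , s′)
  inj {σ} {σ′} {s} {s′} p p′ e
    with injective (∙-perm (lift-perm p) (tr-perm zero s)) s s′
      (trans (to-s σ s) (sym (trans (cong (λ v → lookup v s′) e) (to-s σ′ s′))))
  ... | refl = cong (_, s) (lift-injective (∙-injective (tr-involutive zero s) e))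
  surj : ∀ {ρ} → IsPerm ρ → Σ[ x ∈ _ ] (IsPerm (proj₁ x) × ⊤) × to x ≡ ρ
  surj {ρ} p with perm-surjective p zero
  ... | s , e with unlift (∙-perm p (tr-perm zero s))
         (trans (lookup-∙ ρ (tr zero s) zero) (trans (cong (lookup ρ) (trans (lookup-tr zero s zero) (swapFin-fst zero s))) e))
  ... | σ , q , h = (σ , s) , (q , tt) , trans (cong (_∙ tr zero s) h) (cancelʳ ρ (tr-involutive zero s))

-- Invariant colourings

-- The number of colourings invariant under σ, that is N to the number of cycles of σ.
Fix : ∀ N {n} → Vec (Fin n) n → ℤ
Fix N {n} σ = ∑[ c ∈ cols N n ] ⟨ (c ∙ σ) ≟ᵛ c ⟩

vec₀-unique : ∀ {A : Set} (u v : Vec A 0) → u ≡ v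
vec₀-unique [] [] = refl

Fix-empty : ∀ N → Fix N [] ≡ 1ℤ
Fix-empty N = trans (ℤₚ.+-identityʳ _) (⟨⟩-yes (([] ∙ []) ≟ᵛ []) (vec₀-unique ([] ∙ []) []))

∑-cols-∙ : ∀ {N n} {σ ρ : Vec (Fin n) n} → σ ∙ ρ ≡ idV → ρ ∙ σ ≡ idV → (f : Vec (Fin N) n → ℤ) →
  (∑[ c ∈ cols N n ] f (c ∙ σ)) ≡ ∑ (cols N n) f
∑-cols-∙ {N} {n} {σ} {ρ} h k f = reindex (cols-enumerates N n) (cols-enumerates N n) (_∙ σ)
  (λ _ → tt) (λ _ _ → ∙-injective h) (λ {d} _ → d ∙ ρ , tt , cancelʳ d k) f

Fix-conj : ∀ N {n} {σ ρ : Vec (Fin n) n} → σ ∙ ρ ≡ idV → ρ ∙ σ ≡ idV → ∀ τ → Fix N (σ ∙ τ ∙ ρ) ≡ Fix N τ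
Fix-conj N {n} {σ} {ρ} h k τ = trans (sym (∑-cols-∙ k h _)) (∑-cong (cols N n) (λ c →
  ⟨⟩-cong _ _
    (λ e → ∙-injective k (trans (sym (move c)) e))
    (λ e → trans (move c) (cong (_∙ ρ) e))))
  where
  open ≡-Reasoning
  move : ∀ c → c ∙ ρ ∙ (σ ∙ τ ∙ ρ) ≡ c ∙ τ ∙ ρ
  move c = begin
    c ∙ ρ ∙ (σ ∙ τ ∙ ρ)  ≡⟨ ∙-assoc (c ∙ ρ) (σ ∙ τ) ρ ⟨
    c ∙ ρ ∙ (σ ∙ τ) ∙ ρ  ≡⟨ cong (_∙ ρ) (∙-assoc (c ∙ ρ) σ τ) ⟨
    c ∙ ρ ∙ σ ∙ τ ∙ ρ    ≡⟨ cong (λ d → d ∙ τ ∙ ρ) (cancelʳ c k) ⟩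
    c ∙ τ ∙ ρ            ∎

∑-perms-conj : ∀ {n} {σ : Vec (Fin n) n} → σ ∙ σ ≡ idV → (f : Vec (Fin n) n → ℤ) →
  (∑[ ρ ∈ perms n ] f (σ ∙ ρ ∙ σ)) ≡ ∑ (perms n) f
∑-perms-conj {n} {σ} h f = reindex (perms-enumerates n) (perms-enumerates n) (λ ρ → σ ∙ ρ ∙ σ)
  (λ p → ∙-perm (∙-perm q p) q)
  (λ {ρ} {ρ′} _ _ e → trans (sym (twice ρ)) (trans (cong (λ v → σ ∙ v ∙ σ) e) (twice ρ′)))
  (λ {ρ} p → σ ∙ ρ ∙ σ , ∙-perm (∙-perm q p) q , twice ρ) f
  where
  open ≡-Reasoning
  q : IsPerm σ
  q = retract-perm h
  twice : ∀ ρ → σ ∙ (σ ∙ ρ ∙ σ) ∙ σ ≡ ρ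
  twice ρ = begin
    σ ∙ (σ ∙ ρ ∙ σ) ∙ σ   ≡⟨ cong (_∙ σ) (∙-assoc σ (σ ∙ ρ) σ) ⟨
    σ ∙ (σ ∙ ρ) ∙ σ ∙ σ   ≡⟨ cancelʳ _ h ⟩
    σ ∙ (σ ∙ ρ)           ≡⟨ ∙-assoc σ σ ρ ⟨
    σ ∙ σ ∙ ρ             ≡⟨ cong (_∙ ρ) h ⟩
    idV ∙ ρ               ≡⟨ ∙-identityˡ ρ ⟩
    ρ                     ∎

∑-1-allFin : ∀ N → (∑[ _ ∈ allFin N ] 1ℤ) ≡ pos N
∑-1-allFin zero = refl
∑-1-allFin (suc N) = trans (∑-allFin {N} (λ _ → 1ℤ)) (cong (1ℤ +_) (∑-1-allFin N))

cons-∙-lift : ∀ {A : Set} {n} (x : A) (c : Vec A n) (σ : Vec (Fin n) n) → (x ∷ c) ∙ lift σ ≡ x ∷ (c ∙ σ)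
cons-∙-lift x c σ = lookup-ext λ
  { zero → lookup-∙ (x ∷ c) (lift σ) zero
  ; (suc s) → trans (lookup-∙ (x ∷ c) (lift σ) (suc s))
      (trans (cong (lookup (x ∷ c)) (lookup-lift σ s)) (sym (lookup-∙ c σ s))) }

Fix-lift : ∀ N {n} (σ : Vec (Fin n) n) → Fix N (lift σ) ≡ pos N * Fix N σ
Fix-lift N {n} σ = begin
  Fix N (lift σ)
    ≡⟨ ∑-cons (allFin N) n _ ⟩
  (∑[ x ∈ allFin N ] ∑[ c ∈ cols N n ] ⟨ ((x ∷ c) ∙ lift σ) ≟ᵛ (x ∷ c) ⟩)
    ≡⟨ ∑-cong (allFin N) (λ x → ∑-cong (cols N n) (λ c → ⟨⟩-cong _ ((c ∙ σ) ≟ᵛ c)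
         (λ e → Vecₚ.∷-injectiveʳ (trans (sym (cons-∙-lift x c σ)) e))
         (λ e → trans (cons-∙-lift x c σ) (cong (x ∷_) e)))) ⟩
  (∑[ x ∈ allFin N ] Fix N σ)
    ≡⟨ ∑-const (allFin N) (Fix N σ) ⟩
  Fix N σ * (∑[ x ∈ allFin N ] 1ℤ)
    ≡⟨ cong (Fix N σ *_) (∑-1-allFin N) ⟩
  Fix N σ * pos N
    ≡⟨ ℤₚ.*-comm (Fix N σ) (pos N) ⟩
  pos N * Fix N σ ∎
  where open ≡-Reasoning

-- Multiplying by (0 s+1) inserts 0 into the cycle of s+1, so the colour of 0 is forced and no cycle
-- is added; in `Fix-lift` the point 0 is a cycle of its own. The two cases are the coefficients 1
-- and N in the factor N + J.
Fix-lift-tr : ∀ N {n} (σ : Vec (Fin n) n) (s : Fin n) → Fix N (lift σ ∙ tr zero (suc s)) ≡ Fix N σ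
Fix-lift-tr N {n} σ s = begin
  Fix N (lift σ ∙ tr zero (suc s))
    ≡⟨ ∑-cons (allFin N) n _ ⟩
  (∑[ x ∈ allFin N ] ∑[ c ∈ cols N n ] ⟨ ((x ∷ c) ∙ (lift σ ∙ tr zero (suc s))) ≟ᵛ (x ∷ c) ⟩)
    ≡⟨ ∑-cong (allFin N) (λ x → ∑-cong (cols N n) (λ c → trans
         (⟨⟩-cong _ (x Finₚ.≟ lookup c s ×-dec (c ∙ σ) ≟ᵛ c) (fwd x c) (bwd x c))
         (⟨⟩-× (x Finₚ.≟ lookup c s) ((c ∙ σ) ≟ᵛ c)))) ⟩
  (∑[ x ∈ allFin N ] ∑[ c ∈ cols N n ] ⟨ x Finₚ.≟ lookup c s ⟩ * ⟨ (c ∙ σ) ≟ᵛ c ⟩)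
    ≡⟨ ∑-swap (allFin N) (cols N n) _ ⟩
  (∑[ c ∈ cols N n ] ∑[ x ∈ allFin N ] ⟨ x Finₚ.≟ lookup c s ⟩ * ⟨ (c ∙ σ) ≟ᵛ c ⟩)
    ≡⟨ ∑-cong (cols N n) (λ c → Enumerates.pick (allFin-enumerates N) {lookup c s} tt _) ⟩
  Fix N σ ∎
  where
  open ≡-Reasoning
  t : Vec (Fin (suc n)) (suc n)
  t = tr zero (suc s)
  toggle : ∀ {A : Set} {c d : Vec A (suc n)} → c ∙ t ≡ d → c ≡ d ∙ t
  toggle {c = c} e = trans (sym (cancelʳ c (tr-involutive zero (suc s)))) (cong (_∙ t) e)
  lk : ∀ {A : Set} (c : Vec A (suc n)) i → lookup (c ∙ t) i ≡ lookup c (swapFin zero (suc s) i)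
  lk c i = trans (lookup-∙ c t i) (cong (lookup c) (lookup-tr zero (suc s) i))
  fwd : ∀ x c → (x ∷ c) ∙ (lift σ ∙ t) ≡ x ∷ c → (x ≡ lookup c s) × (c ∙ σ ≡ c)
  fwd x c e = x≡ , lookup-ext go
    where
    e′ : x ∷ (c ∙ σ) ≡ (x ∷ c) ∙ t
    e′ = trans (sym (cons-∙-lift x c σ)) (toggle (trans (∙-assoc (x ∷ c) (lift σ) t) e))
    at : ∀ i → lookup (x ∷ (c ∙ σ)) i ≡ lookup (x ∷ c) (swapFin zero (suc s) i)
    at i = trans (cong (λ v → lookup v i) e′) (lk (x ∷ c) i)
    x≡ : x ≡ lookup c s
    x≡ = trans (at zero) (cong (lookup (x ∷ c)) (swapFin-fst zero (suc s)))
    go : ∀ i → lookup (c ∙ σ) i ≡ lookup c i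
    go i with i Finₚ.≟ s
    ... | yes refl = trans (at (suc i)) (trans (cong (lookup (x ∷ c)) (swapFin-snd zero (suc i))) x≡)
    ... | no p = trans (at (suc i)) (cong (lookup (x ∷ c))
      (swapFin-other {a = zero} {suc s} {suc i} (λ ()) (λ q → p (Finₚ.suc-injective q))))
  bwd : ∀ x c → (x ≡ lookup c s) × (c ∙ σ ≡ c) → (x ∷ c) ∙ (lift σ ∙ t) ≡ x ∷ c
  bwd x c (refl , e) = trans (sym (∙-assoc (x ∷ c) (lift σ) t))
    (trans (cong (_∙ t) (trans (cons-∙-lift x c σ) (cong (x ∷_) e)))
      (lookup-ext (λ i → trans (lk (x ∷ c) i) (go i))))
    where
    go : ∀ i → lookup (x ∷ c) (swapFin zero (suc s) i) ≡ lookup (x ∷ c) i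
    go = swapCases zero (suc s) _
      (cong (lookup (x ∷ c)) (swapFin-fst zero (suc s)))
      (cong (lookup (x ∷ c)) (swapFin-snd zero (suc s)))
      (λ i p q → cong (lookup (x ∷ c)) (swapFin-other p q))

-- The first colour acts first, in the order in which the face permutation runs through the colours;
-- the cycles of the product correspond to the faces.
prod : ∀ {m n} → Vec (Vec (Fin n) n) m → Vec (Fin n) n
prod [] = idV
prod (σ ∷ t) = prod t ∙ σ

-- Determinants

module Determinant (R : CommutativeRing 0ℓ 0ℓ) where
  open CommutativeRing R
    using (Carrier; _≈_; setoid; +-cong; +-congˡ; +-congʳ; *-cong; *-congˡ; *-congʳ; -‿cong;
           +-identityˡ; +-identityʳ; *-identityˡ; *-identityʳ; zeroˡ; zeroʳ; distribˡ; distribʳ; *-comm; *-assoc;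
           +-assoc; +-comm; -‿inverseʳ; -‿inverseˡ)
    renaming (_+_ to _⊕_; _*_ to _⊛_; -_ to ⊖_; 0# to 𝟘; 1# to 𝟙; refl to ≈-refl; sym to ≈-sym; trans to ≈-trans; reflexive to ≈-reflexive)
  open SetoidReasoning setoid
  open RingProperties (CommutativeRing.ring R)
  open RingSum R using (+-interchange)

  -- Laplace expansion along a row, with the complementary minor left as a function of the remaining
  -- list. Determinants and antisymmetrised sums are iterations of it, so signs of permutations
  -- never appear.
  alt : ∀ {A : Set} → List A → (A → List A → Carrier) → Carrier
  alt [] F = 𝟘
  alt (x ∷ xs) F = F x xs ⊕ ⊖ alt xs (λ y ys → F y (x ∷ ys))

  alt-cong : ∀ {A : Set} (xs : List A) {F G : A → List A → Carrier} →
    (∀ y ys → F y ys ≈ G y ys) → alt xs F ≈ alt xs G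
  alt-cong [] h = ≈-refl
  alt-cong (x ∷ xs) h = +-cong (h x xs) (-‿cong (alt-cong xs (λ y ys → h y (x ∷ ys))))

  alt-zero : ∀ {A : Set} (xs : List A) {F : A → List A → Carrier} →
    (∀ as y bs → xs ≡ as ++ y ∷ bs → F y (as ++ bs) ≈ 𝟘) → alt xs F ≈ 𝟘
  alt-zero [] h = ≈-refl
  alt-zero (x ∷ xs) h = begin
    _        ≈⟨ +-cong (h [] x xs refl) (-‿cong (alt-zero xs (λ as y bs e → h (x ∷ as) y bs (cong (x ∷_) e)))) ⟩
    𝟘 ⊕ ⊖ 𝟘  ≈⟨ -‿inverseʳ 𝟘 ⟩
    𝟘        ∎

  alt-+ : ∀ {A : Set} (xs : List A) (F G : A → List A → Carrier) →
    alt xs (λ y ys → F y ys ⊕ G y ys) ≈ alt xs F ⊕ alt xs G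
  alt-+ [] F G = ≈-sym (+-identityˡ 𝟘)
  alt-+ (x ∷ xs) F G = begin
    (F x xs ⊕ G x xs) ⊕ ⊖ alt xs (λ y ys → F y (x ∷ ys) ⊕ G y (x ∷ ys))
      ≈⟨ +-congˡ (-‿cong (alt-+ xs _ _)) ⟩
    (F x xs ⊕ G x xs) ⊕ ⊖ (alt xs _ ⊕ alt xs _)
      ≈⟨ +-congˡ (≈-sym (-‿+-comm _ _)) ⟩
    (F x xs ⊕ G x xs) ⊕ (⊖ alt xs _ ⊕ ⊖ alt xs _)
      ≈⟨ +-interchange _ _ _ _ ⟩
    _ ∎

  alt-*ˡ : ∀ {A : Set} (xs : List A) (a : Carrier) (F : A → List A → Carrier) →
    alt xs (λ y ys → a ⊛ F y ys) ≈ a ⊛ alt xs F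
  alt-*ˡ [] a F = ≈-sym (zeroʳ a)
  alt-*ˡ (x ∷ xs) a F = begin
    a ⊛ F x xs ⊕ ⊖ alt xs (λ y ys → a ⊛ F y (x ∷ ys))  ≈⟨ +-congˡ (-‿cong (alt-*ˡ xs a _)) ⟩
    a ⊛ F x xs ⊕ ⊖ (a ⊛ alt xs _)                      ≈⟨ +-congˡ (-‿distribʳ-* a _) ⟩
    a ⊛ F x xs ⊕ a ⊛ ⊖ alt xs _                        ≈⟨ distribˡ a _ _ ⟨
    a ⊛ (F x xs ⊕ ⊖ alt xs _)                          ∎

  alt-neg : ∀ {A : Set} (xs : List A) (F : A → List A → Carrier) →
    alt xs (λ y ys → ⊖ F y ys) ≈ ⊖ alt xs F
  alt-neg [] F = ≈-sym -0#≈0#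
  alt-neg (x ∷ xs) F = ≈-trans (+-congˡ (-‿cong (alt-neg xs _))) (-‿+-comm _ _)

  alt-swap : ∀ {A B : Set} (xs : List A) (ys : List B) (F : A → List A → B → List B → Carrier) →
    alt xs (λ x xs′ → alt ys (F x xs′)) ≈ alt ys (λ y ys′ → alt xs (λ x xs′ → F x xs′ y ys′))
  alt-swap [] ys F = ≈-sym (alt-zero ys (λ _ _ _ _ → ≈-refl))
  alt-swap (x ∷ xs) ys F = begin
    alt ys (F x xs) ⊕ ⊖ alt xs (λ z zs → alt ys (F z (x ∷ zs)))
      ≈⟨ +-congˡ (-‿cong (alt-swap xs ys (λ z zs → F z (x ∷ zs)))) ⟩
    alt ys (F x xs) ⊕ ⊖ alt ys (λ y ys′ → alt xs (λ z zs → F z (x ∷ zs) y ys′))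
      ≈⟨ +-congˡ (alt-neg ys _) ⟨
    alt ys (F x xs) ⊕ alt ys (λ y ys′ → ⊖ alt xs (λ z zs → F z (x ∷ zs) y ys′))
      ≈⟨ alt-+ ys _ _ ⟨
    _ ∎

  alt-transpose : ∀ {A : Set} (xs : List A) (u v : A) (ys : List A) (F : A → List A → Carrier) →
    (∀ y as bs → F y (as ++ u ∷ v ∷ bs) ≈ ⊖ F y (as ++ v ∷ u ∷ bs)) →
    alt (xs ++ u ∷ v ∷ ys) F ≈ ⊖ alt (xs ++ v ∷ u ∷ ys) F
  alt-transpose [] u v ys F h = begin
    p ⊕ ⊖ (q ⊕ ⊖ alt ys (λ y zs → F y (u ∷ v ∷ zs)))
      ≈⟨ +-congˡ (-‿cong (+-congˡ (-‿cong (≈-trans (alt-cong ys (λ y zs → h y [] zs)) (alt-neg ys _))))) ⟩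
    p ⊕ ⊖ (q ⊕ ⊖ ⊖ w)          ≈⟨ +-congˡ (-‿+-comm q (⊖ ⊖ w)) ⟨
    p ⊕ (⊖ q ⊕ ⊖ ⊖ ⊖ w)        ≈⟨ +-congˡ (+-comm _ _) ⟩
    p ⊕ (⊖ ⊖ ⊖ w ⊕ ⊖ q)        ≈⟨ +-assoc _ _ _ ⟨
    (p ⊕ ⊖ ⊖ ⊖ w) ⊕ ⊖ q        ≈⟨ +-comm _ _ ⟩
    ⊖ q ⊕ (p ⊕ ⊖ ⊖ ⊖ w)        ≈⟨ +-congˡ (+-cong (-‿involutive p) (-‿cong (≈-sym (-‿involutive w)) )) ⟨
    ⊖ q ⊕ (⊖ ⊖ p ⊕ ⊖ w)        ≈⟨ +-congˡ (+-congˡ (-‿cong (-‿involutive w))) ⟨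
    ⊖ q ⊕ (⊖ ⊖ p ⊕ ⊖ ⊖ ⊖ w)    ≈⟨ +-congˡ (-‿+-comm _ _) ⟩
    ⊖ q ⊕ ⊖ (⊖ p ⊕ ⊖ ⊖ w)      ≈⟨ -‿+-comm _ _ ⟩
    ⊖ (q ⊕ (⊖ p ⊕ ⊖ ⊖ w))      ≈⟨ -‿cong (+-congˡ (-‿+-comm _ _)) ⟩
    ⊖ (q ⊕ ⊖ (p ⊕ ⊖ w))        ∎
    where
    p = F u (v ∷ ys)
    q = F v (u ∷ ys)
    w = alt ys (λ y zs → F y (v ∷ u ∷ zs))
  alt-transpose (x ∷ xs) u v ys F h = begin
    F x (xs ++ u ∷ v ∷ ys) ⊕ ⊖ alt (xs ++ u ∷ v ∷ ys) (λ y zs → F y (x ∷ zs))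
      ≈⟨ +-cong (h x xs ys) (-‿cong (alt-transpose xs u v ys _ (λ y as bs → h y (x ∷ as) bs))) ⟩
    ⊖ F x (xs ++ v ∷ u ∷ ys) ⊕ ⊖ ⊖ alt (xs ++ v ∷ u ∷ ys) (λ y zs → F y (x ∷ zs))
      ≈⟨ -‿+-comm _ _ ⟩
    _ ∎

  alt-repeat : ∀ {A : Set} (xs : List A) (u : A) (ys : List A) (F : A → List A → Carrier) →
    (∀ y as bs → F y (as ++ u ∷ u ∷ bs) ≈ 𝟘) →
    alt (xs ++ u ∷ u ∷ ys) F ≈ 𝟘
  alt-repeat [] u ys F h = begin
    F u (u ∷ ys) ⊕ ⊖ (F u (u ∷ ys) ⊕ ⊖ alt ys (λ y zs → F y (u ∷ u ∷ zs)))
      ≈⟨ +-congˡ (-‿cong (+-congˡ (-‿cong (alt-zero ys (λ as y bs _ → h y [] (as ++ bs)))))) ⟩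
    F u (u ∷ ys) ⊕ ⊖ (F u (u ∷ ys) ⊕ ⊖ 𝟘)
      ≈⟨ +-congˡ (-‿cong (≈-trans (+-congˡ -0#≈0#) (+-identityʳ _))) ⟩
    F u (u ∷ ys) ⊕ ⊖ F u (u ∷ ys)
      ≈⟨ -‿inverseʳ _ ⟩
    𝟘 ∎
  alt-repeat (x ∷ xs) u ys F h = begin
    _        ≈⟨ +-cong (h x xs ys) (-‿cong (alt-repeat xs u ys _ (λ y as bs → h y (x ∷ as) bs))) ⟩
    𝟘 ⊕ ⊖ 𝟘  ≈⟨ -‿inverseʳ 𝟘 ⟩
    𝟘        ∎

  -- Rows and columns are lists of labels, so that a minor is a change of lists. Lists of different
  -- lengths give 0, which lets the expansions hold without size hypotheses.
  det : ∀ {I J : Set} → (I → J → Carrier) → List I → List J → Carrier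
  det b [] [] = 𝟙
  det b [] (_ ∷ _) = 𝟘
  det b (r ∷ rs) cs = alt cs (λ c cs′ → b r c ⊛ det b rs cs′)

  det-cong : ∀ {I J : Set} {b b′ : I → J → Carrier} (rs : List I) (cs : List J) →
    (∀ r c → b r c ≈ b′ r c) → det b rs cs ≈ det b′ rs cs
  det-cong [] [] h = ≈-refl
  det-cong [] (_ ∷ _) h = ≈-refl
  det-cong (r ∷ rs) cs h = alt-cong cs (λ c cs′ → *-cong (h r c) (det-cong rs cs′ h))

  alt-map : ∀ {A B : Set} (f : A → B) (xs : List A) (F : B → List B → Carrier) →
    alt (map f xs) F ≈ alt xs (λ x xs′ → F (f x) (map f xs′))
  alt-map f [] F = ≈-refl
  alt-map f (x ∷ xs) F = +-congˡ (-‿cong (alt-map f xs _))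

  det-map : ∀ {I J K : Set} (b : I → J → Carrier) (f : K → J) (rs : List I) (ks : List K) →
    det b rs (map f ks) ≈ det (λ r k → b r (f k)) rs ks
  det-map b f [] [] = ≈-refl
  det-map b f [] (_ ∷ _) = ≈-refl
  det-map b f (r ∷ rs) ks = ≈-trans (alt-map f ks _) (alt-cong ks (λ k ks′ → *-congˡ (det-map b f rs ks′)))

  -- Induction on the rows: the row expansion and the inductive column expansion of the minors are
  -- exchanged by `alt-swap`.
  det-column : ∀ {I J : Set} (b : I → J → Carrier) (rs : List I) (c : J) (cs : List J) →
    det b rs (c ∷ cs) ≈ alt rs (λ r rs′ → b r c ⊛ det b rs′ cs)
  det-column b [] c cs = ≈-refl
  det-column b (r ∷ rs) c cs = +-congˡ (-‿cong (begin
    alt cs (λ w ws → b r w ⊛ det b rs (c ∷ ws))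
      ≈⟨ alt-cong cs (λ w ws → ≈-trans (*-congˡ (det-column b rs c ws)) (≈-sym (alt-*ˡ rs (b r w) _))) ⟩
    alt cs (λ w ws → alt rs (λ r′ rs′ → b r w ⊛ (b r′ c ⊛ det b rs′ ws)))
      ≈⟨ alt-swap cs rs _ ⟩
    alt rs (λ r′ rs′ → alt cs (λ w ws → b r w ⊛ (b r′ c ⊛ det b rs′ ws)))
      ≈⟨ alt-cong rs (λ r′ rs′ → ≈-trans
           (alt-cong cs (λ w ws → ≈-trans (≈-sym (*-assoc _ _ _)) (≈-trans (*-congʳ (*-comm _ _)) (*-assoc _ _ _))))
           (alt-*ˡ cs (b r′ c) _)) ⟩
    alt rs (λ r′ rs′ → b r′ c ⊛ det b (r ∷ rs′) cs) ∎))

  det-flip : ∀ {I J : Set} (b : I → J → Carrier) (rs : List I) (cs : List J) →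
    det b rs cs ≈ det (λ c r → b r c) cs rs
  det-flip b [] [] = ≈-refl
  det-flip b (r ∷ rs) [] = ≈-refl
  det-flip b rs (c ∷ cs) = ≈-trans (det-column b rs c cs)
    (alt-cong rs (λ r rs′ → *-congˡ (det-flip b rs′ cs)))

  det-transpose : ∀ {I J : Set} (b : I → J → Carrier) (rs : List I) (xs : List J) (u v : J) (ys : List J) →
    det b rs (xs ++ u ∷ v ∷ ys) ≈ ⊖ det b rs (xs ++ v ∷ u ∷ ys)
  det-transpose b [] [] u v ys = ≈-sym -0#≈0#
  det-transpose b [] (_ ∷ _) u v ys = ≈-sym -0#≈0#
  det-transpose b (r ∷ rs) xs u v ys = alt-transpose xs u v ys _ (λ y as bs →
    ≈-trans (*-congˡ (det-transpose b rs as u v bs)) (≈-sym (-‿distribʳ-* _ _)))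

  det-repeat : ∀ {I J : Set} (b : I → J → Carrier) (rs : List I) (xs : List J) (u : J) (ys : List J) →
    det b rs (xs ++ u ∷ u ∷ ys) ≈ 𝟘
  det-repeat b [] [] u ys = ≈-refl
  det-repeat b [] (_ ∷ _) u ys = ≈-refl
  det-repeat b (r ∷ rs) xs u ys = alt-repeat xs u ys _ (λ y as bs →
    ≈-trans (*-congˡ (det-repeat b rs as u bs)) (zeroʳ _))

  sgn : ∀ {A : Set} → List A → Carrier → Carrier
  sgn [] x = x
  sgn (_ ∷ as) x = ⊖ sgn as x

  sgn-cong : ∀ {A : Set} (as : List A) {x y} → x ≈ y → sgn as x ≈ sgn as y
  sgn-cong [] h = h
  sgn-cong (_ ∷ as) h = -‿cong (sgn-cong as h)

  sgn-neg : ∀ {A : Set} (as : List A) x → sgn as (⊖ x) ≈ ⊖ sgn as x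
  sgn-neg [] x = ≈-refl
  sgn-neg (_ ∷ as) x = -‿cong (sgn-neg as x)

  sgn-sgn : ∀ {A B : Set} (as : List A) (bs : List B) x → length as ≡ length bs → sgn as (sgn bs x) ≈ x
  sgn-sgn [] [] x e = ≈-refl
  sgn-sgn (_ ∷ as) (_ ∷ bs) x e = begin
    ⊖ sgn as (⊖ sgn bs x)  ≈⟨ -‿cong (sgn-neg as _) ⟩
    ⊖ ⊖ sgn as (sgn bs x)  ≈⟨ -‿involutive _ ⟩
    sgn as (sgn bs x)      ≈⟨ sgn-sgn as bs x (ℕₚ.suc-injective e) ⟩
    x                      ∎

  sgn-zero : ∀ {A : Set} (as : List A) → sgn as 𝟘 ≈ 𝟘
  sgn-zero [] = ≈-refl
  sgn-zero (_ ∷ as) = ≈-trans (-‿cong (sgn-zero as)) -0#≈0#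

  det-move : ∀ {I J : Set} (b : I → J → Carrier) (rs : List I) (as xs : List J) (u : J) (ys : List J) →
    det b rs (as ++ xs ++ u ∷ ys) ≈ sgn xs (det b rs (as ++ u ∷ xs ++ ys))
  det-move b rs as [] u ys = ≈-refl
  det-move b rs as (x ∷ xs) u ys = begin
    det b rs (as ++ x ∷ xs ++ u ∷ ys)
      ≈⟨ ≈-reflexive (cong (det b rs) (sym (Listₚ.++-assoc as [ x ] (xs ++ u ∷ ys)))) ⟩
    det b rs ((as ++ [ x ]) ++ xs ++ u ∷ ys)
      ≈⟨ det-move b rs (as ++ [ x ]) xs u ys ⟩
    sgn xs (det b rs ((as ++ [ x ]) ++ u ∷ xs ++ ys))
      ≈⟨ sgn-cong xs (≈-reflexive (cong (det b rs) (Listₚ.++-assoc as [ x ] (u ∷ xs ++ ys)))) ⟩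
    sgn xs (det b rs (as ++ x ∷ u ∷ xs ++ ys))
      ≈⟨ sgn-cong xs (det-transpose b rs as x u (xs ++ ys)) ⟩
    sgn xs (⊖ det b rs (as ++ u ∷ x ∷ xs ++ ys))
      ≈⟨ sgn-neg xs _ ⟩
    ⊖ sgn xs (det b rs (as ++ u ∷ x ∷ xs ++ ys)) ∎

  det-repeat-head : ∀ {I J : Set} (b : I → J → Carrier) (rs : List I) (u : J) (xs ys : List J) →
    det b rs (u ∷ xs ++ u ∷ ys) ≈ 𝟘
  det-repeat-head b rs u xs ys = begin
    det b rs (u ∷ xs ++ u ∷ ys)          ≈⟨ det-move b rs [ u ] xs u ys ⟩
    sgn xs (det b rs (u ∷ u ∷ xs ++ ys)) ≈⟨ sgn-cong xs (det-repeat b rs [] u (xs ++ ys)) ⟩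
    sgn xs 𝟘                             ≈⟨ sgn-zero xs ⟩
    𝟘                                    ∎

  -- Moving the last row and the last column to the front costs two signs, equal because the lengths
  -- agree.
  det-rotate : ∀ {I J : Set} (b : I → J → Carrier) (rs : List I) (r : I) (cs : List J) (c : J) →
    length rs ≡ length cs → det b (rs ++ [ r ]) (cs ++ [ c ]) ≈ det b (r ∷ rs) (c ∷ cs)
  det-rotate b rs r cs c e = begin
    det b (rs ++ [ r ]) (cs ++ [ c ])
      ≈⟨ det-move b (rs ++ [ r ]) [] cs c [] ⟩
    sgn cs (det b (rs ++ [ r ]) (c ∷ cs ++ []))
      ≈⟨ sgn-cong cs (≈-reflexive (cong (λ l → det b (rs ++ [ r ]) (c ∷ l)) (Listₚ.++-identityʳ cs))) ⟩
    sgn cs (det b (rs ++ [ r ]) (c ∷ cs))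
      ≈⟨ sgn-cong cs (det-flip b (rs ++ [ r ]) (c ∷ cs)) ⟩
    sgn cs (det bᵀ (c ∷ cs) (rs ++ [ r ]))
      ≈⟨ sgn-cong cs (det-move bᵀ (c ∷ cs) [] rs r []) ⟩
    sgn cs (sgn rs (det bᵀ (c ∷ cs) (r ∷ rs ++ [])))
      ≈⟨ sgn-sgn cs rs _ (sym e) ⟩
    det bᵀ (c ∷ cs) (r ∷ rs ++ [])
      ≈⟨ ≈-reflexive (cong (λ l → det bᵀ (c ∷ cs) (r ∷ l)) (Listₚ.++-identityʳ rs)) ⟩
    det bᵀ (c ∷ cs) (r ∷ rs)
      ≈⟨ det-flip b (r ∷ rs) (c ∷ cs) ⟨
    det b (r ∷ rs) (c ∷ cs) ∎
    where bᵀ = λ c r → b r c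

  -- The Plücker relation: D(I; x ∷ ws) is linear in the entries of x, and
  -- replacing it by the entry in row r produces a determinant with row r twice.
  plücker : ∀ {I J : Set} (b : I → J → Carrier) (rs : List I) (xs ws : List J) →
    alt xs (λ x xs′ → det b rs xs′ ⊛ det b rs (x ∷ ws)) ≈ 𝟘
  plücker b rs xs ws = begin
    alt xs (λ x xs′ → det b rs xs′ ⊛ det b rs (x ∷ ws))
      ≈⟨ alt-cong xs (λ x xs′ → ≈-trans (*-congˡ (det-column b rs x ws)) (≈-sym (alt-*ˡ rs _ _))) ⟩
    alt xs (λ x xs′ → alt rs (λ r rs′ → det b rs xs′ ⊛ (b r x ⊛ det b rs′ ws)))
      ≈⟨ alt-swap xs rs _ ⟩
    alt rs (λ r rs′ → alt xs (λ x xs′ → det b rs xs′ ⊛ (b r x ⊛ det b rs′ ws)))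
      ≈⟨ alt-cong rs (λ r rs′ → ≈-trans
           (alt-cong xs (λ x xs′ → ≈-trans (≈-sym (*-assoc _ _ _))
             (≈-trans (*-comm _ _) (*-congˡ (*-comm _ _)))))
           (alt-*ˡ xs (det b rs′ ws) _)) ⟩
    alt rs (λ r rs′ → det b rs′ ws ⊛ det b (r ∷ rs) xs)
      ≈⟨ alt-zero rs (λ { as r bs refl → ≈-trans (*-congˡ (≈-trans (det-flip b (r ∷ as ++ r ∷ bs) xs)
           (det-repeat-head (λ c r → b r c) xs r as bs))) (zeroʳ _) }) ⟩
    𝟘 ∎

  -- Columns become arbitrary vectors, so unit vectors and linear combinations can be used as
  -- columns.
  entry : ∀ {I : Set} → I → (I → Carrier) → Carrier
  entry r v = v r

  det-unit : ∀ {I : Set} (e : I → Carrier) (r : I) (rs : List I) (cs : List (I → Carrier)) →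
    e r ≈ 𝟙 → (∀ {r′} → r′ ∈ rs → e r′ ≈ 𝟘) → det entry (r ∷ rs) (e ∷ cs) ≈ det entry rs cs
  det-unit e r rs cs h k = begin
    det entry (r ∷ rs) (e ∷ cs)
      ≈⟨ det-column entry (r ∷ rs) e cs ⟩
    e r ⊛ det entry rs cs ⊕ ⊖ alt rs (λ r′ rs′ → e r′ ⊛ det entry (r ∷ rs′) cs)
      ≈⟨ +-cong (≈-trans (*-congʳ h) (*-identityˡ _)) (-‿cong (alt-zero rs (λ { as r′ bs refl →
           ≈-trans (*-congʳ (k (∈ₚ.∈-++⁺ʳ as (here refl)))) (zeroˡ _) }))) ⟩
    det entry rs cs ⊕ ⊖ 𝟘
      ≈⟨ ≈-trans (+-congˡ -0#≈0#) (+-identityʳ _) ⟩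
    det entry rs cs ∎

  -- The Plücker relation for the columns e, c₁, c₂, cs against f, cs, where e and f are the unit
  -- vectors of the rows r₁ and r₂. A unit column deletes its row, which turns the full-size
  -- determinants into the minors of the identity.
  desnanot-jacobi : ∀ {J : Set} (b : ℕ → J → Carrier) (r₁ r₂ : ℕ) (rs : List ℕ) (c₁ c₂ : J) (cs : List J) →
    r₁ ≢ r₂ → r₁ ∉ rs → r₂ ∉ rs →
    det b (r₁ ∷ r₂ ∷ rs) (c₁ ∷ c₂ ∷ cs) ⊛ det b rs cs ⊕
      det b (r₂ ∷ rs) (c₁ ∷ cs) ⊛ det b (r₁ ∷ rs) (c₂ ∷ cs) ≈
    det b (r₂ ∷ rs) (c₂ ∷ cs) ⊛ det b (r₁ ∷ rs) (c₁ ∷ cs)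
  desnanot-jacobi {J} b r₁ r₂ rs c₁ c₂ cs r₁≢r₂ r₁∉ r₂∉ = begin
    D rr (c₁ ∷ c₂ ∷ cs) ⊛ D rs cs ⊕ D (r₂ ∷ rs) (c₁ ∷ cs) ⊛ D (r₁ ∷ rs) (c₂ ∷ cs)
      ≈⟨ +-cong (*-cong (toEntry rr (c₁ ∷ c₂ ∷ cs)) (≈-trans (toEntry rs cs) (≈-sym ef)))
                (*-cong (≈-trans (toEntry (r₂ ∷ rs) (c₁ ∷ cs)) (≈-sym (e- c₁))) (≈-trans (toEntry (r₁ ∷ rs) (c₂ ∷ cs)) (≈-sym (-f c₂)))) ⟩
    F e (v c₁ ∷ v c₂ ∷ vs) ⊕ F (v c₂) (e ∷ v c₁ ∷ vs)
      ≈⟨ x-[y-z]≈0⇒x+z≈y _ _ _ relation ⟩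
    F (v c₁) (e ∷ v c₂ ∷ vs)
      ≈⟨ *-cong (≈-trans (e- c₂) (≈-sym (toEntry (r₂ ∷ rs) (c₂ ∷ cs)))) (≈-trans (-f c₁) (≈-sym (toEntry (r₁ ∷ rs) (c₁ ∷ cs)))) ⟩
    D (r₂ ∷ rs) (c₂ ∷ cs) ⊛ D (r₁ ∷ rs) (c₁ ∷ cs) ∎
    where
    D = det b
    rr = r₁ ∷ r₂ ∷ rs
    unit : ℕ → ℕ → Carrier
    unit r r′ with r ℕₚ.≟ r′
    ... | yes _ = 𝟙
    ... | no _ = 𝟘
    unit-1 : ∀ r → unit r r ≈ 𝟙
    unit-1 r with r ℕₚ.≟ r
    ... | yes _ = ≈-refl
    ... | no p = contradiction refl p
    unit-0 : ∀ {r r′} → r ≢ r′ → unit r r′ ≈ 𝟘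
    unit-0 {r} {r′} p with r ℕₚ.≟ r′
    ... | yes q = contradiction q p
    ... | no _ = ≈-refl
    e f : ℕ → Carrier
    e = unit r₁
    f = unit r₂
    v : J → ℕ → Carrier
    v c r = b r c
    vs : List (ℕ → Carrier)
    vs = map v cs
    toEntry : ∀ is js → D is js ≈ det entry is (map v js)
    toEntry is js = ≈-sym (det-map entry v is js)
    f-rs : ∀ {r′} → r′ ∈ rs → f r′ ≈ 𝟘
    f-rs {r′} p = unit-0 {r₂} {r′} (λ { refl → r₂∉ p })
    e-rs : ∀ {r′} → r′ ∈ r₂ ∷ rs → e r′ ≈ 𝟘
    e-rs (here refl) = unit-0 r₁≢r₂
    e-rs {r′} (there p) = unit-0 {r₁} {r′} (λ { refl → r₁∉ p })
    f-rs′ : ∀ {r′} → r′ ∈ r₁ ∷ rs → f r′ ≈ 𝟘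
    f-rs′ (here refl) = unit-0 (r₁≢r₂ ∘ sym)
    f-rs′ (there p) = f-rs p
    e- : ∀ c → det entry rr (e ∷ v c ∷ vs) ≈ det entry (r₂ ∷ rs) (v c ∷ vs)
    e- c = det-unit e r₁ (r₂ ∷ rs) (v c ∷ vs) (unit-1 r₁) e-rs
    ef : det entry rr (e ∷ f ∷ vs) ≈ det entry rs vs
    ef = ≈-trans (det-unit e r₁ (r₂ ∷ rs) (f ∷ vs) (unit-1 r₁) e-rs) (det-unit f r₂ rs vs (unit-1 r₂) f-rs)
    -f : ∀ c → det entry rr (v c ∷ f ∷ vs) ≈ det entry (r₁ ∷ rs) (v c ∷ vs)
    -f c = begin
      det entry rr (v c ∷ f ∷ vs)
        ≈⟨ det-transpose entry rr [] (v c) f vs ⟩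
      ⊖ det entry rr (f ∷ v c ∷ vs)
        ≈⟨ -‿cong (det-flip entry rr (f ∷ v c ∷ vs)) ⟩
      ⊖ det (λ c r → entry r c) (f ∷ v c ∷ vs) (r₁ ∷ r₂ ∷ rs)
        ≈⟨ -‿cong (det-transpose (λ c r → entry r c) (f ∷ v c ∷ vs) [] r₁ r₂ rs) ⟩
      ⊖ ⊖ det (λ c r → entry r c) (f ∷ v c ∷ vs) (r₂ ∷ r₁ ∷ rs)
        ≈⟨ -‿involutive _ ⟩
      det (λ c r → entry r c) (f ∷ v c ∷ vs) (r₂ ∷ r₁ ∷ rs)
        ≈⟨ det-flip entry (r₂ ∷ r₁ ∷ rs) (f ∷ v c ∷ vs) ⟨
      det entry (r₂ ∷ r₁ ∷ rs) (f ∷ v c ∷ vs)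
        ≈⟨ det-unit f r₂ (r₁ ∷ rs) (v c ∷ vs) (unit-1 r₂) f-rs′ ⟩
      det entry (r₁ ∷ rs) (v c ∷ vs) ∎
    F : (ℕ → Carrier) → List (ℕ → Carrier) → Carrier
    F x xs = det entry rr xs ⊛ det entry rr (x ∷ f ∷ vs)
    -- Only three terms of the Plücker sum survive: when a column of `vs` is exchanged, it occurs
    -- twice in the second factor.
    relation : F e (v c₁ ∷ v c₂ ∷ vs) ⊕ ⊖ (F (v c₁) (e ∷ v c₂ ∷ vs) ⊕ ⊖ F (v c₂) (e ∷ v c₁ ∷ vs)) ≈ 𝟘
    relation = begin
      _ ≈⟨ +-congˡ (-‿cong (+-congˡ (-‿cong (≈-trans (≈-sym (+-identityʳ _)) (+-congˡ (≈-sym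
             (≈-trans (-‿cong (alt-zero vs (λ { as x bs eq → ≈-trans (*-congˡ
               (≈-trans (≈-reflexive (cong (λ l → det entry rr (x ∷ f ∷ l)) eq))
                 (det-repeat-head entry rr x (f ∷ as) bs))) (zeroʳ _) }))) -0#≈0#))))))) ⟩
      alt (e ∷ v c₁ ∷ v c₂ ∷ vs) F ≈⟨ plücker entry rr (e ∷ v c₁ ∷ v c₂ ∷ vs) (f ∷ vs) ⟩
      𝟘 ∎
    x-[y-z]≈0⇒x+z≈y : ∀ x y z → x ⊕ ⊖ (y ⊕ ⊖ z) ≈ 𝟘 → x ⊕ z ≈ y
    x-[y-z]≈0⇒x+z≈y x y z h = begin
      x ⊕ z                ≈⟨ +-congʳ (≈-trans (inverseˡ-unique x _ h) (-‿involutive _)) ⟩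
      (y ⊕ ⊖ z) ⊕ z        ≈⟨ +-assoc _ _ _ ⟩
      y ⊕ (⊖ z ⊕ z)        ≈⟨ +-congˡ (-‿inverseˡ z) ⟩
      y ⊕ 𝟘                ≈⟨ +-identityʳ y ⟩
      y                    ∎
      where
      open import Algebra.Properties.Group (CommutativeRing.+-group R) using (inverseˡ-unique)

  -- Multilinearity and column operations

  alt-linear : ∀ {A : Set} (y : Carrier) (w u v : A) (xs ys : List A) (F : A → List A → Carrier) →
    (∀ z as bs → F z (as ++ w ∷ bs) ≈ F z (as ++ u ∷ bs) ⊕ y ⊛ F z (as ++ v ∷ bs)) →
    (∀ as → F w as ≈ F u as ⊕ y ⊛ F v as) →
    alt (xs ++ w ∷ ys) F ≈ alt (xs ++ u ∷ ys) F ⊕ y ⊛ alt (xs ++ v ∷ ys) F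
  alt-linear y w u v xs ys F h k = begin
    alt (xs ++ w ∷ ys) F ≈⟨ go xs F h k ⟩
    alt (xs ++ u ∷ ys) F ⊕ y ⊛ alt (xs ++ v ∷ ys) F ∎
    where
    step : ∀ {p q p₁ q₁ p₂ q₂} → p ≈ p₁ ⊕ y ⊛ p₂ → q ≈ q₁ ⊕ y ⊛ q₂ →
      p ⊕ ⊖ q ≈ (p₁ ⊕ ⊖ q₁) ⊕ y ⊛ (p₂ ⊕ ⊖ q₂)
    step {p} {q} {p₁} {q₁} {p₂} {q₂} e e′ = begin
      p ⊕ ⊖ q                                  ≈⟨ +-cong e (-‿cong e′) ⟩
      (p₁ ⊕ y ⊛ p₂) ⊕ ⊖ (q₁ ⊕ y ⊛ q₂)          ≈⟨ +-congˡ (≈-sym (-‿+-comm _ _)) ⟩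
      (p₁ ⊕ y ⊛ p₂) ⊕ (⊖ q₁ ⊕ ⊖ (y ⊛ q₂))      ≈⟨ +-interchange _ _ _ _ ⟩
      (p₁ ⊕ ⊖ q₁) ⊕ (y ⊛ p₂ ⊕ ⊖ (y ⊛ q₂))      ≈⟨ +-congˡ (+-congˡ (-‿distribʳ-* y q₂)) ⟩
      (p₁ ⊕ ⊖ q₁) ⊕ (y ⊛ p₂ ⊕ y ⊛ ⊖ q₂)        ≈⟨ +-congˡ (distribˡ y _ _) ⟨
      (p₁ ⊕ ⊖ q₁) ⊕ y ⊛ (p₂ ⊕ ⊖ q₂)            ∎
    go : ∀ xs F → (∀ z as bs → F z (as ++ w ∷ bs) ≈ F z (as ++ u ∷ bs) ⊕ y ⊛ F z (as ++ v ∷ bs)) →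
      (∀ as → F w as ≈ F u as ⊕ y ⊛ F v as) →
      alt (xs ++ w ∷ ys) F ≈ alt (xs ++ u ∷ ys) F ⊕ y ⊛ alt (xs ++ v ∷ ys) F
    go [] F h k = step (k ys) (begin
      alt ys (λ z zs → F z (w ∷ zs))  ≈⟨ alt-cong ys (λ z zs → h z [] zs) ⟩
      _                               ≈⟨ alt-+ ys _ _ ⟩
      _                               ≈⟨ +-congˡ (alt-*ˡ ys y _) ⟩
      _ ∎)
    go (x ∷ xs) F h k = step (h x xs ys) (go xs _ (λ z as bs → h z (x ∷ as) bs) (λ as → k (x ∷ as)))

  det-linear : ∀ {I : Set} (rs : List I) (y : Carrier) (u v : I → Carrier) (xs ys : List (I → Carrier)) →
    det entry rs (xs ++ (λ r → u r ⊕ y ⊛ v r) ∷ ys) ≈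
    det entry rs (xs ++ u ∷ ys) ⊕ y ⊛ det entry rs (xs ++ v ∷ ys)
  det-linear [] y u v [] ys = ≈-sym (≈-trans (+-identityˡ _) (zeroʳ y))
  det-linear [] y u v (_ ∷ _) ys = ≈-sym (≈-trans (+-identityˡ _) (zeroʳ y))
  det-linear (r ∷ rs) y u v xs ys = alt-linear y _ u v xs ys _
    (λ z as bs → begin
      z r ⊛ det entry rs (as ++ _ ∷ bs)      ≈⟨ *-congˡ (det-linear rs y u v as bs) ⟩
      z r ⊛ (det entry rs (as ++ u ∷ bs) ⊕ y ⊛ det entry rs (as ++ v ∷ bs)) ≈⟨ distribˡ _ _ _ ⟩
      _ ⊕ z r ⊛ (y ⊛ det entry rs (as ++ v ∷ bs))  ≈⟨ +-congˡ (swapˡ _ _ _) ⟩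
      _ ∎)
    (λ as → ≈-trans (distribʳ _ _ _) (+-congˡ (*-assoc y _ _)))
    where
    swapˡ : ∀ p q s → p ⊛ (q ⊛ s) ≈ q ⊛ (p ⊛ s)
    swapˡ p q s = ≈-trans (≈-sym (*-assoc p q s)) (≈-trans (*-congʳ (*-comm p q)) (*-assoc q p s))

  differences : ∀ {I : Set} → Carrier → (I → Carrier) → List (I → Carrier) → List (I → Carrier)
  differences y v [] = []
  differences y v (w ∷ vs) = (λ r → w r ⊕ (⊖ y) ⊛ v r) ∷ differences y w vs

  det-differences : ∀ {I : Set} (rs : List I) (y : Carrier) (xs : List (I → Carrier)) (w : I → Carrier) (vs : List (I → Carrier)) →
    det entry rs (xs ++ w ∷ differences y w vs) ≈ det entry rs (xs ++ w ∷ vs)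
  det-differences rs y xs w [] = ≈-refl
  det-differences rs y xs w (w′ ∷ vs) = begin
    det entry rs (xs ++ w ∷ (λ r → w′ r ⊕ (⊖ y) ⊛ w r) ∷ differences y w′ vs)
      ≈⟨ ≈-reflexive (cong (det entry rs) (sym (Listₚ.++-assoc xs [ w ] _))) ⟩
    det entry rs ((xs ++ [ w ]) ++ (λ r → w′ r ⊕ (⊖ y) ⊛ w r) ∷ differences y w′ vs)
      ≈⟨ det-linear rs (⊖ y) w′ w (xs ++ [ w ]) (differences y w′ vs) ⟩
    det entry rs ((xs ++ [ w ]) ++ w′ ∷ differences y w′ vs) ⊕ (⊖ y) ⊛ det entry rs ((xs ++ [ w ]) ++ w ∷ differences y w′ vs)
      ≈⟨ +-cong (det-differences rs y (xs ++ [ w ]) w′ vs)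
           (≈-trans (*-congˡ (≈-trans (≈-reflexive (cong (det entry rs) (Listₚ.++-assoc xs [ w ] _)))
             (det-repeat entry rs xs w _))) (zeroʳ _)) ⟩
    det entry rs ((xs ++ [ w ]) ++ w′ ∷ vs) ⊕ 𝟘
      ≈⟨ +-identityʳ _ ⟩
    det entry rs ((xs ++ [ w ]) ++ w′ ∷ vs)
      ≈⟨ ≈-reflexive (cong (det entry rs) (Listₚ.++-assoc xs [ w ] _)) ⟩
    det entry rs (xs ++ w ∷ w′ ∷ vs) ∎

  iota : ℕ → ℕ → List ℕ
  iota k zero = []
  iota k (suc l) = k ∷ iota (suc k) l

  -- If row r is a geometric progression of ratio y, subtracting y times each
  -- column from the next one clears it.
  det-geometric : ∀ {I : Set} (b : I → ℕ → Carrier) (y : Carrier) (r : I) (rs : List I) (k l : ℕ) →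
    (∀ j → b r (suc j) ≈ y ⊛ b r j) →
    det b (r ∷ rs) (iota k (suc l)) ≈ b r k ⊛ det (λ s j → b s (suc j) ⊕ (⊖ y) ⊛ b s j) rs (iota k l)
  det-geometric {I} b y r rs k l geo = begin
    det b (r ∷ rs) (iota k (suc l))
      ≈⟨ det-map entry col (r ∷ rs) (iota k (suc l)) ⟨
    det entry (r ∷ rs) (map col (iota k (suc l)))
      ≈⟨ go [] k l ⟩
    b r k ⊛ det entry rs (differences y (col k) (map col (iota (suc k) l)))
      ≈⟨ *-congˡ (≈-reflexive (cong (det entry rs) (diffs k l))) ⟩
    b r k ⊛ det entry rs (map (λ j s → b s (suc j) ⊕ (⊖ y) ⊛ b s j) (iota k l))
      ≈⟨ *-congˡ (det-map entry _ rs (iota k l)) ⟩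
    b r k ⊛ det (λ s j → b s (suc j) ⊕ (⊖ y) ⊛ b s j) rs (iota k l) ∎
    where
    col : ℕ → I → Carrier
    col j s = b s j
    diffs : ∀ k l → differences y (col k) (map col (iota (suc k) l)) ≡ map (λ j s → b s (suc j) ⊕ (⊖ y) ⊛ b s j) (iota k l)
    diffs k zero = refl
    diffs k (suc l) = cong (_ ∷_) (diffs (suc k) l)
    go : ∀ xs k l → alt (map col (iota k (suc l))) (λ c cs → c r ⊛ det entry rs (xs ++ cs)) ≈
      b r k ⊛ det entry rs (xs ++ differences y (col k) (map col (iota (suc k) l)))
    go xs k zero = ≈-trans (+-congˡ -0#≈0#) (+-identityʳ _)
    go xs k (suc l) = begin
      b r k ⊛ det entry rs (xs ++ ws) ⊕ ⊖ alt ws (λ c cs → c r ⊛ det entry rs (xs ++ col k ∷ cs))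
        ≈⟨ +-cong (*-congˡ (≈-sym (det-differences rs y xs (col (suc k)) (map col (iota (suc (suc k)) l)))))
             (-‿cong (alt-cong ws {λ c cs → c r ⊛ det entry rs (xs ++ col k ∷ cs)} {λ c cs → c r ⊛ det entry rs ((xs ++ [ col k ]) ++ cs)}
               (λ c cs → *-congˡ (≈-reflexive (cong (det entry rs) (sym (Listₚ.++-assoc xs [ col k ] cs))))))) ⟩
      b r k ⊛ p ⊕ ⊖ alt ws (λ c cs → c r ⊛ det entry rs ((xs ++ [ col k ]) ++ cs))
        ≈⟨ +-congˡ (-‿cong (≈-trans (go (xs ++ [ col k ]) (suc k) l)
             (*-cong (geo k) (≈-reflexive (cong (det entry rs) (Listₚ.++-assoc xs [ col k ] _)))))) ⟩
      b r k ⊛ p ⊕ ⊖ ((y ⊛ b r k) ⊛ q)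
        ≈⟨ +-congˡ (≈-trans (-‿cong (≈-trans (*-congʳ (*-comm y (b r k))) (*-assoc _ _ _)))
             (≈-trans (-‿distribʳ-* _ _) (*-congˡ (-‿distribˡ-* y q)))) ⟩
      b r k ⊛ p ⊕ b r k ⊛ ((⊖ y) ⊛ q)
        ≈⟨ distribˡ _ _ _ ⟨
      b r k ⊛ (p ⊕ (⊖ y) ⊛ q)
        ≈⟨ *-congˡ (det-linear rs (⊖ y) (col (suc k)) (col k) xs ds) ⟨
      b r k ⊛ det entry rs (xs ++ (λ s → b s (suc k) ⊕ (⊖ y) ⊛ b s k) ∷ ds) ∎
      where
      ws = map col (iota (suc k) (suc l))
      ds = differences y (col (suc k)) (map col (iota (suc (suc k)) l))
      p = det entry rs (xs ++ col (suc k) ∷ ds)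
      q = det entry rs (xs ++ col k ∷ ds)

  ∏ : ∀ {A : Set} → List A → (A → Carrier) → Carrier
  ∏ [] f = 𝟙
  ∏ (x ∷ xs) f = f x ⊛ ∏ xs f

  det-scale : ∀ {I J : Set} (s : I → Carrier) (b : I → J → Carrier) (rs : List I) (cs : List J) →
    det (λ r c → s r ⊛ b r c) rs cs ≈ ∏ rs s ⊛ det b rs cs
  det-scale s b [] [] = ≈-sym (*-identityˡ 𝟙)
  det-scale s b [] (_ ∷ _) = ≈-sym (zeroʳ 𝟙)
  det-scale s b (r ∷ rs) cs = ≈-trans (alt-cong cs (λ c cs′ → begin
      (s r ⊛ b r c) ⊛ det (λ r c → s r ⊛ b r c) rs cs′  ≈⟨ *-congˡ (det-scale s b rs cs′) ⟩
      (s r ⊛ b r c) ⊛ (∏ rs s ⊛ det b rs cs′)           ≈⟨ *-interchange _ _ _ _ ⟩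
      (s r ⊛ ∏ rs s) ⊛ (b r c ⊛ det b rs cs′)           ∎))
    (alt-*ˡ cs (s r ⊛ ∏ rs s) _)
    where
    *-interchange : ∀ p q u v → (p ⊛ q) ⊛ (u ⊛ v) ≈ (p ⊛ u) ⊛ (q ⊛ v)
    *-interchange p q u v = begin
      (p ⊛ q) ⊛ (u ⊛ v)  ≈⟨ *-assoc _ _ _ ⟩
      p ⊛ (q ⊛ (u ⊛ v))  ≈⟨ *-congˡ (≈-trans (≈-sym (*-assoc _ _ _)) (≈-trans (*-congʳ (*-comm q u)) (*-assoc _ _ _))) ⟩
      p ⊛ (u ⊛ (q ⊛ v))  ≈⟨ *-assoc _ _ _ ⟨
      (p ⊛ u) ⊛ (q ⊛ v)  ∎

  -- The signed sum of g over the arrangements of ks in n places.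
  altVec : ∀ n → List ℕ → (Vec ℕ n → Carrier) → Carrier
  altVec zero [] g = g []
  altVec zero (_ ∷ _) g = 𝟘
  altVec (suc n) ks g = alt ks (λ k ks′ → altVec n ks′ (λ w → g (k ∷ w)))

  rowProduct : ∀ {I : Set} {n} → (I → ℕ → Carrier) → Vec I n → Vec ℕ n → Carrier
  rowProduct b [] [] = 𝟙
  rowProduct b (r ∷ rs) (k ∷ w) = b r k ⊛ rowProduct b rs w

  altVec-*ˡ : ∀ n ks a (g : Vec ℕ n → Carrier) → altVec n ks (λ w → a ⊛ g w) ≈ a ⊛ altVec n ks g
  altVec-*ˡ zero [] a g = ≈-refl
  altVec-*ˡ zero (_ ∷ _) a g = ≈-sym (zeroʳ a)
  altVec-*ˡ (suc n) ks a g = ≈-trans (alt-cong ks (λ k ks′ → altVec-*ˡ n ks′ a _)) (alt-*ˡ ks a _)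

  det-altVec : ∀ {I : Set} {n} (b : I → ℕ → Carrier) (rs : Vec I n) (ks : List ℕ) →
    det b (Vec.toList rs) ks ≈ altVec n ks (rowProduct b rs)
  det-altVec b [] [] = ≈-refl
  det-altVec b [] (_ ∷ _) = ≈-refl
  det-altVec {n = suc n} b (r ∷ rs) ks = alt-cong ks (λ k ks′ →
    ≈-trans (*-congˡ (det-altVec b rs ks′)) (≈-sym (altVec-*ˡ n ks′ (b r k) _)))

  altVec-cong : ∀ n ks {g h : Vec ℕ n → Carrier} → (∀ w → g w ≈ h w) → altVec n ks g ≈ altVec n ks h
  altVec-cong zero [] e = e []
  altVec-cong zero (_ ∷ _) e = ≈-refl
  altVec-cong (suc n) ks e = alt-cong ks (λ k ks′ → altVec-cong n ks′ (λ w → e (k ∷ w)))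

-- The Toda equation for the determinants of moments

-- Sequences with the product of exponential generating functions; the shift ∂
-- and multiplication by the index 𝓓 are d/dz and z d/dz.
Seq : Set
Seq = ℕ → ℤ

infix 4 _≐_
_≐_ : Seq → Seq → Set
f ≐ g = ∀ n → f n ≡ g n

∂ : Seq → Seq
∂ f n = f (suc n)

infixl 7 _⋆_
-- Binomial convolution, defined by its Leibniz rule: ∂ is a derivation by definition, and the ring
-- laws need no binomial coefficients.
_⋆_ : Seq → Seq → Seq
(f ⋆ g) zero = f zero * g zero
(f ⋆ g) (suc n) = (∂ f ⋆ g) n + (f ⋆ ∂ g) n

infixl 6 _⊹_
_⊹_ : Seq → Seq → Seq
(f ⊹ g) n = f n + g n

neg : Seq → Seq
neg f n = - f n

𝟎 𝟏 : Seq
𝟎 _ = 0ℤ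
𝟏 zero = 1ℤ
𝟏 (suc _) = 0ℤ

⋆-cong : ∀ {f f′ g g′} → f ≐ f′ → g ≐ g′ → f ⋆ g ≐ f′ ⋆ g′
⋆-cong p q zero = cong₂ _*_ (p zero) (q zero)
⋆-cong p q (suc n) = cong₂ _+_ (⋆-cong (λ k → p (suc k)) q n) (⋆-cong p (λ k → q (suc k)) n)

⋆-comm : ∀ f g → f ⋆ g ≐ g ⋆ f
⋆-comm f g zero = ℤₚ.*-comm (f zero) (g zero)
⋆-comm f g (suc n) = trans (cong₂ _+_ (⋆-comm (∂ f) g n) (⋆-comm f (∂ g) n)) (ℤₚ.+-comm ((g ⋆ ∂ f) n) _)

shuffle4 : ∀ a b c d → (a + b) + (c + d) ≡ (a + c) + (b + d)
shuffle4 = RingSum.+-interchange ℤₚ.+-*-commutativeRing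

⋆-distribʳ : ∀ h f g → (f ⊹ g) ⋆ h ≐ f ⋆ h ⊹ g ⋆ h
⋆-distribʳ h f g zero = ℤₚ.*-distribʳ-+ (h zero) (f zero) (g zero)
⋆-distribʳ h f g (suc n) = trans
  (cong₂ _+_ (⋆-distribʳ h (∂ f) (∂ g) n) (⋆-distribʳ (∂ h) f g n))
  (shuffle4 ((∂ f ⋆ h) n) _ _ _)

⋆-distribˡ : ∀ h f g → h ⋆ (f ⊹ g) ≐ h ⋆ f ⊹ h ⋆ g
⋆-distribˡ h f g n = trans (⋆-comm h (f ⊹ g) n)
  (trans (⋆-distribʳ h f g n) (cong₂ _+_ (⋆-comm f h n) (⋆-comm g h n)))

⋆-zeroˡ : ∀ f → 𝟎 ⋆ f ≐ 𝟎
⋆-zeroˡ f zero = refl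
⋆-zeroˡ f (suc n) = cong₂ _+_ (⋆-zeroˡ f n) (⋆-zeroˡ (∂ f) n)

⋆-identityˡ : ∀ f → 𝟏 ⋆ f ≐ f
⋆-identityˡ f zero = ℤₚ.*-identityˡ (f zero)
⋆-identityˡ f (suc n) = trans (cong₂ _+_ (⋆-zeroˡ f n) (⋆-identityˡ (∂ f) n)) (ℤₚ.+-identityˡ _)

⋆-assoc : ∀ f g h → (f ⋆ g) ⋆ h ≐ f ⋆ (g ⋆ h)
⋆-assoc f g h zero = ℤₚ.*-assoc (f zero) (g zero) (h zero)
⋆-assoc f g h (suc n) = begin
  (∂ (f ⋆ g) ⋆ h) n + ((f ⋆ g) ⋆ ∂ h) n
    ≡⟨ cong₂ _+_ (⋆-distribʳ h (∂ f ⋆ g) (f ⋆ ∂ g) n) (⋆-assoc f g (∂ h) n) ⟩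
  (((∂ f ⋆ g) ⋆ h) n + ((f ⋆ ∂ g) ⋆ h) n) + (f ⋆ (g ⋆ ∂ h)) n
    ≡⟨ cong₂ (λ a b → (a + b) + (f ⋆ (g ⋆ ∂ h)) n) (⋆-assoc (∂ f) g h n) (⋆-assoc f (∂ g) h n) ⟩
  ((∂ f ⋆ (g ⋆ h)) n + (f ⋆ (∂ g ⋆ h)) n) + (f ⋆ (g ⋆ ∂ h)) n
    ≡⟨ ℤₚ.+-assoc ((∂ f ⋆ (g ⋆ h)) n) _ _ ⟩
  (∂ f ⋆ (g ⋆ h)) n + ((f ⋆ (∂ g ⋆ h)) n + (f ⋆ (g ⋆ ∂ h)) n)
    ≡⟨ cong ((∂ f ⋆ (g ⋆ h)) n +_) (⋆-distribˡ f (∂ g ⋆ h) (g ⋆ ∂ h) n) ⟨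
  (∂ f ⋆ (g ⋆ h)) n + (f ⋆ ∂ (g ⋆ h)) n ∎
  where open ≡-Reasoning

seqRing : CommutativeRing 0ℓ 0ℓ
seqRing = record
  { Carrier = Seq ; _≈_ = _≐_ ; _+_ = _⊹_ ; _*_ = _⋆_ ; -_ = neg ; 0# = 𝟎 ; 1# = 𝟏
  ; isCommutativeRing = record
    { isRing = record
      { +-isAbelianGroup = record
        { isGroup = record
          { isMonoid = record
            { isSemigroup = record
              { isMagma = record
                { isEquivalence = record
                  { refl = λ _ → refl ; sym = λ e n → sym (e n) ; trans = λ e e′ n → trans (e n) (e′ n) }
                ; ∙-cong = λ e e′ n → cong₂ _+_ (e n) (e′ n) }
              ; assoc = λ f g h n → ℤₚ.+-assoc (f n) (g n) (h n) }
            ; identity = (λ f n → ℤₚ.+-identityˡ (f n)) , (λ f n → ℤₚ.+-identityʳ (f n)) }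
          ; inverse = (λ f n → ℤₚ.+-inverseˡ (f n)) , (λ f n → ℤₚ.+-inverseʳ (f n))
          ; ⁻¹-cong = λ e n → cong -_ (e n) }
        ; comm = λ f g n → ℤₚ.+-comm (f n) (g n) }
      ; *-cong = ⋆-cong
      ; *-assoc = ⋆-assoc
      ; *-identity = ⋆-identityˡ , (λ f n → trans (⋆-comm f 𝟏 n) (⋆-identityˡ f n))
      ; distrib = ⋆-distribˡ , ⋆-distribʳ }
    ; *-comm = ⋆-comm } }

infixr 8 _·_
_·_ : ℤ → Seq → Seq
(a · f) n = a * f n

·-⋆ : ∀ a f g → (a · f) ⋆ g ≐ a · (f ⋆ g)
·-⋆ a f g zero = ℤₚ.*-assoc a (f zero) (g zero)
·-⋆ a f g (suc n) = trans (cong₂ _+_ (·-⋆ a (∂ f) g n) (·-⋆ a f (∂ g) n)) (sym (ℤₚ.*-distribˡ-+ a _ _))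

⋆-· : ∀ a f g → f ⋆ (a · g) ≐ a · (f ⋆ g)
⋆-· a f g n = trans (⋆-comm f (a · g) n) (trans (·-⋆ a g f n) (cong (a *_) (⋆-comm g f n)))

𝓓 : Seq → Seq
𝓓 f n = pos n * f n

𝓓-suc : ∀ f n → 𝓓 f (suc n) ≡ 𝓓 (∂ f) n + ∂ f n
𝓓-suc f n = trans (ℤₚ.suc-* (pos n) (f (suc n))) (ℤₚ.+-comm (f (suc n)) _)

𝓓-⋆ : ∀ f g → 𝓓 (f ⋆ g) ≐ 𝓓 f ⋆ g ⊹ f ⋆ 𝓓 g
𝓓-⋆ f g zero = sym (cong (λ x → 0ℤ * g zero + x) (ℤₚ.*-zeroʳ (f zero)))
𝓓-⋆ f g (suc n) = begin
  𝓓 (f ⋆ g) (suc n)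
    ≡⟨ trans (𝓓-suc (f ⋆ g) n) (cong (_+ (u + v)) (ℤₚ.*-distribˡ-+ (pos n) u v)) ⟩
  (pos n * u + pos n * v) + (u + v)
    ≡⟨ cong₂ (λ a b → (a + b) + (u + v)) (𝓓-⋆ (∂ f) g n) (𝓓-⋆ f (∂ g) n) ⟩
  (((𝓓 (∂ f) ⋆ g) n + (∂ f ⋆ 𝓓 g) n) + ((𝓓 f ⋆ ∂ g) n + (f ⋆ 𝓓 (∂ g)) n)) + (u + v)
    ≡⟨ arrange ((𝓓 (∂ f) ⋆ g) n) _ _ _ u v ⟩
  (((𝓓 (∂ f) ⋆ g) n + u) + (𝓓 f ⋆ ∂ g) n) + ((∂ f ⋆ 𝓓 g) n + ((f ⋆ 𝓓 (∂ g)) n + v))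
    ≡⟨ cong₂ (λ a b → (a + (𝓓 f ⋆ ∂ g) n) + ((∂ f ⋆ 𝓓 g) n + b))
         (trans (sym (⋆-distribʳ g (𝓓 (∂ f)) (∂ f) n)) (⋆-cong (λ k → sym (𝓓-suc f k)) (λ _ → refl) n))
         (trans (sym (⋆-distribˡ f (𝓓 (∂ g)) (∂ g) n)) (⋆-cong (λ _ → refl) (λ k → sym (𝓓-suc g k)) n)) ⟩
  ((∂ (𝓓 f) ⋆ g) n + (𝓓 f ⋆ ∂ g) n) + ((∂ f ⋆ 𝓓 g) n + (f ⋆ ∂ (𝓓 g)) n) ∎
  where
  open ≡-Reasoning
  u = (∂ f ⋆ g) n
  v = (f ⋆ ∂ g) n
  arrange : ∀ a b c d u v → ((a + b) + (c + d)) + (u + v) ≡ ((a + u) + c) + (b + (d + v))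
  arrange = ℤ-Solver.solve-∀

-- Stated for additive maps, because it is applied to the derivations ∂ and 𝓓 and to the extraction
-- of a coefficient, which are not multiplicative.
module AltHom (R S : CommutativeRing 0ℓ 0ℓ)
  (h : CommutativeRing.Carrier R → CommutativeRing.Carrier S)
  (h-0 : CommutativeRing._≈_ S (h (CommutativeRing.0# R)) (CommutativeRing.0# S))
  (h-sub : ∀ x y → CommutativeRing._≈_ S (h (CommutativeRing._+_ R x (CommutativeRing.-_ R y)))
                     (CommutativeRing._+_ S (h x) (CommutativeRing.-_ S (h y)))) where
  private
    module S = CommutativeRing S
    module DR = Determinant R
    module DS = Determinant S

  alt-hom : ∀ {A : Set} (xs : List A) (F : A → List A → CommutativeRing.Carrier R) →
    h (DR.alt xs F) S.≈ DS.alt xs (λ y ys → h (F y ys))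
  alt-hom [] F = h-0
  alt-hom (x ∷ xs) F = S.trans (h-sub _ _) (S.+-congˡ (S.-‿cong (alt-hom xs _)))

  altVec-hom : ∀ n ks (g : Vec ℕ n → CommutativeRing.Carrier R) →
    h (DR.altVec n ks g) S.≈ DS.altVec n ks (λ w → h (g w))
  altVec-hom zero [] g = S.refl
  altVec-hom zero (_ ∷ _) g = h-0
  altVec-hom (suc n) ks g = S.trans (alt-hom ks _) (DS.alt-cong ks (λ k ks′ → altVec-hom n ks′ _))

-- The absorption identity (i+1) C(j, i+1) = (j - i) C(j, i), with the subtraction moved to the
-- other side; induction by Pascal's rule.
absorb : ∀ i j → suc i ℕ.* (j C suc i) ℕ.+ i ℕ.* (j C i) ≡ j ℕ.* (j C i)
absorb zero zero = refl
absorb (suc i) zero = cong₂ ℕ._+_ (ℕₚ.*-zeroʳ i) (ℕₚ.*-zeroʳ i)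
absorb zero (suc j) = trans (ℕₚ.+-identityʳ _) (trans (ℕₚ.+-identityʳ _) (trans (nC1≡n (suc j)) (sym (ℕₚ.*-identityʳ (suc j)))))
absorb (suc i) (suc j) = begin
  suc (suc i) ℕ.* (suc j C suc (suc i)) ℕ.+ suc i ℕ.* (suc j C suc i)
    ≡⟨ cong₂ (λ a b → suc (suc i) ℕ.* a ℕ.+ suc i ℕ.* b) (nCk+nC[k+1]≡[n+1]C[k+1] j (suc i)) (nCk+nC[k+1]≡[n+1]C[k+1] j i) ⟨
  suc (suc i) ℕ.* (c₁ ℕ.+ c₂) ℕ.+ suc i ℕ.* (c₀ ℕ.+ c₁)
    ≡⟨ regroup i c₀ c₁ c₂ ⟩
  ((suc (suc i) ℕ.* c₂ ℕ.+ suc i ℕ.* c₁) ℕ.+ (suc i ℕ.* c₁ ℕ.+ i ℕ.* c₀)) ℕ.+ (c₀ ℕ.+ c₁)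
    ≡⟨ cong₂ (λ a b → (a ℕ.+ b) ℕ.+ (c₀ ℕ.+ c₁)) (absorb (suc i) j) (absorb i j) ⟩
  (j ℕ.* c₁ ℕ.+ j ℕ.* c₀) ℕ.+ (c₀ ℕ.+ c₁)
    ≡⟨ collect j c₀ c₁ ⟩
  suc j ℕ.* (c₀ ℕ.+ c₁)
    ≡⟨ cong (suc j ℕ.*_) (nCk+nC[k+1]≡[n+1]C[k+1] j i) ⟩
  suc j ℕ.* (suc j C suc i) ∎
  where
  open ≡-Reasoning
  c₀ = j C i
  c₁ = j C suc i
  c₂ = j C suc (suc i)
  regroup : ∀ i c₀ c₁ c₂ → suc (suc i) ℕ.* (c₁ ℕ.+ c₂) ℕ.+ suc i ℕ.* (c₀ ℕ.+ c₁) ≡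
    ((suc (suc i) ℕ.* c₂ ℕ.+ suc i ℕ.* c₁) ℕ.+ (suc i ℕ.* c₁ ℕ.+ i ℕ.* c₀)) ℕ.+ (c₀ ℕ.+ c₁)
  regroup = ℕ-Solver.solve-∀
  collect : ∀ j c₀ c₁ → (j ℕ.* c₁ ℕ.+ j ℕ.* c₀) ℕ.+ (c₀ ℕ.+ c₁) ≡ suc j ℕ.* (c₀ ℕ.+ c₁)
  collect = ℕ-Solver.solve-∀

absorb-ℤ : ∀ i j → pos (suc i) * pos (j C suc i) + (pos i - pos j) * pos (j C i) ≡ 0ℤ
absorb-ℤ i j = begin
  pos (suc i) * pos (j C suc i) + (pos i - pos j) * pos (j C i)
    ≡⟨ expand (pos (suc i)) (pos (j C suc i)) (pos i) (pos j) (pos (j C i)) ⟩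
  (pos (suc i) * pos (j C suc i) + pos i * pos (j C i)) - pos j * pos (j C i)
    ≡⟨ cong₂ (λ a b → a - b)
         (trans (cong₂ _+_ (sym (ℤₚ.pos-* (suc i) _)) (sym (ℤₚ.pos-* i _))) (cong pos (absorb i j)))
         (sym (ℤₚ.pos-* j (j C i))) ⟩
  pos (j ℕ.* (j C i)) - pos (j ℕ.* (j C i))
    ≡⟨ ℤₚ.+-inverseʳ (pos (j ℕ.* (j C i))) ⟩
  0ℤ ∎
  where
  open ≡-Reasoning
  expand : ∀ s c i j d → s * c + (i - j) * d ≡ (s * c + i * d) - j * d
  expand = ℤ-Solver.solve-∀

module _ (m : ℕ) where
  open Determinant seqRing
  open CommutativeRing seqRing using () renaming (refl to ≐-refl; sym to ≐-sym; trans to ≐-trans; setoid to ≐-setoid; +-cong to ⊹-cong)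
  private
    module ∂-hom = AltHom seqRing seqRing ∂ (λ _ → refl) (λ _ _ _ → refl)
    module 𝓓-hom = AltHom seqRing seqRing 𝓓 (λ n → ℤₚ.*-zeroʳ (pos n))
      (λ f g n → trans (ℤₚ.*-distribˡ-+ (pos n) (f n) (- g n)) (cong (pos n * f n +_) (sym (ℤₚ.neg-distribʳ-* (pos n) (g n)))))

  weight : ℕ → ℤ
  weight j = pos (suc j) ^ m

  -- The entry b_ij of the overview: unfolding gives ((j+n)!/j!)^m C(j+n, i). In this form ∂ shifts
  -- the column by definition, ∂ b_ij = (j+1)^m b_{i,j+1}.
  moment : ℕ → ℕ → Seq
  moment i j zero = pos (j C i)
  moment i j (suc n) = weight j * moment i (suc j) n

  -- The factor n is (j+n) - j, and absorption rewrites (j+n) C(j+n, i) by the rows i+1 and i: up to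
  -- a diagonal term, z d/dz shifts the row.
  𝓓-moment : ∀ i j → 𝓓 (moment i j) ≐ pos (suc i) · moment (suc i) j ⊹ (pos i - pos j) · moment i j
  𝓓-moment i j zero = sym (absorb-ℤ i j)
  𝓓-moment i j (suc n) = begin
    pos (suc n) * (weight j * M)
      ≡⟨ factor (weight j) (pos n) M ⟩
    weight j * (pos n * M + M)
      ≡⟨ cong (λ x → weight j * (x + M)) (𝓓-moment i (suc j) n) ⟩
    weight j * ((pos (suc i) * M⁺ + (pos i - pos (suc j)) * M) + M)
      ≡⟨ spread (weight j) (pos (suc i)) M⁺ (pos i) (pos j) M ⟩
    pos (suc i) * (weight j * M⁺) + (pos i - pos j) * (weight j * M) ∎
    where
    open ≡-Reasoning
    M = moment i (suc j) n
    M⁺ = moment (suc i) (suc j) n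
    factor : ∀ w n M → (1ℤ + n) * (w * M) ≡ w * (n * M + M)
    factor = ℤ-Solver.solve-∀
    spread : ∀ w s M⁺ i j M → w * ((s * M⁺ + (i - (1ℤ + j)) * M) + M) ≡ s * (w * M⁺) + (i - j) * (w * M)
    spread = ℤ-Solver.solve-∀

  det-leibniz-row : ∀ (δ : Seq → Seq) → (∀ {A : Set} (xs : List A) F → δ (alt xs F) ≐ alt xs (λ y ys → δ (F y ys))) →
    (∀ f g → δ (f ⋆ g) ≐ δ f ⋆ g ⊹ f ⋆ δ g) → ∀ {I J : Set} (b : I → J → Seq) r rs cs →
    δ (det b (r ∷ rs) cs) ≐ alt cs (λ c cs′ → δ (b r c) ⋆ det b rs cs′) ⊹ alt cs (λ c cs′ → b r c ⋆ δ (det b rs cs′))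
  det-leibniz-row δ δ-alt δ-⋆ b r rs cs = begin
    δ (det b (r ∷ rs) cs)                            ≈⟨ δ-alt cs _ ⟩
    alt cs (λ c cs′ → δ (b r c ⋆ det b rs cs′))      ≈⟨ alt-cong cs (λ c cs′ → δ-⋆ (b r c) (det b rs cs′)) ⟩
    alt cs (λ c cs′ → δ (b r c) ⋆ det b rs cs′ ⊹ b r c ⋆ δ (det b rs cs′))  ≈⟨ alt-+ cs _ _ ⟩
    alt cs (λ c cs′ → δ (b r c) ⋆ det b rs cs′) ⊹ alt cs (λ c cs′ → b r c ⋆ δ (det b rs cs′)) ∎
    where open SetoidReasoning ≐-setoid

  alt-· : ∀ {A : Set} (xs : List A) a (F : A → List A → Seq) → alt xs (λ y ys → a · F y ys) ≐ a · alt xs F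
  alt-· [] a F n = sym (ℤₚ.*-zeroʳ a)
  alt-· (x ∷ xs) a F n = trans (cong (λ z → a * F x xs n + - z) (alt-· xs a (λ y ys → F y (x ∷ ys)) n))
    (factor a (F x xs n) _)
    where
    factor : ∀ a p q → a * p + - (a * q) ≡ a * (p + - q)
    factor = ℤ-Solver.solve-∀

  alt-cong∈ : ∀ {A : Set} (xs : List A) {F G : A → List A → Seq} →
    (∀ as y bs → xs ≡ as ++ y ∷ bs → F y (as ++ bs) ≐ G y (as ++ bs)) → alt xs F ≐ alt xs G
  alt-cong∈ [] h n = refl
  alt-cong∈ (x ∷ xs) h n = cong₂ (λ a b → a + - b) (h [] x xs refl n)
    (alt-cong∈ xs (λ as y bs e → h (x ∷ as) y bs (cong (x ∷_) e)) n)

  momentᵀ : ℕ → ℕ → Seq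
  momentᵀ j i = moment i j

  iota-snoc : ∀ k l → iota k (suc l) ≡ iota k l ++ [ k ℕ.+ l ]
  iota-snoc k zero = cong [_] (sym (ℕₚ.+-identityʳ k))
  iota-snoc k (suc l) = cong (k ∷_) (trans (iota-snoc (suc k) l) (cong (λ j → iota (suc k) l ++ [ j ]) (sym (ℕₚ.+-suc k l))))

  -- The run of consecutive indices with its last one raised, such as k, k+1, k+3: the only new list
  -- that a derivation of the determinant leaves.
  raised : ℕ → ℕ → List ℕ
  raised k zero = []
  raised k (suc l) = iota k l ++ [ suc (k ℕ.+ l) ]

  raised-suc : ∀ k l → k ∷ raised (suc k) (suc l) ≡ raised k (suc (suc l))
  raised-suc k l = cong (λ j → k ∷ iota (suc k) l ++ [ suc j ]) (sym (ℕₚ.+-suc k l))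

  -- Differentiating one column of a run of consecutive columns duplicates the
  -- next one, so only the last column contributes.
  ∂-det : ∀ rs k l → ∂ (det moment rs (iota k (suc l))) ≐ weight (k ℕ.+ l) · det moment rs (raised k (suc l))
  ∂-det rs k l = begin
    ∂ (det moment rs (iota k (suc l)))
      ≈⟨ (λ n → det-flip moment rs (iota k (suc l)) (suc n)) ⟩
    ∂ (det momentᵀ (iota k (suc l)) rs)
      ≈⟨ go rs k l ⟩
    weight (k ℕ.+ l) · det momentᵀ (raised k (suc l)) rs
      ≈⟨ (λ n → cong (weight (k ℕ.+ l) *_) (det-flip moment rs (raised k (suc l)) n)) ⟨
    weight (k ℕ.+ l) · det moment rs (raised k (suc l)) ∎
    where
    open SetoidReasoning ≐-setoid
    ∂-empty : ∀ rs → ∂ (det momentᵀ [] rs) ≐ 𝟎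
    ∂-empty [] n = refl
    ∂-empty (_ ∷ _) n = refl
    shifted : ∀ k ks rs → alt rs (λ r rs′ → ∂ (moment r k) ⋆ det momentᵀ ks rs′) ≐ weight k · det momentᵀ (suc k ∷ ks) rs
    shifted k ks rs = ≐-trans (alt-cong rs (λ r rs′ → ·-⋆ (weight k) (moment r (suc k)) (det momentᵀ ks rs′)))
      (alt-· rs (weight k) (λ r rs′ → moment r (suc k) ⋆ det momentᵀ ks rs′))
    go : ∀ rs k l → ∂ (det momentᵀ (iota k (suc l)) rs) ≐ weight (k ℕ.+ l) · det momentᵀ (raised k (suc l)) rs
    go rs k zero = begin
      ∂ (det momentᵀ [ k ] rs)
        ≈⟨ det-leibniz-row ∂ ∂-hom.alt-hom (λ f g n → refl) momentᵀ k [] rs ⟩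
      _ ≈⟨ ⊹-cong (shifted k [] rs) (alt-zero rs {λ r rs′ → moment r k ⋆ ∂ (det momentᵀ [] rs′)} (λ as r bs _ →
             ≐-trans (⋆-cong {moment r k} (λ _ → refl) (∂-empty (as ++ bs)))
               (λ n → trans (⋆-comm (moment r k) 𝟎 n) (⋆-zeroˡ (moment r k) n)))) ⟩
      _ ≈⟨ (λ n → trans (ℤₚ.+-identityʳ _)
             (cong (λ j → weight j * det momentᵀ [ suc j ] rs n) (sym (ℕₚ.+-identityʳ k)))) ⟩
      weight (k ℕ.+ zero) · det momentᵀ (raised k 1) rs ∎
    go rs k (suc l) = begin
      ∂ (det momentᵀ (k ∷ iota (suc k) (suc l)) rs)
        ≈⟨ det-leibniz-row ∂ ∂-hom.alt-hom (λ f g n → refl) momentᵀ k (iota (suc k) (suc l)) rs ⟩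
      _ ≈⟨ ⊹-cong (≐-trans (shifted k (iota (suc k) (suc l)) rs) repeated)
             (≐-trans (alt-cong rs (λ r rs′ → ≐-trans (⋆-cong {moment r k} (λ _ → refl) (go rs′ (suc k) l))
                 (⋆-· (weight (suc k ℕ.+ l)) (moment r k) _)))
               (alt-· rs (weight (suc k ℕ.+ l)) (λ r rs′ → moment r k ⋆ det momentᵀ (raised (suc k) (suc l)) rs′))) ⟩
      _ ≈⟨ (λ n → trans (ℤₚ.+-identityˡ _) (cong₂ (λ j ks → weight j * det momentᵀ ks rs n)
             (sym (ℕₚ.+-suc k l)) (raised-suc k l))) ⟩
      weight (k ℕ.+ suc l) · det momentᵀ (raised k (suc (suc l))) rs ∎
      where
      repeated : weight k · det momentᵀ (suc k ∷ iota (suc k) (suc l)) rs ≐ 𝟎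
      repeated n = trans (cong (weight k *_) (trans (sym (det-flip moment rs (suc k ∷ suc k ∷ iota (suc (suc k)) l) n))
        (det-repeat moment rs [] (suc k) (iota (suc (suc k)) l) n))) (ℤₚ.*-zeroʳ (weight k))

  total : List ℕ → ℤ
  total = List.foldr (λ k s → pos k + s) 0ℤ

  total-insert : ∀ as k bs → total (as ++ k ∷ bs) ≡ pos k + total (as ++ bs)
  total-insert [] k bs = refl
  total-insert (a ∷ as) k bs = trans (cong (pos a +_) (total-insert as k bs)) (swap3 (pos a) (pos k) (total (as ++ bs)))
    where
    swap3 : ∀ a k t → a + (k + t) ≡ k + (a + t)
    swap3 = ℤ-Solver.solve-∀

  det-empty : ∀ cs → (0ℤ - total cs) · det moment [] cs ≐ 𝟎
  det-empty [] n = ℤₚ.*-zeroˡ (𝟏 n)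
  det-empty (c ∷ cs) n = ℤₚ.*-zeroʳ (0ℤ - total (c ∷ cs))

  raisedDet : ℕ → ℕ → List ℕ → Seq
  raisedDet i zero cs = 𝟎
  raisedDet i (suc l) cs = pos (suc (i ℕ.+ l)) · det moment (raised i (suc l)) cs

  -- Raising a row other than the last duplicates the next row. The diagonal parts of `𝓓-moment` add
  -- up to the sum of the rows minus the sum of the columns in every term of the expansion, however
  -- rows and columns are matched.
  𝓓-det : ∀ i l cs → 𝓓 (det moment (iota i l) cs) ≐
    raisedDet i l cs ⊹ (total (iota i l) - total cs) · det moment (iota i l) cs
  𝓓-det i zero cs n = trans (empty cs n) (sym (trans (ℤₚ.+-identityˡ _) (det-empty cs n)))
    where
    empty : ∀ cs → 𝓓 (det moment [] cs) ≐ 𝟎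
    empty [] zero = refl
    empty [] (suc n) = ℤₚ.*-zeroʳ (pos (suc n))
    empty (_ ∷ _) n = ℤₚ.*-zeroʳ (pos n)
  𝓓-det i (suc l) cs = begin
    𝓓 (det moment (i ∷ rs) cs)
      ≈⟨ 𝓓-hom.alt-hom cs _ ⟩
    alt cs (λ c cs′ → 𝓓 (moment i c ⋆ det moment rs cs′))
      ≈⟨ alt-cong∈ cs (λ { as c bs refl → term as c bs }) ⟩
    alt cs (λ c cs′ → (P c cs′ ⊹ Q c cs′) ⊹ S · (moment i c ⋆ det moment rs cs′))
      ≈⟨ ≐-trans (alt-+ cs (λ c cs′ → P c cs′ ⊹ Q c cs′) (λ c cs′ → S · (moment i c ⋆ det moment rs cs′)))
           (⊹-cong (alt-+ cs P Q) (alt-· cs S (λ c cs′ → moment i c ⋆ det moment rs cs′))) ⟩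
    (alt cs P ⊹ alt cs Q) ⊹ S · det moment (i ∷ rs) cs
      ≈⟨ ⊹-cong {alt cs P ⊹ alt cs Q} (≐-trans (⊹-cong {alt cs P} (alt-· cs (pos (suc i)) (λ c cs′ → moment (suc i) c ⋆ det moment rs cs′)) ≐-refl) (last l)) ≐-refl ⟩
    raisedDet i (suc l) cs ⊹ S · det moment (i ∷ rs) cs ∎
    where
    open SetoidReasoning ≐-setoid hiding (step-≡-⟩; step-≡-⟨; step-≡; step-≡-∣; step-≡˘)
    rs = iota (suc i) l
    S : ℤ
    S = total (i ∷ rs) - total cs
    P Q : ℕ → List ℕ → Seq
    P c cs′ = pos (suc i) · (moment (suc i) c ⋆ det moment rs cs′)
    Q c cs′ = moment i c ⋆ raisedDet (suc i) l cs′
    term : ∀ as c bs → 𝓓 (moment i c ⋆ det moment rs (as ++ bs)) ≐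
      (P c (as ++ bs) ⊹ Q c (as ++ bs)) ⊹ (total (i ∷ rs) - total (as ++ c ∷ bs)) · (moment i c ⋆ det moment rs (as ++ bs))
    term as c bs n = begin′
      𝓓 (moment i c ⋆ d) n
        ≡⟨ 𝓓-⋆ (moment i c) d n ⟩
      (𝓓 (moment i c) ⋆ d) n + (moment i c ⋆ 𝓓 d) n
        ≡⟨ cong₂ _+_
             (trans (⋆-cong (𝓓-moment i c) (λ _ → refl) n) (trans (⋆-distribʳ d _ _ n)
               (cong₂ _+_ (·-⋆ (pos (suc i)) (moment (suc i) c) d n) (·-⋆ (pos i - pos c) (moment i c) d n))))
             (trans (⋆-cong {moment i c} (λ _ → refl) (𝓓-det (suc i) l (as ++ bs)) n) (trans (⋆-distribˡ (moment i c) _ _ n)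
               (cong ((moment i c ⋆ raisedDet (suc i) l (as ++ bs)) n +_) (⋆-· (total rs - total (as ++ bs)) (moment i c) d n)))) ⟩
      (p + (pos i - pos c) * x) + (q + (total rs - total (as ++ bs)) * x)
        ≡⟨ gather p q (pos i) (pos c) (total rs) (total (as ++ bs)) x ⟩
      (p + q) + ((pos i + total rs) - (pos c + total (as ++ bs))) * x
        ≡⟨ cong (λ t → (p + q) + ((pos i + total rs) - t) * x) (total-insert as c bs) ⟨
      (p + q) + (total (i ∷ rs) - total (as ++ c ∷ bs)) * x ∎′
      where
      open ≡-Reasoning renaming (begin_ to begin′_; _∎ to _∎′)
      d = det moment rs (as ++ bs)
      x = (moment i c ⋆ d) n
      p = P c (as ++ bs) n
      q = Q c (as ++ bs) n
      gather : ∀ p q i c r t x → (p + (i - c) * x) + (q + (r - t) * x) ≡ (p + q) + ((i + r) - (c + t)) * x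
      gather = ℤ-Solver.solve-∀
    last : ∀ l → pos (suc i) · det moment (suc i ∷ iota (suc i) l) cs ⊹ alt cs (λ c cs′ → moment i c ⋆ raisedDet (suc i) l cs′)
      ≐ raisedDet i (suc l) cs
    last zero n = trans (cong₂ _+_
        (cong (λ j → pos (suc j) * det moment [ suc j ] cs n) (sym (ℕₚ.+-identityʳ i)))
        (alt-zero cs {λ c cs′ → moment i c ⋆ 𝟎} (λ as c bs _ n → trans (⋆-comm (moment i c) 𝟎 n) (⋆-zeroˡ (moment i c) n)) n))
      (ℤₚ.+-identityʳ _)
    last (suc l) n = trans (cong₂ _+_
        (trans (cong (pos (suc i) *_) (trans (det-flip moment (suc i ∷ suc i ∷ iota (suc (suc i)) l) cs n)
          (det-repeat momentᵀ cs [] (suc i) (iota (suc (suc i)) l) n))) (ℤₚ.*-zeroʳ (pos (suc i))))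
        (trans (alt-cong cs (λ c cs′ → ⋆-· (pos (suc (suc i ℕ.+ l))) (moment i c) (det moment (raised (suc i) (suc l)) cs′)) n)
          (alt-· cs (pos (suc (suc i ℕ.+ l))) (λ c cs′ → moment i c ⋆ det moment (raised (suc i) (suc l)) cs′) n)))
      (trans (ℤₚ.+-identityˡ _) (cong₂ (λ j ks → pos (suc j) * det moment ks cs n) (sym (ℕₚ.+-suc i l)) (raised-suc i l)))

  hankel : ℕ → Seq
  hankel K = det moment (iota 0 K) (iota 0 K)

  -- Desnanot-Jacobi for the rows and columns K, K+1 bordering 0, ..., K-1. With N = K+1 and w = N^m
  -- the four bordered minors are Z, ∂Z/w, 𝓓Z/N and ∂𝓓Z/(Nw). This is the Toda equation of the
  -- overview with one factor z removed.
  toda : ∀ K → (pos (suc K) * weight K) · (hankel (suc (suc K)) ⋆ hankel K) ⊹ 𝓓 (hankel (suc K)) ⋆ ∂ (hankel (suc K))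
    ≐ ∂ (𝓓 (hankel (suc K))) ⋆ hankel (suc K)
  toda K = begin
    (N * w) · (hankel (suc (suc K)) ⋆ hankel K) ⊹ 𝓓 Z ⋆ ∂ Z
      ≈⟨ ⊹-cong {(N * w) · (hankel (suc (suc K)) ⋆ hankel K)} ≐-refl
           (≐-trans (⋆-cong 𝓓Z ∂Z) (≐-trans (·-⋆ N (d (suc K) K) (w · d K (suc K)))
             (λ n → cong (N *_) (⋆-· w (d (suc K) K) (d K (suc K)) n)))) ⟩
    (N * w) · (hankel (suc (suc K)) ⋆ hankel K) ⊹ N · w · (d (suc K) K ⋆ d K (suc K))
      ≈⟨ (λ n → trans (cong ((N * w) * (hankel (suc (suc K)) ⋆ hankel K) n +_) (sym (ℤₚ.*-assoc N w _)))
           (trans (sym (ℤₚ.*-distribˡ-+ (N * w) _ _)) (cong ((N * w) *_) (trans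
             (cong (_+ (d (suc K) K ⋆ d K (suc K)) n) (⋆-cong big ≐-refl n))
             (desnanot-jacobi moment K (suc K) I₀ K (suc K) I₀ (λ ()) (fresh 0 K ℕₚ.≤-refl) (fresh 0 K (ℕₚ.n≤1+n K)) n))))) ⟩
    (N * w) · (d (suc K) (suc K) ⋆ d K K)
      ≈⟨ ·-⋆ (N * w) (d (suc K) (suc K)) (d K K) ⟨
    ((N * w) · d (suc K) (suc K)) ⋆ d K K
      ≈⟨ ⋆-cong ∂𝓓Z Z≐ ⟨
    ∂ (𝓓 Z) ⋆ Z ∎
    where
    open SetoidReasoning ≐-setoid
    N w : ℤ
    N = pos (suc K)
    w = weight K
    Z = hankel (suc K)
    I₀ = iota 0 K
    d : ℕ → ℕ → Seq
    d r c = det moment (r ∷ I₀) (c ∷ I₀)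
    rotate : ∀ r c → det moment (I₀ ++ [ r ]) (I₀ ++ [ c ]) ≐ d r c
    rotate r c = det-rotate moment I₀ r I₀ c refl
    I₁ : iota 0 (suc K) ≡ I₀ ++ [ K ]
    I₁ = iota-snoc 0 K
    fresh : ∀ k l {r} → k ℕ.+ l ≤ r → r ∉ iota k l
    fresh k (suc l) h (here refl) = ℕₚ.1+n≰n (ℕₚ.≤-trans (ℕₚ.≤-trans (s≤s (ℕₚ.m≤m+n k l)) (ℕₚ.≤-reflexive (sym (ℕₚ.+-suc k l)))) h)
    fresh k (suc l) h (there p) = fresh (suc k) l (ℕₚ.≤-trans (ℕₚ.≤-reflexive (sym (ℕₚ.+-suc k l))) h) p
    Z≐ : Z ≐ d K K
    Z≐ n = trans (cong (λ l → det moment l l n) I₁) (rotate K K n)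
    ∂Z : ∂ Z ≐ w · d K (suc K)
    ∂Z n = trans (∂-det (iota 0 (suc K)) 0 K n)
      (cong (w *_) (trans (cong (λ l → det moment l (raised 0 (suc K)) n) I₁) (rotate K (suc K) n)))
    𝓓Z : 𝓓 Z ≐ N · d (suc K) K
    𝓓Z n = trans (𝓓-det 0 (suc K) (iota 0 (suc K)) n)
      (trans (cong₂ (λ a b → N * a + b * Z n)
        (trans (cong (λ l → det moment (raised 0 (suc K)) l n) I₁) (rotate (suc K) K n))
        (ℤₚ.+-inverseʳ (total (iota 0 (suc K)))))
      (trans (cong (N * d (suc K) K n +_) (ℤₚ.*-zeroˡ (Z n))) (ℤₚ.+-identityʳ _)))
    -- This -1 cancels the extra ∂Z that arises from ∂𝓓 = 𝓓∂ + ∂.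
    drop : total (iota 0 (suc K)) - total (raised 0 (suc K)) ≡ - 1ℤ
    drop = trans (cong₂ (λ a b → a - b) (trans (cong total I₁) (total-insert I₀ K [])) (total-insert I₀ (suc K) []))
      (cancel (pos K) (total (I₀ ++ [])))
      where
      cancel : ∀ k t → (k + t) - ((1ℤ + k) + t) ≡ - 1ℤ
      cancel = ℤ-Solver.solve-∀
    ∂𝓓Z : ∂ (𝓓 Z) ≐ (N * w) · d (suc K) (suc K)
    ∂𝓓Z n = trans (𝓓-suc Z n) (trans (cong₂ _+_ 𝓓∂Z (∂Z n)) (finish N w (d (suc K) (suc K) n) (d K (suc K) n)))
      where
      finish : ∀ N w x y → w * (N * x + - 1ℤ * y) + w * y ≡ (N * w) * x
      finish = ℤ-Solver.solve-∀
      swap : ∀ n w x → n * (w * x) ≡ w * (n * x)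
      swap = ℤ-Solver.solve-∀
      𝓓∂Z : pos n * ∂ Z n ≡ w * (N * d (suc K) (suc K) n + - 1ℤ * d K (suc K) n)
      𝓓∂Z = trans (cong (pos n *_) (∂-det (iota 0 (suc K)) 0 K n)) (trans (swap (pos n) w _) (cong (w *_)
        (trans (𝓓-det 0 (suc K) (raised 0 (suc K)) n) (cong₂ (λ a b → N * a + b)
          (rotate (suc K) (suc K) n)
          (cong₂ _*_ drop (trans (cong (λ l → det moment l (raised 0 (suc K)) n) I₁) (rotate K (suc K) n)))))))
    big : hankel (suc (suc K)) ≐ det moment (K ∷ suc K ∷ I₀) (K ∷ suc K ∷ I₀)
    big n = trans (cong (λ l → det moment l l n) (trans (iota-snoc 0 (suc K)) (cong (_++ [ suc K ]) I₁)))
      (trans (det-rotate moment (I₀ ++ [ K ]) (suc K) (I₀ ++ [ K ]) (suc K) refl n)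
        (det-rotate moment (suc K ∷ I₀) K (suc K ∷ I₀) K refl n))

-- Polynomials and the Vandermonde determinant

infixl 6 _⊞_
_⊞_ : ∀ {N} → Vec ℕ N → Vec ℕ N → Vec ℕ N
_⊞_ = Vec.zipWith ℕ._+_

𝟘ᵛ : ∀ {N} → Vec ℕ N
𝟘ᵛ = Vec.replicate _ 0

⊞-comm : ∀ {N} (α β : Vec ℕ N) → α ⊞ β ≡ β ⊞ α
⊞-comm = Vecₚ.zipWith-comm ℕₚ.+-comm

⊞-assoc : ∀ {N} (α β γ : Vec ℕ N) → (α ⊞ β) ⊞ γ ≡ α ⊞ (β ⊞ γ)
⊞-assoc = Vecₚ.zipWith-assoc ℕₚ.+-assoc

⊞-identityˡ : ∀ {N} (α : Vec ℕ N) → 𝟘ᵛ ⊞ α ≡ α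
⊞-identityˡ = Vecₚ.zipWith-identityˡ ℕₚ.+-identityˡ

add : ∀ {N} → Fin N → ℕ → Vec ℕ N → Vec ℕ N
add i k α = Vec.updateAt α i (k ℕ.+_)

inc : ∀ {N} → Fin N → Vec ℕ N → Vec ℕ N
inc i = add i 1

add-⊞ : ∀ {N} (i : Fin N) k α β → add i k α ⊞ β ≡ add i k (α ⊞ β)
add-⊞ zero k (x ∷ α) (y ∷ β) = cong (_∷ (α ⊞ β)) (ℕₚ.+-assoc k x y)
add-⊞ (suc i) k (x ∷ α) (y ∷ β) = cong ((x ℕ.+ y) ∷_) (add-⊞ i k α β)

lookup-inc : ∀ {N} (i : Fin N) α → lookup (inc i α) i ≡ suc (lookup α i)
lookup-inc i α = Vecₚ.lookup∘updateAt i α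

lookup-inc′ : ∀ {N} (i j : Fin N) → i ≢ j → ∀ α → lookup (inc j α) i ≡ lookup α i
lookup-inc′ i j p α = Vecₚ.lookup∘updateAt′ i j p α

inc-comm : ∀ {N} (i j : Fin N) α → inc i (inc j α) ≡ inc j (inc i α)
inc-comm i j α with i Finₚ.≟ j
... | yes refl = refl
... | no p = Vecₚ.updateAt-commutes i j p α

q₁ q₂ : ∀ {N} → Vec ℕ N → ℤ
q₁ [] = 0ℤ
q₁ (x ∷ α) = pos x + q₁ α
q₂ [] = 0ℤ
q₂ (x ∷ α) = pos x * pos x + q₂ α

dot : ∀ {N} → Vec ℕ N → Vec ℕ N → ℤ
dot [] [] = 0ℤ
dot (x ∷ α) (y ∷ β) = pos x * pos y + dot α β

q₁-⊞ : ∀ {N} (α β : Vec ℕ N) → q₁ (α ⊞ β) ≡ q₁ α + q₁ β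
q₁-⊞ [] [] = refl
q₁-⊞ (x ∷ α) (y ∷ β) = trans (cong (pos (x ℕ.+ y) +_) (q₁-⊞ α β)) (shuffle4 (pos x) (pos y) (q₁ α) (q₁ β))

q₂-⊞ : ∀ {N} (α β : Vec ℕ N) → q₂ (α ⊞ β) ≡ q₂ α + (dot α β + dot α β) + q₂ β
q₂-⊞ [] [] = refl
q₂-⊞ (x ∷ α) (y ∷ β) = trans (cong (pos (x ℕ.+ y) * pos (x ℕ.+ y) +_) (q₂-⊞ α β))
  (expand (pos x) (pos y) (q₂ α) (dot α β) (q₂ β))
  where
  expand : ∀ x y a d b → (x + y) * (x + y) + (a + (d + d) + b) ≡
    (x * x + a) + ((x * y + d) + (x * y + d)) + (y * y + b)
  expand = ℤ-Solver.solve-∀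

dot-𝟘 : ∀ {N} (β : Vec ℕ N) → dot 𝟘ᵛ β ≡ 0ℤ
dot-𝟘 [] = refl
dot-𝟘 (y ∷ β) = trans (cong₂ _+_ (ℤₚ.*-zeroˡ (pos y)) (dot-𝟘 β)) refl

dot-inc : ∀ {N} (i : Fin N) α β → dot (inc i α) β ≡ dot α β + pos (lookup β i)
dot-inc zero (x ∷ α) (y ∷ β) = expand (pos x) (pos y) (dot α β)
  where
  expand : ∀ x y d → (1ℤ + x) * y + d ≡ (x * y + d) + y
  expand = ℤ-Solver.solve-∀
dot-inc (suc i) (x ∷ α) (y ∷ β) = trans (cong (pos x * pos y +_) (dot-inc i α β)) (sym (ℤₚ.+-assoc (pos x * pos y) _ _))

q₁-inc : ∀ {N} (i : Fin N) α → q₁ (inc i α) ≡ q₁ α + 1ℤ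
q₁-inc zero (x ∷ α) = expand (pos x) (q₁ α)
  where
  expand : ∀ x d → (1ℤ + x) + d ≡ (x + d) + 1ℤ
  expand = ℤ-Solver.solve-∀
q₁-inc (suc i) (x ∷ α) = trans (cong (pos x +_) (q₁-inc i α)) (sym (ℤₚ.+-assoc (pos x) (q₁ α) 1ℤ))

q₂-inc : ∀ {N} (i : Fin N) α → q₂ (inc i α) ≡ q₂ α + (pos (lookup α i) + pos (lookup α i) + 1ℤ)
q₂-inc zero (x ∷ α) = expand (pos x) (q₂ α)
  where
  expand : ∀ x d → (1ℤ + x) * (1ℤ + x) + d ≡ (x * x + d) + (x + x + 1ℤ)
  expand = ℤ-Solver.solve-∀
q₂-inc (suc i) (x ∷ α) = trans (cong (pos x * pos x +_) (q₂-inc i α)) (sym (ℤₚ.+-assoc (pos x * pos x) _ _))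

q₁-∑ : ∀ {N} (α : Vec ℕ N) → (∑[ i ∈ allFin N ] pos (lookup α i)) ≡ q₁ α
q₁-∑ [] = refl
q₁-∑ {suc N} (x ∷ α) = trans (∑-allFin {N} (λ i → pos (lookup (x ∷ α) i))) (cong (pos x +_) (q₁-∑ α))

q₂-∑ : ∀ {N} (α : Vec ℕ N) → (∑[ i ∈ allFin N ] pos (lookup α i) * pos (lookup α i)) ≡ q₂ α
q₂-∑ [] = refl
q₂-∑ {suc N} (x ∷ α) = trans (∑-allFin {N} (λ i → pos (lookup (x ∷ α) i) * pos (lookup (x ∷ α) i))) (cong (pos x * pos x +_) (q₂-∑ α))

-- A polynomial in N variables is a list of terms, and is identified with the
-- linear functional φ ↦ Σ coefficient · φ(exponent).
Poly : ℕ → Set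
Poly N = List (ℤ × Vec ℕ N)

⟦_⟧ : ∀ {N} → Poly N → (Vec ℕ N → ℤ) → ℤ
⟦ p ⟧ φ = ∑ p (λ (a , α) → a * φ α)

⟦⟧-cong : ∀ {N} (p : Poly N) {φ ψ} → (∀ α → φ α ≡ ψ α) → ⟦ p ⟧ φ ≡ ⟦ p ⟧ ψ
⟦⟧-cong p h = ∑-cong p (λ (a , α) → cong (a *_) (h α))

⟦⟧-+ : ∀ {N} (p : Poly N) φ ψ → ⟦ p ⟧ (λ α → φ α + ψ α) ≡ ⟦ p ⟧ φ + ⟦ p ⟧ ψ
⟦⟧-+ p φ ψ = trans (∑-cong p (λ (a , α) → ℤₚ.*-distribˡ-+ a (φ α) (ψ α))) (∑-+ p _ _)

⟦⟧-* : ∀ {N} (p : Poly N) k φ → ⟦ p ⟧ (λ α → k * φ α) ≡ k * ⟦ p ⟧ φ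
⟦⟧-* p k φ = trans (∑-cong p (λ (a , α) → swap a k (φ α))) (sym (∑-*ˡ p k _))
  where
  swap : ∀ a k x → a * (k * x) ≡ k * (a * x)
  swap = ℤ-Solver.solve-∀

⟦⟧-∑ : ∀ {N} (p : Poly N) {A : Set} (xs : List A) (φ : A → Vec ℕ N → ℤ) →
  ⟦ p ⟧ (λ α → ∑[ x ∈ xs ] φ x α) ≡ ∑[ x ∈ xs ] ⟦ p ⟧ (φ x)
⟦⟧-∑ p xs φ = trans (∑-cong p (λ (a , α) → ∑-*ˡ xs a (λ x → φ x α))) (∑-swap p xs _)

⟦⟧-swap : ∀ {N M} (p : Poly N) (q : Poly M) (F : Vec ℕ N → Vec ℕ M → ℤ) →
  ⟦ p ⟧ (λ α → ⟦ q ⟧ (F α)) ≡ ⟦ q ⟧ (λ β → ⟦ p ⟧ (λ α → F α β))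
⟦⟧-swap p q F = trans (⟦⟧-∑ p q (λ (b , β) α → b * F α β))
  (∑-cong q (λ (b , β) → ⟦⟧-* p b (λ α → F α β)))

infix 4 _≋_
_≋_ : ∀ {N} → Poly N → Poly N → Set
p ≋ q = ∀ φ → ⟦ p ⟧ φ ≡ ⟦ q ⟧ φ

negₚ : ∀ {N} → Poly N → Poly N
negₚ = map (λ (a , α) → - a , α)

infixl 7 _*ₚ_
_*ₚ_ : ∀ {N} → Poly N → Poly N → Poly N
p *ₚ q = concatMap (λ (a , α) → map (λ (b , β) → a * b , α ⊞ β) q) p

⟦neg⟧ : ∀ {N} (p : Poly N) φ → ⟦ negₚ p ⟧ φ ≡ - ⟦ p ⟧ φ
⟦neg⟧ p φ = trans (∑-map p _ _) (trans (∑-cong p (λ (a , α) → sym (ℤₚ.neg-distribˡ-* a (φ α)))) (∑-neg p _))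

⟦++⟧ : ∀ {N} (p q : Poly N) φ → ⟦ p ++ q ⟧ φ ≡ ⟦ p ⟧ φ + ⟦ q ⟧ φ
⟦++⟧ p q φ = ∑-++ p q _

⟦*⟧ : ∀ {N} (p q : Poly N) φ → ⟦ p *ₚ q ⟧ φ ≡ ⟦ p ⟧ (λ α → ⟦ q ⟧ (λ β → φ (α ⊞ β)))
⟦*⟧ p q φ = trans (∑-concatMap p _ _) (∑-cong p (λ (a , α) → trans (∑-map q _ _)
  (trans (∑-cong q (λ (b , β) → ℤₚ.*-assoc a b _)) (sym (∑-*ˡ q a _)))))

oneₚ : ∀ {N} → Poly N
oneₚ = [ 1ℤ , 𝟘ᵛ ]

⟦term⟧ : ∀ {N} (α : Vec ℕ N) φ → ⟦ [ 1ℤ , α ] ⟧ φ ≡ φ α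
⟦term⟧ α φ = trans (ℤₚ.+-identityʳ _) (ℤₚ.*-identityˡ _)

polyRing : ℕ → CommutativeRing 0ℓ 0ℓ
polyRing N = record
  { Carrier = Poly N ; _≈_ = _≋_ ; _+_ = _++_ ; _*_ = _*ₚ_ ; -_ = negₚ ; 0# = [] ; 1# = oneₚ
  ; isCommutativeRing = record
    { isRing = record
      { +-isAbelianGroup = record
        { isGroup = record
          { isMonoid = record
            { isSemigroup = record
              { isMagma = record
                { isEquivalence = record
                  { refl = λ _ → refl ; sym = λ e φ → sym (e φ) ; trans = λ e e′ φ → trans (e φ) (e′ φ) }
                ; ∙-cong = λ {p} {p′} {q} {q′} e e′ φ → trans (⟦++⟧ p q φ) (trans (cong₂ _+_ (e φ) (e′ φ)) (sym (⟦++⟧ p′ q′ φ))) }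
              ; assoc = λ p q r φ → cong (λ l → ⟦ l ⟧ φ) (Listₚ.++-assoc p q r) }
            ; identity = (λ p φ → refl) , (λ p φ → cong (λ l → ⟦ l ⟧ φ) (Listₚ.++-identityʳ p)) }
          ; inverse = (λ p φ → trans (⟦++⟧ (negₚ p) p φ) (trans (cong (_+ ⟦ p ⟧ φ) (⟦neg⟧ p φ)) (ℤₚ.+-inverseˡ (⟦ p ⟧ φ))))
                    , (λ p φ → trans (⟦++⟧ p (negₚ p) φ) (trans (cong (⟦ p ⟧ φ +_) (⟦neg⟧ p φ)) (ℤₚ.+-inverseʳ (⟦ p ⟧ φ))))
          ; ⁻¹-cong = λ {p} {q} e φ → trans (⟦neg⟧ p φ) (trans (cong -_ (e φ)) (sym (⟦neg⟧ q φ))) }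
        ; comm = λ p q φ → trans (⟦++⟧ p q φ) (trans (ℤₚ.+-comm (⟦ p ⟧ φ) _) (sym (⟦++⟧ q p φ))) }
      ; *-cong = λ {p} {p′} {q} {q′} e e′ φ → trans (⟦*⟧ p q φ) (trans (e _)
          (trans (⟦⟧-cong p′ (λ α → e′ _)) (sym (⟦*⟧ p′ q′ φ))))
      ; *-assoc = λ p q r φ → trans (⟦*⟧ (p *ₚ q) r φ) (trans (⟦*⟧ p q _) (sym (trans (⟦*⟧ p (q *ₚ r) φ)
          (⟦⟧-cong p (λ α → trans (⟦*⟧ q r _) (⟦⟧-cong q (λ β → ⟦⟧-cong r (λ γ → cong φ (sym (⊞-assoc α β γ))))))))))
      ; *-identity = idˡ , (λ p φ → trans (comm p oneₚ φ) (idˡ p φ))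
      ; distrib = (λ p q r φ → trans (comm p (q ++ r) φ) (trans (disʳ p q r φ)
            (trans (⟦++⟧ (q *ₚ p) (r *ₚ p) φ) (trans (cong₂ _+_ (comm q p φ) (comm r p φ)) (sym (⟦++⟧ (p *ₚ q) (p *ₚ r) φ))))))
          , disʳ }
    ; *-comm = comm } }
  where
  comm : ∀ (p q : Poly N) → p *ₚ q ≋ q *ₚ p
  comm p q φ = trans (⟦*⟧ p q φ) (trans (⟦⟧-swap p q _)
    (trans (⟦⟧-cong q (λ β → ⟦⟧-cong p (λ α → cong φ (⊞-comm α β)))) (sym (⟦*⟧ q p φ))))
  idˡ : ∀ (p : Poly N) → oneₚ *ₚ p ≋ p
  idˡ p φ = trans (⟦*⟧ oneₚ p φ) (trans (⟦term⟧ 𝟘ᵛ (λ α → ⟦ p ⟧ (λ β → φ (α ⊞ β)))) (⟦⟧-cong p (λ β → cong φ (⊞-identityˡ β))))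
  disʳ : ∀ (p q r : Poly N) → (q ++ r) *ₚ p ≋ q *ₚ p ++ r *ₚ p
  disʳ p q r φ = trans (⟦*⟧ (q ++ r) p φ) (trans (⟦++⟧ q r _)
    (sym (trans (⟦++⟧ (q *ₚ p) (r *ₚ p) φ) (cong₂ _+_ (⟦*⟧ q p φ) (⟦*⟧ r p φ)))))

pow : ∀ {N} → Fin N → ℕ → Poly N
pow i k = [ 1ℤ , add i k 𝟘ᵛ ]

⟦pow*⟧ : ∀ {N} (i : Fin N) k p φ → ⟦ pow i k *ₚ p ⟧ φ ≡ ⟦ p ⟧ (λ α → φ (add i k α))
⟦pow*⟧ i k p φ = trans (⟦*⟧ (pow i k) p φ) (trans (⟦term⟧ (add i k 𝟘ᵛ) (λ α → ⟦ p ⟧ (λ β → φ (α ⊞ β))))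
  (⟦⟧-cong p (λ α → cong φ (trans (add-⊞ i k 𝟘ᵛ α) (cong (add i k) (⊞-identityˡ α))))))

diff : ∀ {N} → Fin N × Fin N → Poly N
diff (i , j) = pow j 1 ++ negₚ (pow i 1)

⟦diff*⟧ : ∀ {N} (i j : Fin N) p φ → ⟦ diff (i , j) *ₚ p ⟧ φ ≡ ⟦ p ⟧ (λ α → φ (inc j α)) - ⟦ p ⟧ (λ α → φ (inc i α))
⟦diff*⟧ {N} i j p φ = begin
  ⟦ (pow j 1 ++ negₚ (pow i 1)) *ₚ p ⟧ φ
    ≡⟨ R.distribʳ p (pow j 1) (negₚ (pow i 1)) φ ⟩
  ⟦ pow j 1 *ₚ p ++ negₚ (pow i 1) *ₚ p ⟧ φ
    ≡⟨ ⟦++⟧ (pow j 1 *ₚ p) (negₚ (pow i 1) *ₚ p) φ ⟩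
  ⟦ pow j 1 *ₚ p ⟧ φ + ⟦ negₚ (pow i 1) *ₚ p ⟧ φ
    ≡⟨ cong₂ _+_ (⟦pow*⟧ j 1 p φ) (trans (⟦*⟧ (negₚ (pow i 1)) p φ) (trans (⟦neg⟧ (pow i 1) (λ α → ⟦ p ⟧ (λ β → φ (α ⊞ β))))
         (cong -_ (trans (sym (⟦*⟧ (pow i 1) p φ)) (⟦pow*⟧ i 1 p φ))))) ⟩
  ⟦ p ⟧ (λ α → φ (inc j α)) - ⟦ p ⟧ (λ α → φ (inc i α)) ∎
  where
  open ≡-Reasoning
  module R = CommutativeRing (polyRing N)

pairs : ∀ {A : Set} → List A → List (A × A)
pairs [] = []
pairs (i ∷ is) = map (i ,_) is ++ pairs is

module _ {N : ℕ} where
  open Determinant (polyRing N)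
  open CommutativeRing (polyRing N) using () renaming (setoid to ≋-setoid; *-cong to *ₚ-cong; *-congˡ to *ₚ-congˡ; *-congʳ to *ₚ-congʳ;
    *-assoc to *ₚ-assoc; *-identityˡ to *ₚ-identityˡ)
  open SetoidReasoning ≋-setoid

  ∏-++ : ∀ {A : Set} (xs ys : List A) (f : A → Poly N) → ∏ (xs ++ ys) f ≋ ∏ xs f *ₚ ∏ ys f
  ∏-++ [] ys f φ = sym (*ₚ-identityˡ (∏ ys f) φ)
  ∏-++ (x ∷ xs) ys f φ = trans (*ₚ-congˡ {f x} {∏ (xs ++ ys) f} {∏ xs f *ₚ ∏ ys f} (∏-++ xs ys f) φ)
    (sym (*ₚ-assoc (f x) (∏ xs f) (∏ ys f) φ))

  ∏-map : ∀ {A B : Set} (h : A → B) (xs : List A) (f : B → Poly N) → ∏ (map h xs) f ≡ ∏ xs (λ x → f (h x))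
  ∏-map h [] f = refl
  ∏-map h (x ∷ xs) f = cong (f (h x) *ₚ_) (∏-map h xs f)

  -- The row of x_i is geometric of ratio x_i. Clearing it leaves a factor x_s - x_i in every other
  -- row s and a determinant of the same shape.
  vandermonde : ∀ (is : List (Fin N)) → det pow is (iota 0 (length is)) ≋ ∏ (pairs is) diff
  vandermonde [] φ = refl
  vandermonde (i ∷ is) = begin
    det pow (i ∷ is) (iota 0 (suc (length is)))
      ≈⟨ det-geometric pow (pow i 1) i is 0 (length is) geo ⟩
    pow i 0 *ₚ det (λ s j → pow s (suc j) ++ negₚ (pow i 1) *ₚ pow s j) is (iota 0 (length is))
      ≈⟨ *ₚ-cong {pow i 0} {oneₚ} {det (λ s j → pow s (suc j) ++ negₚ (pow i 1) *ₚ pow s j) is (iota 0 (length is))}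
           {det (λ s j → diff (i , s) *ₚ pow s j) is (iota 0 (length is))} pow-0 (det-cong is (iota 0 (length is)) factor) ⟩
    oneₚ *ₚ det (λ s j → diff (i , s) *ₚ pow s j) is (iota 0 (length is))
      ≈⟨ *ₚ-identityˡ (det (λ s j → diff (i , s) *ₚ pow s j) is (iota 0 (length is))) ⟩
    det (λ s j → diff (i , s) *ₚ pow s j) is (iota 0 (length is))
      ≈⟨ det-scale (λ s → diff (i , s)) pow is (iota 0 (length is)) ⟩
    ∏ is (λ s → diff (i , s)) *ₚ det pow is (iota 0 (length is))
      ≈⟨ *ₚ-cong {∏ is (λ s → diff (i , s))} {∏ (map (i ,_) is) diff} {det pow is (iota 0 (length is))} {∏ (pairs is) diff} (λ φ → cong (λ p → ⟦ p ⟧ φ) (sym (∏-map (i ,_) is diff))) (vandermonde is) ⟩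
    ∏ (map (i ,_) is) diff *ₚ ∏ (pairs is) diff
      ≈⟨ ∏-++ (map (i ,_) is) (pairs is) diff ⟨
    ∏ (pairs (i ∷ is)) diff ∎
    where
    pow-suc : ∀ s j → pow s (suc j) ≋ pow s 1 *ₚ pow s j
    pow-suc s j φ = trans (⟦term⟧ (add s (suc j) 𝟘ᵛ) φ) (sym (trans (⟦pow*⟧ s 1 (pow s j) φ)
      (trans (⟦term⟧ (add s j 𝟘ᵛ) (λ α → φ (add s 1 α))) (cong φ (Vecₚ.updateAt-updateAt s {1 ℕ.+_} {j ℕ.+_} 𝟘ᵛ)))))
    pow-0 : pow i 0 ≋ oneₚ
    pow-0 φ = trans (⟦term⟧ (add i 0 𝟘ᵛ) φ) (trans (cong φ (Vecₚ.updateAt-id i 𝟘ᵛ)) (sym (⟦term⟧ 𝟘ᵛ φ)))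
    geo : ∀ j → pow i (suc j) ≋ pow i 1 *ₚ pow i j
    geo = pow-suc i
    factor : ∀ s j → pow s (suc j) ++ negₚ (pow i 1) *ₚ pow s j ≋ diff (i , s) *ₚ pow s j
    factor s j φ = trans (⟦++⟧ (pow s (suc j)) (negₚ (pow i 1) *ₚ pow s j) φ)
      (trans (cong (_+ ⟦ negₚ (pow i 1) *ₚ pow s j ⟧ φ) (pow-suc s j φ))
        (trans (sym (⟦++⟧ (pow s 1 *ₚ pow s j) (negₚ (pow i 1) *ₚ pow s j) φ))
          (sym (CommutativeRing.distribʳ (polyRing N) (pow s j) (pow s 1) (negₚ (pow i 1)) φ))))

  private module ⟦⟧-hom φ = AltHom (polyRing N) ℤₚ.+-*-commutativeRing (λ p → ⟦ p ⟧ φ) refl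
            (λ p q → trans (⟦++⟧ p (negₚ q) φ) (cong (⟦ p ⟧ φ +_) (⟦neg⟧ q φ)))

  exponents : ∀ {n} → Vec (Fin N) n → Vec ℕ n → Vec ℕ N
  exponents [] [] = 𝟘ᵛ
  exponents (i ∷ is) (k ∷ w) = add i k (exponents is w)

  ⟦rowProduct⟧ : ∀ {n} (is : Vec (Fin N) n) w φ → ⟦ rowProduct pow is w ⟧ φ ≡ φ (exponents is w)
  ⟦rowProduct⟧ [] [] φ = ⟦term⟧ 𝟘ᵛ φ
  ⟦rowProduct⟧ (i ∷ is) (k ∷ w) φ = trans (⟦pow*⟧ i k (rowProduct pow is w) φ) (⟦rowProduct⟧ is w _)

  ⟦det-pow⟧ : ∀ {n} (is : Vec (Fin N) n) ks φ →
    ⟦ det pow (Vec.toList is) ks ⟧ φ ≡ Determinant.altVec ℤₚ.+-*-commutativeRing n ks (λ w → φ (exponents is w))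
  ⟦det-pow⟧ {n} is ks φ = trans (det-altVec pow is ks φ) (trans (⟦⟧-hom.altVec-hom φ n ks (rowProduct pow is))
    (Determinant.altVec-cong ℤₚ.+-*-commutativeRing n ks (λ w → ⟦rowProduct⟧ is w φ)))

exponents-suc : ∀ {N n} (is : Vec (Fin N) n) w → exponents (Vec.map suc is) w ≡ 0 ∷ exponents is w
exponents-suc [] [] = refl
exponents-suc (i ∷ is) (k ∷ w) = cong (add (suc i) k) (exponents-suc is w)

exponents-allFin : ∀ {N} (w : Vec ℕ N) → exponents (Vec.allFin N) w ≡ w
exponents-allFin [] = refl
exponents-allFin {suc N} (k ∷ w) = trans
  (cong (λ is → add zero k (exponents is w)) (Vecₚ.tabulate-∘ suc id))
  (trans (cong (add zero k) (exponents-suc (Vec.allFin N) w))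
    (cong₂ _∷_ (ℕₚ.+-identityʳ k) (exponents-allFin w)))

altℤ : ∀ n → List ℕ → (Vec ℕ n → ℤ) → ℤ
altℤ = Determinant.altVec ℤₚ.+-*-commutativeRing

iotaℕ : ℕ → ℕ → List ℕ
iotaℕ = Determinant.iota ℤₚ.+-*-commutativeRing

vand : ∀ N → Poly N
vand N = Determinant.∏ (polyRing N) (pairs (Vec.toList (Vec.allFin N))) diff

-- Both forms are used: the product allows an induction on the factors in `carré-du-champ`, while
-- the signed sum over arrangements gives the eigenvalues and the final determinant.
⟦vand⟧ : ∀ N φ → ⟦ vand N ⟧ φ ≡ altℤ N (iotaℕ 0 N) φ
⟦vand⟧ N φ = trans (sym (vandermonde (Vec.toList (Vec.allFin N)) φ))
  (trans (cong (λ l → ⟦ Determinant.det (polyRing N) pow (Vec.toList (Vec.allFin N)) l ⟧ φ)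
      (trans (cong (Determinant.iota (polyRing N) 0) (Vecₚ.length-toList (Vec.allFin N))) (same 0 N)))
    (trans (⟦det-pow⟧ (Vec.allFin N) (iotaℕ 0 N) φ)
      (Determinant.altVec-cong ℤₚ.+-*-commutativeRing N (iotaℕ 0 N) (λ w → cong φ (exponents-allFin w)))))
  where
  same : ∀ k l → Determinant.iota (polyRing N) k l ≡ iotaℕ k l
  same k zero = refl
  same k (suc l) = cong (k ∷_) (same (suc k) l)

-- The Vandermonde determinant and the transposition operator

-- The exponents of every monomial of the Vandermonde determinant are a
-- rearrangement of 0, …, N−1, so symmetric functions of them are constant.
vand-eigen : (q : ∀ {n} → Vec ℕ n → ℤ) (f : ℕ → ℤ) → q [] ≡ 0ℤ → (∀ {n} x (α : Vec ℕ n) → q (x ∷ α) ≡ f x + q α) →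
  ∀ N → Σ[ κ ∈ ℤ ] (∀ φ → ⟦ vand N ⟧ (λ α → q α * φ α) ≡ κ * ⟦ vand N ⟧ φ)
vand-eigen q f q[] q∷ N = κ (iotaℕ 0 N) , λ φ → begin
  ⟦ vand N ⟧ (λ α → q α * φ α)          ≡⟨ ⟦vand⟧ N _ ⟩
  altℤ N (iotaℕ 0 N) (λ α → q α * φ α)  ≡⟨ go N (iotaℕ 0 N) φ ⟩
  κ (iotaℕ 0 N) * altℤ N (iotaℕ 0 N) φ  ≡⟨ cong (κ (iotaℕ 0 N) *_) (⟦vand⟧ N φ) ⟨
  κ (iotaℕ 0 N) * ⟦ vand N ⟧ φ          ∎
  where
  open ≡-Reasoning
  open Determinant ℤₚ.+-*-commutativeRing
  κ : List ℕ → ℤ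
  κ ks = ∑ ks f
  κ-insert : ∀ as k bs → κ (as ++ k ∷ bs) ≡ f k + κ (as ++ bs)
  κ-insert [] k bs = refl
  κ-insert (a ∷ as) k bs = trans (cong (f a +_) (κ-insert as k bs)) (swap3 (f a) (f k) (κ (as ++ bs)))
    where
    swap3 : ∀ a k t → a + (k + t) ≡ k + (a + t)
    swap3 = ℤ-Solver.solve-∀
  alt-scale : ∀ ks (F G : ℕ → List ℕ → ℤ) c →
    (∀ as k bs → ks ≡ as ++ k ∷ bs → F k (as ++ bs) ≡ c * G k (as ++ bs)) → alt ks F ≡ c * alt ks G
  alt-scale [] F G c h = sym (ℤₚ.*-zeroʳ c)
  alt-scale (k ∷ ks) F G c h = trans (cong₂ (λ a b → a + - b) (h [] k ks refl)
      (alt-scale ks _ _ c (λ as k′ bs e → h (k ∷ as) k′ bs (cong (k ∷_) e))))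
    (factor c (G k ks) _)
    where
    factor : ∀ a p q → a * p + - (a * q) ≡ a * (p + - q)
    factor = ℤ-Solver.solve-∀
  altVec-+ : ∀ n ks (g h : Vec ℕ n → ℤ) → altVec n ks (λ w → g w + h w) ≡ altVec n ks g + altVec n ks h
  altVec-+ zero [] g h = refl
  altVec-+ zero (_ ∷ _) g h = refl
  altVec-+ (suc n) ks g h = trans (alt-cong ks (λ k ks′ → altVec-+ n ks′ _ _)) (alt-+ ks _ _)
  go : ∀ n ks (φ : Vec ℕ n → ℤ) → altVec n ks (λ α → q α * φ α) ≡ κ ks * altVec n ks φ
  go zero [] φ = cong (_* φ []) q[]
  go zero (k ∷ ks) φ = sym (ℤₚ.*-zeroʳ (κ (k ∷ ks)))
  go (suc n) ks φ = alt-scale ks _ _ (κ ks) (λ { as k bs refl → begin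
    altVec n (as ++ bs) (λ w → q (k ∷ w) * φ (k ∷ w))
      ≡⟨ altVec-cong n (as ++ bs) (λ w → trans (cong (_* φ (k ∷ w)) (q∷ k w)) (ℤₚ.*-distribʳ-+ (φ (k ∷ w)) (f k) (q w))) ⟩
    altVec n (as ++ bs) (λ w → f k * φ (k ∷ w) + q w * φ (k ∷ w))
      ≡⟨ trans (altVec-+ n (as ++ bs) _ _) (cong₂ _+_ (altVec-*ˡ n (as ++ bs) (f k) _) (go n (as ++ bs) _)) ⟩
    f k * A (as ++ bs) k + κ (as ++ bs) * A (as ++ bs) k
      ≡⟨ ℤₚ.*-distribʳ-+ (A (as ++ bs) k) (f k) (κ (as ++ bs)) ⟨
    (f k + κ (as ++ bs)) * A (as ++ bs) k
      ≡⟨ cong (_* A (as ++ bs) k) (κ-insert as k bs) ⟨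
    κ (as ++ k ∷ bs) * A (as ++ bs) k ∎ })
    where
    A : List ℕ → ℕ → ℤ
    A ks k = altVec n ks (λ w → φ (k ∷ w))

∑-pairs : ∀ {A : Set} (xs : List A) (F : A → A → ℤ) →
  (∑[ x ∈ xs ] ∑[ y ∈ xs ] F x y) ≡ (∑[ x ∈ xs ] F x x) + (∑[ (x , y) ∈ pairs xs ] (F x y + F y x))
∑-pairs [] F = refl
∑-pairs (x ∷ xs) F = begin
  (F x x + r) + (∑[ y ∈ xs ] (F y x + ∑ xs (F y)))
    ≡⟨ cong ((F x x + r) +_) (trans (∑-+ xs (λ y → F y x) _) (cong (∑ xs (λ y → F y x) +_) (∑-pairs xs F))) ⟩
  (F x x + r) + (c + (d + e))
    ≡⟨ arrange (F x x) r c d e ⟩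
  (F x x + d) + ((r + c) + e)
    ≡⟨ cong (λ z → (F x x + d) + (z + e)) (trans (sym (∑-+ xs (F x) (λ y → F y x))) (sym (∑-map xs (x ,_) _))) ⟩
  (F x x + d) + (∑ (map (x ,_) xs) _ + e)
    ≡⟨ cong ((F x x + d) +_) (∑-++ (map (x ,_) xs) (pairs xs) _) ⟨
  (F x x + d) + ∑ (pairs (x ∷ xs)) _ ∎
  where
  open ≡-Reasoning
  r = ∑ xs (F x)
  c = ∑[ y ∈ xs ] F y x
  d = ∑[ y ∈ xs ] F y y
  e = ∑[ (y , z) ∈ pairs xs ] (F y z + F z y)
  arrange : ∀ x r c d e → (x + r) + (c + (d + e)) ≡ (x + d) + ((r + c) + e)
  arrange = ℤ-Solver.solve-∀

∑-pairs-degree : ∀ {A : Set} (xs : List A) (f : A → ℤ) →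
  (∑[ (x , y) ∈ pairs xs ] (f x + f y)) ≡ (pos (length xs) - 1ℤ) * ∑ xs f
∑-pairs-degree [] f = refl
∑-pairs-degree (x ∷ xs) f = begin
  ∑ (map (x ,_) xs ++ pairs xs) _
    ≡⟨ trans (∑-++ (map (x ,_) xs) (pairs xs) _) (cong₂ _+_ (∑-map xs (x ,_) _) (∑-pairs-degree xs f)) ⟩
  (∑[ y ∈ xs ] (f x + f y)) + (l - 1ℤ) * ∑ xs f
    ≡⟨ cong (_+ (l - 1ℤ) * ∑ xs f) (trans (∑-+ xs (λ _ → f x) f) (cong (_+ ∑ xs f) (const xs))) ⟩
  (l * f x + ∑ xs f) + (l - 1ℤ) * ∑ xs f
    ≡⟨ collect l (f x) (∑ xs f) ⟩
  ((1ℤ + l) - 1ℤ) * (f x + ∑ xs f) ∎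
  where
  open ≡-Reasoning
  l = pos (length xs)
  const : ∀ ys → (∑[ y ∈ ys ] f x) ≡ pos (length ys) * f x
  const [] = refl
  const (y ∷ ys) = trans (cong (f x +_) (const ys)) (sym (ℤₚ.suc-* (pos (length ys)) (f x)))
  collect : ∀ l a s → (l * a + s) + (l - 1ℤ) * s ≡ ((1ℤ + l) - 1ℤ) * (a + s)
  collect = ℤ-Solver.solve-∀

inc-⊞ʳ : ∀ {N} (i : Fin N) α β → inc i α ⊞ β ≡ α ⊞ inc i β
inc-⊞ʳ i α β = trans (add-⊞ i 1 α β) (trans (cong (inc i) (⊞-comm α β)) (trans (sym (add-⊞ i 1 β α)) (⊞-comm (inc i β) α)))

-- The sums of i and of i² over 0 ≤ i < N, left unevaluated: they normalise `casimir` and drop out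
-- of its differences.
κ₁ κ₂ : ℕ → ℤ
κ₁ N = proj₁ (vand-eigen q₁ pos refl (λ _ _ → refl) N)
κ₂ N = proj₁ (vand-eigen q₂ (λ x → pos x * pos x) refl (λ _ _ → refl) N)

-- The eigenvalue of the sum of all transpositions.
casimir : ∀ N → Vec ℕ N → ℤ
casimir N γ = (q₂ γ - (c + c) * q₁ γ) + ((c + c) * κ₁ N - κ₂ N)
  where c = pos N - 1ℤ

-- With D_k = x_k ∂_k, `rel` reads (x_j - x_i) T i j = x_i D_j p - x_j D_i p: T i j is a divided
-- difference of p, characterised without division.
module _ {N : ℕ} (p : Poly N) (T : Fin N → Fin N → Poly N)
  (rel : ∀ (i j : Fin N) → i ≢ j → ∀ (φ : Vec ℕ N → ℤ) →
    ⟦ T i j ⟧ (λ β → φ (inc j β)) + ⟦ p ⟧ (λ β → pos (lookup β i) * φ (inc j β)) ≡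
    ⟦ T i j ⟧ (λ β → φ (inc i β)) + ⟦ p ⟧ (λ β → pos (lookup β j) * φ (inc i β))) where

  private
    ∏ₚ : List (Fin N × Fin N) → Poly N
    ∏ₚ L = Determinant.∏ (polyRing N) L diff

    -- The quotient (x_j D_j p - x_i D_i p)/(x_j - x_i), which equals T i j + D_i p + D_j p.
    G : Fin N × Fin N → (Vec ℕ N → ℤ) → Vec ℕ N → ℤ
    G (i , j) φ α = ⟦ T i j ⟧ (λ β → φ (α ⊞ β)) + ⟦ p ⟧ (λ β → (pos (lookup β i) + pos (lookup β j)) * φ (α ⊞ β))

    -- Tested against a polynomial A, this is Σ_k D_k A · D_k p, half the cross term when Σ_k D_k²
    -- acts on A·p.
    H : (Vec ℕ N → ℤ) → Vec ℕ N → ℤ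
    H φ α = ⟦ p ⟧ (λ β → dot α β * φ (α ⊞ β))

    G-inc : ∀ e φ k α → G e φ (inc k α) ≡ G e (λ γ → φ (inc k γ)) α
    G-inc (i , j) φ k α = cong₂ _+_
      (⟦⟧-cong (T i j) (λ β → cong φ (add-⊞ k 1 α β)))
      (⟦⟧-cong p (λ β → cong (λ γ → (pos (lookup β i) + pos (lookup β j)) * φ γ) (add-⊞ k 1 α β)))

    H-inc : ∀ φ k α → H φ (inc k α) ≡ H (λ γ → φ (inc k γ)) α + ⟦ p ⟧ (λ β → pos (lookup β k) * φ (α ⊞ inc k β))
    H-inc φ k α = trans (⟦⟧-cong p (λ β → trans (cong₂ _*_ (dot-inc k α β) (cong φ (inc-⊞ʳ k α β)))
        (trans (ℤₚ.*-distribʳ-+ (φ (α ⊞ inc k β)) (dot α β) (pos (lookup β k)))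
          (cong (λ γ → dot α β * φ γ + pos (lookup β k) * φ (α ⊞ inc k β)) (trans (sym (inc-⊞ʳ k α β)) (add-⊞ k 1 α β))))))
      (⟦⟧-+ p _ _)

    G-diff : ∀ i j → i ≢ j → ∀ φ α →
      G (i , j) φ (inc j α) - G (i , j) φ (inc i α) ≡
      ⟦ p ⟧ (λ β → pos (lookup β j) * φ (α ⊞ inc j β)) - ⟦ p ⟧ (λ β → pos (lookup β i) * φ (α ⊞ inc i β))
    G-diff i j i≢j φ α = trans (cong₂ (λ a b → a - b) (split j) (split i))
      (solve4 (t j) (d i j) (d j j) (t i) (d i i) (d j i) (rel i j i≢j (λ γ → φ (α ⊞ γ))))
      where
      t : Fin N → ℤ
      t k = ⟦ T i j ⟧ (λ β → φ (α ⊞ inc k β))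
      d : Fin N → Fin N → ℤ
      d l k = ⟦ p ⟧ (λ β → pos (lookup β l) * φ (α ⊞ inc k β))
      split : ∀ k → G (i , j) φ (inc k α) ≡ t k + (d i k + d j k)
      split k = cong₂ _+_
        (⟦⟧-cong (T i j) (λ β → cong φ (inc-⊞ʳ k α β)))
        (trans (⟦⟧-cong p (λ β → trans (cong (λ γ → (pos (lookup β i) + pos (lookup β j)) * φ γ) (inc-⊞ʳ k α β))
          (ℤₚ.*-distribʳ-+ (φ (α ⊞ inc k β)) (pos (lookup β i)) (pos (lookup β j))))) (⟦⟧-+ p _ _))
      solve4 : ∀ a b c a′ b′ c′ → a + b ≡ a′ + c′ → (a + (b + c)) - (a′ + (b′ + c′)) ≡ c - b′
      solve4 a b c a′ b′ c′ h = trans (e₁ a b c a′ b′ c′) (trans (cong (λ z → (z - (a′ + c′)) + (c - b′)) h) (e₂ (a′ + c′) c b′))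
        where
        e₁ : ∀ a b c a′ b′ c′ → (a + (b + c)) - (a′ + (b′ + c′)) ≡ ((a + b) - (a′ + c′)) + (c - b′)
        e₁ = ℤ-Solver.solve-∀
        e₂ : ∀ x c b → (x - x) + (c - b) ≡ c - b
        e₂ = ℤ-Solver.solve-∀

    -- Leibniz rule for the D_k over the factors of A: the factor x_j - x_i contributes A times the
    -- quotient `G (i , j)`, and `G-diff` is the computation for a single factor.
    carré-du-champ : ∀ L → (∀ {i j} → (i , j) ∈ L → i ≢ j) → ∀ φ →
      ⟦ ∏ₚ L ⟧ (λ α → ∑[ e ∈ L ] G e φ α) ≡ ⟦ ∏ₚ L ⟧ (H φ)
    carré-du-champ [] h φ = trans (⟦term⟧ {N} 𝟘ᵛ (λ _ → 0ℤ)) (sym (trans (⟦term⟧ 𝟘ᵛ (H φ))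
      (trans (⟦⟧-cong p (λ β → trans (cong (_* φ (𝟘ᵛ ⊞ β)) (dot-𝟘 β)) (sym (ℤₚ.*-zeroˡ 0ℤ)))) (trans (⟦⟧-* p 0ℤ (λ _ → 0ℤ)) (ℤₚ.*-zeroˡ (⟦ p ⟧ (λ _ → 0ℤ)))))))
    carré-du-champ ((i , j) ∷ L) h φ = begin
      ⟦ diff (i , j) *ₚ A ⟧ (λ α → G (i , j) φ α + S φ α)
        ≡⟨ ⟦diff*⟧ i j A _ ⟩
      ⟦ A ⟧ (λ α → G (i , j) φ (inc j α) + S φ (inc j α)) - ⟦ A ⟧ (λ α → G (i , j) φ (inc i α) + S φ (inc i α))
        ≡⟨ cong₂ (λ a b → a - b) (part j) (part i) ⟩
      (g j + ⟦ A ⟧ (H (φ⁺ j))) - (g i + ⟦ A ⟧ (H (φ⁺ i)))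
        ≡⟨ regroup (g j) (⟦ A ⟧ (H (φ⁺ j))) (g i) (⟦ A ⟧ (H (φ⁺ i))) ⟩
      (g j - g i) + (⟦ A ⟧ (H (φ⁺ j)) - ⟦ A ⟧ (H (φ⁺ i)))
        ≡⟨ cong (_+ (⟦ A ⟧ (H (φ⁺ j)) - ⟦ A ⟧ (H (φ⁺ i)))) (trans (sym (sub _ _)) (trans (⟦⟧-cong A (G-diff i j (h (here refl)) φ)) (sub _ _))) ⟩
      (d j - d i) + (⟦ A ⟧ (H (φ⁺ j)) - ⟦ A ⟧ (H (φ⁺ i)))
        ≡⟨ regroup′ (d j) (d i) (⟦ A ⟧ (H (φ⁺ j))) (⟦ A ⟧ (H (φ⁺ i))) ⟩
      (⟦ A ⟧ (H (φ⁺ j)) + d j) - (⟦ A ⟧ (H (φ⁺ i)) + d i)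
        ≡⟨ cong₂ (λ a b → a - b) (part′ j) (part′ i) ⟨
      ⟦ A ⟧ (λ α → H φ (inc j α)) - ⟦ A ⟧ (λ α → H φ (inc i α))
        ≡⟨ ⟦diff*⟧ i j A (H φ) ⟨
      ⟦ diff (i , j) *ₚ A ⟧ (H φ) ∎
      where
      open ≡-Reasoning
      A = ∏ₚ L
      S : (Vec ℕ N → ℤ) → Vec ℕ N → ℤ
      S φ α = ∑[ e ∈ L ] G e φ α
      φ⁺ : Fin N → Vec ℕ N → ℤ
      φ⁺ k γ = φ (inc k γ)
      g d : Fin N → ℤ
      g k = ⟦ A ⟧ (λ α → G (i , j) φ (inc k α))
      d k = ⟦ A ⟧ (λ α → ⟦ p ⟧ (λ β → pos (lookup β k) * φ (α ⊞ inc k β)))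
      part : ∀ k → ⟦ A ⟧ (λ α → G (i , j) φ (inc k α) + S φ (inc k α)) ≡ g k + ⟦ A ⟧ (H (φ⁺ k))
      part k = trans (⟦⟧-+ A _ _) (cong (g k +_) (trans (⟦⟧-cong A (λ α → ∑-cong L (λ e → G-inc e φ k α)))
        (carré-du-champ L (λ q → h (there q)) (φ⁺ k))))
      part′ : ∀ k → ⟦ A ⟧ (λ α → H φ (inc k α)) ≡ ⟦ A ⟧ (H (φ⁺ k)) + d k
      part′ k = trans (⟦⟧-cong A (H-inc φ k)) (⟦⟧-+ A _ _)
      sub : ∀ f f′ → ⟦ A ⟧ (λ α → f α - f′ α) ≡ ⟦ A ⟧ f - ⟦ A ⟧ f′
      sub f f′ = trans (⟦⟧-+ A f (λ α → - f′ α)) (cong (⟦ A ⟧ f +_) (trans (⟦⟧-cong A (λ α → sym (ℤₚ.-1*i≡-i (f′ α))))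
        (trans (⟦⟧-* A (- 1ℤ) f′) (ℤₚ.-1*i≡-i _))))
      regroup : ∀ a b c d → (a + b) - (c + d) ≡ (a - c) + (b - d)
      regroup = ℤ-Solver.solve-∀
      regroup′ : ∀ a b c d → (a - b) + (c - d) ≡ (c + a) - (d + b)
      regroup′ = ℤ-Solver.solve-∀

  allPairs : List (Fin N × Fin N)
  allPairs = pairs (Vec.toList (Vec.allFin N))

  -- Σ D_k² on a·p has the cross term computed by `carré-du-champ`. There each D_i p occurs in N - 1
  -- pairs, which the q₁ term of `casimir` removes, while its constants remove the eigenvalues of a.
  -- What remains is a times Σ D_k² p + 2 Σ T i j.
  vand-casimir : (∀ {i j} → (i , j) ∈ allPairs → i ≢ j) → (∀ (f : Fin N → ℤ) → ∑ (Vec.toList (Vec.allFin N)) f ≡ ∑ (allFin N) f) → ∀ φ →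
    ⟦ vand N ⟧ (λ α → ⟦ p ⟧ (λ β → casimir N (α ⊞ β) * φ (α ⊞ β))) ≡
    ⟦ vand N ⟧ (λ α → ⟦ p ⟧ (λ β → q₂ β * φ (α ⊞ β)) + ∑ allPairs (λ (i , j) → ⟦ T i j ⟧ (λ β → φ (α ⊞ β)) + ⟦ T i j ⟧ (λ β → φ (α ⊞ β))))
  vand-casimir distinct toList-∑ φ = begin
    V (λ α → ⟦ p ⟧ (λ β → casimir N (α ⊞ β) * φ (α ⊞ β)))
      ≡⟨ ⟦⟧-cong (vand N) inner ⟩
    V (λ α → ((q₂ α * P α + (- (c + c)) * (q₁ α * P α)) + K * P α) + ((H φ α + H φ α) + (B α + (- (c + c)) * E α)))
      ≡⟨ trans (⟦⟧-+ (vand N) _ _) (cong₂ _+_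
           (trans (⟦⟧-+ (vand N) _ _) (cong₂ _+_
             (trans (⟦⟧-+ (vand N) _ _) (cong₂ _+_ (proj₂ eigen₂ P) (trans (⟦⟧-* (vand N) (- (c + c)) _) (cong ((- (c + c)) *_) (proj₂ eigen₁ P)))))
             (⟦⟧-* (vand N) K P)))
           (trans (⟦⟧-+ (vand N) _ _) (cong₂ _+_ (⟦⟧-+ (vand N) _ _) (trans (⟦⟧-+ (vand N) _ _) (cong (V B +_) (⟦⟧-* (vand N) (- (c + c)) E)))))) ⟩
    ((κ₂ N * V P + (- (c + c)) * (κ₁ N * V P)) + K * V P) + ((V (H φ) + V (H φ)) + (V B + (- (c + c)) * V E))
      ≡⟨ cong (λ x → ((κ₂ N * V P + (- (c + c)) * (κ₁ N * V P)) + K * V P) + ((x + x) + (V B + (- (c + c)) * V E))) champ ⟩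
    ((κ₂ N * V P + (- (c + c)) * (κ₁ N * V P)) + K * V P) + (((V S + c * V E) + (V S + c * V E)) + (V B + (- (c + c)) * V E))
      ≡⟨ collapse (κ₂ N) (V P) c (κ₁ N) (V S) (V E) (V B) ⟩
    V B + (V S + V S)
      ≡⟨ trans (⟦⟧-+ (vand N) B _) (cong (V B +_) (trans (⟦⟧-cong (vand N) (λ α → ∑-+ allPairs (λ (i , j) → ⟦ T i j ⟧ (λ β → φ (α ⊞ β))) _)) (⟦⟧-+ (vand N) S S))) ⟨
    V (λ α → B α + ∑ allPairs (λ (i , j) → ⟦ T i j ⟧ (λ β → φ (α ⊞ β)) + ⟦ T i j ⟧ (λ β → φ (α ⊞ β)))) ∎
    where
    open ≡-Reasoning
    eigen₁ = vand-eigen q₁ pos refl (λ _ _ → refl) N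
    eigen₂ = vand-eigen q₂ (λ x → pos x * pos x) refl (λ _ _ → refl) N
    c K : ℤ
    c = pos N - 1ℤ
    K = (c + c) * κ₁ N - κ₂ N
    V : (Vec ℕ N → ℤ) → ℤ
    V = ⟦ vand N ⟧
    P B E S : Vec ℕ N → ℤ
    P α = ⟦ p ⟧ (λ β → φ (α ⊞ β))
    B α = ⟦ p ⟧ (λ β → q₂ β * φ (α ⊞ β))
    E α = ⟦ p ⟧ (λ β → q₁ β * φ (α ⊞ β))
    S α = ∑[ (i , j) ∈ allPairs ] ⟦ T i j ⟧ (λ β → φ (α ⊞ β))
    inner : ∀ α → ⟦ p ⟧ (λ β → casimir N (α ⊞ β) * φ (α ⊞ β)) ≡
      ((q₂ α * P α + (- (c + c)) * (q₁ α * P α)) + K * P α) + ((H φ α + H φ α) + (B α + (- (c + c)) * E α))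
    inner α = trans (⟦⟧-cong p (λ β → trans (cong₂ (λ a b → ((a - (c + c) * b) + K) * φ (α ⊞ β)) (q₂-⊞ α β) (q₁-⊞ α β))
        (expand (q₂ α) (dot α β) (q₂ β) c (q₁ α) (q₁ β) K (φ (α ⊞ β)))))
      (trans (⟦⟧-+ p _ _) (cong₂ _+_
        (trans (⟦⟧-+ p _ _) (cong₂ _+_ (trans (⟦⟧-+ p _ _) (cong₂ _+_ (⟦⟧-* p (q₂ α) _)
          (trans (⟦⟧-* p (- (c + c)) _) (cong ((- (c + c)) *_) (⟦⟧-* p (q₁ α) _))))) (⟦⟧-* p K _)))
        (trans (⟦⟧-+ p _ _) (cong₂ _+_ (⟦⟧-+ p _ _) (trans (⟦⟧-+ p _ _) (cong (B α +_) (⟦⟧-* p (- (c + c)) _)))))))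
      where
      expand : ∀ a d b c x y K f → (((a + (d + d) + b) - (c + c) * (x + y)) + K) * f ≡
        ((a * f + (- (c + c)) * (x * f)) + K * f) + ((d * f + d * f) + (b * f + (- (c + c)) * (y * f)))
      expand = ℤ-Solver.solve-∀
    champ : V (H φ) ≡ V S + c * V E
    champ = trans (sym (carré-du-champ allPairs distinct φ)) (trans
      (⟦⟧-cong (vand N) (λ α → trans (∑-+ allPairs _ _) (cong (S α +_) (begin
        (∑[ (i , j) ∈ allPairs ] ⟦ p ⟧ (λ β → (pos (lookup β i) + pos (lookup β j)) * φ (α ⊞ β)))
          ≡⟨ ⟦⟧-∑ p allPairs _ ⟨
        ⟦ p ⟧ (λ β → ∑[ (i , j) ∈ allPairs ] (pos (lookup β i) + pos (lookup β j)) * φ (α ⊞ β))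
          ≡⟨ ⟦⟧-cong p (λ β → trans (sym (∑-*ʳ allPairs (φ (α ⊞ β)) (λ (i , j) → pos (lookup β i) + pos (lookup β j))))
               (trans (cong (_* φ (α ⊞ β)) (degree β)) (ℤₚ.*-assoc c (q₁ β) _))) ⟩
        ⟦ p ⟧ (λ β → c * (q₁ β * φ (α ⊞ β)))
          ≡⟨ ⟦⟧-* p c _ ⟩
        c * E α ∎))))
      (trans (⟦⟧-+ (vand N) _ _) (cong (V S +_) (⟦⟧-* (vand N) c E))))
      where
      degree : ∀ β → (∑[ (i , j) ∈ allPairs ] (pos (lookup β i) + pos (lookup β j))) ≡ c * q₁ β
      degree β = trans (∑-pairs-degree (Vec.toList (Vec.allFin N)) (λ i → pos (lookup β i)))
        (cong₂ (λ l s → (pos l - 1ℤ) * s) (Vecₚ.length-toList (Vec.allFin N)) (trans (toList-∑ (λ i → pos (lookup β i))) (q₁-∑ β)))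
    collapse : ∀ k₂ v c k₁ s e b →
      ((k₂ * v + (- (c + c)) * (k₁ * v)) + ((c + c) * k₁ - k₂) * v) + (((s + c * e) + (s + c * e)) + (b + (- (c + c)) * e)) ≡ b + (s + s)
    collapse = ℤ-Solver.solve-∀

-- Power sums

⟨⟩³ : ∀ {P Q R P′ Q′ R′ : Set} (p : Dec P) (q : Dec Q) (r : Dec R) (p′ : Dec P′) (q′ : Dec Q′) (r′ : Dec R′) →
  (P → Q → R → P′ × Q′ × R′) → (P′ → Q′ → R′ → P × Q × R) → ⟨ p ⟩ * (⟨ q ⟩ * ⟨ r ⟩) ≡ ⟨ p′ ⟩ * (⟨ q′ ⟩ * ⟨ r′ ⟩)
⟨⟩³ p q r p′ q′ r′ f g = trans (sym (join p q r))
  (trans (⟨⟩-cong (p ×-dec (q ×-dec r)) (p′ ×-dec (q′ ×-dec r′)) (λ (x , y , z) → f x y z) (λ (x , y , z) → g x y z)) (join p′ q′ r′))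
  where
  join : ∀ {P Q R : Set} (p : Dec P) (q : Dec Q) (r : Dec R) → ⟨ p ×-dec (q ×-dec r) ⟩ ≡ ⟨ p ⟩ * (⟨ q ⟩ * ⟨ r ⟩)
  join p q r = trans (⟨⟩-× p (q ×-dec r)) (cong (⟨ p ⟩ *_) (⟨⟩-× q r))

⟨⟩³-no : ∀ {P Q R : Set} (p : Dec P) (q : Dec Q) (r : Dec R) → (P → Q → ⊥) → ⟨ p ⟩ * (⟨ q ⟩ * ⟨ r ⟩) ≡ 0ℤ
⟨⟩³-no (yes x) (yes y) r h = ⊥-elim (h x y)
⟨⟩³-no (yes x) (no y) r h = refl
⟨⟩³-no (no x) q r h = refl

cnt : ∀ {N n} → Vec (Fin N) n → Vec ℕ N
cnt [] = 𝟘ᵛ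
cnt (x ∷ c) = inc x (cnt c)

cnt-lookup : ∀ {N n} (c : Vec (Fin N) n) i → pos (lookup (cnt c) i) ≡ ∑[ a ∈ allFin n ] ⟨ lookup c a Finₚ.≟ i ⟩
cnt-lookup [] i = cong pos (Vecₚ.lookup-replicate i 0)
cnt-lookup {n = suc n} (x ∷ c) i = trans (go (x Finₚ.≟ i)) (sym (∑-allFin {n} (λ a → ⟨ lookup (x ∷ c) a Finₚ.≟ i ⟩)))
  where
  go : (d : Dec (x ≡ i)) → pos (lookup (inc x (cnt c)) i) ≡ ⟨ d ⟩ + ∑ (allFin n) (λ a → ⟨ lookup c a Finₚ.≟ i ⟩)
  go (yes refl) = trans (cong pos (lookup-inc x (cnt c))) (cong (1ℤ +_) (cnt-lookup c x))
  go (no p) = trans (cong pos (lookup-inc′ i x (λ e → p (sym e)) (cnt c))) (trans (cnt-lookup c i) (sym (ℤₚ.+-identityˡ _)))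

cnt-update : ∀ {N n} (c : Vec (Fin N) n) a i → inc (lookup c a) (cnt (c [ a ]≔ i)) ≡ inc i (cnt c)
cnt-update (x ∷ c) zero i = inc-comm x i (cnt c)
cnt-update (x ∷ c) (suc a) i = trans (inc-comm (lookup c a) x _) (trans (cong (inc x) (cnt-update c a i)) (inc-comm x i (cnt c)))

-- Recolouring the point a matches the two families of colourings; the rest of the colouring is
-- untouched.
∑-update : ∀ {N n} (a : Fin n) (i j : Fin N) (F : Vec (Fin N) n → ℤ) →
  (∑[ u ∈ cols N n ] ⟨ lookup u a Finₚ.≟ i ⟩ * F u) ≡ ∑[ v ∈ cols N n ] ⟨ lookup v a Finₚ.≟ j ⟩ * F (v [ a ]≔ i)
∑-update {N} {suc n} zero i j F = trans (trans (∑-cons (allFin N) n _) (side i (λ x w → F (x ∷ w))))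
  (sym (trans (∑-cons (allFin N) n _) (side j (λ x w → F (i ∷ w)))))
  where
  side : ∀ k (G : Fin N → Vec (Fin N) n → ℤ) →
    (∑[ x ∈ allFin N ] ∑[ w ∈ cols N n ] ⟨ x Finₚ.≟ k ⟩ * G x w) ≡ ∑[ w ∈ cols N n ] G k w
  side k G = trans
    (∑-cong (allFin N) (λ x → sym (∑-*ˡ (cols N n) ⟨ x Finₚ.≟ k ⟩ (G x))))
    (Enumerates.pick (allFin-enumerates N) {k} tt (λ x → ∑ (cols N n) (G x)))
∑-update {N} {suc n} (suc a) i j F = trans (∑-cons (allFin N) n _)
  (trans (∑-cong (allFin N) (λ x → ∑-update a i j (λ w → F (x ∷ w)))) (sym (∑-cons (allFin N) n _)))

update-∙ : ∀ {N n} {σ : Vec (Fin n) n} → IsPerm σ → (v : Vec (Fin N) n) (a : Fin n) (i : Fin N) →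
  (v [ lookup σ a ]≔ i) ∙ σ ≡ (v ∙ σ) [ a ]≔ i
update-∙ {σ = σ} p v a i = lookup-ext (λ s → trans (lookup-∙ (v [ lookup σ a ]≔ i) σ s) (go s))
  where
  go : ∀ s → lookup (v [ lookup σ a ]≔ i) (lookup σ s) ≡ lookup ((v ∙ σ) [ a ]≔ i) s
  go s with s Finₚ.≟ a
  ... | yes refl = trans (Vecₚ.lookup∘update (lookup σ a) v i) (sym (Vecₚ.lookup∘update a (v ∙ σ) i))
  ... | no q = trans (Vecₚ.lookup∘update′ (λ e → q (IsPerm.injective p s a e)) v i)
    (trans (sym (lookup-∙ v σ s)) (sym (Vecₚ.lookup∘update′ q (v ∙ σ) i)))

lookup-∙-tr : ∀ {A : Set} {n} (c : Vec A n) a b s → lookup (c ∙ tr a b) s ≡ lookup c (swapFin a b s)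
lookup-∙-tr c a b s = trans (lookup-∙ c (tr a b) s) (cong (lookup c) (lookup-tr a b s))

-- Colourings c of colour i at a and j at b with c ∘ σ = c ∘ (a b), counted over a and b.
cut : ∀ {N n} → Vec (Fin n) n → Fin N → Fin N → Vec (Fin N) n → ℤ
cut {N} {n} σ i j c = ∑[ a ∈ allFin n ] ∑[ b ∈ allFin n ]
  ⟨ lookup c a Finₚ.≟ i ⟩ * (⟨ lookup c b Finₚ.≟ j ⟩ * ⟨ (c ∙ σ) ≟ᵛ (c ∙ tr a b) ⟩)

-- The polynomial p_σ of the overview: an invariant colouring chooses for every cycle, of length k
-- say, one term x_i^k of the power sum.
powerSum : ∀ N {n} → Vec (Fin n) n → Poly N
powerSum N {n} σ = map (λ c → ⟨ (c ∙ σ) ≟ᵛ c ⟩ , cnt c) (cols N n)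

-- Half of what the pairs (a, b) coloured by i and j in either order contribute to Σ p_{σ(a b)};
-- `cut-relation` shows that it is the divided difference T i j for p_σ.
cutPoly : ∀ {N n} → Vec (Fin n) n → Fin N → Fin N → Poly N
cutPoly {N} {n} σ i j = map (λ c → cut σ i j c , cnt c) (cols N n)

⟦powerSum⟧ : ∀ {N n} (σ : Vec (Fin n) n) φ → ⟦ powerSum N σ ⟧ φ ≡ ∑[ c ∈ cols N n ] ⟨ (c ∙ σ) ≟ᵛ c ⟩ * φ (cnt c)
⟦powerSum⟧ {N} {n} σ φ = ∑-map (cols N n) _ _

⟦cutPoly⟧ : ∀ {N n} (σ : Vec (Fin n) n) i j φ → ⟦ cutPoly σ i j ⟧ φ ≡ ∑[ c ∈ cols N n ] cut σ i j c * φ (cnt c)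
⟦cutPoly⟧ {N} {n} σ i j φ = ∑-map (cols N n) _ _

∑∑-diagonal : ∀ {n} (X : Fin n → ℤ) → (∑[ a ∈ allFin n ] ∑[ b ∈ allFin n ] ⟨ b Finₚ.≟ a ⟩ * X b) ≡ ∑ (allFin n) X
∑∑-diagonal {n} X = ∑-cong (allFin n) (λ a → Enumerates.pick (allFin-enumerates n) {a} tt X)

module _ {N n : ℕ} {σ : Vec (Fin n) n} (σ-perm : IsPerm σ) {i j : Fin N} (i≢j : i ≢ j) where
  private
    fixed : Vec (Fin N) n → ℤ
    fixed c = ⟨ (c ∙ σ) ≟ᵛ c ⟩

    sum-terms : ∀ (k : Fin N) c (X : Fin n → Fin n → ℤ) →
      (∀ a b → X a b ≡ ⟨ lookup c a Finₚ.≟ i ⟩ * (⟨ lookup c b Finₚ.≟ j ⟩ * ⟨ (c ∙ σ) ≟ᵛ (c ∙ tr a b) ⟩)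
        + ⟨ b Finₚ.≟ a ⟩ * (⟨ lookup c b Finₚ.≟ k ⟩ * fixed c)) →
      (∑[ a ∈ allFin n ] ∑[ b ∈ allFin n ] X a b) ≡ cut σ i j c + pos (lookup (cnt c) k) * fixed c
    sum-terms k c X h = begin
      (∑[ a ∈ allFin n ] ∑[ b ∈ allFin n ] X a b)
        ≡⟨ ∑-cong (allFin n) (λ a → trans (∑-cong (allFin n) (h a)) (∑-+ (allFin n) _ _)) ⟩
      _ ≡⟨ ∑-+ (allFin n) _ _ ⟩
      cut σ i j c + (∑[ a ∈ allFin n ] ∑[ b ∈ allFin n ] ⟨ b Finₚ.≟ a ⟩ * (⟨ lookup c b Finₚ.≟ k ⟩ * fixed c))
        ≡⟨ cong (cut σ i j c +_) (trans (∑∑-diagonal (λ b → ⟨ lookup c b Finₚ.≟ k ⟩ * fixed c))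
             (trans (sym (∑-*ʳ (allFin n) (fixed c) (λ b → ⟨ lookup c b Finₚ.≟ k ⟩))) (cong (_* fixed c) (sym (cnt-lookup c k))))) ⟩
      cut σ i j c + pos (lookup (cnt c) k) * fixed c ∎
      where open ≡-Reasoning

    -- For b = a the two updates restore c; for b ≠ a they exchange the colours at a and b, which is
    -- composition with (a b).
    open-fst : ∀ c a b →
      ⟨ lookup c a Finₚ.≟ i ⟩ * (⟨ lookup (c [ a ]≔ j) b Finₚ.≟ j ⟩ * ⟨ (c ∙ σ) ≟ᵛ (c [ a ]≔ j [ b ]≔ i) ⟩) ≡
      ⟨ lookup c a Finₚ.≟ i ⟩ * (⟨ lookup c b Finₚ.≟ j ⟩ * ⟨ (c ∙ σ) ≟ᵛ (c ∙ tr a b) ⟩)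
        + ⟨ b Finₚ.≟ a ⟩ * (⟨ lookup c b Finₚ.≟ i ⟩ * fixed c)
    open-fst c a b = go (b Finₚ.≟ a)
      where
      restore : lookup c a ≡ i → c [ a ]≔ j [ a ]≔ i ≡ c
      restore e = trans (Vecₚ.[]≔-idempotent c a) (trans (cong (c [ a ]≔_) (sym e)) (Vecₚ.[]≔-lookup c a))
      swapped : b ≢ a → lookup c a ≡ i → lookup c b ≡ j → c [ a ]≔ j [ b ]≔ i ≡ c ∙ tr a b
      swapped q e f = lookup-ext (λ s → trans (at s) (sym (lookup-∙-tr c a b s)))
        where
        at : ∀ s → lookup (c [ a ]≔ j [ b ]≔ i) s ≡ lookup c (swapFin a b s)
        at = swapCases a b _
          (trans (Vecₚ.lookup∘update′ (λ z → q (sym z)) (c [ a ]≔ j) i) (trans (Vecₚ.lookup∘update a c j)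
            (trans (sym f) (cong (lookup c) (sym (swapFin-fst a b))))))
          (trans (Vecₚ.lookup∘update b (c [ a ]≔ j) i) (trans (sym e) (cong (lookup c) (sym (swapFin-snd a b)))))
          (λ s p r → trans (Vecₚ.lookup∘update′ r (c [ a ]≔ j) i) (trans (Vecₚ.lookup∘update′ p c j)
            (cong (lookup c) (sym (swapFin-other p r)))))
      go : (d : Dec (b ≡ a)) →
        ⟨ lookup c a Finₚ.≟ i ⟩ * (⟨ lookup (c [ a ]≔ j) b Finₚ.≟ j ⟩ * ⟨ (c ∙ σ) ≟ᵛ (c [ a ]≔ j [ b ]≔ i) ⟩) ≡
        ⟨ lookup c a Finₚ.≟ i ⟩ * (⟨ lookup c b Finₚ.≟ j ⟩ * ⟨ (c ∙ σ) ≟ᵛ (c ∙ tr a b) ⟩)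
          + ⟨ d ⟩ * (⟨ lookup c b Finₚ.≟ i ⟩ * fixed c)
      go (yes refl) = trans
        (⟨⟩³ (lookup c a Finₚ.≟ i) (lookup (c [ a ]≔ j) a Finₚ.≟ j) ((c ∙ σ) ≟ᵛ (c [ a ]≔ j [ a ]≔ i))
             (yes tt) (lookup c a Finₚ.≟ i) ((c ∙ σ) ≟ᵛ c)
          (λ e _ r → tt , e , trans r (restore e))
          (λ _ e r → e , Vecₚ.lookup∘update a c j , trans r (sym (restore e))))
        (sym (trans (cong (_+ 1ℤ * (⟨ lookup c a Finₚ.≟ i ⟩ * fixed c))
          (⟨⟩³-no (lookup c a Finₚ.≟ i) (lookup c a Finₚ.≟ j) ((c ∙ σ) ≟ᵛ (c ∙ tr a a)) (λ e f → i≢j (trans (sym e) f))))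
          (ℤₚ.+-identityˡ _)))
      go (no q) = trans
        (⟨⟩³ (lookup c a Finₚ.≟ i) (lookup (c [ a ]≔ j) b Finₚ.≟ j) ((c ∙ σ) ≟ᵛ (c [ a ]≔ j [ b ]≔ i))
             (lookup c a Finₚ.≟ i) (lookup c b Finₚ.≟ j) ((c ∙ σ) ≟ᵛ (c ∙ tr a b))
          (λ e f r → let f′ = trans (sym (Vecₚ.lookup∘update′ q c j)) f in e , f′ , trans r (swapped q e f′))
          (λ e f r → e , trans (Vecₚ.lookup∘update′ q c j) f , trans r (sym (swapped q e f))))
        (sym (ℤₚ.+-identityʳ _))

    -- Recolouring at σ(a) before composing with σ is recolouring at a afterwards. So c ∘ σ and c
    -- agree up to the points a and b, where the conditions on colours force an exchange, or
    -- equality if b = a.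
    open-snd : ∀ c a b →
      ⟨ lookup c (lookup σ a) Finₚ.≟ j ⟩ * (⟨ lookup c b Finₚ.≟ j ⟩ * ⟨ ((c [ lookup σ a ]≔ i) ∙ σ) ≟ᵛ (c [ b ]≔ i) ⟩) ≡
      ⟨ lookup c a Finₚ.≟ i ⟩ * (⟨ lookup c b Finₚ.≟ j ⟩ * ⟨ (c ∙ σ) ≟ᵛ (c ∙ tr a b) ⟩)
        + ⟨ b Finₚ.≟ a ⟩ * (⟨ lookup c b Finₚ.≟ j ⟩ * fixed c)
    open-snd c a b = go (b Finₚ.≟ a)
      where
      go : (d : Dec (b ≡ a)) →
        ⟨ lookup c (lookup σ a) Finₚ.≟ j ⟩ * (⟨ lookup c b Finₚ.≟ j ⟩ * ⟨ ((c [ lookup σ a ]≔ i) ∙ σ) ≟ᵛ (c [ b ]≔ i) ⟩) ≡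
        ⟨ lookup c a Finₚ.≟ i ⟩ * (⟨ lookup c b Finₚ.≟ j ⟩ * ⟨ (c ∙ σ) ≟ᵛ (c ∙ tr a b) ⟩)
          + ⟨ d ⟩ * (⟨ lookup c b Finₚ.≟ j ⟩ * fixed c)
      go (yes refl) = trans
        (⟨⟩³ (lookup c (lookup σ a) Finₚ.≟ j) (lookup c a Finₚ.≟ j) (((c [ lookup σ a ]≔ i) ∙ σ) ≟ᵛ (c [ a ]≔ i))
             (yes tt) (lookup c a Finₚ.≟ j) ((c ∙ σ) ≟ᵛ c)
          (λ e f r → tt , f , lookup-ext (fwd e f (trans (sym (update-∙ σ-perm c a i)) r)))
          (λ _ f r → trans (sym (lookup-∙ c σ a)) (trans (cong (λ v → lookup v a) r) f) , f ,
            trans (update-∙ σ-perm c a i) (cong (_[ a ]≔ i) r)))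
        (sym (trans (cong (_+ 1ℤ * (⟨ lookup c a Finₚ.≟ j ⟩ * fixed c))
          (⟨⟩³-no (lookup c a Finₚ.≟ i) (lookup c a Finₚ.≟ j) ((c ∙ σ) ≟ᵛ (c ∙ tr a a)) (λ e f → i≢j (trans (sym e) f))))
          (ℤₚ.+-identityˡ _)))
        where
        fwd : lookup c (lookup σ a) ≡ j → lookup c a ≡ j → (c ∙ σ) [ a ]≔ i ≡ c [ a ]≔ i → ∀ s → lookup (c ∙ σ) s ≡ lookup c s
        fwd e f r s with s Finₚ.≟ a
        ... | yes refl = trans (lookup-∙ c σ s) (trans e (sym f))
        ... | no q = trans (sym (Vecₚ.lookup∘update′ q (c ∙ σ) i)) (trans (cong (λ v → lookup v s) r) (Vecₚ.lookup∘update′ q c i))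
      go (no q) = trans
        (⟨⟩³ (lookup c (lookup σ a) Finₚ.≟ j) (lookup c b Finₚ.≟ j) (((c [ lookup σ a ]≔ i) ∙ σ) ≟ᵛ (c [ b ]≔ i))
             (lookup c a Finₚ.≟ i) (lookup c b Finₚ.≟ j) ((c ∙ σ) ≟ᵛ (c ∙ tr a b))
          (λ e f r → fwd e f (trans (sym (update-∙ σ-perm c a i)) r))
          (λ e f r → bwd e f (λ s → trans (cong (λ v → lookup v s) r) (lookup-∙-tr c a b s))))
        (sym (ℤₚ.+-identityʳ _))
        where
        q′ : a ≢ b
        q′ e = q (sym e)
        fwd : lookup c (lookup σ a) ≡ j → lookup c b ≡ j → (c ∙ σ) [ a ]≔ i ≡ c [ b ]≔ i →
          (lookup c a ≡ i) × (lookup c b ≡ j) × (c ∙ σ ≡ c ∙ tr a b)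
        fwd e f r = ca , f , lookup-ext (λ s → trans (at s) (sym (lookup-∙-tr c a b s)))
          where
          r-at : ∀ s → lookup ((c ∙ σ) [ a ]≔ i) s ≡ lookup (c [ b ]≔ i) s
          r-at s = cong (λ v → lookup v s) r
          ca : lookup c a ≡ i
          ca = trans (sym (Vecₚ.lookup∘update′ q′ c i)) (trans (sym (r-at a)) (Vecₚ.lookup∘update a (c ∙ σ) i))
          at : ∀ s → lookup (c ∙ σ) s ≡ lookup c (swapFin a b s)
          at = swapCases a b _
            (trans (lookup-∙ c σ a) (trans e (trans (sym f) (cong (lookup c) (sym (swapFin-fst a b))))))
            (trans (sym (Vecₚ.lookup∘update′ q (c ∙ σ) i)) (trans (r-at b) (trans (Vecₚ.lookup∘update b c i)
              (trans (sym ca) (cong (lookup c) (sym (swapFin-snd a b)))))))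
            (λ s u v → trans (sym (Vecₚ.lookup∘update′ u (c ∙ σ) i)) (trans (r-at s) (trans (Vecₚ.lookup∘update′ v c i)
              (cong (lookup c) (sym (swapFin-other u v))))))
        bwd : lookup c a ≡ i → lookup c b ≡ j → (∀ s → lookup (c ∙ σ) s ≡ lookup c (swapFin a b s)) →
          (lookup c (lookup σ a) ≡ j) × (lookup c b ≡ j) × ((c [ lookup σ a ]≔ i) ∙ σ ≡ c [ b ]≔ i)
        bwd e f r = trans (sym (lookup-∙ c σ a)) (trans (r a) (trans (cong (lookup c) (swapFin-fst a b)) f)) , f ,
          trans (update-∙ σ-perm c a i) (lookup-ext at)
          where
          at : ∀ s → lookup ((c ∙ σ) [ a ]≔ i) s ≡ lookup (c [ b ]≔ i) s
          at = swapCases a b _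
            (trans (Vecₚ.lookup∘update a (c ∙ σ) i) (trans (sym e) (sym (Vecₚ.lookup∘update′ q′ c i))))
            (trans (Vecₚ.lookup∘update′ q (c ∙ σ) i) (trans (r b) (trans (cong (lookup c) (swapFin-snd a b))
              (trans e (sym (Vecₚ.lookup∘update b c i))))))
            (λ s u v → trans (Vecₚ.lookup∘update′ u (c ∙ σ) i) (trans (r s) (trans (cong (lookup c) (swapFin-other u v))
              (sym (Vecₚ.lookup∘update′ v c i)))))

    merged : ∀ (k : Fin N) (ψ : Vec ℕ N → ℤ) (X : Vec (Fin N) n → ℤ) →
      (∀ c → X c ≡ cut σ i j c + pos (lookup (cnt c) k) * fixed c) →
      ⟦ cutPoly σ i j ⟧ ψ + ⟦ powerSum N σ ⟧ (λ β → pos (lookup β k) * ψ β) ≡ ∑[ c ∈ cols N n ] X c * ψ (cnt c)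
    merged k ψ X h = trans (cong₂ _+_ (⟦cutPoly⟧ σ i j ψ) (⟦powerSum⟧ σ _)) (trans (sym (∑-+ (cols N n) _ _))
      (∑-cong (cols N n) (λ c → trans (collect (cut σ i j c) (ψ (cnt c)) (fixed c) (pos (lookup (cnt c) k))) (cong (_* ψ (cnt c)) (sym (h c))))))
      where
      collect : ∀ t x f m → t * x + f * (m * x) ≡ (t + m * f) * x
      collect = ℤ-Solver.solve-∀

  -- Both sides count triples (v , a , b) with v(a) = v(b) = j such that
  -- recolouring a on the left and b on the right by i makes v invariant under σ.
  cut-relation : ∀ φ →
    ⟦ cutPoly σ i j ⟧ (λ β → φ (inc j β)) + ⟦ powerSum N σ ⟧ (λ β → pos (lookup β i) * φ (inc j β)) ≡
    ⟦ cutPoly σ i j ⟧ (λ β → φ (inc i β)) + ⟦ powerSum N σ ⟧ (λ β → pos (lookup β j) * φ (inc i β))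
  cut-relation φ = begin
    ⟦ cutPoly σ i j ⟧ (λ β → φ (inc j β)) + ⟦ powerSum N σ ⟧ (λ β → pos (lookup β i) * φ (inc j β))
      ≡⟨ merged i (λ β → φ (inc j β)) (λ u → ∑[ a ∈ allFin n ] ∑[ b ∈ allFin n ] X₁ u a b) (λ c → sum-terms i c (X₁ c) (open-fst c)) ⟩
    (∑[ u ∈ cols N n ] (∑[ a ∈ allFin n ] ∑[ b ∈ allFin n ] X₁ u a b) * φ (inc j (cnt u)))
      ≡⟨ ∑-cong (cols N n) (λ u → ∑-*ʳ (allFin n) _ _) ⟩
    (∑[ u ∈ cols N n ] ∑[ a ∈ allFin n ] (∑[ b ∈ allFin n ] X₁ u a b) * φ (inc j (cnt u)))
      ≡⟨ ∑-swap (cols N n) (allFin n) _ ⟩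
    (∑[ a ∈ allFin n ] ∑[ u ∈ cols N n ] (∑[ b ∈ allFin n ] X₁ u a b) * φ (inc j (cnt u)))
      ≡⟨ ∑-cong (allFin n) (λ a → trans (∑-cong (cols N n) (λ u → pull ⟨ lookup u a Finₚ.≟ i ⟩ (λ b → Y₁ u a b) (φ (inc j (cnt u)))))
           (∑-update a i j _)) ⟩
    (∑[ a ∈ allFin n ] ∑[ v ∈ cols N n ] ⟨ lookup v a Finₚ.≟ j ⟩ * ((∑[ b ∈ allFin n ] Y₁ (v [ a ]≔ i) a b) * φ (inc j (cnt (v [ a ]≔ i)))))
      ≡⟨ ∑-cong (allFin n) (λ a → ∑-cong (cols N n) (λ v → ⟨⟩-*-cong (lookup v a Finₚ.≟ j) (λ e → cong₂ _*_
           (∑-cong (allFin n) (λ b → cong (λ w → ⟨ lookup w b Finₚ.≟ j ⟩ * ⟨ ((v [ a ]≔ i) ∙ σ) ≟ᵛ (w [ b ]≔ i) ⟩)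
             (trans (Vecₚ.[]≔-idempotent v a) (trans (cong (v [ a ]≔_) (sym e)) (Vecₚ.[]≔-lookup v a)))))
           (cong φ (trans (cong (λ k → inc k (cnt (v [ a ]≔ i))) (sym e)) (cnt-update v a i)))))) ⟩
    (∑[ a ∈ allFin n ] ∑[ v ∈ cols N n ] ⟨ lookup v a Finₚ.≟ j ⟩ * ((∑[ b ∈ allFin n ] Y₂ v a b) * φ (inc i (cnt v))))
      ≡⟨ ∑-cong (allFin n) (λ a → ∑-cong (cols N n) (λ v → sym (pull ⟨ lookup v a Finₚ.≟ j ⟩ (Y₂ v a) (φ (inc i (cnt v)))))) ⟩
    (∑[ a ∈ allFin n ] ∑[ v ∈ cols N n ] (∑[ b ∈ allFin n ] X₂ v a b) * φ (inc i (cnt v)))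
      ≡⟨ ∑-swap (allFin n) (cols N n) _ ⟩
    (∑[ v ∈ cols N n ] ∑[ a ∈ allFin n ] (∑[ b ∈ allFin n ] X₂ v a b) * φ (inc i (cnt v)))
      -- The summation index a is replaced by σ(a), which brings the terms to the form of
      -- `open-snd`.
      ≡⟨ ∑-cong (cols N n) (λ v → sym (reindex (allFin-enumerates n) (allFin-enumerates n) (lookup σ) (λ _ → tt)
           (λ _ _ → IsPerm.injective σ-perm _ _) (λ {y} _ → let (x , e) = perm-surjective σ-perm y in x , tt , e) _)) ⟩
    (∑[ v ∈ cols N n ] ∑[ a ∈ allFin n ] (∑[ b ∈ allFin n ] X₂ v (lookup σ a) b) * φ (inc i (cnt v)))
      ≡⟨ ∑-cong (cols N n) (λ v → sym (∑-*ʳ (allFin n) _ _)) ⟩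
    (∑[ v ∈ cols N n ] (∑[ a ∈ allFin n ] ∑[ b ∈ allFin n ] X₂ v (lookup σ a) b) * φ (inc i (cnt v)))
      ≡⟨ merged j (λ β → φ (inc i β)) (λ v → ∑[ a ∈ allFin n ] ∑[ b ∈ allFin n ] X₂ v (lookup σ a) b) (λ c → sum-terms j c (λ a → X₂ c (lookup σ a)) (open-snd c)) ⟨
    ⟦ cutPoly σ i j ⟧ (λ β → φ (inc i β)) + ⟦ powerSum N σ ⟧ (λ β → pos (lookup β j) * φ (inc i β)) ∎
    where
    open ≡-Reasoning
    Y₁ Y₂ X₁ X₂ : Vec (Fin N) n → Fin n → Fin n → ℤ
    Y₁ u a b = ⟨ lookup (u [ a ]≔ j) b Finₚ.≟ j ⟩ * ⟨ (u ∙ σ) ≟ᵛ (u [ a ]≔ j [ b ]≔ i) ⟩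
    X₁ u a b = ⟨ lookup u a Finₚ.≟ i ⟩ * Y₁ u a b
    Y₂ v a b = ⟨ lookup v b Finₚ.≟ j ⟩ * ⟨ ((v [ a ]≔ i) ∙ σ) ≟ᵛ (v [ b ]≔ i) ⟩
    X₂ v a b = ⟨ lookup v a Finₚ.≟ j ⟩ * Y₂ v a b
    pull : ∀ x (Y : Fin n → ℤ) z → (∑[ b ∈ allFin n ] x * Y b) * z ≡ x * ((∑[ b ∈ allFin n ] Y b) * z)
    pull x Y z = trans (cong (_* z) (sym (∑-*ˡ (allFin n) x Y))) (ℤₚ.*-assoc x _ z)

toList-tabulate : ∀ {A : Set} {n} (f : Fin n → A) → Vec.toList (tabulate f) ≡ List.tabulate f
toList-tabulate {n = zero} f = refl
toList-tabulate {n = suc n} f = cong (f zero ∷_) (toList-tabulate (λ i → f (suc i)))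

pairs-distinct : ∀ {A : Set} (xs : List A) → Unique xs → ∀ {x y} → (x , y) ∈ pairs xs → x ≢ y
pairs-distinct (x ∷ xs) (px ∷ u) e with ∈ₚ.∈-++⁻ (map (x ,_) xs) e
... | inj₂ e′ = pairs-distinct xs u e′
... | inj₁ e′ with ∈ₚ.∈-map⁻ (x ,_) e′
... | y , y∈ , refl = All.lookup px y∈

-- The product a·p_σ as a function of σ for fixed φ: operators acting on σ can be exchanged for
-- operators acting on φ.
powerSumᵛ : ∀ {N n} → (Vec ℕ N → ℤ) → Vec (Fin n) n → ℤ
powerSumᵛ {N} φ σ = ⟦ vand N ⟧ (λ α → ⟦ powerSum N σ ⟧ (λ β → φ (α ⊞ β)))

-- A colouring c is invariant under σ (a b) when c ∘ σ = c ∘ (a b). Pairs are sorted by the colours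
-- of a and b: with equal colours (a b) does not change c, and counting such pairs gives q₂;
-- different colours give the cut terms, twice by symmetry.
transpositions-powerSum : ∀ {N n} (σ : Vec (Fin n) n) φ →
  (∑[ a ∈ allFin n ] ∑[ b ∈ allFin n ] ⟦ powerSum N (σ ∙ tr a b) ⟧ φ) ≡
  ⟦ powerSum N σ ⟧ (λ β → q₂ β * φ β) + ∑ (pairs (allFin N)) (λ (i , j) → ⟦ cutPoly σ i j ⟧ φ + ⟦ cutPoly σ i j ⟧ φ)
transpositions-powerSum {N} {n} σ φ = begin
  (∑[ a ∈ allFin n ] ∑[ b ∈ allFin n ] ⟦ powerSum N (σ ∙ tr a b) ⟧ φ)
    ≡⟨ ∑-cong (allFin n) (λ a → trans (∑-cong (allFin n) (λ b → trans (⟦powerSum⟧ (σ ∙ tr a b) φ)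
         (∑-cong (cols N n) (λ c → cong (_* φ (cnt c)) (turn c a b))))) (∑-swap (allFin n) (cols N n) _)) ⟩
  (∑[ a ∈ allFin n ] ∑[ c ∈ cols N n ] ∑[ b ∈ allFin n ] W c a b * φ (cnt c))
    ≡⟨ trans (∑-swap (allFin n) (cols N n) _) (∑-cong (cols N n) (λ c → trans
         (∑-cong (allFin n) (λ a → sym (∑-*ʳ (allFin n) (φ (cnt c)) (W c a)))) (sym (∑-*ʳ (allFin n) (φ (cnt c)) _)))) ⟩
  (∑[ c ∈ cols N n ] (∑[ a ∈ allFin n ] ∑[ b ∈ allFin n ] W c a b) * φ (cnt c))
    ≡⟨ ∑-cong (cols N n) (λ c → trans (cong (_* φ (cnt c)) (colours c)) (ℤₚ.*-distribʳ-+ (φ (cnt c)) (q₂ (cnt c) * fixed c) _)) ⟩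
  (∑[ c ∈ cols N n ] (q₂ (cnt c) * fixed c * φ (cnt c) + ∑ (pairs (allFin N)) (λ (i , j) → cut σ i j c + cut σ i j c) * φ (cnt c)))
    ≡⟨ ∑-+ (cols N n) _ _ ⟩
  _ ≡⟨ cong₂ _+_
         (trans (∑-cong (cols N n) (λ c → swap (q₂ (cnt c)) (fixed c) (φ (cnt c)))) (sym (⟦powerSum⟧ σ _)))
         (trans (∑-cong (cols N n) (λ c → ∑-*ʳ (pairs (allFin N)) (φ (cnt c)) _))
           (trans (∑-swap (cols N n) (pairs (allFin N)) _) (∑-cong (pairs (allFin N)) (λ (i , j) →
             trans (∑-cong (cols N n) (λ c → ℤₚ.*-distribʳ-+ (φ (cnt c)) (cut σ i j c) (cut σ i j c)))
               (trans (∑-+ (cols N n) _ _) (sym (cong₂ _+_ (⟦cutPoly⟧ σ i j φ) (⟦cutPoly⟧ σ i j φ)))))))) ⟩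
  ⟦ powerSum N σ ⟧ (λ β → q₂ β * φ β) + ∑ (pairs (allFin N)) (λ (i , j) → ⟦ cutPoly σ i j ⟧ φ + ⟦ cutPoly σ i j ⟧ φ) ∎
  where
  open ≡-Reasoning
  fixed : Vec (Fin N) n → ℤ
  fixed c = ⟨ (c ∙ σ) ≟ᵛ c ⟩
  W : Vec (Fin N) n → Fin n → Fin n → ℤ
  W c a b = ⟨ (c ∙ σ) ≟ᵛ (c ∙ tr a b) ⟩
  swap : ∀ x y z → (x * y) * z ≡ y * (x * z)
  swap = ℤ-Solver.solve-∀
  turn : ∀ c a b → ⟨ (c ∙ (σ ∙ tr a b)) ≟ᵛ c ⟩ ≡ W c a b
  turn c a b = ⟨⟩-cong _ _
    (λ e → trans (sym (cancelʳ (c ∙ σ) (tr-involutive a b))) (cong (_∙ tr a b) (trans (∙-assoc c σ (tr a b)) e)))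
    (λ e → trans (sym (∙-assoc c σ (tr a b))) (trans (cong (_∙ tr a b) e) (cancelʳ c (tr-involutive a b))))
  colours : ∀ c → (∑[ a ∈ allFin n ] ∑[ b ∈ allFin n ] W c a b) ≡
    q₂ (cnt c) * fixed c + ∑ (pairs (allFin N)) (λ (i , j) → cut σ i j c + cut σ i j c)
  colours c = begin
    (∑[ a ∈ allFin n ] ∑[ b ∈ allFin n ] W c a b)
      ≡⟨ ∑-cong (allFin n) (λ a → ∑-cong (allFin n) (λ b → sym (trans
           (∑-cong (allFin N) (λ i → trans (sym (∑-*ˡ (allFin N) ⟨ lookup c a Finₚ.≟ i ⟩ _))
             (cong (⟨ lookup c a Finₚ.≟ i ⟩ *_) (∑-pick (lookup c b) (W c a b)))))
           (∑-pick (lookup c a) (W c a b))))) ⟩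
    (∑[ a ∈ allFin n ] ∑[ b ∈ allFin n ] ∑[ i ∈ allFin N ] ∑[ j ∈ allFin N ] V i j a b)
      ≡⟨ trans (∑-cong (allFin n) (λ a → trans (∑-swap (allFin n) (allFin N) _)
           (∑-cong (allFin N) (λ i → ∑-swap (allFin n) (allFin N) _))))
           (trans (∑-swap (allFin n) (allFin N) _) (∑-cong (allFin N) (λ i → ∑-swap (allFin n) (allFin N) _))) ⟩
    (∑[ i ∈ allFin N ] ∑[ j ∈ allFin N ] cut σ i j c)
      ≡⟨ ∑-pairs (allFin N) (λ i j → cut σ i j c) ⟩
    (∑[ i ∈ allFin N ] cut σ i i c) + ∑ (pairs (allFin N)) (λ (i , j) → cut σ i j c + cut σ j i c)
      ≡⟨ cong₂ _+_ (trans (∑-cong (allFin N) diagonal) (trans (sym (∑-*ʳ (allFin N) (fixed c) _)) (cong (_* fixed c) (q₂-∑ (cnt c)))))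
           (∑-cong (pairs (allFin N)) (λ (i , j) → cong (cut σ i j c +_) (symmetric i j))) ⟩
    q₂ (cnt c) * fixed c + ∑ (pairs (allFin N)) (λ (i , j) → cut σ i j c + cut σ i j c) ∎
    where
    V : Fin N → Fin N → Fin n → Fin n → ℤ
    V i j a b = ⟨ lookup c a Finₚ.≟ i ⟩ * (⟨ lookup c b Finₚ.≟ j ⟩ * W c a b)
    symmetric : ∀ i j → cut σ j i c ≡ cut σ i j c
    symmetric i j = trans (∑-swap (allFin n) (allFin n) _) (∑-cong (allFin n) (λ a → ∑-cong (allFin n) (λ b →
      trans (comm3 ⟨ lookup c b Finₚ.≟ j ⟩ ⟨ lookup c a Finₚ.≟ i ⟩ _)
        (cong (λ t → ⟨ lookup c a Finₚ.≟ i ⟩ * (⟨ lookup c b Finₚ.≟ j ⟩ * ⟨ (c ∙ σ) ≟ᵛ (c ∙ t) ⟩)) (tr-comm b a)))))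
      where
      comm3 : ∀ x y z → x * (y * z) ≡ y * (x * z)
      comm3 = ℤ-Solver.solve-∀
    diagonal : ∀ i → cut σ i i c ≡ pos (lookup (cnt c) i) * pos (lookup (cnt c) i) * fixed c
    diagonal i = begin
      (∑[ a ∈ allFin n ] ∑[ b ∈ allFin n ] ⟨ lookup c a Finₚ.≟ i ⟩ * (⟨ lookup c b Finₚ.≟ i ⟩ * W c a b))
        ≡⟨ ∑-cong (allFin n) (λ a → ∑-cong (allFin n) (λ b → ⟨⟩-*-cong (lookup c a Finₚ.≟ i) (λ e → ⟨⟩-*-cong (lookup c b Finₚ.≟ i) (λ f →
             cong (λ v → ⟨ (c ∙ σ) ≟ᵛ v ⟩) (lookup-ext (λ s → trans (lookup-∙-tr c a b s) (same e f s))))))) ⟩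
      (∑[ a ∈ allFin n ] ∑[ b ∈ allFin n ] ⟨ lookup c a Finₚ.≟ i ⟩ * (⟨ lookup c b Finₚ.≟ i ⟩ * fixed c))
        ≡⟨ ∑-cong (allFin n) (λ a → trans (sym (∑-*ˡ (allFin n) ⟨ lookup c a Finₚ.≟ i ⟩ _))
             (cong (⟨ lookup c a Finₚ.≟ i ⟩ *_) (trans (sym (∑-*ʳ (allFin n) (fixed c) _)) (cong (_* fixed c) (sym (cnt-lookup c i)))))) ⟩
      (∑[ a ∈ allFin n ] ⟨ lookup c a Finₚ.≟ i ⟩ * (pos (lookup (cnt c) i) * fixed c))
        ≡⟨ trans (sym (∑-*ʳ (allFin n) _ _)) (cong (_* (pos (lookup (cnt c) i) * fixed c)) (sym (cnt-lookup c i))) ⟩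
      pos (lookup (cnt c) i) * (pos (lookup (cnt c) i) * fixed c)
        ≡⟨ ℤₚ.*-assoc (pos (lookup (cnt c) i)) (pos (lookup (cnt c) i)) (fixed c) ⟨
      pos (lookup (cnt c) i) * pos (lookup (cnt c) i) * fixed c ∎
      where
      same : ∀ {a b} → lookup c a ≡ i → lookup c b ≡ i → ∀ s → lookup c (swapFin a b s) ≡ lookup c s
      same {a} {b} e f = swapCases a b _
        (trans (cong (lookup c) (swapFin-fst a b)) (trans f (sym e)))
        (trans (cong (lookup c) (swapFin-snd a b)) (trans e (sym f)))
        (λ s p q → cong (lookup c) (swapFin-other p q))

-- The sum is over ordered pairs with the diagonal, that is n plus twice the sum of the
-- transpositions, which keeps halves out of the eigenvalue.
transpositions-eigen : ∀ {N n} {σ : Vec (Fin n) n} → IsPerm σ → ∀ φ →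
  (∑[ a ∈ allFin n ] ∑[ b ∈ allFin n ] powerSumᵛ φ (σ ∙ tr a b)) ≡ powerSumᵛ (λ γ → casimir N γ * φ γ) σ
transpositions-eigen {N} {n} {σ} p φ = begin
  (∑[ a ∈ allFin n ] ∑[ b ∈ allFin n ] powerSumᵛ φ (σ ∙ tr a b))
    ≡⟨ trans (⟦⟧-∑ (vand N) (allFin n) _) (∑-cong (allFin n) (λ a → ⟦⟧-∑ (vand N) (allFin n) _)) ⟨
  ⟦ vand N ⟧ (λ α → ∑[ a ∈ allFin n ] ∑[ b ∈ allFin n ] ⟦ powerSum N (σ ∙ tr a b) ⟧ (λ β → φ (α ⊞ β)))
    ≡⟨ ⟦⟧-cong (vand N) (λ α → transpositions-powerSum σ (λ β → φ (α ⊞ β))) ⟩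
  ⟦ vand N ⟧ (λ α → ⟦ powerSum N σ ⟧ (λ β → q₂ β * φ (α ⊞ β)) +
    ∑ (pairs (allFin N)) (λ (i , j) → ⟦ cutPoly σ i j ⟧ (λ β → φ (α ⊞ β)) + ⟦ cutPoly σ i j ⟧ (λ β → φ (α ⊞ β))))
    ≡⟨ ⟦⟧-cong (vand N) (λ α → cong (λ l → ⟦ powerSum N σ ⟧ (λ β → q₂ β * φ (α ⊞ β)) +
         ∑ (pairs l) (λ (i , j) → ⟦ cutPoly σ i j ⟧ (λ β → φ (α ⊞ β)) + ⟦ cutPoly σ i j ⟧ (λ β → φ (α ⊞ β)))) (sym list)) ⟩
  _ ≡⟨ vand-casimir (powerSum N σ) (cutPoly σ) (λ i j → cut-relation p)
         (λ {i} {j} e → pairs-distinct (Vec.toList (Vec.allFin N)) (subst Unique (sym list) (allFin⁺ N)) e)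
         (λ f → cong (λ l → ∑ l f) list) φ ⟨
  powerSumᵛ (λ γ → casimir N γ * φ γ) σ ∎
  where
  open ≡-Reasoning
  list : Vec.toList (Vec.allFin N) ≡ allFin N
  list = toList-tabulate id

-- Jucys–Murphy elements

module _ (N : ℕ) where

  -- Functions on the symmetric group are acted on by right multiplication:
  -- jucysMurphy is N plus the Jucys–Murphy element of the point 0.
  jucysMurphy : ∀ {n} → (Vec (Fin (suc n)) (suc n) → ℤ) → Vec (Fin (suc n)) (suc n) → ℤ
  jucysMurphy {n} P σ = pos N * P σ + (∑[ s ∈ allFin n ] P (σ ∙ tr zero (suc s)))

  jmPower : ∀ {n} → ℕ → (Vec (Fin (suc n)) (suc n) → ℤ) → Vec (Fin (suc n)) (suc n) → ℤ
  jmPower zero P = P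
  jmPower (suc k) P = jmPower k (jucysMurphy P)

  jm-cong : ∀ {n} {P Q : Vec (Fin (suc n)) (suc n) → ℤ} → (∀ {σ} → IsPerm σ → P σ ≡ Q σ) →
    ∀ {σ} → IsPerm σ → jucysMurphy P σ ≡ jucysMurphy Q σ
  jm-cong {n} h p = cong₂ _+_ (cong (pos N *_) (h p)) (∑-cong (allFin n) (λ s → h (∙-perm p (tr-perm zero (suc s)))))

  jmPower-cong : ∀ {n} k {P Q : Vec (Fin (suc n)) (suc n) → ℤ} → (∀ {σ} → IsPerm σ → P σ ≡ Q σ) →
    ∀ {σ} → IsPerm σ → jmPower k P σ ≡ jmPower k Q σ
  jmPower-cong zero h p = h p
  jmPower-cong (suc k) h p = jmPower-cong k (jm-cong h) p

  jmPower-suc : ∀ {n} k (P : Vec (Fin (suc n)) (suc n) → ℤ) → ∀ {σ} → IsPerm σ → jmPower (suc k) P σ ≡ jucysMurphy (jmPower k P) σ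
  jmPower-suc zero P p = refl
  jmPower-suc (suc k) P p = jmPower-suc k (jucysMurphy P) p

  jm-linear : ∀ {n} a b (P Q : Vec (Fin (suc n)) (suc n) → ℤ) σ →
    jucysMurphy (λ ρ → a * P ρ + b * Q ρ) σ ≡ a * jucysMurphy P σ + b * jucysMurphy Q σ
  jm-linear {n} a b P Q σ = trans
    (cong (pos N * (a * P σ + b * Q σ) +_) (trans (∑-+ (allFin n) _ _) (sym (cong₂ _+_ (∑-*ˡ (allFin n) a _) (∑-*ˡ (allFin n) b _)))))
    (arrange (pos N) a (P σ) b (Q σ) _ _)
    where
    arrange : ∀ N a p b q x y → N * (a * p + b * q) + (a * x + b * y) ≡ a * (N * p + x) + b * (N * q + y)
    arrange = ℤ-Solver.solve-∀

  jmPower-linear : ∀ {n} k a b (P Q : Vec (Fin (suc n)) (suc n) → ℤ) {σ} → IsPerm σ →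
    jmPower k (λ ρ → a * P ρ + b * Q ρ) σ ≡ a * jmPower k P σ + b * jmPower k Q σ
  jmPower-linear zero a b P Q p = refl
  jmPower-linear (suc k) a b P Q p = trans (jmPower-cong k (λ {ρ} _ → jm-linear a b P Q ρ) p)
    (jmPower-linear k a b (jucysMurphy P) (jucysMurphy Q) p)

  -- The transposition sum of the subgroup S(n) fixing 0, acting inside S(n+1).
  K° : ∀ {n} → (Vec (Fin (suc n)) (suc n) → ℤ) → Vec (Fin (suc n)) (suc n) → ℤ
  K° {n} P σ = ∑[ a ∈ allFin n ] ∑[ b ∈ allFin n ] P (σ ∙ tr (suc a) (suc b))

  ∑-swapFin : ∀ {n} a b (f : Fin n → ℤ) → (∑[ s ∈ allFin n ] f (swapFin a b s)) ≡ ∑ (allFin n) f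
  ∑-swapFin {n} a b f = reindex (allFin-enumerates n) (allFin-enumerates n) (swapFin a b) (λ _ → tt)
    (λ {x} {y} _ _ e → trans (sym (swapFin-involutive a b x)) (trans (cong (swapFin a b) e) (swapFin-involutive a b y)))
    (λ {y} _ → swapFin a b y , tt , swapFin-involutive a b y) f

  -- Conjugation by (a b) with a, b ≠ 0 fixes 0 and permutes the other points s, hence permutes the
  -- terms (0 s).
  jm-K° : ∀ {n} (P : Vec (Fin (suc n)) (suc n) → ℤ) σ → jucysMurphy (K° P) σ ≡ K° (jucysMurphy P) σ
  jm-K° {n} P σ = sym (begin
    (∑[ a ∈ allFin n ] ∑[ b ∈ allFin n ] (pos N * P (σ ∙ g a b) + (∑[ s ∈ allFin n ] P (σ ∙ g a b ∙ t s))))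
      ≡⟨ ∑-cong (allFin n) (λ a → ∑-+ (allFin n) _ _) ⟩
    (∑[ a ∈ allFin n ] ((∑[ b ∈ allFin n ] pos N * P (σ ∙ g a b)) + (∑[ b ∈ allFin n ] ∑[ s ∈ allFin n ] P (σ ∙ g a b ∙ t s))))
      ≡⟨ ∑-+ (allFin n) _ _ ⟩
    _ ≡⟨ cong₂ _+_
           (trans (∑-cong (allFin n) (λ a → sym (∑-*ˡ (allFin n) (pos N) _))) (sym (∑-*ˡ (allFin n) (pos N) _)))
           (trans (∑-cong (allFin n) (λ a → trans (∑-cong (allFin n) (λ b → commute a b)) (∑-swap (allFin n) (allFin n) _)))
             (∑-swap (allFin n) (allFin n) _)) ⟩
    pos N * K° P σ + (∑[ s ∈ allFin n ] K° P (σ ∙ t s)) ∎)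
    where
    open ≡-Reasoning
    g : Fin n → Fin n → Vec (Fin (suc n)) (suc n)
    g a b = tr (suc a) (suc b)
    t : Fin n → Vec (Fin (suc n)) (suc n)
    t s = tr zero (suc s)
    commute : ∀ a b → (∑[ s ∈ allFin n ] P (σ ∙ g a b ∙ t s)) ≡ ∑[ s ∈ allFin n ] P (σ ∙ t s ∙ g a b)
    commute a b = trans (∑-cong (allFin n) (λ s → cong P (begin
        σ ∙ g a b ∙ t s                          ≡⟨ ∙-assoc σ (g a b) (t s) ⟩
        σ ∙ (g a b ∙ t s)                        ≡⟨ cong (σ ∙_) (perm-tr (tr-perm (suc a) (suc b)) zero (suc s)) ⟩
        σ ∙ (tr (lookup (g a b) zero) (lookup (g a b) (suc s)) ∙ g a b)
          ≡⟨ cong₂ (λ x y → σ ∙ (tr x y ∙ g a b)) (cong (λ v → lookup v zero) (sym (lift-tr a b)))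
               (trans (cong (λ v → lookup v (suc s)) (sym (lift-tr a b))) (trans (lookup-lift (tr a b) s) (cong suc (lookup-tr a b s)))) ⟩
        σ ∙ (t (swapFin a b s) ∙ g a b)          ≡⟨ ∙-assoc σ (t (swapFin a b s)) (g a b) ⟨
        σ ∙ t (swapFin a b s) ∙ g a b            ∎)))
      (∑-swapFin a b (λ s → P (σ ∙ t s ∙ g a b)))

  jmPower-K° : ∀ {n} k (P : Vec (Fin (suc n)) (suc n) → ℤ) {σ} → IsPerm σ → jmPower k (K° P) σ ≡ K° (jmPower k P) σ
  jmPower-K° zero P p = refl
  jmPower-K° (suc k) P p = trans (jmPower-cong k (λ {ρ} _ → jm-K° P ρ) p) (jmPower-K° k (jucysMurphy P) p)

  transpositions-split : ∀ {n} (P : Vec (Fin (suc n)) (suc n) → ℤ) σ →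
    (∑[ a ∈ allFin (suc n) ] ∑[ b ∈ allFin (suc n) ] P (σ ∙ tr a b)) ≡
    (P σ + ((∑[ s ∈ allFin n ] P (σ ∙ tr zero (suc s))) + (∑[ s ∈ allFin n ] P (σ ∙ tr zero (suc s))))) + K° P σ
  transpositions-split {n} P σ = begin
    (∑[ a ∈ allFin (suc n) ] ∑[ b ∈ allFin (suc n) ] P (σ ∙ tr a b))
      ≡⟨ ∑-allFin {n} (λ a → ∑[ b ∈ allFin (suc n) ] P (σ ∙ tr a b)) ⟩
    (∑[ b ∈ allFin (suc n) ] P (σ ∙ tr zero b)) + (∑[ a ∈ allFin n ] ∑[ b ∈ allFin (suc n) ] P (σ ∙ tr (suc a) b))
      ≡⟨ cong₂ _+_ (∑-allFin {n} (λ b → P (σ ∙ tr zero b))) (trans (∑-cong (allFin n) (λ a → ∑-allFin {n} (λ b → P (σ ∙ tr (suc a) b)))) (∑-+ (allFin n) _ _)) ⟩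
    (P (σ ∙ tr zero zero) + S) + ((∑[ a ∈ allFin n ] P (σ ∙ tr (suc a) zero)) + K° P σ)
      ≡⟨ cong₂ (λ x y → (x + S) + (y + K° P σ)) (cong P (trans (cong (σ ∙_) (tr-refl zero)) (∙-identityʳ σ)))
           (∑-cong (allFin n) (λ a → cong (λ v → P (σ ∙ v)) (tr-comm (suc a) zero))) ⟩
    (P σ + S) + (S + K° P σ)
      ≡⟨ arrange (P σ) S (K° P σ) ⟩
    (P σ + (S + S)) + K° P σ ∎
    where
    open ≡-Reasoning
    S = ∑[ s ∈ allFin n ] P (σ ∙ tr zero (suc s))
    arrange : ∀ p s k → (p + s) + (s + k) ≡ (p + (s + s)) + k
    arrange = ℤ-Solver.solve-∀

  -- The transpose of X_k: on a monomial of exponent α, (x_i ∂_i + 1)^k gives (α_i + 1)^k and x_i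
  -- raises α_i.
  raise : ℕ → (Vec ℕ N → ℤ) → Vec ℕ N → ℤ
  raise k φ α = ∑[ i ∈ allFin N ] pos (suc (lookup α i)) ^ k * φ (inc i α)

  powerSumᵛ-cong : ∀ {n} {φ ψ : Vec ℕ N → ℤ} → (∀ α → φ α ≡ ψ α) → (σ : Vec (Fin n) n) → powerSumᵛ φ σ ≡ powerSumᵛ ψ σ
  powerSumᵛ-cong h σ = ⟦⟧-cong (vand N) (λ α → ⟦⟧-cong (powerSum N σ) (λ β → h (α ⊞ β)))

  powerSumᵛ-linear : ∀ {n} a b (φ ψ : Vec ℕ N → ℤ) (σ : Vec (Fin n) n) →
    powerSumᵛ (λ γ → a * φ γ + b * ψ γ) σ ≡ a * powerSumᵛ φ σ + b * powerSumᵛ ψ σ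
  powerSumᵛ-linear a b φ ψ σ = trans
    (⟦⟧-cong (vand N) (λ α → trans (⟦⟧-+ (powerSum N σ) _ _) (cong₂ _+_ (⟦⟧-* (powerSum N σ) a _) (⟦⟧-* (powerSum N σ) b _))))
    (trans (⟦⟧-+ (vand N) _ _) (cong₂ _+_ (⟦⟧-* (vand N) a _) (⟦⟧-* (vand N) b _)))

  -- A new fixed point multiplies p_σ by x_1 + ... + x_N, which is X_0.
  powerSumᵛ-lift : ∀ {n} φ (σ : Vec (Fin n) n) → powerSumᵛ φ (lift σ) ≡ powerSumᵛ (raise 0 φ) σ
  powerSumᵛ-lift {n} φ σ = ⟦⟧-cong (vand N) (λ α → begin
    ⟦ powerSum N (lift σ) ⟧ (λ β → φ (α ⊞ β))
      ≡⟨ trans (⟦powerSum⟧ (lift σ) (λ β → φ (α ⊞ β))) (∑-cons (allFin N) n (λ c → ⟨ (c ∙ lift σ) ≟ᵛ c ⟩ * φ (α ⊞ cnt c))) ⟩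
    (∑[ x ∈ allFin N ] ∑[ c ∈ cols N n ] ⟨ ((x ∷ c) ∙ lift σ) ≟ᵛ (x ∷ c) ⟩ * φ (α ⊞ inc x (cnt c)))
      ≡⟨ ∑-cong (allFin N) (λ x → ∑-cong (cols N n) (λ c → cong₂ _*_
           (⟨⟩-cong (((x ∷ c) ∙ lift σ) ≟ᵛ (x ∷ c)) ((c ∙ σ) ≟ᵛ c) (λ e → Vecₚ.∷-injectiveʳ (trans (sym (cons-∙-lift x c σ)) e)) (λ e → trans (cons-∙-lift x c σ) (cong (x ∷_) e)))
           (trans (cong φ (trans (sym (inc-⊞ʳ x α (cnt c))) (add-⊞ x 1 α (cnt c)))) (sym (ℤₚ.*-identityˡ _))))) ⟩
    (∑[ x ∈ allFin N ] ∑[ c ∈ cols N n ] ⟨ (c ∙ σ) ≟ᵛ c ⟩ * (1ℤ * φ (inc x (α ⊞ cnt c))))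
      ≡⟨ trans (∑-swap (allFin N) (cols N n) _) (∑-cong (cols N n) (λ c → sym (∑-*ˡ (allFin N) ⟨ (c ∙ σ) ≟ᵛ c ⟩ (λ x → 1ℤ * φ (inc x (α ⊞ cnt c)))))) ⟩
    (∑[ c ∈ cols N n ] ⟨ (c ∙ σ) ≟ᵛ c ⟩ * raise 0 φ (α ⊞ cnt c))
      ≡⟨ ⟦powerSum⟧ σ (λ β → raise 0 φ (α ⊞ β)) ⟨
    ⟦ powerSum N σ ⟧ (λ β → raise 0 φ (α ⊞ β)) ∎)
    where open ≡-Reasoning

  -- Twice the Jucys–Murphy element is the difference of the Casimir elements
  -- of S(n+1) and S(n), minus 1, so its powers are computed by commutators.
  raise-suc : ∀ k φ α → (pos N + pos N - 1ℤ) * raise k φ α + (raise k (λ γ → casimir N γ * φ γ) α - casimir N α * raise k φ α)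
    ≡ raise (suc k) φ α + raise (suc k) φ α
  raise-suc k φ α = begin
    z * raise k φ α + (raise k (λ γ → casimir N γ * φ γ) α - casimir N α * raise k φ α)
      ≡⟨ cong₂ _+_ (∑-*ˡ (allFin N) z _) (cong (raise k (λ γ → casimir N γ * φ γ) α +_)
           (trans (cong -_ (∑-*ˡ (allFin N) (casimir N α) _)) (sym (∑-neg (allFin N) _)))) ⟩
    ∑ (allFin N) (λ i → z * (w i * φ (inc i α))) + (∑ (allFin N) (λ i → w i * (casimir N (inc i α) * φ (inc i α)))
      + ∑ (allFin N) (λ i → - (casimir N α * (w i * φ (inc i α)))))
      ≡⟨ trans (cong (∑ (allFin N) (λ i → z * (w i * φ (inc i α))) +_) (sym (∑-+ (allFin N) _ _))) (sym (∑-+ (allFin N) _ _)) ⟩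
    (∑[ i ∈ allFin N ] (z * (w i * φ (inc i α)) + (w i * (casimir N (inc i α) * φ (inc i α)) + - (casimir N α * (w i * φ (inc i α))))))
      ≡⟨ ∑-cong (allFin N) (λ i → trans (cong₂ (λ a b → z * (w i * φ (inc i α)) + (w i * (((a - (c + c) * b) + κ) * φ (inc i α)) + - (casimir N α * (w i * φ (inc i α))))) (q₂-inc i α) (q₁-inc i α))
           (identity (pos N) (w i) (φ (inc i α)) (q₂ α) (q₁ α) (pos (lookup α i)) κ)) ⟩
    (∑[ i ∈ allFin N ] (pos (suc (lookup α i)) * w i * φ (inc i α) + pos (suc (lookup α i)) * w i * φ (inc i α)))
      ≡⟨ ∑-+ (allFin N) _ _ ⟩
    raise (suc k) φ α + raise (suc k) φ α ∎
    where
    open ≡-Reasoning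
    z c κ : ℤ
    z = pos N + pos N - 1ℤ
    c = pos N - 1ℤ
    κ = (c + c) * κ₁ N - κ₂ N
    w : Fin N → ℤ
    w i = pos (suc (lookup α i)) ^ k
    identity : ∀ N w f a b l κ →
      (N + N - 1ℤ) * (w * f) + (w * ((((a + (l + l + 1ℤ)) - ((N - 1ℤ) + (N - 1ℤ)) * (b + 1ℤ)) + κ) * f)
        + - (((a - ((N - 1ℤ) + (N - 1ℤ)) * b) + κ) * (w * f)))
      ≡ (1ℤ + l) * w * f + (1ℤ + l) * w * f
    identity = ℤ-Solver.solve-∀

  -- Twice N + J is the transposition sum of S(n+1), minus that of S(n), plus 2N - 1. The first
  -- multiplies φ by `casimir`. The second is `K°`, which commutes with J and moves outside the
  -- power, where the induction hypothesis is applied at the permutations σ (a b). The induction on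
  -- k thus runs over all φ and σ.
  jmPower-powerSumᵛ : ∀ {n} k φ {σ : Vec (Fin n) n} → IsPerm σ →
    jmPower k (powerSumᵛ φ) (lift σ) ≡ powerSumᵛ (raise k φ) σ
  jmPower-powerSumᵛ zero φ {σ} p = powerSumᵛ-lift φ σ
  jmPower-powerSumᵛ {n} (suc k) φ {σ} p = double-injective (begin
    jmPower k (jucysMurphy P) (lift σ) + jmPower k (jucysMurphy P) (lift σ)
      ≡⟨ ones (jmPower k (jucysMurphy P) (lift σ)) ⟨
    1ℤ * jmPower k (jucysMurphy P) (lift σ) + 1ℤ * jmPower k (jucysMurphy P) (lift σ)
      ≡⟨ jmPower-linear k 1ℤ 1ℤ (jucysMurphy P) (jucysMurphy P) (lift-perm p) ⟨
    jmPower k (λ ρ → 1ℤ * jucysMurphy P ρ + 1ℤ * jucysMurphy P ρ) (lift σ)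
      ≡⟨ jmPower-cong k doubled (lift-perm p) ⟩
    jmPower k (λ ρ → z * P ρ + 1ℤ * (1ℤ * powerSumᵛ φ′ ρ + (- 1ℤ) * K° P ρ)) (lift σ)
      ≡⟨ jmPower-linear k z 1ℤ P _ (lift-perm p) ⟩
    z * jmPower k P (lift σ) + 1ℤ * jmPower k (λ ρ → 1ℤ * powerSumᵛ φ′ ρ + (- 1ℤ) * K° P ρ) (lift σ)
      ≡⟨ cong (λ x → z * jmPower k P (lift σ) + 1ℤ * x) (jmPower-linear k 1ℤ (- 1ℤ) (powerSumᵛ φ′) (K° P) (lift-perm p)) ⟩
    z * jmPower k P (lift σ) + 1ℤ * (1ℤ * jmPower k (powerSumᵛ φ′) (lift σ) + (- 1ℤ) * jmPower k (K° P) (lift σ))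
      ≡⟨ cong₂ (λ x y → z * x + 1ℤ * y) (jmPower-powerSumᵛ k φ p)
           (cong₂ (λ x y → 1ℤ * x + (- 1ℤ) * y) (jmPower-powerSumᵛ k φ′ p) lower) ⟩
    z * powerSumᵛ (raise k φ) σ + 1ℤ * (1ℤ * powerSumᵛ (raise k φ′) σ + (- 1ℤ) * powerSumᵛ (λ γ → casimir N γ * raise k φ γ) σ)
      ≡⟨ trans (powerSumᵛ-linear z 1ℤ (raise k φ) (λ γ → 1ℤ * raise k φ′ γ + (- 1ℤ) * (casimir N γ * raise k φ γ)) σ) (cong (λ x → z * powerSumᵛ (raise k φ) σ + 1ℤ * x)
           (powerSumᵛ-linear 1ℤ (- 1ℤ) (raise k φ′) (λ γ → casimir N γ * raise k φ γ) σ)) ⟨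
    powerSumᵛ (λ γ → z * raise k φ γ + 1ℤ * (1ℤ * raise k φ′ γ + (- 1ℤ) * (casimir N γ * raise k φ γ))) σ
      ≡⟨ powerSumᵛ-cong (λ γ → trans (cong (z * raise k φ γ +_) (minus (raise k φ′ γ) (casimir N γ * raise k φ γ)))
           (trans (raise-suc k φ γ) (sym (ones (raise (suc k) φ γ))))) σ ⟩
    powerSumᵛ (λ γ → 1ℤ * raise (suc k) φ γ + 1ℤ * raise (suc k) φ γ) σ
      ≡⟨ trans (powerSumᵛ-linear 1ℤ 1ℤ (raise (suc k) φ) (raise (suc k) φ) σ) (ones (powerSumᵛ (raise (suc k) φ) σ)) ⟩
    powerSumᵛ (raise (suc k) φ) σ + powerSumᵛ (raise (suc k) φ) σ ∎)
    where
    open ≡-Reasoning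
    P : ∀ {n} → Vec (Fin n) n → ℤ
    P = powerSumᵛ φ
    z : ℤ
    z = pos N + pos N - 1ℤ
    φ′ : Vec ℕ N → ℤ
    φ′ γ = casimir N γ * φ γ
    ones : ∀ x → 1ℤ * x + 1ℤ * x ≡ x + x
    ones = ℤ-Solver.solve-∀
    minus : ∀ x y → 1ℤ * (1ℤ * x + (- 1ℤ) * y) ≡ x - y
    minus = ℤ-Solver.solve-∀
    double-injective : ∀ {x y : ℤ} → x + x ≡ y + y → x ≡ y
    double-injective {x} {y} e = ℤₚ.*-cancelˡ-≡ (pos 2) x y (trans (two x) (trans e (sym (two y))))
      where
      two : ∀ x → pos 2 * x ≡ x + x
      two = ℤ-Solver.solve-∀
    doubled : ∀ {ρ : Vec (Fin (suc n)) (suc n)} → IsPerm ρ →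
      1ℤ * jucysMurphy P ρ + 1ℤ * jucysMurphy P ρ ≡ z * P ρ + 1ℤ * (1ℤ * powerSumᵛ φ′ ρ + (- 1ℤ) * K° P ρ)
    doubled {ρ} q = sym (trans
      (cong (λ x → z * P ρ + 1ℤ * (1ℤ * x + (- 1ℤ) * K° P ρ)) (trans (sym (transpositions-eigen q φ)) (transpositions-split P ρ)))
      (arrange (pos N) (P ρ) _ (K° P ρ)))
      where
      arrange : ∀ N p s k → (N + N - 1ℤ) * p + 1ℤ * (1ℤ * ((p + (s + s)) + k) + (- 1ℤ) * k) ≡ 1ℤ * (N * p + s) + 1ℤ * (N * p + s)
      arrange = ℤ-Solver.solve-∀
    lower : jmPower k (K° P) (lift σ) ≡ powerSumᵛ (λ γ → casimir N γ * raise k φ γ) σ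
    lower = trans (jmPower-K° k P (lift-perm p)) (trans
      (∑-cong (allFin n) (λ a → ∑-cong (allFin n) (λ b → trans
        (cong (jmPower k P) (trans (cong (lift σ ∙_) (sym (lift-tr a b))) (lift-∙ σ (tr a b))))
        (jmPower-powerSumᵛ k φ (∙-perm p (tr-perm a b))))))
      (transpositions-eigen p (raise k φ)))

  -- Right multiplication by the central element Σ_τ N^{cycles τ} τ; one factor for each colour.
  Ω : ∀ {n} → (Vec (Fin n) n → ℤ) → Vec (Fin n) n → ℤ
  Ω {n} P σ = ∑[ τ ∈ perms n ] Fix N τ * P (σ ∙ τ)

  ΩPower : ∀ {n} → ℕ → (Vec (Fin n) n → ℤ) → Vec (Fin n) n → ℤ
  ΩPower zero P = P
  ΩPower (suc k) P = ΩPower k (Ω P)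

  Ω-cong : ∀ {n} {P Q : Vec (Fin n) n → ℤ} → (∀ {σ} → IsPerm σ → P σ ≡ Q σ) → ∀ {σ} → IsPerm σ → Ω P σ ≡ Ω Q σ
  Ω-cong {n} h p = ∑-cong∈ (perms n) (λ {τ} τ∈ → cong (Fix N τ *_) (h (∙-perm p (Enumerates.sound (perms-enumerates n) τ∈))))

  ΩPower-cong : ∀ {n} k {P Q : Vec (Fin n) n → ℤ} → (∀ {σ} → IsPerm σ → P σ ≡ Q σ) → ∀ {σ} → IsPerm σ → ΩPower k P σ ≡ ΩPower k Q σ
  ΩPower-cong zero h p = h p
  ΩPower-cong (suc k) h p = ΩPower-cong k (Ω-cong h) p

  -- `Fix` is a class function, so conjugating by (0 s) only permutes the sum over τ.
  jm-Ω : ∀ {n} (P : Vec (Fin (suc n)) (suc n) → ℤ) σ → jucysMurphy (Ω P) σ ≡ Ω (jucysMurphy P) σ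
  jm-Ω {n} P σ = sym (begin
    (∑[ τ ∈ perms (suc n) ] Fix N τ * (pos N * P (σ ∙ τ) + (∑[ s ∈ allFin n ] P (σ ∙ τ ∙ t s))))
      ≡⟨ ∑-cong (perms (suc n)) (λ τ → trans (distribute (Fix N τ) (pos N) (P (σ ∙ τ)) _)
           (cong (pos N * (Fix N τ * P (σ ∙ τ)) +_) (∑-*ˡ (allFin n) (Fix N τ) _))) ⟩
    (∑[ τ ∈ perms (suc n) ] (pos N * (Fix N τ * P (σ ∙ τ)) + (∑[ s ∈ allFin n ] Fix N τ * P (σ ∙ τ ∙ t s))))
      ≡⟨ ∑-+ (perms (suc n)) _ _ ⟩
    _ ≡⟨ cong₂ _+_ (sym (∑-*ˡ (perms (suc n)) (pos N) _))
           (trans (∑-swap (perms (suc n)) (allFin n) _) (∑-cong (allFin n) conj)) ⟩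
    pos N * Ω P σ + (∑[ s ∈ allFin n ] Ω P (σ ∙ t s)) ∎)
    where
    open ≡-Reasoning
    t : Fin n → Vec (Fin (suc n)) (suc n)
    t s = tr zero (suc s)
    distribute : ∀ f N p s → f * (N * p + s) ≡ N * (f * p) + f * s
    distribute = ℤ-Solver.solve-∀
    conj : ∀ s → (∑[ τ ∈ perms (suc n) ] Fix N τ * P (σ ∙ τ ∙ t s)) ≡ Ω P (σ ∙ t s)
    conj s = trans (∑-cong (perms (suc n)) (λ τ → cong₂ _*_ (sym (Fix-conj N inv inv τ)) (cong P (sym (begin
        σ ∙ t s ∙ (t s ∙ τ ∙ t s)    ≡⟨ ∙-assoc (σ ∙ t s) (t s ∙ τ) (t s) ⟨
        σ ∙ t s ∙ (t s ∙ τ) ∙ t s    ≡⟨ cong (_∙ t s) (∙-assoc (σ ∙ t s) (t s) τ) ⟨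
        σ ∙ t s ∙ t s ∙ τ ∙ t s      ≡⟨ cong (λ v → v ∙ τ ∙ t s) (cancelʳ σ inv) ⟩
        σ ∙ τ ∙ t s                  ∎)))))
      (∑-perms-conj inv (λ τ → Fix N τ * P (σ ∙ t s ∙ τ)))
      where inv = tr-involutive zero (suc s)

  jmPower-Ω : ∀ {n} k (P : Vec (Fin (suc n)) (suc n) → ℤ) {σ} → IsPerm σ → jmPower k (Ω P) σ ≡ Ω (jmPower k P) σ
  jmPower-Ω zero P p = refl
  jmPower-Ω (suc k) P p = trans (jmPower-cong k (λ {ρ} _ → jm-Ω P ρ) p) (jmPower-Ω k (jucysMurphy P) p)

  -- Decomposing into cosets, the weighted sum over S(n+1) is the one over S(n) times N + J: the
  -- coset representative 1 gives the factor N, each (0 s) the factor 1.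
  Ω-lift : ∀ {n} (P : Vec (Fin (suc n)) (suc n) → ℤ) (σ : Vec (Fin n) n) →
    Ω P (lift σ) ≡ Ω (λ ρ → jucysMurphy P (lift ρ)) σ
  Ω-lift {n} P σ = trans (∑-perms-suc {n} (λ τ → Fix N τ * P (lift σ ∙ τ))) (∑-cong (perms n) (λ τ → begin
    (∑[ s ∈ allFin (suc n) ] Fix N (lift τ ∙ tr zero s) * P (lift σ ∙ (lift τ ∙ tr zero s)))
      ≡⟨ ∑-allFin {n} (λ s → Fix N (lift τ ∙ tr zero s) * P (lift σ ∙ (lift τ ∙ tr zero s))) ⟩
    Fix N (lift τ ∙ tr zero zero) * P (lift σ ∙ (lift τ ∙ tr zero zero))
      + (∑[ s ∈ allFin n ] Fix N (lift τ ∙ tr zero (suc s)) * P (lift σ ∙ (lift τ ∙ tr zero (suc s))))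
      ≡⟨ cong₂ _+_
           (trans (cong (λ v → Fix N v * P (lift σ ∙ v)) (trans (cong (lift τ ∙_) (tr-refl zero)) (∙-identityʳ (lift τ))))
             (trans (cong₂ _*_ (Fix-lift N τ) (cong P (lift-∙ σ τ))) (swap (pos N) (Fix N τ) _)))
           (trans (∑-cong (allFin n) (λ s → cong₂ _*_ (Fix-lift-tr N τ s)
               (cong P (trans (sym (∙-assoc (lift σ) (lift τ) (tr zero (suc s)))) (cong (_∙ tr zero (suc s)) (lift-∙ σ τ))))))
             (sym (∑-*ˡ (allFin n) (Fix N τ) _))) ⟩
    Fix N τ * (pos N * P (lift (σ ∙ τ))) + Fix N τ * (∑[ s ∈ allFin n ] P (lift (σ ∙ τ) ∙ tr zero (suc s)))
      ≡⟨ ℤₚ.*-distribˡ-+ (Fix N τ) _ _ ⟨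
    Fix N τ * jucysMurphy P (lift (σ ∙ τ)) ∎))
    where
    open ≡-Reasoning
    swap : ∀ a b c → (a * b) * c ≡ b * (a * c)
    swap = ℤ-Solver.solve-∀

  ΩPower-lift : ∀ {n} k (P : Vec (Fin (suc n)) (suc n) → ℤ) {σ : Vec (Fin n) n} → IsPerm σ →
    ΩPower k P (lift σ) ≡ ΩPower k (λ ρ → jmPower k P (lift ρ)) σ
  ΩPower-lift zero P p = refl
  ΩPower-lift (suc k) P p = trans (ΩPower-lift k (Ω P) p) (ΩPower-cong k (λ {ρ} q → trans (jmPower-Ω k P (lift-perm q))
    (trans (Ω-lift (jmPower k P) ρ) (Ω-cong (λ {τ} r → sym (jmPower-suc k P (lift-perm r))) q))) p)

  raisePower : ℕ → ℕ → (Vec ℕ N → ℤ) → Vec ℕ N → ℤ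
  raisePower m zero φ = φ
  raisePower m (suc n) φ = raisePower m n (raise m φ)

  -- Points are removed one at a time, each replacing φ by `raise m φ`. On no points p_σ is 1 and
  -- only a is left.
  ΩPower-vand : ∀ m n φ → ΩPower m (powerSumᵛ φ) (idV {n}) ≡ ⟦ vand N ⟧ (raisePower m n φ)
  ΩPower-vand m (suc n) φ = trans (cong (ΩPower m (powerSumᵛ φ)) (sym lift-id))
    (trans (ΩPower-lift m (powerSumᵛ φ) idV-perm)
      (trans (ΩPower-cong m (λ q → jmPower-powerSumᵛ m φ q) idV-perm) (ΩPower-vand m n (raise m φ))))
  ΩPower-vand m zero φ = trans (trivial m (powerSumᵛ φ)) (⟦⟧-cong (vand N) (λ α → trans (⟦powerSum⟧ {N} [] (λ β → φ (α ⊞ β)))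
      (trans (ℤₚ.+-identityʳ _) (trans (cong (_* φ (α ⊞ 𝟘ᵛ)) (⟨⟩-yes (([] ∙ []) ≟ᵛ []) (vec₀-unique ([] ∙ []) []))) (trans (ℤₚ.*-identityˡ _)
        (cong φ (trans (⊞-comm α 𝟘ᵛ) (⊞-identityˡ α))))))))
    where
    trivial : ∀ k (P : Vec (Fin 0) 0 → ℤ) → ΩPower k P [] ≡ P []
    trivial zero P = refl
    trivial (suc k) P = trans (trivial k (Ω P)) (trans (ℤₚ.+-identityʳ _)
      (trans (cong₂ _*_ (Fix-empty N) (cong P (vec₀-unique ([] ∙ []) []))) (ℤₚ.*-identityˡ _)))

-- Tuples of permutations counted by colourings

-- For r = 0 the pairing with this function is ∏ ∂_i^i / i! at x = (1, ..., 1), with i counted from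
-- 0.
binomials : ∀ {N} → ℕ → Vec ℕ N → ℤ
binomials r [] = 1ℤ
binomials r (x ∷ α) = pos (x C r) * binomials (suc r) α

module _ where
  open Determinant ℤₚ.+-*-commutativeRing

  det-mapʳ : ∀ {I J K : Set} (b : I → J → ℤ) (f : K → I) (ks : List K) (cs : List J) →
    det b (map f ks) cs ≡ det (λ k c → b (f k) c) ks cs
  det-mapʳ b f [] [] = refl
  det-mapʳ b f [] (_ ∷ _) = refl
  det-mapʳ b f (k ∷ ks) cs = alt-cong cs (λ c cs′ → cong (b (f k) c *_) (det-mapʳ b f ks cs′))

  private
    entryᵇ : ℕ × ℕ → ℕ → ℤ
    entryᵇ (r , y) k = pos ((k ℕ.+ y) C r)

    rows : ∀ {N} → ℕ → Vec ℕ N → Vec (ℕ × ℕ) N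
    rows r [] = []
    rows r (y ∷ β) = (r , y) ∷ rows (suc r) β

    bump : ℕ × ℕ → ℕ × ℕ
    bump (r , y) = suc r , y

    rows-suc : ∀ {N} r (β : Vec ℕ N) → Vec.toList (rows (suc r) β) ≡ map bump (Vec.toList (rows r β))
    rows-suc r [] = refl
    rows-suc r (y ∷ β) = cong ((suc r , y) ∷_) (rows-suc (suc r) β)

    rowProduct-binomials : ∀ {N} r (α β : Vec ℕ N) → rowProduct entryᵇ (rows r β) α ≡ binomials r (α ⊞ β)
    rowProduct-binomials r [] [] = refl
    rowProduct-binomials r (x ∷ α) (y ∷ β) = cong (pos ((x ℕ.+ y) C r) *_) (rowProduct-binomials (suc r) α β)

  -- Whatever y is, row r is a polynomial of degree r in the column index with leading coefficient
  -- 1/r!. The constant row 0 is cleared by differences of neighbouring columns, and by Pascal's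
  -- rule these lower every other r by one.
  det-binomials : ∀ {N} (β : Vec ℕ N) k → det entryᵇ (Vec.toList (rows 0 β)) (iota k N) ≡ 1ℤ
  det-binomials [] k = refl
  det-binomials {suc N} (y ∷ β) k = begin
    det entryᵇ ((0 , y) ∷ Vec.toList (rows 1 β)) (iota k (suc N))
      ≡⟨ det-geometric entryᵇ 1ℤ (0 , y) (Vec.toList (rows 1 β)) k N (λ j → refl) ⟩
    1ℤ * det (λ s j → entryᵇ s (suc j) + (- 1ℤ) * entryᵇ s j) (Vec.toList (rows 1 β)) (iota k N)
      ≡⟨ ℤₚ.*-identityˡ _ ⟩
    det (λ s j → entryᵇ s (suc j) + (- 1ℤ) * entryᵇ s j) (Vec.toList (rows 1 β)) (iota k N)
      ≡⟨ cong (λ l → det (λ s j → entryᵇ s (suc j) + (- 1ℤ) * entryᵇ s j) l (iota k N)) (rows-suc 0 β) ⟩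
    det (λ s j → entryᵇ s (suc j) + (- 1ℤ) * entryᵇ s j) (map bump (Vec.toList (rows 0 β))) (iota k N)
      ≡⟨ det-mapʳ _ bump (Vec.toList (rows 0 β)) (iota k N) ⟩
    det (λ s j → entryᵇ (bump s) (suc j) + (- 1ℤ) * entryᵇ (bump s) j) (Vec.toList (rows 0 β)) (iota k N)
      ≡⟨ det-cong (Vec.toList (rows 0 β)) (iota k N) pascal ⟩
    det entryᵇ (Vec.toList (rows 0 β)) (iota k N)
      ≡⟨ det-binomials β k ⟩
    1ℤ ∎
    where
    open ≡-Reasoning
    pascal : ∀ s j → entryᵇ (bump s) (suc j) + (- 1ℤ) * entryᵇ (bump s) j ≡ entryᵇ s j
    pascal (r , y) j = trans (cong (λ x → pos x + (- 1ℤ) * pos ((j ℕ.+ y) C suc r)) (sym (nCk+nC[k+1]≡[n+1]C[k+1] (j ℕ.+ y) r)))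
      (cancel (pos ((j ℕ.+ y) C r)) (pos ((j ℕ.+ y) C suc r)))
      where
      cancel : ∀ a b → (a + b) + (- 1ℤ) * b ≡ a
      cancel = ℤ-Solver.solve-∀

  -- The pairing of a with the shifted function is 1 for every shift β, so a·p is sent to the sum of
  -- the coefficients of p; for p_σ this counts the invariant colourings.
  powerSumᵛ-binomials : ∀ {N n} (σ : Vec (Fin n) n) → powerSumᵛ (binomials {N} 0) σ ≡ Fix N σ
  powerSumᵛ-binomials {N} {n} σ = begin
    ⟦ vand N ⟧ (λ α → ⟦ powerSum N σ ⟧ (λ β → binomials 0 (α ⊞ β)))
      ≡⟨ ⟦⟧-swap (vand N) (powerSum N σ) (λ α β → binomials 0 (α ⊞ β)) ⟩
    ⟦ powerSum N σ ⟧ (λ β → ⟦ vand N ⟧ (λ α → binomials 0 (α ⊞ β)))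
      ≡⟨ ⟦⟧-cong (powerSum N σ) (λ β → trans (⟦vand⟧ N (λ α → binomials 0 (α ⊞ β)))
           (trans (altVec-cong N (iota 0 N) (λ α → sym (rowProduct-binomials 0 α β)))
             (trans (sym (det-altVec entryᵇ (rows 0 β) (iota 0 N))) (det-binomials β 0)))) ⟩
    ⟦ powerSum N σ ⟧ (λ _ → 1ℤ)
      ≡⟨ trans (⟦powerSum⟧ σ (λ _ → 1ℤ)) (∑-cong (cols N n) (λ c → ℤₚ.*-identityʳ _)) ⟩
    Fix N σ ∎
    where open ≡-Reasoning

module _ (m : ℕ) where

  momentProduct : ∀ {N} → ℕ → Vec ℕ N → Seq
  momentProduct r [] = 𝟏
  momentProduct r (x ∷ α) = moment m r x ⋆ momentProduct (suc r) α

  -- The column shift ∂ b_ij = (j+1)^m b_{i,j+1} and the product rule reproduce `raise m`. Hence n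
  -- applications of `raise m` to `binomials` give the coefficient of index n.
  ∂-momentProduct : ∀ {N} r (α : Vec ℕ N) n →
    momentProduct r α (suc n) ≡ ∑[ i ∈ allFin N ] pos (suc (lookup α i)) ^ m * momentProduct r (inc i α) n
  ∂-momentProduct r [] n = refl
  ∂-momentProduct {suc N} r (x ∷ α) n = begin
    (∂ (moment m r x) ⋆ M) n + (moment m r x ⋆ ∂ M) n
      ≡⟨ cong₂ _+_ (·-⋆ (pos (suc x) ^ m) (moment m r (suc x)) M n)
           (⋆-cong {moment m r x} (λ _ → refl) (∂-momentProduct (suc r) α) n) ⟩
    pos (suc x) ^ m * (moment m r (suc x) ⋆ M) n + (moment m r x ⋆ (λ n → ∑[ i ∈ allFin N ] w i * momentProduct (suc r) (inc i α) n)) n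
      ≡⟨ cong (pos (suc x) ^ m * (moment m r (suc x) ⋆ M) n +_) (⋆-∑ (allFin N) (moment m r x) (λ i → momentProduct (suc r) (inc i α)) n) ⟩
    pos (suc x) ^ m * (moment m r (suc x) ⋆ M) n + (∑[ i ∈ allFin N ] w i * (moment m r x ⋆ momentProduct (suc r) (inc i α)) n)
      ≡⟨ ∑-allFin {N} (λ i → pos (suc (lookup (x ∷ α) i)) ^ m * momentProduct r (inc i (x ∷ α)) n) ⟨
    (∑[ i ∈ allFin (suc N) ] pos (suc (lookup (x ∷ α) i)) ^ m * momentProduct r (inc i (x ∷ α)) n) ∎
    where
    open ≡-Reasoning
    M = momentProduct (suc r) α
    w : Fin N → ℤ
    w i = pos (suc (lookup α i)) ^ m
    ⋆-∑ : ∀ is f (g : Fin N → Seq) n → (f ⋆ (λ n → ∑[ i ∈ is ] w i * g i n)) n ≡ ∑[ i ∈ is ] w i * (f ⋆ g i) n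
    ⋆-∑ [] f g n = trans (⋆-comm f 𝟎 n) (⋆-zeroˡ f n)
    ⋆-∑ (i ∷ is) f g n = trans (⋆-distribˡ f (w i · g i) _ n) (cong₂ _+_ (⋆-· (w i) f (g i) n) (⋆-∑ is f g n))

  raisePower-moment : ∀ N n d φ → (∀ α → φ α ≡ momentProduct 0 α d) → ∀ α → raisePower N m n φ α ≡ momentProduct 0 α (n ℕ.+ d)
  raisePower-moment N zero d φ h α = h α
  raisePower-moment N (suc n) d φ h α = trans
    (raisePower-moment N n (suc d) (raise N m φ) (λ β → trans
      (∑-cong (allFin N) (λ i → cong (pos (suc (lookup β i)) ^ m *_) (h (inc i β)))) (sym (∂-momentProduct 0 β d))) α)
    (cong (momentProduct 0 α) (ℕₚ.+-suc n d))

  private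
    binomials-moment : ∀ {N} r (α : Vec ℕ N) → binomials r α ≡ momentProduct r α 0
    binomials-moment r [] = refl
    binomials-moment r (x ∷ α) = cong (pos (x C r) *_) (binomials-moment (suc r) α)

    open Determinant seqRing
    module at n = AltHom seqRing ℤₚ.+-*-commutativeRing (λ f → f n) refl (λ _ _ → refl)

    iotaᵛ : ∀ k l → Vec ℕ l
    iotaᵛ k zero = []
    iotaᵛ k (suc l) = k ∷ iotaᵛ (suc k) l

    toList-iotaᵛ : ∀ k l → Vec.toList (iotaᵛ k l) ≡ iota k l
    toList-iotaᵛ k zero = refl
    toList-iotaᵛ k (suc l) = cong (k ∷_) (toList-iotaᵛ (suc k) l)

    iotaℕ≡ : ∀ k l → iotaℕ k l ≡ iota k l
    iotaℕ≡ k zero = refl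
    iotaℕ≡ k (suc l) = cong (k ∷_) (iotaℕ≡ (suc k) l)

    rowProduct-moment : ∀ {N} r (α : Vec ℕ N) → rowProduct (moment m) (iotaᵛ r N) α ≐ momentProduct r α
    rowProduct-moment r [] n = refl
    rowProduct-moment r (x ∷ α) n = ⋆-cong {moment m r x} (λ _ → refl) (rowProduct-moment (suc r) α) n

  -- Pairing with a antisymmetrises the product of the b_{i,α_i} over the arrangements α of 0, ...,
  -- N-1, which is the Leibniz formula.
  vand-hankel : ∀ N n → ⟦ vand N ⟧ (raisePower N m n (binomials 0)) ≡ hankel m N n
  vand-hankel N n = begin
    ⟦ vand N ⟧ (raisePower N m n (binomials 0))
      ≡⟨ ⟦⟧-cong (vand N) (λ α → trans (raisePower-moment N n 0 (binomials 0) (binomials-moment 0) α)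
           (cong (momentProduct 0 α) (ℕₚ.+-identityʳ n))) ⟩
    ⟦ vand N ⟧ (λ α → momentProduct 0 α n)
      ≡⟨ ⟦vand⟧ N _ ⟩
    altℤ N (iotaℕ 0 N) (λ α → momentProduct 0 α n)
      ≡⟨ cong (λ l → altℤ N l (λ α → momentProduct 0 α n)) (iotaℕ≡ 0 N) ⟩
    altℤ N (iota 0 N) (λ α → momentProduct 0 α n)
      ≡⟨ at.altVec-hom n N (iota 0 N) (momentProduct 0) ⟨
    altVec N (iota 0 N) (momentProduct 0) n
      ≡⟨ altVec-cong N (iota 0 N) (rowProduct-moment 0) n ⟨
    altVec N (iota 0 N) (rowProduct (moment m) (iotaᵛ 0 N)) n
      ≡⟨ det-altVec (moment m) (iotaᵛ 0 N) (iota 0 N) n ⟨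
    det (moment m) (Vec.toList (iotaᵛ 0 N)) (iota 0 N) n
      ≡⟨ cong (λ l → det (moment m) l (iota 0 N) n) (toList-iotaᵛ 0 N) ⟩
    hankel m N n ∎
    where open ≡-Reasoning

permTuples : ∀ m n → List (Tuple m n)
permTuples m n = vecsOver (perms n) m

∏Fix : ∀ N {m n} → Tuple m n → ℤ
∏Fix N [] = 1ℤ
∏Fix N (σ ∷ t) = Fix N σ * ∏Fix N t

-- N to the number of vertices and faces.
colourWeight : ∀ N {m n} → Tuple m n → ℤ
colourWeight N t = ∏Fix N t * Fix N (prod t)

∑-permTuples : ∀ N m n (P : Vec (Fin n) n → ℤ) σ →
  (∑[ t ∈ permTuples m n ] ∏Fix N t * P (σ ∙ prod t)) ≡ ΩPower N m P σ
∑-permTuples N zero n P σ = trans (ℤₚ.+-identityʳ _) (trans (ℤₚ.*-identityˡ _) (cong P (∙-identityʳ σ)))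
∑-permTuples N (suc m) n P σ = begin
  (∑[ t ∈ permTuples (suc m) n ] ∏Fix N t * P (σ ∙ prod t))
    ≡⟨ trans (∑-cons (perms n) m _) (∑-swap (perms n) (permTuples m n) _) ⟩
  (∑[ t ∈ permTuples m n ] ∑[ τ ∈ perms n ] (Fix N τ * ∏Fix N t) * P (σ ∙ (prod t ∙ τ)))
    ≡⟨ ∑-cong (permTuples m n) (λ t → trans (∑-cong (perms n) (λ τ → trans
         (cong (λ v → (Fix N τ * ∏Fix N t) * P v) (sym (∙-assoc σ (prod t) τ)))
         (swap (Fix N τ) (∏Fix N t) _))) (sym (∑-*ˡ (perms n) (∏Fix N t) _))) ⟩
  (∑[ t ∈ permTuples m n ] ∏Fix N t * Ω N P (σ ∙ prod t))
    ≡⟨ ∑-permTuples N m n (Ω N P) σ ⟩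
  ΩPower N m (Ω N P) σ ∎
  where
  open ≡-Reasoning
  swap : ∀ a b c → (a * b) * c ≡ b * (a * c)
  swap = ℤ-Solver.solve-∀

-- Z_N as a determinant: the m colours are m applications of `Ω`, and the faces enter through the
-- starting function `Fix N`.
total-hankel : ∀ N m n → (∑[ t ∈ permTuples m n ] colourWeight N t) ≡ hankel m N n
total-hankel N m n = begin
  (∑[ t ∈ permTuples m n ] ∏Fix N t * Fix N (prod t))
    ≡⟨ ∑-cong (permTuples m n) (λ t → cong (λ v → ∏Fix N t * Fix N v) (sym (∙-identityˡ (prod t)))) ⟩
  (∑[ t ∈ permTuples m n ] ∏Fix N t * Fix N (idV ∙ prod t))
    ≡⟨ ∑-permTuples N m n (Fix N) idV ⟩
  ΩPower N m (Fix N) idV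
    ≡⟨ ΩPower-cong N m (λ {σ} _ → sym (powerSumᵛ-binomials {N} σ)) idV-perm ⟩
  ΩPower N m (powerSumᵛ (binomials {N} 0)) idV
    ≡⟨ ΩPower-vand N m n (binomials 0) ⟩
  ⟦ vand N ⟧ (raisePower N m n (binomials 0))
    ≡⟨ vand-hankel m N n ⟩
  hankel m N n ∎
  where open ≡-Reasoning

-- Splitting a permutation along an invariant subset

#t #f : ∀ {n} → Vec Bool n → ℕ
#t [] = 0
#t (true ∷ B) = suc (#t B)
#t (false ∷ B) = #t B
#f [] = 0
#f (true ∷ B) = #f B
#f (false ∷ B) = suc (#f B)

-- Increasing enumeration of the subset with indicator B; `E₂` enumerates its complement.
E₁ : ∀ {n} (B : Vec Bool n) → Vec (Fin n) (#t B)
E₁ [] = []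
E₁ (true ∷ B) = zero ∷ Vec.map suc (E₁ B)
E₁ (false ∷ B) = Vec.map suc (E₁ B)

E₂ : ∀ {n} (B : Vec Bool n) → Vec (Fin n) (#f B)
E₂ [] = []
E₂ (true ∷ B) = Vec.map suc (E₂ B)
E₂ (false ∷ B) = zero ∷ Vec.map suc (E₂ B)

glue : ∀ {A : Set} {n} (B : Vec Bool n) → Vec A (#t B) → Vec A (#f B) → Vec A n
glue [] c d = []
glue (true ∷ B) (x ∷ c) d = x ∷ glue B c d
glue (false ∷ B) c (y ∷ d) = y ∷ glue B c d

glue-E₁ : ∀ {A : Set} {n} (B : Vec Bool n) (c : Vec A (#t B)) d i → lookup (glue B c d) (lookup (E₁ B) i) ≡ lookup c i
glue-E₁ (true ∷ B) (x ∷ c) d zero = refl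
glue-E₁ (true ∷ B) (x ∷ c) d (suc i) = trans (cong (lookup (x ∷ glue B c d)) (Vecₚ.lookup-map i suc (E₁ B))) (glue-E₁ B c d i)
glue-E₁ (false ∷ B) c (y ∷ d) i = trans (cong (lookup (y ∷ glue B c d)) (Vecₚ.lookup-map i suc (E₁ B))) (glue-E₁ B c d i)

glue-E₂ : ∀ {A : Set} {n} (B : Vec Bool n) (c : Vec A (#t B)) d i → lookup (glue B c d) (lookup (E₂ B) i) ≡ lookup d i
glue-E₂ (false ∷ B) c (y ∷ d) zero = refl
glue-E₂ (true ∷ B) (x ∷ c) d i = trans (cong (lookup (x ∷ glue B c d)) (Vecₚ.lookup-map i suc (E₂ B))) (glue-E₂ B c d i)
glue-E₂ (false ∷ B) c (y ∷ d) (suc i) = trans (cong (lookup (y ∷ glue B c d)) (Vecₚ.lookup-map i suc (E₂ B))) (glue-E₂ B c d i)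

locate : ∀ {n} (B : Vec Bool n) s →
  (lookup B s ≡ true × Σ[ i ∈ Fin (#t B) ] lookup (E₁ B) i ≡ s) ⊎ (lookup B s ≡ false × Σ[ i ∈ Fin (#f B) ] lookup (E₂ B) i ≡ s)
locate (true ∷ B) zero = inj₁ (refl , zero , refl)
locate (false ∷ B) zero = inj₂ (refl , zero , refl)
locate (true ∷ B) (suc s) with locate B s
... | inj₁ (h , i , e) = inj₁ (h , suc i , trans (Vecₚ.lookup-map i suc (E₁ B)) (cong suc e))
... | inj₂ (h , i , e) = inj₂ (h , i , trans (Vecₚ.lookup-map i suc (E₂ B)) (cong suc e))
locate (false ∷ B) (suc s) with locate B s
... | inj₁ (h , i , e) = inj₁ (h , i , trans (Vecₚ.lookup-map i suc (E₁ B)) (cong suc e))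
... | inj₂ (h , i , e) = inj₂ (h , suc i , trans (Vecₚ.lookup-map i suc (E₂ B)) (cong suc e))

E₁-true : ∀ {n} (B : Vec Bool n) i → lookup B (lookup (E₁ B) i) ≡ true
E₁-true (true ∷ B) zero = refl
E₁-true (true ∷ B) (suc i) = trans (cong (lookup (true ∷ B)) (Vecₚ.lookup-map i suc (E₁ B))) (E₁-true B i)
E₁-true (false ∷ B) i = trans (cong (lookup (false ∷ B)) (Vecₚ.lookup-map i suc (E₁ B))) (E₁-true B i)

E₂-false : ∀ {n} (B : Vec Bool n) i → lookup B (lookup (E₂ B) i) ≡ false
E₂-false (false ∷ B) zero = refl
E₂-false (true ∷ B) i = trans (cong (lookup (true ∷ B)) (Vecₚ.lookup-map i suc (E₂ B))) (E₂-false B i)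
E₂-false (false ∷ B) (suc i) = trans (cong (lookup (false ∷ B)) (Vecₚ.lookup-map i suc (E₂ B))) (E₂-false B i)

E₁-injective : ∀ {n} (B : Vec Bool n) {i j} → lookup (E₁ B) i ≡ lookup (E₁ B) j → i ≡ j
E₁-injective B {i} {j} e = trans (sym (left i)) (trans (cong (lookup (glue B idV (Vec.replicate _ i))) e) (left j))
  where
  left : ∀ k → lookup (glue B idV (Vec.replicate _ i)) (lookup (E₁ B) k) ≡ k
  left k = trans (glue-E₁ B idV _ k) (Vecₚ.lookup-allFin k)

E₂-injective : ∀ {n} (B : Vec Bool n) {i j} → lookup (E₂ B) i ≡ lookup (E₂ B) j → i ≡ j
E₂-injective B {i} {j} e = trans (sym (left i)) (trans (cong (lookup (glue B (Vec.replicate _ i) idV)) e) (left j))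
  where
  left : ∀ k → lookup (glue B (Vec.replicate _ i) idV) (lookup (E₂ B) k) ≡ k
  left k = trans (glue-E₂ B _ idV k) (Vecₚ.lookup-allFin k)

glue-∙₁ : ∀ {A : Set} {n} (B : Vec Bool n) (c : Vec A (#t B)) d → glue B c d ∙ E₁ B ≡ c
glue-∙₁ B c d = lookup-ext (λ i → trans (lookup-∙ (glue B c d) (E₁ B) i) (glue-E₁ B c d i))

glue-∙₂ : ∀ {A : Set} {n} (B : Vec Bool n) (c : Vec A (#t B)) d → glue B c d ∙ E₂ B ≡ d
glue-∙₂ B c d = lookup-ext (λ i → trans (lookup-∙ (glue B c d) (E₂ B) i) (glue-E₂ B c d i))

split-ext : ∀ {A : Set} {n} (B : Vec Bool n) {u v : Vec A n} → u ∙ E₁ B ≡ v ∙ E₁ B → u ∙ E₂ B ≡ v ∙ E₂ B → u ≡ v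
split-ext B {u} {v} e f = lookup-ext go
  where
  at : ∀ {k} (E : Vec (Fin _) k) → u ∙ E ≡ v ∙ E → ∀ i → lookup u (lookup E i) ≡ lookup v (lookup E i)
  at E e i = trans (sym (lookup-∙ u E i)) (trans (cong (λ w → lookup w i) e) (lookup-∙ v E i))
  go : ∀ s → lookup u s ≡ lookup v s
  go s with locate B s
  ... | inj₁ (_ , i , refl) = at (E₁ B) e i
  ... | inj₂ (_ , i , refl) = at (E₂ B) f i

∑-glue : ∀ {A : Set} (xs : List A) {n} (B : Vec Bool n) (G : Vec A n → ℤ) →
  ∑ (vecsOver xs n) G ≡ ∑[ c ∈ vecsOver xs (#t B) ] ∑[ d ∈ vecsOver xs (#f B) ] G (glue B c d)
∑-glue xs [] G = sym (ℤₚ.+-identityʳ _)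
∑-glue xs {suc n} (true ∷ B) G = trans (∑-cons xs n G)
  (trans (∑-cong xs (λ x → ∑-glue xs B (λ c → G (x ∷ c)))) (sym (∑-cons xs (#t B) _)))
∑-glue xs {suc n} (false ∷ B) G = trans (∑-cons xs n G)
  (trans (∑-cong xs (λ x → ∑-glue xs B (λ c → G (x ∷ c))))
    (trans (∑-swap xs (vecsOver xs (#t B)) _) (∑-cong (vecsOver xs (#t B)) (λ c → sym (∑-cons xs (#f B) _)))))

merge : ∀ {n} (B : Vec Bool n) → Vec (Fin (#t B)) (#t B) → Vec (Fin (#f B)) (#f B) → Vec (Fin n) n
merge B u v = glue B (E₁ B ∙ u) (E₂ B ∙ v)

merge-∙ : ∀ {n} (B : Vec Bool n) u v u′ v′ → merge B u v ∙ merge B u′ v′ ≡ merge B (u ∙ u′) (v ∙ v′)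
merge-∙ B u v u′ v′ = split-ext B
  (begin
    merge B u v ∙ merge B u′ v′ ∙ E₁ B    ≡⟨ trans (∙-assoc (merge B u v) (merge B u′ v′) (E₁ B)) (cong (merge B u v ∙_) (glue-∙₁ B (E₁ B ∙ u′) (E₂ B ∙ v′))) ⟩
    merge B u v ∙ (E₁ B ∙ u′)             ≡⟨ trans (sym (∙-assoc (merge B u v) (E₁ B) u′)) (cong (_∙ u′) (glue-∙₁ B (E₁ B ∙ u) (E₂ B ∙ v))) ⟩
    E₁ B ∙ u ∙ u′                         ≡⟨ trans (∙-assoc (E₁ B) u u′) (sym (glue-∙₁ B (E₁ B ∙ (u ∙ u′)) (E₂ B ∙ (v ∙ v′)))) ⟩
    merge B (u ∙ u′) (v ∙ v′) ∙ E₁ B      ∎)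
  (begin
    merge B u v ∙ merge B u′ v′ ∙ E₂ B    ≡⟨ trans (∙-assoc (merge B u v) (merge B u′ v′) (E₂ B)) (cong (merge B u v ∙_) (glue-∙₂ B (E₁ B ∙ u′) (E₂ B ∙ v′))) ⟩
    merge B u v ∙ (E₂ B ∙ v′)             ≡⟨ trans (sym (∙-assoc (merge B u v) (E₂ B) v′)) (cong (_∙ v′) (glue-∙₂ B (E₁ B ∙ u) (E₂ B ∙ v))) ⟩
    E₂ B ∙ v ∙ v′                         ≡⟨ trans (∙-assoc (E₂ B) v v′) (sym (glue-∙₂ B (E₁ B ∙ (u ∙ u′)) (E₂ B ∙ (v ∙ v′)))) ⟩
    merge B (u ∙ u′) (v ∙ v′) ∙ E₂ B      ∎)
  where open ≡-Reasoning

merge-id : ∀ {n} (B : Vec Bool n) → merge B idV idV ≡ idV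
merge-id B = split-ext B
  (trans (glue-∙₁ B (E₁ B ∙ idV) (E₂ B ∙ idV)) (trans (∙-identityʳ (E₁ B)) (sym (∙-identityˡ (E₁ B)))))
  (trans (glue-∙₂ B (E₁ B ∙ idV) (E₂ B ∙ idV)) (trans (∙-identityʳ (E₂ B)) (sym (∙-identityˡ (E₂ B)))))

merge-perm : ∀ {n} (B : Vec Bool n) {u v} → IsPerm u → IsPerm v → IsPerm (merge B u v)
merge-perm B {u} {v} p q = retract-perm {ρ = merge B (inverse p) (inverse q)}
  (trans (merge-∙ B (inverse p) (inverse q) u v) (trans (cong₂ (merge B) (∙-inverseˡ p) (∙-inverseˡ q)) (merge-id B)))

lookup-merge₁ : ∀ {n} (B : Vec Bool n) u v i → lookup (merge B u v) (lookup (E₁ B) i) ≡ lookup (E₁ B) (lookup u i)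
lookup-merge₁ B u v i = trans (glue-E₁ B (E₁ B ∙ u) (E₂ B ∙ v) i) (lookup-∙ (E₁ B) u i)

lookup-merge₂ : ∀ {n} (B : Vec Bool n) u v i → lookup (merge B u v) (lookup (E₂ B) i) ≡ lookup (E₂ B) (lookup v i)
lookup-merge₂ B u v i = trans (glue-E₂ B (E₁ B ∙ u) (E₂ B ∙ v) i) (lookup-∙ (E₂ B) v i)

merge-injective : ∀ {n} (B : Vec Bool n) {u v u′ v′} → merge B u v ≡ merge B u′ v′ → u ≡ u′ × v ≡ v′
merge-injective B {u} {v} {u′} {v′} e =
  lookup-ext (λ i → E₁-injective B (trans (sym (lookup-merge₁ B u v i)) (trans (cong (λ w → lookup w (lookup (E₁ B) i)) e) (lookup-merge₁ B u′ v′ i)))) ,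
  lookup-ext (λ i → E₂-injective B (trans (sym (lookup-merge₂ B u v i)) (trans (cong (λ w → lookup w (lookup (E₂ B) i)) e) (lookup-merge₂ B u′ v′ i))))

Fix-merge : ∀ N {n} (B : Vec Bool n) u v → Fix N (merge B u v) ≡ Fix N u * Fix N v
Fix-merge N {n} B u v = begin
  Fix N (merge B u v)
    ≡⟨ ∑-glue (allFin N) B _ ⟩
  (∑[ c ∈ cols N (#t B) ] ∑[ d ∈ cols N (#f B) ] ⟨ (glue B c d ∙ merge B u v) ≟ᵛ glue B c d ⟩)
    ≡⟨ ∑-cong (cols N (#t B)) (λ c → trans (∑-cong (cols N (#f B)) (λ d → trans
         (⟨⟩-cong _ ((c ∙ u) ≟ᵛ c ×-dec (d ∙ v) ≟ᵛ d) (fwd c d) (bwd c d)) (⟨⟩-× ((c ∙ u) ≟ᵛ c) ((d ∙ v) ≟ᵛ d))))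
         (sym (∑-*ˡ (cols N (#f B)) ⟨ (c ∙ u) ≟ᵛ c ⟩ (λ d → ⟨ (d ∙ v) ≟ᵛ d ⟩)))) ⟩
  (∑[ c ∈ cols N (#t B) ] ⟨ (c ∙ u) ≟ᵛ c ⟩ * Fix N v)
    ≡⟨ ∑-*ʳ (cols N (#t B)) (Fix N v) _ ⟨
  Fix N u * Fix N v ∎
  where
  open ≡-Reasoning
  r₁ : ∀ (c : Vec (Fin N) _) d → glue B c d ∙ merge B u v ∙ E₁ B ≡ c ∙ u
  r₁ c d = trans (∙-assoc (glue B c d) (merge B u v) (E₁ B)) (trans (cong (glue B c d ∙_) (glue-∙₁ B (E₁ B ∙ u) (E₂ B ∙ v)))
    (trans (sym (∙-assoc (glue B c d) (E₁ B) u)) (cong (_∙ u) (glue-∙₁ B c d))))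
  r₂ : ∀ (c : Vec (Fin N) _) d → glue B c d ∙ merge B u v ∙ E₂ B ≡ d ∙ v
  r₂ c d = trans (∙-assoc (glue B c d) (merge B u v) (E₂ B)) (trans (cong (glue B c d ∙_) (glue-∙₂ B (E₁ B ∙ u) (E₂ B ∙ v)))
    (trans (sym (∙-assoc (glue B c d) (E₂ B) v)) (cong (_∙ v) (glue-∙₂ B c d))))
  fwd : ∀ c d → glue B c d ∙ merge B u v ≡ glue B c d → (c ∙ u ≡ c) × (d ∙ v ≡ d)
  fwd c d e = trans (sym (r₁ c d)) (trans (cong (_∙ E₁ B) e) (glue-∙₁ B c d)) ,
              trans (sym (r₂ c d)) (trans (cong (_∙ E₂ B) e) (glue-∙₂ B c d))
  bwd : ∀ c d → (c ∙ u ≡ c) × (d ∙ v ≡ d) → glue B c d ∙ merge B u v ≡ glue B c d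
  bwd c d (e , f) = split-ext B (trans (r₁ c d) (trans e (sym (glue-∙₁ B c d)))) (trans (r₂ c d) (trans f (sym (glue-∙₂ B c d))))

mergeT : ∀ {m n} (B : Vec Bool n) → Tuple m (#t B) → Tuple m (#f B) → Tuple m n
mergeT B = Vec.zipWith (merge B)

prod-mergeT : ∀ {m n} (B : Vec Bool n) (t : Tuple m (#t B)) u → prod (mergeT B t u) ≡ merge B (prod t) (prod u)
prod-mergeT B [] [] = sym (merge-id B)
prod-mergeT B (σ ∷ t) (ρ ∷ u) = trans (cong (_∙ merge B σ ρ) (prod-mergeT B t u)) (merge-∙ B (prod t) (prod u) σ ρ)

colourWeight-mergeT : ∀ N {m n} (B : Vec Bool n) (t : Tuple m (#t B)) u →
  colourWeight N (mergeT B t u) ≡ colourWeight N t * colourWeight N u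
colourWeight-mergeT N B t u = trans
  (cong₂ _*_ (∏Fix-mergeT t u) (trans (cong (Fix N) (prod-mergeT B t u)) (Fix-merge N B (prod t) (prod u))))
  (interchange (∏Fix N t) (∏Fix N u) (Fix N (prod t)) (Fix N (prod u)))
  where
  interchange : ∀ a b c d → (a * b) * (c * d) ≡ (a * c) * (b * d)
  interchange = ℤ-Solver.solve-∀
  ∏Fix-mergeT : ∀ {m} (t : Tuple m (#t B)) u → ∏Fix N (mergeT B t u) ≡ ∏Fix N t * ∏Fix N u
  ∏Fix-mergeT [] [] = refl
  ∏Fix-mergeT (σ ∷ t) (ρ ∷ u) = trans (cong₂ _*_ (Fix-merge N B σ ρ) (∏Fix-mergeT t u))
    (interchange (Fix N σ) (Fix N ρ) (∏Fix N t) (∏Fix N u))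

Closed : ∀ {n} → Vec Bool n → Vec (Fin n) n → Set
Closed B σ = ∀ s → lookup B s ≡ true → lookup B (lookup σ s) ≡ true

-- A permutation of a finite set preserving a subset preserves its complement.
unmerge : ∀ {n} (B : Vec Bool n) {σ : Vec (Fin n) n} → IsPerm σ → Closed B σ →
  Σ[ u ∈ Vec (Fin (#t B)) (#t B) ] Σ[ v ∈ Vec (Fin (#f B)) (#f B) ] IsPerm u × IsPerm v × merge B u v ≡ σ
unmerge {n} B {σ} p closed = u , v , u-perm , v-perm , split-ext B
  (trans (glue-∙₁ B (E₁ B ∙ u) (E₂ B ∙ v)) (lookup-ext (λ i → trans (lookup-∙ (E₁ B) u i) (trans (u-eq i) (sym (lookup-∙ σ (E₁ B) i))))))
  (trans (glue-∙₂ B (E₁ B ∙ u) (E₂ B ∙ v)) (lookup-ext (λ i → trans (lookup-∙ (E₂ B) v i) (trans (v-eq i) (sym (lookup-∙ σ (E₂ B) i))))))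
  where
  pre₁ : ∀ i → Σ[ j ∈ Fin (#t B) ] lookup (E₁ B) j ≡ lookup σ (lookup (E₁ B) i)
  pre₁ i with locate B (lookup σ (lookup (E₁ B) i))
  ... | inj₁ (_ , r) = r
  ... | inj₂ (e , _) = contradiction (trans (sym (closed _ (E₁-true B i))) e) λ ()
  u : Vec (Fin (#t B)) (#t B)
  u = tabulate (λ i → proj₁ (pre₁ i))
  u-eq : ∀ i → lookup (E₁ B) (lookup u i) ≡ lookup σ (lookup (E₁ B) i)
  u-eq i = trans (cong (lookup (E₁ B)) (Vecₚ.lookup∘tabulate _ i)) (proj₂ (pre₁ i))
  u-perm : IsPerm u
  u-perm .IsPerm.injective i j e = E₁-injective B (IsPerm.injective p _ _ (trans (sym (u-eq i)) (trans (cong (lookup (E₁ B)) e) (u-eq j))))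
  pre₂ : ∀ i → Σ[ j ∈ Fin (#f B) ] lookup (E₂ B) j ≡ lookup σ (lookup (E₂ B) i)
  pre₂ i with locate B (lookup σ (lookup (E₂ B) i))
  ... | inj₂ (_ , r) = r
  -- The restriction u to the subset is already onto it, so σ would take the same value at a point
  -- of the subset and at one outside.
  ... | inj₁ (_ , j , e) = contradiction (trans (sym (E₁-true B k))
      (trans (cong (lookup B) (IsPerm.injective p _ _ (trans (sym (u-eq k)) (trans (cong (lookup (E₁ B)) (proj₂ (perm-surjective u-perm j))) e))))
        (E₂-false B i))) λ ()
    where
    k = proj₁ (perm-surjective u-perm j)
  v : Vec (Fin (#f B)) (#f B)
  v = tabulate (λ i → proj₁ (pre₂ i))
  v-eq : ∀ i → lookup (E₂ B) (lookup v i) ≡ lookup σ (lookup (E₂ B) i)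
  v-eq i = trans (cong (lookup (E₂ B)) (Vecₚ.lookup∘tabulate _ i)) (proj₂ (pre₂ i))
  v-perm : IsPerm v
  v-perm .IsPerm.injective i j e = E₂-injective B (IsPerm.injective p _ _ (trans (sym (v-eq i)) (trans (cong (lookup (E₂ B)) e) (v-eq j))))

unmergeT : ∀ {m n} (B : Vec Bool n) {t : Tuple m n} → AllV IsPerm t → AllV (Closed B) t →
  Σ[ u ∈ Tuple m (#t B) ] Σ[ v ∈ Tuple m (#f B) ] AllV IsPerm u × AllV IsPerm v × mergeT B u v ≡ t
unmergeT B {[]} ps cs = [] , [] , (λ ()) , (λ ()) , refl
unmergeT B {σ ∷ t} ps cs with unmerge B (ps zero) (cs zero) | unmergeT B {t} (λ i → ps (suc i)) (λ i → cs (suc i))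
... | u , v , p , q , e | us , vs , ps′ , qs′ , e′ =
  u ∷ us , v ∷ vs , (λ { zero → p ; (suc i) → ps′ i }) , (λ { zero → q ; (suc i) → qs′ i }) , cong₂ _∷_ e e′

-- Connected components and the exponential formula

reach-refl : ∀ {m n} (t : Tuple m n) r k → reach t r k r ≡ true
reach-refl t r zero = ≡⇒== refl
reach-refl t r (suc k) rewrite reach-refl t r k = refl

reach-suc : ∀ {m n} (t : Tuple m n) r k s → reach t r k s ≡ true → reach t r (suc k) s ≡ true
reach-suc t r k s h rewrite h = refl

reach-step : ∀ {m n} (t : Tuple m n) r k i s → reach t r k s ≡ true → reach t r (suc k) (τ t i s) ≡ true
reach-step {m} {n} t r k i s h with reach t r k (τ t i s)
... | true = refl
... | false = any-true⁺ _ (allFin m) (∈ₚ.∈-allFin i) (any-true⁺ _ (allFin n) (∈ₚ.∈-allFin s) hit)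
  where
  hit : (reach t r k s ∧ (τ t i s == τ t i s)) ≡ true
  hit rewrite h = ≡⇒== refl

reach-suc⁻ : ∀ {m n} (t : Tuple m n) r k s → reach t r (suc k) s ≡ true →
  reach t r k s ≡ true ⊎ Σ[ i ∈ Fin m ] Σ[ s′ ∈ Fin n ] reach t r k s′ ≡ true × τ t i s′ ≡ s
reach-suc⁻ {m} {n} t r k s h with reach t r k s
... | true = inj₁ refl
... | false with any-true⁻ _ (allFin m) h
... | i , h′ with any-true⁻ _ (allFin n) h′
... | s′ , h″ with reach t r k s′ in eq
... | true = inj₂ (i , s′ , eq , ==⇒≡ h″)

-- The induction principle of reachability: every closed set containing r contains what is reached
-- from it.
reach-minimal : ∀ {m n} (t : Tuple m n) r (S : Fin n → Set) → S r → (∀ i s → S s → S (τ t i s)) →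
  ∀ k s → reach t r k s ≡ true → S s
reach-minimal t r S Sr step zero s h = subst S (==⇒≡ h) Sr
reach-minimal t r S Sr step (suc k) s h with reach-suc⁻ t r k s h
... | inj₁ h′ = reach-minimal t r S Sr step k s h′
... | inj₂ (i , s′ , h′ , refl) = step i s′ (reach-minimal t r S Sr step k s′ h′)

count : ∀ {n} → (Fin n → Bool) → ℕ
count {zero} p = 0
count {suc n} p = (if p zero then 1 else 0) ℕ.+ count (λ i → p (suc i))

count≤n : ∀ {n} (p : Fin n → Bool) → count p ≤ n
count≤n {zero} p = z≤n
count≤n {suc n} p with p zero
... | true = s≤s (count≤n _)
... | false = ℕₚ.m≤n⇒m≤1+n (count≤n _)

count-mono : ∀ {n} (p q : Fin n → Bool) → (∀ i → p i ≡ true → q i ≡ true) → count p ≤ count q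
count-mono {zero} p q h = z≤n
count-mono {suc n} p q h with p zero | q zero | h zero
... | true | true | _ = s≤s (count-mono _ _ (λ i → h (suc i)))
... | true | false | f = contradiction (f refl) λ ()
... | false | true | _ = ℕₚ.m≤n⇒m≤1+n (count-mono _ _ (λ i → h (suc i)))
... | false | false | _ = count-mono _ _ (λ i → h (suc i))

count-strict : ∀ {n} (p q : Fin n → Bool) → (∀ i → p i ≡ true → q i ≡ true) → ∀ j → p j ≡ false → q j ≡ true → count p < count q
count-strict {suc n} p q h zero e f rewrite e | f = s≤s (count-mono _ _ (λ i → h (suc i)))
count-strict {suc n} p q h (suc j) e f with p zero | q zero | h zero
... | true | true | _ = s≤s (count-strict _ _ (λ i → h (suc i)) j e f)
... | true | false | g = contradiction (g refl) λ ()
... | false | true | _ = ℕₚ.m≤n⇒m≤1+n (count-strict _ _ (λ i → h (suc i)) j e f)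
... | false | false | _ = count-strict _ _ (λ i → h (suc i)) j e f

module _ {m n : ℕ} (t : Tuple m n) (r : Fin n) where
  private
    Stable : ℕ → Set
    Stable k = ∀ s → reach t r (suc k) s ≡ true → reach t r k s ≡ true

    stable-suc : ∀ k → Stable k → Stable (suc k)
    stable-suc k st s h with reach-suc⁻ t r (suc k) s h
    ... | inj₁ h′ = h′
    ... | inj₂ (i , s′ , h′ , refl) = reach-step t r k i s′ (st s′ h′)

    stable? : ∀ k → Stable k ⊎ Σ[ s ∈ Fin n ] (reach t r k s ≡ false) × (reach t r (suc k) s ≡ true)
    stable? k with Finₚ.any? (λ s → (reach t r k s Boolₚ.≟ false) ×-dec (reach t r (suc k) s Boolₚ.≟ true))
    ... | yes w = inj₂ w
    ... | no ¬w = inj₁ (λ s h → go s h (reach t r k s) refl)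
      where
      go : ∀ s → reach t r (suc k) s ≡ true → ∀ b → reach t r k s ≡ b → reach t r k s ≡ true
      go s h true e = e
      go s h false e = contradiction (s , e , h) ¬w

    -- As long as the search has not stabilised, each step reaches a new point.
    grows : ∀ k → Stable k ⊎ k < count (reach t r k)
    grows zero = inj₂ (lower (count-strict (λ _ → false) (reach t r 0) (λ _ ()) r refl (reach-refl t r 0)))
      where
      lower : ∀ {a b} → a < b → 0 < b
      lower (s≤s _) = s≤s z≤n
    grows (suc k) with grows k
    ... | inj₁ st = inj₁ (stable-suc k st)
    ... | inj₂ lt with stable? k
    ... | inj₁ st = inj₁ (stable-suc k st)
    ... | inj₂ (s , e , f) = inj₂ (ℕₚ.≤-trans (s≤s lt) (count-strict (reach t r k) (reach t r (suc k)) (reach-suc t r k) s e f))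

  -- Justifies the bound n in `isConnected`: a search that has not stabilised after n steps would
  -- have reached more than n points.
  reach-closed : ∀ i s → reach t r n s ≡ true → reach t r n (τ t i s) ≡ true
  reach-closed i s h with grows n
  ... | inj₁ st = st _ (reach-step t r n i s h)
  ... | inj₂ lt = contradiction (ℕₚ.≤-trans lt (count≤n (reach t r n))) ℕₚ.1+n≰n

component : ∀ {m n} → Tuple m n → Fin n → Vec Bool n
component {n = n} t r = tabulate (reach t r n)

lookup-component : ∀ {m n} (t : Tuple m n) r s → lookup (component t r) s ≡ reach t r n s
lookup-component {n = n} t r s = Vecₚ.lookup∘tabulate (reach t r n) s

component-closed : ∀ {m n} (t : Tuple m n) r → AllV (Closed (component t r)) t
component-closed t r i s h = trans (lookup-component t r _) (reach-closed t r i s (trans (sym (lookup-component t r s)) h))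

-- Reachability along permutations is symmetric, because by `unmerge` a closed set has a closed
-- complement.
connected⁺ : ∀ {m n} (t : Tuple m (suc n)) → AllV IsPerm t → (∀ s → reach t zero (suc n) s ≡ true) → isConnected t ≡ true
connected⁺ {m} {n} t ps h = all-true⁺ _ (allFin (suc n)) (λ {r} _ → all-true⁺ _ (allFin (suc n)) (λ {s} _ →
  reach-minimal t zero (λ s → reach t r (suc n) s ≡ true) (zero∈ r) (reach-closed t r) (suc n) s (h s)))
  where
  -- Otherwise the complement of the component of r would be closed and contain 0.
  zero∈ : ∀ r → reach t r (suc n) zero ≡ true
  zero∈ r with reach t r (suc n) zero in eq
  ... | true = refl
  ... | false = contradiction (trans (sym (reach-refl t r (suc n))) (trans (sym (lookup-component t r r))
      (reach-minimal t zero (λ s → lookup B s ≡ false) (trans (lookup-component t r zero) eq) step (suc n) r (h r)))) λ ()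
    where
    B = component t r
    step : ∀ i s → lookup B s ≡ false → lookup B (τ t i s) ≡ false
    step i s e with unmerge B (ps i) (component-closed t r i)
    ... | u , v , _ , _ , eq′ with locate B s
    ... | inj₁ (e′ , _) = contradiction (trans (sym e) e′) λ ()
    ... | inj₂ (_ , k , refl) = trans (cong (λ w → lookup B (lookup w (lookup (E₂ B) k))) (sym eq′))
      (trans (cong (lookup B) (lookup-merge₂ B u v k)) (E₂-false B _))

connected⁻ : ∀ {m n} (t : Tuple m n) → isConnected t ≡ true → ∀ r s → reach t r n s ≡ true
connected⁻ {n = n} t h r s = all-true⁻ _ (allFin n) (all-true⁻ _ (allFin n) h (∈ₚ.∈-allFin r)) (∈ₚ.∈-allFin s)

τ-mergeT : ∀ {m n} (B : Vec Bool n) (t : Tuple m (#t B)) u i s → τ (mergeT B t u) i s ≡ lookup (merge B (lookup t i) (lookup u i)) s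
τ-mergeT B t u i s = cong (λ v → lookup v s) (Vecₚ.lookup-zipWith (merge B) i t u)

module _ {m n : ℕ} (B : Vec Bool n) (t : Tuple m (#t (true ∷ B))) (u : Tuple m (#f (true ∷ B))) where
  private
    B⁺ = true ∷ B
    M = mergeT B⁺ t u
    e : Fin (#t B⁺) → Fin (suc n)
    e = lookup (E₁ B⁺)
    along : ∀ i k → τ M i (e k) ≡ e (τ t i k)
    along i k = trans (τ-mergeT B⁺ t u i (e k)) (lookup-merge₁ B⁺ (lookup t i) (lookup u i) k)

  component-mergeT⁺ : isConnected t ≡ true → component M zero ≡ B⁺
  component-mergeT⁺ conn = lookup-ext (λ s → trans (lookup-component M zero s) (go s))
    where
    inside : ∀ k → reach M zero (suc n) (e k) ≡ true
    inside k = reach-minimal t zero (λ k → reach M zero (suc n) (e k) ≡ true) (reach-refl M zero (suc n))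
      (λ i k h → subst (λ s → reach M zero (suc n) s ≡ true) (along i k) (reach-closed M zero i (e k) h)) (#t B⁺) k (connected⁻ t conn zero k)
    outside : ∀ s → reach M zero (suc n) s ≡ true → lookup B⁺ s ≡ true
    outside = reach-minimal M zero (λ s → lookup B⁺ s ≡ true) refl step (suc n)
      where
      step : ∀ i s → lookup B⁺ s ≡ true → lookup B⁺ (τ M i s) ≡ true
      step i s h with locate B⁺ s
      ... | inj₁ (_ , k , refl) = trans (cong (lookup B⁺) (along i k)) (E₁-true B⁺ (τ t i k))
      ... | inj₂ (h′ , _) = contradiction (trans (sym h) h′) λ ()
    go : ∀ s → reach M zero (suc n) s ≡ lookup B⁺ s
    go s with locate B⁺ s
    ... | inj₁ (h , k , refl) = trans (inside k) (sym h)
    ... | inj₂ (h , _) with reach M zero (suc n) s in eq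
    ... | false = sym h
    ... | true = sym (outside s eq)

  component-mergeT⁻ : AllV IsPerm t → component M zero ≡ B⁺ → isConnected t ≡ true
  component-mergeT⁻ ps eq = connected⁺ t ps (λ k → extract k (reach-minimal M zero S
      (zero , refl , reach-refl t zero (#t B⁺)) step (suc n) (e k)
      (trans (sym (lookup-component M zero (e k))) (trans (cong (λ v → lookup v (e k)) eq) (E₁-true B⁺ k)))))
    where
    S : Fin (suc n) → Set
    S s = Σ[ k ∈ Fin (#t B⁺) ] e k ≡ s × reach t zero (#t B⁺) k ≡ true
    step : ∀ i s → S s → S (τ M i s)
    step i s (k , refl , h) = τ t i k , sym (along i k) , reach-closed t zero i k h
    extract : ∀ k → S (e k) → reach t zero (#t B⁺) k ≡ true
    extract k (k′ , eq′ , h) = subst (λ j → reach t zero (#t B⁺) j ≡ true) (E₁-injective B⁺ eq′) h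

connTuples : ∀ m n → List (Tuple m n)
connTuples m n = filterᵇ isConnected (permTuples m n)

_≟ᵗ_ : ∀ {m n} → DecidableEquality (Tuple m n)
_≟ᵗ_ = vec-≟ _≟ᵛ_

permTuples-enumerates : ∀ m n → Enumerates _≟ᵗ_ (permTuples m n) (AllV IsPerm)
permTuples-enumerates m n = vecsOver-enumerates (perms-enumerates n) m

connTuples-enumerates : ∀ m n → Enumerates _≟ᵗ_ (connTuples m n) (λ t → AllV IsPerm t × isConnected t ≡ true)
connTuples-enumerates m n = filterᵇ-enumerates (permTuples-enumerates m n) isConnected

bools : List Bool
bools = true ∷ false ∷ []

_≟ᴮ_ : ∀ {n} → DecidableEquality (Vec Bool n)
_≟ᴮ_ = vec-≟ Boolₚ._≟_

bools-enumerates : ∀ n → Enumerates _≟ᴮ_ (vecsOver bools n) (λ _ → ⊤)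
bools-enumerates n = weaken (λ _ → tt) (λ _ _ → tt) (vecsOver-enumerates base n)
  where
  base : Enumerates Boolₚ._≟_ bools (λ _ → ⊤)
  base .Enumerates.sound _ = tt
  base .Enumerates.once {true} _ = refl
  base .Enumerates.once {false} _ = refl

mergeT-injective : ∀ {m n} (B : Vec Bool n) {t t′ : Tuple m (#t B)} {u u′ : Tuple m (#f B)} →
  mergeT B t u ≡ mergeT B t′ u′ → t ≡ t′ × u ≡ u′
mergeT-injective B {[]} {[]} {[]} {[]} e = refl , refl
mergeT-injective B {σ ∷ t} {σ′ ∷ t′} {ρ ∷ u} {ρ′ ∷ u′} e
  with merge-injective B (Vecₚ.∷-injectiveˡ e) | mergeT-injective B {t} {t′} {u} {u′} (Vecₚ.∷-injectiveʳ e)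
... | refl , refl | refl , refl = refl , refl

module _ (N m : ℕ) where
  totalWeight connWeight : Seq
  totalWeight n = ∑[ t ∈ permTuples m n ] colourWeight N t
  connWeight n = ∑[ t ∈ connTuples m n ] colourWeight N t

  private
    withComponent : ∀ n → Vec Bool n → List (Tuple m (suc n))
    withComponent n B = filterᵇ (λ t → ⌊ component t zero ≟ᴮ (true ∷ B) ⌋) (permTuples m (suc n))

  -- A tuple with the prescribed component of 0 is a connected tuple on it and an arbitrary one on
  -- the complement, and cycles never cross between the two, so weights multiply.
  component-sum : ∀ n (B : Vec Bool n) →
    (∑[ t ∈ permTuples m (suc n) ] ⟨ component t zero ≟ᴮ (true ∷ B) ⟩ * colourWeight N t) ≡
    connWeight (suc (#t B)) * totalWeight (#f B)
  component-sum n B = begin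
    (∑[ t ∈ permTuples m (suc n) ] ⟨ component t zero ≟ᴮ (true ∷ B) ⟩ * colourWeight N t)
      ≡⟨ ∑-cong (permTuples m (suc n)) (λ t → cong (_* colourWeight N t) (ι-⌊⌋ (component t zero ≟ᴮ (true ∷ B)))) ⟨
    (∑[ t ∈ permTuples m (suc n) ] ι ⌊ component t zero ≟ᴮ (true ∷ B) ⌋ * colourWeight N t)
      ≡⟨ ∑-filterᵇ _ (permTuples m (suc n)) (colourWeight N) ⟨
    ∑ (withComponent n B) (colourWeight N)
      ≡⟨ reindex (cartesianProduct-enumerates (connTuples-enumerates m (suc (#t B))) (permTuples-enumerates m (#f B)))
           (filterᵇ-enumerates (permTuples-enumerates m (suc n)) (λ t → ⌊ component t zero ≟ᴮ (true ∷ B) ⌋))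
           (λ (t , u) → mergeT (true ∷ B) t u)
           (λ {(t , u)} ((ps , c) , qs) →
             (λ i → subst IsPerm (sym (Vecₚ.lookup-zipWith (merge (true ∷ B)) i t u)) (merge-perm (true ∷ B) (ps i) (qs i))) ,
             true-⌊⌋ (component (mergeT (true ∷ B) t u) zero ≟ᴮ (true ∷ B)) (component-mergeT⁺ B t u c))
           (λ _ _ e → let (e₁ , e₂) = mergeT-injective (true ∷ B) e in cong₂ _,_ e₁ e₂)
           surj (colourWeight N) ⟨
    (∑[ (t , u) ∈ cartesianProduct (connTuples m (suc (#t B))) (permTuples m (#f B)) ] colourWeight N (mergeT (true ∷ B) t u))
      ≡⟨ ∑-cartesianProduct (connTuples m (suc (#t B))) (permTuples m (#f B)) _ ⟩
    (∑[ t ∈ connTuples m (suc (#t B)) ] ∑[ u ∈ permTuples m (#f B) ] colourWeight N (mergeT (true ∷ B) t u))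
      ≡⟨ ∑-cong (connTuples m (suc (#t B))) (λ t → trans (∑-cong (permTuples m (#f B)) (colourWeight-mergeT N (true ∷ B) t))
           (sym (∑-*ˡ (permTuples m (#f B)) (colourWeight N t) (colourWeight N)))) ⟩
    (∑[ t ∈ connTuples m (suc (#t B)) ] colourWeight N t * totalWeight (#f B))
      ≡⟨ ∑-*ʳ (connTuples m (suc (#t B))) (totalWeight (#f B)) (colourWeight N) ⟨
    connWeight (suc (#t B)) * totalWeight (#f B) ∎
    where
    open ≡-Reasoning
    surj : ∀ {t} → AllV IsPerm t × ⌊ component t zero ≟ᴮ (true ∷ B) ⌋ ≡ true →
      Σ[ x ∈ _ ] ((AllV IsPerm (proj₁ x) × isConnected (proj₁ x) ≡ true) × AllV IsPerm (proj₂ x)) × mergeT (true ∷ B) (proj₁ x) (proj₂ x) ≡ t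
    surj {t} (ps , h) with ⌊⌋-true (component t zero ≟ᴮ (true ∷ B)) h
    ... | eq with unmergeT (true ∷ B) {t} ps (subst (λ C → AllV (Closed C) t) eq (component-closed t zero))
    ... | u , v , pu , pv , refl = (u , v) , ((pu , component-mergeT⁻ B u v pu eq) , pv) , refl

  -- The product of exponential generating functions distributes the labels over two sets; each use
  -- of the Leibniz rule decides the place of one label.
  ⋆-bools : ∀ f g n → (f ⋆ g) n ≡ ∑[ B ∈ vecsOver bools n ] f (#t B) * g (#f B)
  ⋆-bools f g zero = sym (ℤₚ.+-identityʳ _)
  ⋆-bools f g (suc n) = trans (cong₂ _+_ (⋆-bools (∂ f) g n) (⋆-bools f (∂ g) n))
    (sym (trans (∑-cons bools n (λ B → f (#t B) * g (#f B))) (cong (∑ (vecsOver bools n) (λ B → f (suc (#t B)) * g (#f B)) +_) (ℤₚ.+-identityʳ _))))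

  -- The derivative of Z = exp L, obtained by sorting the tuples by the component of 0.
  exponential-formula : ∂ totalWeight ≐ ∂ connWeight ⋆ totalWeight
  exponential-formula n = begin
    (∑[ t ∈ permTuples m (suc n) ] colourWeight N t)
      ≡⟨ ∑-cong (permTuples m (suc n)) (λ t → sym (trans (∑-cong (vecsOver bools n) (λ B →
           cong (_* colourWeight N t) (⟨⟩-cong (component t zero ≟ᴮ (true ∷ B)) (B ≟ᴮ rest t)
             (λ e → Vecₚ.∷-injectiveʳ (trans (sym e) (whole t))) (λ e → trans (whole t) (cong (true ∷_) (sym e))))))
           (Enumerates.pick (bools-enumerates n) {rest t} tt (λ _ → colourWeight N t)))) ⟩
    (∑[ t ∈ permTuples m (suc n) ] ∑[ B ∈ vecsOver bools n ] ⟨ component t zero ≟ᴮ (true ∷ B) ⟩ * colourWeight N t)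
      ≡⟨ ∑-swap (permTuples m (suc n)) (vecsOver bools n) _ ⟩
    (∑[ B ∈ vecsOver bools n ] ∑[ t ∈ permTuples m (suc n) ] ⟨ component t zero ≟ᴮ (true ∷ B) ⟩ * colourWeight N t)
      ≡⟨ ∑-cong (vecsOver bools n) (component-sum n) ⟩
    (∑[ B ∈ vecsOver bools n ] connWeight (suc (#t B)) * totalWeight (#f B))
      ≡⟨ ⋆-bools (∂ connWeight) totalWeight n ⟨
    (∂ connWeight ⋆ totalWeight) n ∎
    where
    open ≡-Reasoning
    rest : Tuple m (suc n) → Vec Bool n
    rest t = Vec.tail (component t zero)
    whole : ∀ t → component t zero ≡ true ∷ rest t
    whole t = cong (_∷ rest t) (reach-refl t zero (suc n))

-- The Toda equation for connected tuples

z· : Seq → Seq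
z· f zero = 0ℤ
z· f (suc n) = pos (suc n) * f n

z·-∂ : ∀ f → z· (∂ f) ≐ 𝓓 f
z·-∂ f zero = sym (ℤₚ.*-zeroˡ (f zero))
z·-∂ f (suc n) = refl

∂-z· : ∀ f → ∂ (z· f) ≐ 𝓓 f ⊹ f
∂-z· f n = trans (ℤₚ.suc-* (pos n) (f n)) (ℤₚ.+-comm (f n) _)

z·-move : ∀ f h → z· f ⋆ h ≐ f ⋆ z· h
z·-move f h zero = trans (ℤₚ.*-zeroˡ (h zero)) (sym (ℤₚ.*-zeroʳ (f zero)))
z·-move f h (suc n) = begin
  (∂ (z· f) ⋆ h) n + (z· f ⋆ ∂ h) n
    ≡⟨ cong₂ _+_ (trans (⋆-cong (∂-z· f) (λ _ → refl) n) (⋆-distribʳ h (𝓓 f) f n))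
         (trans (z·-move f (∂ h) n) (⋆-cong {f} (λ _ → refl) (z·-∂ h) n)) ⟩
  ((𝓓 f ⋆ h) n + (f ⋆ h) n) + (f ⋆ 𝓓 h) n
    ≡⟨ arrange ((𝓓 f ⋆ h) n) ((f ⋆ h) n) ((f ⋆ 𝓓 h) n) ⟩
  (𝓓 f ⋆ h) n + ((f ⋆ 𝓓 h) n + (f ⋆ h) n)
    ≡⟨ cong₂ _+_ (trans (sym (z·-move (∂ f) h n)) (⋆-cong (z·-∂ f) (λ _ → refl) n))
         (trans (⋆-cong {f} (λ _ → refl) (∂-z· h) n) (⋆-distribˡ f (𝓓 h) h n)) ⟨
  (∂ f ⋆ z· h) n + (f ⋆ ∂ (z· h)) n ∎
  where
  open ≡-Reasoning
  arrange : ∀ a b c → (a + b) + c ≡ a + (c + b)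
  arrange = ℤ-Solver.solve-∀

z·-⋆ : ∀ f h → z· (f ⋆ h) ≐ z· f ⋆ h
z·-⋆ f h zero = sym (ℤₚ.*-zeroˡ (h zero))
z·-⋆ f h (suc n) = begin
  pos (suc n) * (f ⋆ h) n
    ≡⟨ ∂-z· (f ⋆ h) n ⟩
  𝓓 (f ⋆ h) n + (f ⋆ h) n
    ≡⟨ cong (_+ (f ⋆ h) n) (𝓓-⋆ f h n) ⟩
  ((𝓓 f ⋆ h) n + (f ⋆ 𝓓 h) n) + (f ⋆ h) n
    ≡⟨ arrange ((𝓓 f ⋆ h) n) ((f ⋆ 𝓓 h) n) ((f ⋆ h) n) ⟩
  ((𝓓 f ⋆ h) n + (f ⋆ h) n) + (f ⋆ 𝓓 h) n
    ≡⟨ cong₂ _+_ (trans (⋆-cong (∂-z· f) (λ _ → refl) n) (⋆-distribʳ h (𝓓 f) f n))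
         (trans (z·-move f (∂ h) n) (⋆-cong {f} (λ _ → refl) (z·-∂ h) n)) ⟨
  (∂ (z· f) ⋆ h) n + (z· f ⋆ ∂ h) n ∎
  where
  open ≡-Reasoning
  arrange : ∀ a b c → (a + b) + c ≡ (a + c) + b
  arrange = ℤ-Solver.solve-∀

⋆-leading : ∀ n d y → (∀ j → j < n → d j ≡ 0ℤ) → (d ⋆ y) n ≡ d n * y 0
⋆-leading zero d y h = refl
⋆-leading (suc n) d y h = trans (cong₂ _+_
    (⋆-leading n (∂ d) y (λ j lt → h (suc j) (s≤s lt)))
    (trans (⋆-leading n d (∂ y) (λ j lt → h j (ℕₚ.m≤n⇒m≤1+n lt))) (trans (cong (_* y 1) (h n ℕₚ.≤-refl)) (ℤₚ.*-zeroˡ (y 1)))))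
  (ℤₚ.+-identityʳ _)

-- The lowest nonzero coefficient of f - g would survive in the product, as y starts with 1.
⋆-cancelʳ : ∀ f g y → y 0 ≡ 1ℤ → f ⋆ y ≐ g ⋆ y → f ≐ g
⋆-cancelʳ f g y y₀ h n = ℤₚ.i-j≡0⇒i≡j (f n) (g n) (vanish n)
  where
  open import Data.Nat.Induction using (<-rec)
  d : Seq
  d = f ⊹ neg g
  d⋆y : d ⋆ y ≐ 𝟎
  d⋆y k = trans (⋆-distribʳ y f (neg g) k) (trans (cong ((f ⋆ y) k +_) (negˡ k)) (trans (cong (_- (g ⋆ y) k) (h k)) (ℤₚ.+-inverseʳ ((g ⋆ y) k))))
    where
    negˡ : neg g ⋆ y ≐ neg (g ⋆ y)
    negˡ k = sym (RingProperties.-‿distribˡ-* (CommutativeRing.ring seqRing) g y k)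
  vanish : ∀ n → d n ≡ 0ℤ
  vanish = <-rec _ (λ n ih → trans (sym (ℤₚ.*-identityʳ (d n))) (trans (cong (d n *_) (sym y₀))
    (trans (sym (⋆-leading n d y (λ j lt → ih lt))) (d⋆y n))))

module _ (m : ℕ) where
  private
    Z L g : ℕ → Seq
    Z N = totalWeight N m
    L N = connWeight N m
    g N = 𝓓 (L N)

    Z≐hankel : ∀ N → Z N ≐ hankel m N
    Z≐hankel N = total-hankel N m

    Z₀ : ∀ N → Z N 0 ≡ 1ℤ
    Z₀ N = trans (Z≐hankel N 0) (trans (sym (vand-hankel m N 0)) (trans (⟦⟧-cong (vand N) (λ α → cong (binomials 0)
        (sym (trans (⊞-comm α 𝟘ᵛ) (⊞-identityˡ α))))) one))
      where
      one : ⟦ vand N ⟧ (λ α → binomials 0 (α ⊞ 𝟘ᵛ)) ≡ 1ℤ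
      one = trans (sym (⟦⟧-cong (vand N) (λ α → trans (⟦powerSum⟧ {N} [] (λ β → binomials 0 (α ⊞ β)))
          (trans (ℤₚ.+-identityʳ _) (trans (cong (_* binomials 0 (α ⊞ 𝟘ᵛ)) (⟨⟩-yes (([] ∙ []) ≟ᵛ []) (vec₀-unique ([] ∙ []) []))) (ℤₚ.*-identityˡ _))))))
        (trans (powerSumᵛ-binomials {N} []) (Fix-empty N))
    𝓓Z : ∀ N → 𝓓 (Z N) ≐ g N ⋆ Z N
    𝓓Z N n = begin
      𝓓 (Z N) n                     ≡⟨ z·-∂ (Z N) n ⟨
      z· (∂ (Z N)) n                ≡⟨ z·-cong (exponential-formula N m) n ⟩
      z· (∂ (L N) ⋆ Z N) n          ≡⟨ z·-⋆ (∂ (L N)) (Z N) n ⟩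
      (z· (∂ (L N)) ⋆ Z N) n        ≡⟨ ⋆-cong (z·-∂ (L N)) (λ _ → refl) n ⟩
      (g N ⋆ Z N) n                 ∎
      where
      open ≡-Reasoning
      z·-cong : ∀ {f h} → f ≐ h → z· f ≐ z· h
      z·-cong e zero = refl
      z·-cong e (suc n) = cong (pos (suc n) *_) (e n)

    open import Algebra.Solver.Ring.NaturalCoefficients.Default (CommutativeRing.commutativeSemiring seqRing)
      using (solve; _:=_; _:+_; _:*_)

    -- With 𝓓Z = gZ, the difference ∂(𝓓Z) Z - 𝓓Z ∂Z collapses to ∂g Z².
    todaZ : ∀ K → (pos (suc K) * weight m K) · (Z (suc (suc K)) ⋆ Z K) ≐ ∂ (g (suc K)) ⋆ (Z (suc K) ⋆ Z (suc K))
    todaZ K n = RingProperties.+-cancelʳ ℤₚ.+-*-ring (((g₁ ⋆ Z₁) ⋆ ∂ Z₁) n) _ _ (begin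
      (w · (Z (suc (suc K)) ⋆ Z K)) n + ((g₁ ⋆ Z₁) ⋆ ∂ Z₁) n
        ≡⟨ cong₂ (λ x y → w * x + y) (⋆-cong (Z≐hankel (suc (suc K))) (Z≐hankel K) n)
             (⋆-cong (λ k → trans (sym (𝓓Z (suc K) k)) (cong (pos k *_) (Z≐hankel (suc K) k))) (λ k → Z≐hankel (suc K) (suc k)) n) ⟩
      (w · (hankel m (suc (suc K)) ⋆ hankel m K)) n + (𝓓 (hankel m (suc K)) ⋆ ∂ (hankel m (suc K))) n
        ≡⟨ toda m K n ⟩
      (∂ (𝓓 (hankel m (suc K))) ⋆ hankel m (suc K)) n
        ≡⟨ ⋆-cong (λ k → trans (cong (pos (suc k) *_) (sym (Z≐hankel (suc K) (suc k)))) (𝓓Z (suc K) (suc k))) (λ k → sym (Z≐hankel (suc K) k)) n ⟩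
      ((∂ g₁ ⋆ Z₁ ⊹ g₁ ⋆ ∂ Z₁) ⋆ Z₁) n
        ≡⟨ solve 4 (λ a b c d → (a :* c :+ b :* d) :* c := a :* (c :* c) :+ (b :* c) :* d) (λ _ → refl) (∂ g₁) g₁ Z₁ (∂ Z₁) n ⟩
      (∂ g₁ ⋆ (Z₁ ⋆ Z₁)) n + ((g₁ ⋆ Z₁) ⋆ ∂ Z₁) n ∎)
      where
      open ≡-Reasoning
      w = pos (suc K) * weight m K
      g₁ = g (suc K)
      Z₁ = Z (suc K)

  -- Logarithmic derivative without division: 𝓓 is applied to `todaZ`, each 𝓓Z is replaced by gZ,
  -- and Z² is cancelled. As in `toda`, one factor z is removed.
  connected-toda : ∀ K → 𝓓 (∂ (g (suc K))) ⊹ (g (suc K) ⊹ g (suc K)) ⋆ ∂ (g (suc K)) ≐ (g (suc (suc K)) ⊹ g K) ⋆ ∂ (g (suc K))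
  connected-toda K = ⋆-cancelʳ _ _ (Z₁ ⋆ Z₁) (cong₂ _*_ (Z₀ (suc K)) (Z₀ (suc K))) (λ n → begin
    ((𝓓 (∂ g₁) ⊹ (g₁ ⊹ g₁) ⋆ ∂ g₁) ⋆ (Z₁ ⋆ Z₁)) n
      ≡⟨ solve 4 (λ a b c d → (a :+ (b :+ b) :* c) :* (d :* d) := a :* (d :* d) :+ c :* ((b :* d) :* d :+ d :* (b :* d))) (λ _ → refl)
           (𝓓 (∂ g₁)) g₁ (∂ g₁) Z₁ n ⟩
    (𝓓 (∂ g₁) ⋆ (Z₁ ⋆ Z₁) ⊹ ∂ g₁ ⋆ ((g₁ ⋆ Z₁) ⋆ Z₁ ⊹ Z₁ ⋆ (g₁ ⋆ Z₁))) n
      ≡⟨ cong ((𝓓 (∂ g₁) ⋆ (Z₁ ⋆ Z₁)) n +_) (⋆-cong {∂ g₁} (λ _ → refl) (λ k → sym (trans (𝓓-⋆ Z₁ Z₁ k)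
           (cong₂ _+_ (⋆-cong (𝓓Z (suc K)) (λ _ → refl) k) (⋆-cong {Z₁} (λ _ → refl) (𝓓Z (suc K)) k)))) n) ⟩
    (𝓓 (∂ g₁) ⋆ (Z₁ ⋆ Z₁) ⊹ ∂ g₁ ⋆ 𝓓 (Z₁ ⋆ Z₁)) n
      ≡⟨ 𝓓-⋆ (∂ g₁) (Z₁ ⋆ Z₁) n ⟨
    𝓓 (∂ g₁ ⋆ (Z₁ ⋆ Z₁)) n
      ≡⟨ cong (pos n *_) (sym (todaZ K n)) ⟩
    pos n * (w * (Z₂ ⋆ Z₀′) n)
      ≡⟨ swap (pos n) w _ ⟩
    w * 𝓓 (Z₂ ⋆ Z₀′) n
      ≡⟨ cong (w *_) (trans (𝓓-⋆ Z₂ Z₀′ n) (trans (cong₂ _+_ (⋆-cong (𝓓Z (suc (suc K))) (λ _ → refl) n) (⋆-cong {Z₂} (λ _ → refl) (𝓓Z K) n))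
           (solve 4 (λ a b c d → (a :* c) :* d :+ c :* (b :* d) := (a :+ b) :* (c :* d)) (λ _ → refl) (g (suc (suc K))) (g K) Z₂ Z₀′ n))) ⟩
    w * ((g (suc (suc K)) ⊹ g K) ⋆ (Z₂ ⋆ Z₀′)) n
      ≡⟨ ⋆-· w (g (suc (suc K)) ⊹ g K) (Z₂ ⋆ Z₀′) n ⟨
    ((g (suc (suc K)) ⊹ g K) ⋆ (w · (Z₂ ⋆ Z₀′))) n
      ≡⟨ ⋆-cong {g (suc (suc K)) ⊹ g K} (λ _ → refl) (todaZ K) n ⟩
    ((g (suc (suc K)) ⊹ g K) ⋆ (∂ g₁ ⋆ (Z₁ ⋆ Z₁))) n
      ≡⟨ ⋆-assoc (g (suc (suc K)) ⊹ g K) (∂ g₁) (Z₁ ⋆ Z₁) n ⟨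
    (((g (suc (suc K)) ⊹ g K) ⋆ ∂ g₁) ⋆ (Z₁ ⋆ Z₁)) n ∎)
    where
    open ≡-Reasoning
    w = pos (suc K) * weight m K
    g₁ = g (suc K)
    Z₁ = Z (suc K)
    Z₂ = Z (suc (suc K))
    Z₀′ = Z K
    swap : ∀ a b c → a * (b * c) ≡ b * (a * c)
    swap = ℤ-Solver.solve-∀

-- Cycles and invariant colourings

module _ {n : ℕ} {σ : Vec (Fin n) n} (p : IsPerm σ) where
  private
    f : Fin n → Fin n
    f = lookup σ

    iter-+ : ∀ k l x → iter f (k ℕ.+ l) x ≡ iter f k (iter f l x)
    iter-+ zero l x = refl
    iter-+ (suc k) l x = cong f (iter-+ k l x)

    iter-injective : ∀ k {x y} → iter f k x ≡ iter f k y → x ≡ y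
    iter-injective zero e = e
    iter-injective (suc k) e = iter-injective k (IsPerm.injective p _ _ e)

    period : ∀ x → Σ[ q ∈ ℕ ] q < n × iter f (suc q) x ≡ x
    period x with Finₚ.pigeonhole (ℕₚ.n<1+n n) (λ i → iter f (toℕ i) x)
    ... | i , j , i<j , e with ℕₚ.m≤n⇒∃[o]m+o≡n i<j
    ... | q , eq = q , ℕₚ.≤-trans (ℕₚ.≤-trans (s≤s (ℕₚ.m≤n+m q (toℕ i))) (ℕₚ.≤-reflexive eq)) (ℕₚ.≤-pred (Finₚ.toℕ<n j)) ,
      sym (iter-injective (toℕ i) (trans e (trans (cong (λ k → iter f k x) (trans (sym eq) (sym (ℕₚ.+-suc (toℕ i) q)))) (iter-+ (toℕ i) (suc q) x))))

    Orbit : Fin n → Fin n → Set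
    Orbit x y = Σ[ k ∈ ℕ ] iter f k x ≡ y

    orbit-trans : ∀ {x y z} → Orbit x y → Orbit y z → Orbit x z
    orbit-trans {x} (k , refl) (l , refl) = l ℕ.+ k , iter-+ l k x

    -- Periods are at most n, so 1 to n steps reach the whole orbit. This is the range searched by
    -- `cycles`; the point x itself is reached after a full period.
    orbit-short : ∀ {x y} → Orbit x y → Σ[ j ∈ ℕ ] j < n × iter f (suc j) x ≡ y
    orbit-short {x} (zero , refl) = period x
    orbit-short {x} (suc k , refl) with orbit-short {x} (k , refl)
    ... | j , j<n , e with suc j ℕₚ.<? n
    ... | yes lt = suc j , lt , cong f e
    ... | no ge with period x
    ... | q , q<n , per = reduce (suc (suc j)) (ℕₚ.≤-trans q<n (ℕₚ.≤-trans (ℕₚ.≮⇒≥ ge) (ℕₚ.n≤1+n _))) (cong f e) (s≤s j<n)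
      where
      reduce : ∀ k′ → suc q ≤ k′ → iter f k′ x ≡ f (iter f k x) → k′ ≤ suc n → Σ[ j ∈ ℕ ] j < n × iter f (suc j) x ≡ f (iter f k x)
      reduce k′ le e′ bd with ℕₚ.m≤n⇒∃[o]m+o≡n le
      ... | zero , eq = q , q<n , trans (cong (λ l → iter f l x) (trans (sym (ℕₚ.+-identityʳ (suc q))) eq)) e′
      ... | suc o , eq = o , ℕₚ.≤-trans (ℕₚ.m≤n+m (suc o) q) (ℕₚ.≤-pred (ℕₚ.≤-trans (ℕₚ.≤-reflexive eq) bd)) ,
        trans (sym (cong (iter f (suc o)) per)) (trans (sym (iter-+ (suc o) (suc q) x))
          (trans (cong (λ l → iter f l x) (trans (ℕₚ.+-comm (suc o) (suc q)) eq)) e′))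

    orbit-sym : ∀ {x y} → Orbit x y → Orbit y x
    orbit-sym {x} (zero , refl) = 0 , refl
    orbit-sym {x} (suc k , refl) with orbit-sym {x} (k , refl)
    ... | l , e with period (iter f k x)
    ... | q , _ , per = orbit-trans {f (iter f k x)} {iter f k x} (q , trans (sym (shift q (iter f k x))) per) (l , e)
      where
      shift : ∀ q x → iter f (suc q) x ≡ iter f q (f x)
      shift zero x = refl
      shift (suc q) x = cong f (shift q x)

    isMin : Fin n → Bool
    isMin x = all (λ j → toℕ x ℕ.≤ᵇ toℕ (iter f (suc j) x)) (upTo n)

    isMin⇒≤ : ∀ {x} → isMin x ≡ true → ∀ {y} → Orbit x y → toℕ x ≤ toℕ y
    isMin⇒≤ {x} h o with orbit-short o
    ... | j , j<n , refl = ℕₚ.≤ᵇ⇒≤ _ _ (≡⇒T (all-true⁻ _ (upTo n) h (∈ₚ.∈-upTo⁺ j<n)))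

    all-false : ∀ {A : Set} (q : A → Bool) (xs : List A) → all q xs ≡ false → Σ[ x ∈ A ] q x ≡ false
    all-false q (x ∷ xs) h with q x in eq
    ... | true = all-false q xs h
    ... | false = x , eq

    MinOf : Fin n → Set
    MinOf x = Σ[ y ∈ Fin n ] isMin y ≡ true × Orbit x y

    minOf : ∀ x → MinOf x
    minOf x = go (toℕ x) x ℕₚ.≤-refl
      where
      go : ∀ k x → toℕ x ≤ k → MinOf x
      go k x le with isMin x in eq
      ... | true = x , eq , 0 , refl
      ... | false with all-false _ (upTo n) eq
      ... | j , h with k
      ... | zero = contradiction (trans (sym (T⇒≡ (ℕₚ.≤⇒≤ᵇ (ℕₚ.≤-trans le z≤n)))) h) λ ()
      ... | suc k′ with go k′ (iter f (suc j) x) (ℕₚ.≤-pred (ℕₚ.≤-trans (ℕₚ.≰⇒> (λ l → contradiction (trans (sym (T⇒≡ (ℕₚ.≤⇒≤ᵇ l))) h) λ ())) le))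
      ... | y , m , o = y , m , orbit-trans {x} (suc j , refl) o

    ρ : Fin n → Fin n
    ρ x = proj₁ (minOf x)

    min-unique : ∀ {x y} → isMin x ≡ true → isMin y ≡ true → Orbit x y → x ≡ y
    min-unique hx hy o = Finₚ.toℕ-injective (ℕₚ.≤-antisym (isMin⇒≤ hx o) (isMin⇒≤ hy (orbit-sym o)))

    dependent : List (Fin n)
    dependent = filterᵇ (not ∘ isMin) (allFin n)

    dependent⁻ : ∀ {x} → x ∈ dependent → isMin x ≡ false
    dependent⁻ {x} x∈ = not-true (proj₂ (Enumerates.sound (filterᵇ-enumerates (allFin-enumerates n) (not ∘ isMin)) x∈))
      where
      not-true : ∀ {b} → not b ≡ true → b ≡ false
      not-true {false} _ = refl

    ρ∉dependent : ∀ x → ρ x ∉ dependent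
    ρ∉dependent x x∈ = contradiction (trans (sym (proj₁ (proj₂ (minOf x)))) (dependent⁻ x∈)) λ ()

    module _ {N : ℕ} where
      Determined : Vec (Fin N) n → Fin n → Set
      Determined c x = lookup c x ≡ lookup c (ρ x)

      determined? : ∀ c x → Dec (Determined c x)
      determined? c x = lookup c x Finₚ.≟ lookup c (ρ x)

      invariant : ∀ (c : Vec (Fin N) n) → c ∙ σ ≡ c → ∀ {x y} → Orbit x y → lookup c x ≡ lookup c y
      invariant c e (zero , refl) = refl
      invariant c e {x} (suc k , refl) = trans (invariant c e {x} (k , refl))
        (trans (cong (λ v → lookup v (iter f k x)) (sym e)) (lookup-∙ c σ (iter f k x)))

      fixed⇒ : ∀ (c : Vec (Fin N) n) → c ∙ σ ≡ c → All (Determined c) dependent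
      fixed⇒ c e = All.tabulate (λ {x} _ → invariant c e (proj₂ (proj₂ (minOf x))))

      fixed⇐ : ∀ (c : Vec (Fin N) n) → All (Determined c) dependent → c ∙ σ ≡ c
      fixed⇐ c h = lookup-ext (λ x → trans (lookup-∙ c σ x) (trans (everywhere (f x)) (trans (cong (lookup c) (same x)) (sym (everywhere x)))))
        where
        everywhere : ∀ x → Determined c x
        everywhere x = go (isMin x) refl
          where
          go : ∀ b → isMin x ≡ b → Determined c x
          go true e = cong (lookup c) (min-unique e (proj₁ (proj₂ (minOf x))) (proj₂ (proj₂ (minOf x))))
          go false e = All.lookup h (∈ₚ.∈-filter⁺ (λ y → Relation.Nullary.Decidable.T? (not (isMin y))) (∈ₚ.∈-allFin x) (≡⇒T (cong not e)))
            where import Relation.Nullary.Decidable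
        same : ∀ x → ρ (f x) ≡ ρ x
        same x = min-unique (proj₁ (proj₂ (minOf (f x)))) (proj₁ (proj₂ (minOf x)))
          (orbit-trans (orbit-sym (orbit-trans {x} (1 , refl) (proj₂ (proj₂ (minOf (f x)))))) (proj₂ (proj₂ (minOf x))))

      constraints : List (Fin n) → Vec (Fin N) n → ℤ
      constraints [] c = 1ℤ
      constraints (x ∷ ds) c = ⟨ determined? c x ⟩ * constraints ds c

      constraints-all : ∀ ds c → constraints ds c ≡ ⟨ All.all? (determined? c) ds ⟩
      constraints-all [] c = refl
      constraints-all (x ∷ ds) c = trans (cong (⟨ determined? c x ⟩ *_) (constraints-all ds c))
        (trans (sym (⟨⟩-× (determined? c x) (All.all? (determined? c) ds)))
          (⟨⟩-cong _ (All.all? (determined? c) (x ∷ ds)) (λ (a , b) → a ∷ b) (λ { (a ∷ b) → a , b })))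

      constraints-update : ∀ ds c x v → x ∉ ds → (∀ {y} → y ∈ ds → ρ y ≢ x) → constraints ds (c [ x ]≔ v) ≡ constraints ds c
      constraints-update [] c x v h k = refl
      constraints-update (y ∷ ds) c x v h k = cong₂ _*_
        (cong₂ (λ a b → ⟨ a Finₚ.≟ b ⟩) (Vecₚ.lookup∘update′ (λ e → h (here (sym e))) c v) (Vecₚ.lookup∘update′ (k (here refl)) c v))
        (constraints-update ds c x v (λ q → h (there q)) (λ q → k (there q)))

      -- F does not see the colour at x, so recolouring x carries the colourings obeying the
      -- constraint to those with c(x) = j, for each of the N colours j.
      impose : ∀ x (F : Vec (Fin N) n → ℤ) → ρ x ≢ x → (∀ c v → F (c [ x ]≔ v) ≡ F c) →
        pos N * (∑[ c ∈ cols N n ] ⟨ determined? c x ⟩ * F c) ≡ ∑ (cols N n) F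
      impose x F ρx≢x ind = begin
        pos N * (∑[ c ∈ cols N n ] ⟨ determined? c x ⟩ * F c)
          ≡⟨ trans (ℤₚ.*-comm (pos N) _) (trans (cong (S *_) (sym (∑-1-allFin N))) (trans (sym (∑-const (allFin N) S)) (∑-cong (allFin N) (λ j → expand j)))) ⟩
        (∑[ j ∈ allFin N ] ∑[ i ∈ allFin N ] ∑[ c ∈ cols N n ] ⟨ lookup c x Finₚ.≟ j ⟩ * (⟨ lookup c (ρ x) Finₚ.≟ i ⟩ * F c))
          ≡⟨ trans (∑-cong (allFin N) (λ j → ∑-swap (allFin N) (cols N n) _)) (∑-swap (allFin N) (cols N n) _) ⟩
        (∑[ c ∈ cols N n ] ∑[ j ∈ allFin N ] ∑[ i ∈ allFin N ] ⟨ lookup c x Finₚ.≟ j ⟩ * (⟨ lookup c (ρ x) Finₚ.≟ i ⟩ * F c))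
          ≡⟨ ∑-cong (cols N n) (λ c → trans (∑-cong (allFin N) (λ j → trans (sym (∑-*ˡ (allFin N) ⟨ lookup c x Finₚ.≟ j ⟩ _))
               (cong (⟨ lookup c x Finₚ.≟ j ⟩ *_) (∑-pick (lookup c (ρ x)) (F c))))) (∑-pick (lookup c x) (F c))) ⟩
        ∑ (cols N n) F ∎
        where
        open ≡-Reasoning
        S = ∑[ c ∈ cols N n ] ⟨ determined? c x ⟩ * F c
        expand : ∀ j → S ≡ ∑[ i ∈ allFin N ] ∑[ c ∈ cols N n ] ⟨ lookup c x Finₚ.≟ j ⟩ * (⟨ lookup c (ρ x) Finₚ.≟ i ⟩ * F c)
        expand j = begin
          S ≡⟨ ∑-cong (cols N n) (λ c → sym (∑-pick (lookup c x) (⟨ determined? c x ⟩ * F c))) ⟩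
          (∑[ c ∈ cols N n ] ∑[ i ∈ allFin N ] ⟨ lookup c x Finₚ.≟ i ⟩ * (⟨ determined? c x ⟩ * F c))
            ≡⟨ trans (∑-swap (cols N n) (allFin N) _) (∑-cong (allFin N) (λ i → ∑-cong (cols N n) (λ c → ⟨⟩-*-cong (lookup c x Finₚ.≟ i) (λ e →
                 cong (_* F c) (⟨⟩-cong (determined? c x) (lookup c (ρ x) Finₚ.≟ i) (λ d → trans (sym d) e) (λ d → trans e (sym d))))))) ⟩
          (∑[ i ∈ allFin N ] ∑[ c ∈ cols N n ] ⟨ lookup c x Finₚ.≟ i ⟩ * (⟨ lookup c (ρ x) Finₚ.≟ i ⟩ * F c))
            ≡⟨ ∑-cong (allFin N) (λ i → trans (∑-update x i j _) (∑-cong (cols N n) (λ c → cong (⟨ lookup c x Finₚ.≟ j ⟩ *_)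
                 (cong₂ (λ a b → ⟨ a Finₚ.≟ i ⟩ * b) (Vecₚ.lookup∘update′ ρx≢x c i) (ind c i))))) ⟩
          (∑[ i ∈ allFin N ] ∑[ c ∈ cols N n ] ⟨ lookup c x Finₚ.≟ j ⟩ * (⟨ lookup c (ρ x) Finₚ.≟ i ⟩ * F c)) ∎

      constraints-sum : ∀ ds → Unique ds → (∀ {x} → x ∈ ds → ∀ y → ρ y ≢ x) →
        pos N ^ length ds * ∑ (cols N n) (constraints ds) ≡ ∑[ c ∈ cols N n ] 1ℤ
      constraints-sum [] u h = ℤₚ.*-identityˡ _
      constraints-sum (x ∷ ds) (x∉ ∷ u) h = trans (trans (regroup (pos N) (pos N ^ length ds) _) (cong (pos N ^ length ds *_)
          (impose x (constraints ds) (h (here refl) x) (λ c v → constraints-update ds c x v (λ q → All.lookup x∉ q refl) (λ {y} _ → h (here refl) y)))))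
        (constraints-sum ds u (λ q → h (there q)))
        where
        regroup : ∀ a b c → (a * b) * c ≡ b * (a * c)
        regroup = ℤ-Solver.solve-∀

  -- Every cycle is represented by its minimum. Invariance is one equation c(x) = c(ρ x) for each
  -- other point x, and each equation divides the number of colourings by N. The power of N is
  -- multiplied out and cancelled, for which N must be positive.
  Fix-cycles : ∀ K → Fix (suc K) σ ≡ pos (suc K) ^ cycles (allFin n) toℕ n f
  Fix-cycles K = ℤₚ.*-cancelˡ-≡ (N ^ length dependent) _ _ ⦃ nonZero (length dependent) ⦄ (begin
    N ^ length dependent * Fix (suc K) σ
      ≡⟨ cong (N ^ length dependent *_) (∑-cong (cols (suc K) n) (λ c → sym (trans (constraints-all dependent c)
           (⟨⟩-cong (All.all? (determined? c) dependent) ((c ∙ σ) ≟ᵛ c) (fixed⇐ c) (fixed⇒ c))))) ⟩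
    N ^ length dependent * ∑ (cols (suc K) n) (constraints dependent)
      ≡⟨ constraints-sum dependent (Uniqueₚ.filter⁺ _ (allFin⁺ n)) (λ { x∈ y refl → ρ∉dependent y x∈ }) ⟩
    (∑[ c ∈ cols (suc K) n ] 1ℤ)
      ≡⟨ count-cols n ⟩
    N ^ n
      ≡⟨ cong (N ^_) lengths ⟨
    N ^ (length dependent ℕ.+ cycles (allFin n) toℕ n f)
      ≡⟨ ℤₚ.^-distribˡ-+-* N (length dependent) _ ⟩
    N ^ length dependent * N ^ cycles (allFin n) toℕ n f ∎)
    where
    open ≡-Reasoning
    import Data.List.Relation.Unary.Unique.Propositional.Properties as Uniqueₚ
    N = pos (suc K)
    nonZero : ∀ d → ℤ.NonZero (N ^ d)
    nonZero zero = _
    nonZero (suc d) = ℤₚ.i*j≢0 N (N ^ d) ⦃ _ ⦄ ⦃ nonZero d ⦄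
    count-cols : ∀ k → (∑[ c ∈ cols (suc K) k ] 1ℤ) ≡ N ^ k
    count-cols zero = refl
    count-cols (suc k) = trans (∑-cons (allFin (suc K)) k (λ _ → 1ℤ)) (trans (∑-cong (allFin (suc K)) (λ _ → count-cols k))
      (trans (∑-const (allFin (suc K)) (N ^ k)) (trans (cong (N ^ k *_) (∑-1-allFin (suc K))) (ℤₚ.*-comm (N ^ k) N))))
    lengths : length dependent ℕ.+ cycles (allFin n) toℕ n f ≡ n
    lengths = trans (go (allFin n)) (Listₚ.length-tabulate id)
      where
      go : ∀ xs → length (filterᵇ (not ∘ isMin) xs) ℕ.+ length (filterᵇ isMin xs) ≡ length xs
      go [] = refl
      go (x ∷ xs) with isMin x
      ... | true = trans (ℕₚ.+-suc (length (filterᵇ (not ∘ isMin) xs)) _) (cong suc (go xs))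
      ... | false = cong suc (go xs)

-- Faces

-- The effect on star vertices of following the face permutation from colour i through all later
-- colours until colour 0 returns.
tail : ∀ {m n} → Tuple m n → Fin m → Vec (Fin n) n
tail (σ ∷ t) zero = prod (σ ∷ t)
tail (σ ∷ t) (suc i) = tail t i

tail-step : ∀ {m n} (t : Tuple m n) i j → toℕ j ≡ suc (toℕ i) → tail t i ≡ tail t j ∙ lookup t i
tail-step (σ ∷ ρ ∷ t) zero (suc zero) e = refl
tail-step (σ ∷ t) (suc i) (suc j) e = tail-step t i j (ℕₚ.suc-injective e)

tail-last : ∀ {m n} (t : Tuple (suc m) n) i → toℕ i ≡ m → tail t i ≡ lookup t i
tail-last (σ ∷ []) zero e = ∙-identityˡ σ
tail-last (σ ∷ ρ ∷ t) (suc i) e = tail-last (ρ ∷ t) i (ℕₚ.suc-injective e)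

next-cases : ∀ {m} (i : Fin (suc m)) → (toℕ i ≡ m × next i ≡ zero) ⊎ (toℕ (next i) ≡ suc (toℕ i))
next-cases {m} i with toℕ i ℕₚ.≟ m
... | yes e = inj₁ (e , Finₚ.toℕ-injective (trans (Finₚ.toℕ-fromℕ< _) (trans (cong (λ k → suc k ℕ.% suc m) e) (n%n≡0 (suc m)))))
... | no ne = inj₂ (trans (Finₚ.toℕ-fromℕ< _) (m<n⇒m%n≡m (s≤s (ℕₚ.≤∧≢⇒< (ℕₚ.≤-pred (Finₚ.toℕ<n i)) ne))))

next-injective : ∀ {m} {i j : Fin (suc m)} → next i ≡ next j → i ≡ j
next-injective {m} {i} {j} e with next-cases i | next-cases j
... | inj₁ (a , _) | inj₁ (b , _) = Finₚ.toℕ-injective (trans a (sym b))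
... | inj₁ (_ , a) | inj₂ b = contradiction (trans (sym b) (trans (cong toℕ (sym e)) (cong toℕ a))) λ ()
... | inj₂ a | inj₁ (_ , b) = contradiction (trans (sym a) (trans (cong toℕ e) (cong toℕ b))) λ ()
... | inj₂ a | inj₂ b = Finₚ.toℕ-injective (ℕₚ.suc-injective (trans (sym a) (trans (cong toℕ e) b)))

module _ {m′ n : ℕ} (t : Tuple (suc m′) n) (ps : AllV IsPerm t) where
  private
    m = suc m′
    join : Edge m n → Fin (n ℕ.* m)
    join (s , i) = combine s i

    part : Fin (n ℕ.* m) → Edge m n
    part = remQuot {n} m

    part-join : ∀ x → part (join x) ≡ x
    part-join (s , i) = Finₚ.remQuot-combine s i

    join-part : ∀ e → join (part e) ≡ e
    join-part e = Finₚ.combine-remQuot {n} m e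

    join-injective : ∀ {x y} → join x ≡ join y → x ≡ y
    join-injective {x} {y} e = trans (sym (part-join x)) (trans (cong part e) (part-join y))

    F : Vec (Fin (n ℕ.* m)) (n ℕ.* m)
    F = tabulate (λ e → join (faceπ t (part e)))

    lookup-F : ∀ x → lookup F (join x) ≡ join (faceπ t x)
    lookup-F x = trans (Vecₚ.lookup∘tabulate _ (join x)) (cong (λ y → join (faceπ t y)) (part-join x))

    faceπ-injective : ∀ {x y : Edge m n} → faceπ t x ≡ faceπ t y → x ≡ y
    faceπ-injective {s , i} {s′ , j} e with next-injective {i = i} {j} (cong proj₂ e)
    ... | refl = cong (_, i) (IsPerm.injective (ps i) s s′ (cong proj₁ e))

    F-perm : IsPerm F
    F-perm .IsPerm.injective a b e = trans (sym (join-part a)) (trans (cong join (faceπ-injective (join-injective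
      (trans (sym (Vecₚ.lookup∘tabulate _ a)) (trans e (Vecₚ.lookup∘tabulate _ b)))))) (join-part b))

    all-cong : ∀ {A : Set} {p q : A → Bool} xs → (∀ x → p x ≡ q x) → all p xs ≡ all q xs
    all-cong [] h = refl
    all-cong (x ∷ xs) h = cong₂ _∧_ (h x) (all-cong xs h)

    key : ∀ x → edgeKey x ≡ toℕ (join x)
    key (s , i) = trans (cong (ℕ._+ toℕ i) (ℕₚ.*-comm (toℕ s) m)) (sym (Finₚ.toℕ-combine s i))

    iter-join : ∀ k x → iter (lookup F) k (join x) ≡ join (iter (faceπ t) k x)
    iter-join zero x = refl
    iter-join (suc k) x = trans (cong (lookup F) (iter-join k x)) (lookup-F _)

  faces-cycles : #faces t ≡ cycles (allFin (n ℕ.* m)) toℕ (n ℕ.* m) (lookup F)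
  faces-cycles = ℤₚ.+-injective (begin
    pos (#faces t)
      ≡⟨ length-filterᵇ _ (allEdges m n) ⟩
    ∑ (allEdges m n) (λ x → ι (all (λ j → edgeKey x ℕ.≤ᵇ edgeKey (iter (faceπ t) (suc j) x)) (upTo (n ℕ.* m))))
      ≡⟨ ∑-cong (allEdges m n) (λ x → cong ι (all-cong (upTo (n ℕ.* m)) (λ j → cong₂ ℕ._≤ᵇ_ (key x)
           (trans (key (iter (faceπ t) (suc j) x)) (cong toℕ (sym (iter-join (suc j) x))))))) ⟩
    ∑ (allEdges m n) (λ x → isMin (join x))
      ≡⟨ reindex (cartesianProduct-enumerates (allFin-enumerates n) (allFin-enumerates m)) (allFin-enumerates (n ℕ.* m)) join
           (λ _ → tt) (λ _ _ → join-injective) (λ {e} _ → part e , (tt , tt) , join-part e) isMin ⟩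
    ∑ (allFin (n ℕ.* m)) isMin
      ≡⟨ length-filterᵇ _ (allFin (n ℕ.* m)) ⟨
    pos (cycles (allFin (n ℕ.* m)) toℕ (n ℕ.* m) (lookup F)) ∎)
    where
    open ≡-Reasoning
    isMin : Fin (n ℕ.* m) → ℤ
    isMin e = ι (all (λ j → toℕ e ℕ.≤ᵇ toℕ (iter (lookup F) (suc j) e)) (upTo (n ℕ.* m)))

  -- A colouring of the edges invariant under the face permutation is determined
  -- by its restriction to the edges of colour 0, which is invariant under the product.
  Fix-faces : ∀ N → Fix N F ≡ Fix N (prod t)
  Fix-faces N = begin
    Fix N F
      ≡⟨ as-filter F ⟩
    (∑[ c ∈ invariants F ] 1ℤ)
      ≡⟨ reindex (filterᵇ-enumerates (cols-enumerates N (n ℕ.* m)) (λ c → ⌊ (c ∙ F) ≟ᵛ c ⌋))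
           (filterᵇ-enumerates (cols-enumerates N n) (λ c → ⌊ (c ∙ prod t) ≟ᵛ c ⌋)) restrict
           (λ {c} (_ , h) → tt , true-⌊⌋ (_ ≟ᵛ _) (restrict-fixed c (⌊⌋-true ((c ∙ F) ≟ᵛ c) h)))
           (λ {c} {d} (_ , h) (_ , k) e → determined c d (⌊⌋-true ((c ∙ F) ≟ᵛ c) h) (⌊⌋-true ((d ∙ F) ≟ᵛ d) k) e)
           (λ {c} (_ , h) → extend c , (tt , true-⌊⌋ (_ ≟ᵛ _) (extend-fixed c (⌊⌋-true ((c ∙ prod t) ≟ᵛ c) h))) , restrict-extend c (⌊⌋-true ((c ∙ prod t) ≟ᵛ c) h))
           (λ _ → 1ℤ) ⟩
    (∑[ c ∈ invariants (prod t) ] 1ℤ)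
      ≡⟨ as-filter (prod t) ⟨
    Fix N (prod t) ∎
    where
    open ≡-Reasoning
    invariants : ∀ {k} → Vec (Fin k) k → List (Vec (Fin N) k)
    invariants {k} σ = filterᵇ (λ c → ⌊ (c ∙ σ) ≟ᵛ c ⌋) (cols N k)
    as-filter : ∀ {k} (σ : Vec (Fin k) k) → Fix N σ ≡ ∑[ c ∈ invariants σ ] 1ℤ
    as-filter {k} σ = sym (trans (∑-filterᵇ _ (cols N k) (λ _ → 1ℤ)) (∑-cong (cols N k) (λ c → trans (ℤₚ.*-identityʳ _) (ι-⌊⌋ ((c ∙ σ) ≟ᵛ c)))))
    restrict : Vec (Fin N) (n ℕ.* m) → Vec (Fin N) n
    restrict c = tabulate (λ s → lookup c (join (s , zero)))
    extend : Vec (Fin N) n → Vec (Fin N) (n ℕ.* m)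
    extend c = tabulate (λ e → lookup c (lookup (tail t (proj₂ (part e))) (proj₁ (part e))))
    lookup-extend : ∀ c s i → lookup (extend c) (join (s , i)) ≡ lookup c (lookup (tail t i) s)
    lookup-extend c s i = trans (Vecₚ.lookup∘tabulate _ (join (s , i)))
      (cong (λ (s , i) → lookup c (lookup (tail t i) s)) (part-join (s , i)))
    step : ∀ c → c ∙ F ≡ c → ∀ x → lookup c (join x) ≡ lookup c (join (faceπ t x))
    step c e x = trans (cong (λ v → lookup v (join x)) (sym e)) (trans (lookup-∙ c F (join x)) (cong (lookup c) (lookup-F x)))
    -- The face permutation is followed to the next edge of colour 0; in `go`, k bounds the number
    -- of colours still to pass.
    to-zero : ∀ c → c ∙ F ≡ c → ∀ s i → lookup c (join (s , i)) ≡ lookup c (join (lookup (tail t i) s , zero))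
    to-zero c e s i = go m′ s i (ℕₚ.m≤n+m m′ (toℕ i))
      where
      go : ∀ k s i → m′ ≤ toℕ i ℕ.+ k → lookup c (join (s , i)) ≡ lookup c (join (lookup (tail t i) s , zero))
      go k s i le with next-cases i
      ... | inj₁ (last , nx) = trans (step c e (s , i)) (cong₂ (λ a b → lookup c (join (a , b)))
        (cong (λ v → lookup v s) (sym (tail-last t i last))) nx)
      go zero s i le | inj₂ nx = contradiction (ℕₚ.≤-trans (ℕₚ.≤-reflexive (sym nx)) (ℕₚ.≤-trans (ℕₚ.≤-pred (Finₚ.toℕ<n (next i)))
        (ℕₚ.≤-trans le (ℕₚ.≤-reflexive (ℕₚ.+-identityʳ (toℕ i)))))) ℕₚ.1+n≰n
      go (suc k) s i le | inj₂ nx = trans (step c e (s , i)) (trans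
        (go k (τ t i s) (next i) (ℕₚ.≤-trans le (ℕₚ.≤-reflexive (trans (ℕₚ.+-suc (toℕ i) k) (cong (ℕ._+ k) (sym nx))))))
        (cong (λ a → lookup c (join (a , zero))) (trans (sym (lookup-∙ (tail t (next i)) (lookup t i) s))
          (cong (λ v → lookup v s) (sym (tail-step t i (next i) nx))))))
    tail-zero : tail t zero ≡ prod t
    tail-zero = go t
      where
      go : ∀ (u : Tuple m n) → tail u zero ≡ prod u
      go (σ ∷ u) = refl
    restrict-fixed : ∀ c → c ∙ F ≡ c → restrict c ∙ prod t ≡ restrict c
    restrict-fixed c e = lookup-ext (λ s → begin
      lookup (restrict c ∙ prod t) s               ≡⟨ lookup-∙ (restrict c) (prod t) s ⟩
      lookup (restrict c) (lookup (prod t) s)      ≡⟨ Vecₚ.lookup∘tabulate _ (lookup (prod t) s) ⟩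
      lookup c (join (lookup (prod t) s , zero))   ≡⟨ cong (λ v → lookup c (join (lookup v s , zero))) tail-zero ⟨
      lookup c (join (lookup (tail t zero) s , zero)) ≡⟨ to-zero c e s zero ⟨
      lookup c (join (s , zero))                   ≡⟨ Vecₚ.lookup∘tabulate _ s ⟨
      lookup (restrict c) s                        ∎)
    determined : ∀ c d → c ∙ F ≡ c → d ∙ F ≡ d → restrict c ≡ restrict d → c ≡ d
    determined c d e f r = lookup-ext (λ x → subst (λ y → lookup c y ≡ lookup d y) (join-part x) (at (part x)))
      where
      at : ∀ x → lookup c (join x) ≡ lookup d (join x)
      at (s , i) = trans (to-zero c e s i) (trans (trans (sym (Vecₚ.lookup∘tabulate _ (lookup (tail t i) s)))
        (trans (cong (λ v → lookup v (lookup (tail t i) s)) r) (Vecₚ.lookup∘tabulate _ (lookup (tail t i) s)))) (sym (to-zero d f s i)))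
    extend-fixed : ∀ c → c ∙ prod t ≡ c → extend c ∙ F ≡ extend c
    extend-fixed c e = lookup-ext (λ x → subst (λ y → lookup (extend c ∙ F) y ≡ lookup (extend c) y) (join-part x) (at (part x)))
      where
      at : ∀ x → lookup (extend c ∙ F) (join x) ≡ lookup (extend c) (join x)
      at (s , i) = trans (lookup-∙ (extend c) F _) (trans (cong (lookup (extend c)) (lookup-F (s , i)))
        (trans (lookup-extend c (τ t i s) (next i)) (trans (go (next-cases i)) (sym (lookup-extend c s i)))))
        where
        go : (toℕ i ≡ m′ × next i ≡ zero) ⊎ (toℕ (next i) ≡ suc (toℕ i)) →
          lookup c (lookup (tail t (next i)) (τ t i s)) ≡ lookup c (lookup (tail t i) s)
        go (inj₁ (last , nx)) = trans (cong (λ j → lookup c (lookup (tail t j) (τ t i s))) nx)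
          (trans (cong (λ v → lookup c (lookup v (τ t i s))) tail-zero)
            (trans (sym (lookup-∙ c (prod t) (τ t i s))) (trans (cong (λ v → lookup v (τ t i s)) e)
              (cong (λ v → lookup c (lookup v s)) (sym (tail-last t i last))))))
        go (inj₂ nx) = cong (lookup c) (trans (sym (lookup-∙ (tail t (next i)) (lookup t i) s)) (cong (λ v → lookup v s) (sym (tail-step t i (next i) nx))))
    restrict-extend : ∀ c → c ∙ prod t ≡ c → restrict (extend c) ≡ c
    restrict-extend c e = lookup-ext (λ s → trans (Vecₚ.lookup∘tabulate _ s) (trans (lookup-extend c s zero)
      (trans (cong (λ v → lookup c (lookup v s)) tail-zero) (trans (sym (lookup-∙ c (prod t) s)) (cong (λ v → lookup v s) e)))))

  Fix-prod : ∀ K → Fix (suc K) (prod t) ≡ pos (suc K) ^ #faces t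
  Fix-prod K = trans (sym (Fix-faces (suc K))) (trans (Fix-cycles F-perm K) (cong (pos (suc K) ^_) (sym faces-cycles)))

-- The exponent of N in the weight. Star vertices are left out, their number being fixed by n.
degree : ∀ {m n} → Tuple m n → ℕ
degree t = #coloredVertices t ℕ.+ #faces t

∏Fix-cycles : ∀ K {m n} (t : Tuple m n) → AllV IsPerm t → ∏Fix (suc K) t ≡ pos (suc K) ^ #coloredVertices t
∏Fix-cycles K [] ps = refl
∏Fix-cycles K {suc m} {n} (σ ∷ t) ps = trans (cong₂ _*_ (Fix-cycles (ps zero) K) (∏Fix-cycles K t (λ i → ps (suc i))))
  (trans (sym (ℤₚ.^-distribˡ-+-* (pos (suc K)) (cycles (allFin n) toℕ n (lookup σ)) (#coloredVertices t)))
    (cong (λ k → pos (suc K) ^ (cycles (allFin n) toℕ n (lookup σ) ℕ.+ sum k))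
      (trans (Listₚ.map-tabulate id _) (sym (Listₚ.map-tabulate suc (λ i → cycles (allFin n) toℕ n (τ (σ ∷ t) i)))))))

colourWeight-degree : ∀ K {m n} (t : Tuple (suc m) n) → AllV IsPerm t → colourWeight (suc K) t ≡ pos (suc K) ^ degree t
colourWeight-degree K t ps = trans (cong₂ _*_ (∏Fix-cycles K t ps) (Fix-prod t ps K))
  (sym (ℤₚ.^-distribˡ-+-* (pos (suc K)) (#coloredVertices t) (#faces t)))

-- Rooted constellations

module _ {A Γ : Set} (_≟A_ : DecidableEquality A) {_≟Γ_ : DecidableEquality Γ} {G : List Γ} {Q : Γ → Set}
  (eG : Enumerates _≟Γ_ G Q) (act : Γ → A → A) where

  -- As much of a free group action as orbit counting needs: `back` stands for composition with
  -- inverses and says that orbits which meet coincide.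
  record FreeAction (P : A → Set) : Set where
    field
      closed : ∀ {x g} → P x → Q g → P (act g x)
      free   : ∀ {x g h} → P x → Q g → Q h → act g x ≡ act h x → g ≡ h
      unit   : ∀ {x} → P x → Σ[ g ∈ Γ ] Q g × act g x ≡ x
      back   : ∀ {x y g h} → P x → P y → Q g → Q h → act g y ≡ act h x → Σ[ k ∈ Γ ] Q k × act k x ≡ y

  open FreeAction

  -- The orbit of the first element is removed and the rest treated recursively, with k bounding the
  -- length; freeness makes each orbit as large as G. One list of representatives serves all
  -- invariant φ at once.
  orbit-representatives : ∀ k (X : List A) → length X ≤ k → ∀ {P} → Enumerates _≟A_ X P → FreeAction P →
    Σ[ Y ∈ List A ] (∀ (φ : A → ℤ) → (∀ {x g} → P x → Q g → φ (act g x) ≡ φ x) → ∑ X φ ≡ (∑[ g ∈ G ] 1ℤ) * ∑ Y φ)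
  orbit-representatives k [] le eX F = [] , λ φ inv → sym (ℤₚ.*-zeroʳ (∑[ g ∈ G ] 1ℤ))
  orbit-representatives (suc k) X@(x ∷ X′) le {P} eX F = x ∷ proj₁ rec , λ φ inv → begin
    ∑ X φ
      ≡⟨ ∑-cong X (λ z → split (inOrbit z) (φ z)) ⟩
    (∑[ z ∈ X ] (ι (inOrbit z) * φ z + ι (not (inOrbit z)) * φ z))
      ≡⟨ ∑-+ X (λ z → ι (inOrbit z) * φ z) (λ z → ι (not (inOrbit z)) * φ z) ⟩
    (∑[ z ∈ X ] ι (inOrbit z) * φ z) + (∑[ z ∈ X ] ι (not (inOrbit z)) * φ z)
      ≡⟨ cong₂ _+_ (orbit-sum φ inv) (trans (sym (∑-filterᵇ (not ∘ inOrbit) X φ)) (proj₂ rec φ (λ (p , _) q → inv p q))) ⟩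
    #G * φ x + #G * ∑ (proj₁ rec) φ
      ≡⟨ ℤₚ.*-distribˡ-+ #G (φ x) _ ⟨
    #G * ∑ (x ∷ proj₁ rec) φ ∎
    where
    open ≡-Reasoning
    #G = ∑[ g ∈ G ] 1ℤ
    Px : P x
    Px = Enumerates.sound eX (here refl)
    inOrbit : A → Bool
    inOrbit z = any (λ g → ⌊ z ≟A act g x ⌋) G
    split : ∀ b v → v ≡ ι b * v + ι (not b) * v
    split true v = sym (trans (ℤₚ.+-identityʳ (1ℤ * v)) (ℤₚ.*-identityˡ v))
    split false v = sym (trans (ℤₚ.+-identityˡ (1ℤ * v)) (ℤₚ.*-identityˡ v))
    any-∈ : ∀ {B : Set} (p : B → Bool) (xs : List B) → any p xs ≡ true → Σ[ b ∈ B ] b ∈ xs × p b ≡ true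
    any-∈ p (y ∷ xs) h with p y in eq
    ... | true = y , here refl , eq
    ... | false with any-∈ p xs h
    ... | b , b∈ , e = b , there b∈ , e
    complete : ∀ {g} → Q g → g ∈ G
    complete {g} q = go G (Enumerates.once eG q)
      where
      go : ∀ xs → ∑ xs (λ h → ⟨ h ≟Γ g ⟩) ≡ 1ℤ → g ∈ xs
      go (h ∷ xs) e with h ≟Γ g
      ... | yes refl = here refl
      ... | no _ = there (go xs (trans (sym (ℤₚ.+-identityˡ _)) e))
    inOrbit⁻ : ∀ {z} → inOrbit z ≡ true → Σ[ g ∈ Γ ] Q g × act g x ≡ z
    inOrbit⁻ {z} h with any-∈ _ G h
    ... | g , g∈ , e = g , Enumerates.sound eG g∈ , sym (⌊⌋-true (z ≟A act g x) e)
    inOrbit⁺ : ∀ {g} → Q g → inOrbit (act g x) ≡ true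
    inOrbit⁺ {g} q = any-true⁺ _ G (complete q) (true-⌊⌋ (act g x ≟A act g x) refl)
    count-orbit : ∀ z → ι (inOrbit z) ≡ ∑[ g ∈ G ] ⟨ z ≟A act g x ⟩
    count-orbit z = go (inOrbit z) refl
      where
      go : ∀ b → inOrbit z ≡ b → ι (inOrbit z) ≡ ∑[ g ∈ G ] ⟨ z ≟A act g x ⟩
      go true e with inOrbit⁻ {z} e
      ... | g₀ , q₀ , refl = trans (cong ι e) (sym (trans (∑-cong∈ G (λ {g} g∈ → ⟨⟩-cong (act g₀ x ≟A act g x) (g ≟Γ g₀)
          (λ eq → sym (free F Px q₀ (Enumerates.sound eG g∈) eq)) (λ { refl → refl }))) (Enumerates.once eG q₀)))
      go false e = trans (cong ι e) (sym (∑-zero G (λ {g} g∈ → ⟨⟩-no (z ≟A act g x) (λ { refl →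
        contradiction (trans (sym (inOrbit⁺ (Enumerates.sound eG g∈))) e) λ () }))))
    orbit-sum : ∀ φ → (∀ {x g} → P x → Q g → φ (act g x) ≡ φ x) → (∑[ z ∈ X ] ι (inOrbit z) * φ z) ≡ #G * φ x
    orbit-sum φ inv = begin
      (∑[ z ∈ X ] ι (inOrbit z) * φ z)
        ≡⟨ ∑-cong X (λ z → trans (cong (_* φ z) (count-orbit z)) (∑-*ʳ G (φ z) _)) ⟩
      (∑[ z ∈ X ] ∑[ g ∈ G ] ⟨ z ≟A act g x ⟩ * φ z)
        ≡⟨ ∑-swap X G _ ⟩
      (∑[ g ∈ G ] ∑[ z ∈ X ] ⟨ z ≟A act g x ⟩ * φ z)
        ≡⟨ ∑-cong∈ G (λ {g} g∈ → trans (Enumerates.pick eX (closed F Px (Enumerates.sound eG g∈)) φ)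
             (trans (inv Px (Enumerates.sound eG g∈)) (sym (ℤₚ.*-identityˡ (φ x))))) ⟩
      (∑[ g ∈ G ] 1ℤ * φ x)
        ≡⟨ ∑-*ʳ G (φ x) _ ⟨
      #G * φ x ∎
    x∈orbit : inOrbit x ≡ true
    x∈orbit with unit F Px
    ... | g , q , e = trans (cong inOrbit (sym e)) (inOrbit⁺ q)
    rest : List A
    rest = filterᵇ (not ∘ inOrbit) X
    shorter : length rest ≤ k
    shorter with inOrbit x | x∈orbit
    ... | true | _ = ℕₚ.≤-trans (Listₚ.length-filter _ X′) (ℕₚ.≤-pred le)
    F′ : FreeAction (λ z → P z × (not ∘ inOrbit) z ≡ true)
    F′ .closed {z} {g} (p , h) q = closed F p q , go (inOrbit (act g z)) refl
      where
      go : ∀ b → inOrbit (act g z) ≡ b → not (inOrbit (act g z)) ≡ true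
      go false e = cong not e
      go true e with inOrbit⁻ e
      ... | g′ , q′ , e′ with back F Px p q q′ (sym e′)
      ... | k′ , q″ , refl = contradiction (trans (sym h) (cong not (inOrbit⁺ q″))) λ ()
    F′ .free (p , _) = free F p
    F′ .unit (p , _) = unit F p
    F′ .back (p , _) (p′ , _) = back F p p′
    rec = orbit-representatives k rest shorter (filterᵇ-enumerates eX (not ∘ inOrbit)) F′

private
  invIf : ∀ {n} (σ : Vec (Fin n) n) b → isPerm σ ≡ b → Vec (Fin n) n
  invIf σ true e = inverse (isPerm⇒IsPerm σ e)
  invIf σ false e = σ

-- The inverse of a permutation; the value on other maps is irrelevant.
invV : ∀ {n} → Vec (Fin n) n → Vec (Fin n) n
invV σ = invIf σ (isPerm σ) refl

invV-inverse : ∀ {n} {σ : Vec (Fin n) n} → IsPerm σ → (σ ∙ invV σ ≡ idV) × (invV σ ∙ σ ≡ idV)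
invV-inverse {σ = σ} p = go (isPerm σ) refl
  where
  go : ∀ b e → (σ ∙ invIf σ b e ≡ idV) × (invIf σ b e ∙ σ ≡ idV)
  go true e = ∙-inverseʳ (isPerm⇒IsPerm σ e) , ∙-inverseˡ (isPerm⇒IsPerm σ e)
  go false e = contradiction (trans (sym (IsPerm⇒isPerm σ p)) e) λ ()

invV-perm : ∀ {n} {σ : Vec (Fin n) n} → IsPerm σ → IsPerm (invV σ)
invV-perm p = retract-perm (proj₁ (invV-inverse p))

-- Conjugation by a permutation of the star vertices other than the root 0.
relabel : ∀ {m n} → Vec (Fin n) n → Tuple m (suc n) → Tuple m (suc n)
relabel γ t = Vec.map (λ σ → lift γ ∙ σ ∙ lift (invV γ)) t

module _ {n : ℕ} {γ : Vec (Fin n) n} (p : IsPerm γ) where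
  lift-invʳ : lift γ ∙ lift (invV γ) ≡ idV
  lift-invʳ = trans (lift-∙ γ (invV γ)) (trans (cong lift (proj₁ (invV-inverse p))) lift-id)

  lift-invˡ : lift (invV γ) ∙ lift γ ≡ idV
  lift-invˡ = trans (lift-∙ (invV γ) γ) (trans (cong lift (proj₂ (invV-inverse p))) lift-id)

  relabel-char⁻ : ∀ {m} (t : Tuple m (suc n)) i → lookup (relabel γ t) i ∙ lift γ ≡ lift γ ∙ lookup t i
  relabel-char⁻ t i = trans (cong (_∙ lift γ) (Vecₚ.lookup-map i _ t)) (cancelʳ (lift γ ∙ lookup t i) lift-invˡ)

  relabel-char⁺ : ∀ {m} (t u : Tuple m (suc n)) → (∀ i → lookup u i ∙ lift γ ≡ lift γ ∙ lookup t i) → relabel γ t ≡ u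
  relabel-char⁺ t u h = lookup-ext (λ i → trans (Vecₚ.lookup-map i _ t)
    (trans (cong (_∙ lift (invV γ)) (sym (h i))) (cancelʳ (lookup u i) lift-invʳ)))

  τ-relabel : ∀ {m} (t : Tuple m (suc n)) i s → τ (relabel γ t) i (lookup (lift γ) s) ≡ lookup (lift γ) (τ t i s)
  τ-relabel t i s = trans (sym (lookup-∙ (lookup (relabel γ t) i) (lift γ) s))
    (trans (cong (λ v → lookup v s) (relabel-char⁻ t i)) (lookup-∙ (lift γ) (lookup t i) s))

  relabel-perms : ∀ {m} (t : Tuple m (suc n)) → AllV IsPerm t → AllV IsPerm (relabel γ t)
  relabel-perms t ps i = subst IsPerm (sym (Vecₚ.lookup-map i _ t)) (∙-perm (∙-perm (lift-perm p) (ps i)) (lift-perm (invV-perm p)))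

  relabel-connected : ∀ {m} (t : Tuple m (suc n)) → AllV IsPerm t → isConnected t ≡ true → isConnected (relabel γ t) ≡ true
  relabel-connected t ps c = connected⁺ (relabel γ t) (relabel-perms t ps) (λ s →
    subst (λ r → reach (relabel γ t) zero (suc n) r ≡ true)
      (trans (sym (lookup-∙ (lift γ) (lift (invV γ)) s)) (trans (cong (λ v → lookup v s) lift-invʳ) (Vecₚ.lookup-allFin s)))
      (image (lookup (lift (invV γ)) s)))
    where
    image : ∀ s → reach (relabel γ t) zero (suc n) (lookup (lift γ) s) ≡ true
    image s = reach-minimal t zero (λ s → reach (relabel γ t) zero (suc n) (lookup (lift γ) s) ≡ true)
      (reach-refl (relabel γ t) zero (suc n))
      (λ i s h → subst (λ r → reach (relabel γ t) zero (suc n) r ≡ true) (τ-relabel t i s) (reach-closed (relabel γ t) zero i _ h))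
      (suc n) s (connected⁻ t c zero s)

  colourWeight-relabel : ∀ N {m} (t : Tuple m (suc n)) → colourWeight N (relabel γ t) ≡ colourWeight N t
  colourWeight-relabel N t = cong₂ _*_ (products t) (trans (cong (Fix N) (prod-relabel t)) (Fix-conj N lift-invʳ lift-invˡ (prod t)))
    where
    open ≡-Reasoning
    products : ∀ {m} (t : Tuple m (suc n)) → ∏Fix N (relabel γ t) ≡ ∏Fix N t
    products [] = refl
    products (σ ∷ t) = cong₂ _*_ (Fix-conj N lift-invʳ lift-invˡ σ) (products t)
    a = lift γ
    b = lift (invV γ)
    prod-relabel : ∀ {m} (t : Tuple m (suc n)) → prod (relabel γ t) ≡ a ∙ prod t ∙ b
    prod-relabel [] = sym (trans (cong (_∙ b) (∙-identityʳ a)) lift-invʳ)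
    prod-relabel (σ ∷ t) = begin
      prod (relabel γ t) ∙ (a ∙ σ ∙ b)    ≡⟨ cong (_∙ (a ∙ σ ∙ b)) (prod-relabel t) ⟩
      a ∙ prod t ∙ b ∙ (a ∙ σ ∙ b)        ≡⟨ ∙-assoc (a ∙ prod t ∙ b) (a ∙ σ) b ⟨
      a ∙ prod t ∙ b ∙ (a ∙ σ) ∙ b        ≡⟨ cong (_∙ b) (∙-assoc (a ∙ prod t ∙ b) a σ) ⟨
      a ∙ prod t ∙ b ∙ a ∙ σ ∙ b          ≡⟨ cong (λ v → v ∙ σ ∙ b) (cancelʳ (a ∙ prod t) lift-invˡ) ⟩
      a ∙ prod t ∙ σ ∙ b                  ≡⟨ cong (_∙ b) (∙-assoc a (prod t) σ) ⟩
      a ∙ (prod t ∙ σ) ∙ b                ∎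

2^-injective : ∀ j k → pos 2 ^ j ≡ pos 2 ^ k → j ≡ k
2^-injective zero zero e = refl
2^-injective (suc j) (suc k) e = cong suc (2^-injective j k (ℤₚ.*-cancelˡ-≡ (pos 2) _ _ e))
2^-injective zero (suc k) e = contradiction (trans (cong ℤ.∣_∣ e) (ℤₚ.abs-* (pos 2) (pos 2 ^ k))) (1≢2* ℤ.∣ pos 2 ^ k ∣)
  where
  1≢2* : ∀ x → 1 ≢ 2 ℕ.* x
  1≢2* (suc x) e = contradiction (trans e (cong suc (ℕₚ.+-suc x (x ℕ.+ 0)))) λ ()
2^-injective (suc j) zero e = sym (2^-injective zero (suc j) (sym e))

-- The degree is recovered from the weight at N = 2, which is invariant since `Fix` is a class
-- function.
degree-relabel : ∀ {m n} {γ : Vec (Fin n) n} → IsPerm γ → (t : Tuple (suc m) (suc n)) → AllV IsPerm t → degree (relabel γ t) ≡ degree t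
degree-relabel {γ = γ} p t ps = 2^-injective _ _ (trans (sym (colourWeight-degree 1 (relabel γ t) (relabel-perms p t ps)))
  (trans (colourWeight-relabel p 2 t) (colourWeight-degree 1 t ps)))

perms-count : ∀ n → (∑[ σ ∈ perms n ] 1ℤ) ≡ pos (n !)
perms-count zero = refl
perms-count (suc n) = trans (∑-perms-suc {n} (λ _ → 1ℤ)) (trans (∑-cong (perms n) (λ σ → ∑-1-allFin (suc n)))
  (trans (∑-const (perms n) (pos (suc n))) (trans (cong (pos (suc n) *_) (perms-count n)) (sym (ℤₚ.pos-* (suc n) (n !))))))

-- A relabelling fixing the root and a connected tuple is trivial.
relabel-free : ∀ m n → FreeAction _≟ᵗ_ (perms-enumerates n) (relabel {m}) (λ t → AllV IsPerm t × isConnected t ≡ true)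
relabel-free m n .FreeAction.closed {t} (ps , c) q = relabel-perms q t ps , relabel-connected q t ps c
relabel-free m n .FreeAction.free {t} {g} {h} (ps , c) q r e = lift-injective (lookup-ext (λ s →
  reach-minimal t zero (λ s → lookup (lift g) s ≡ lookup (lift h) s) refl
    (λ i s eq → trans (sym (τ-relabel q t i s)) (trans (cong₂ (λ u x → τ u i x) e eq) (τ-relabel r t i s)))
    (suc n) s (connected⁻ t c zero s)))
relabel-free m n .FreeAction.unit {t} _ = idV , idV-perm , relabel-char⁺ idV-perm t t (λ i →
  trans (cong (lookup t i ∙_) lift-id) (trans (∙-identityʳ _) (sym (trans (cong (_∙ lookup t i) lift-id) (∙-identityˡ _)))))
relabel-free m n .FreeAction.back {x} {y} {g} {h} _ _ q r e = invV g ∙ h , ∙-perm (invV-perm q) r ,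
  relabel-char⁺ (∙-perm (invV-perm q) r) x y (λ i → begin
    lookup y i ∙ lift (invV g ∙ h)                    ≡⟨ trans (cong (lookup y i ∙_) (sym (lift-∙ (invV g) h))) (sym (∙-assoc (lookup y i) b a′)) ⟩
    lookup y i ∙ b ∙ a′                               ≡⟨ cong (_∙ a′) (flipped i) ⟩
    b ∙ lookup (relabel g y) i ∙ a′                   ≡⟨ cong (λ t → b ∙ lookup t i ∙ a′) e ⟩
    b ∙ lookup (relabel h x) i ∙ a′                   ≡⟨ trans (∙-assoc b _ a′) (cong (b ∙_) (relabel-char⁻ r x i)) ⟩
    b ∙ (a′ ∙ lookup x i)                             ≡⟨ trans (sym (∙-assoc b a′ (lookup x i))) (cong (_∙ lookup x i) (lift-∙ (invV g) h)) ⟩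
    lift (invV g ∙ h) ∙ lookup x i                    ∎)
  where
  open ≡-Reasoning
  a = lift g
  b = lift (invV g)
  a′ = lift h
  flipped : ∀ i → lookup y i ∙ b ≡ b ∙ lookup (relabel g y) i
  flipped i = begin
    lookup y i ∙ b                        ≡⟨ cong (_∙ b) (∙-identityˡ (lookup y i)) ⟨
    idV ∙ lookup y i ∙ b                  ≡⟨ cong (λ v → v ∙ lookup y i ∙ b) (lift-invˡ q) ⟨
    b ∙ a ∙ lookup y i ∙ b                ≡⟨ cong (_∙ b) (∙-assoc b a (lookup y i)) ⟩
    b ∙ (a ∙ lookup y i) ∙ b              ≡⟨ cong (λ v → b ∙ v ∙ b) (relabel-char⁻ q y i) ⟨
    b ∙ (lookup (relabel g y) i ∙ a) ∙ b  ≡⟨ cong (_∙ b) (∙-assoc b _ a) ⟨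
    b ∙ lookup (relabel g y) i ∙ a ∙ b    ≡⟨ cancelʳ _ (lift-invʳ q) ⟩
    b ∙ lookup (relabel g y) i            ∎

module _ (m n : ℕ) where
  private
    reps = orbit-representatives _≟ᵗ_ (perms-enumerates n) relabel (length (connTuples (suc m) (suc n))) (connTuples (suc m) (suc n)) ℕₚ.≤-refl
      (connTuples-enumerates (suc m) (suc n)) (relabel-free (suc m) n)

  abstract
    -- The numbers of vertices and faces of the rooted constellations with n + 1 star vertices.
    degrees : List ℕ
    degrees = map degree (proj₁ reps)

    -- The n! relabellings fixing the root act freely on connected tuples, and the degree is
    -- constant on their orbits.
    ∑-degrees : ∀ (φ : ℕ → ℤ) → (∑[ t ∈ connTuples (suc m) (suc n) ] φ (degree t)) ≡ pos (n !) * ∑ degrees φ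
    ∑-degrees φ = trans (proj₂ reps (λ t → φ (degree t)) (λ {t} (ps , _) q → cong φ (degree-relabel q t ps)))
      (cong₂ _*_ (perms-count n) (sym (∑-map (proj₁ reps) degree φ)))

-- Coefficient extraction

conv : Seq → Seq → Seq
conv u v zero = u 0 * v 0
conv u v (suc n) = u 0 * v (suc n) + conv (∂ u) v n

conv-cong : ∀ {u u′ v v′} → u ≐ u′ → v ≐ v′ → conv u v ≐ conv u′ v′
conv-cong p q zero = cong₂ _*_ (p 0) (q 0)
conv-cong p q (suc n) = cong₂ _+_ (cong₂ _*_ (p 0) (q (suc n))) (conv-cong (λ k → p (suc k)) q n)

conv-+ : ∀ u u′ v → conv (u ⊹ u′) v ≐ conv u v ⊹ conv u′ v
conv-+ u u′ v zero = ℤₚ.*-distribʳ-+ (v 0) (u 0) (u′ 0)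
conv-+ u u′ v (suc n) = trans (cong₂ _+_ (ℤₚ.*-distribʳ-+ (v (suc n)) (u 0) (u′ 0)) (conv-+ (∂ u) (∂ u′) v n))
  (shuffle4 (u 0 * v (suc n)) (u′ 0 * v (suc n)) _ _)

conv-suc : ∀ u v n → conv u v (suc n) ≡ conv u (∂ v) n + u (suc n) * v 0
conv-suc u v zero = refl
conv-suc u v (suc n) = trans (cong (u 0 * v (suc (suc n)) +_) (conv-suc (∂ u) v n)) (sym (ℤₚ.+-assoc (u 0 * v (suc (suc n))) (conv (∂ u) (∂ v) n) (u (suc (suc n)) * v 0)))

𝓓-conv : ∀ u v → 𝓓 (conv u v) ≐ conv (𝓓 u) v ⊹ conv u (𝓓 v)
𝓓-conv u v zero = sym (trans (cong₂ _+_ (cong (_* v 0) (ℤₚ.*-zeroˡ (u 0))) (cong (u 0 *_) (ℤₚ.*-zeroˡ (v 0))))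
  (trans (cong (_+ u 0 * 0ℤ) (ℤₚ.*-zeroˡ (v 0))) (trans (ℤₚ.+-identityˡ _) (trans (ℤₚ.*-zeroʳ (u 0)) (sym (ℤₚ.*-zeroˡ (u 0 * v 0)))))))
𝓓-conv u v (suc n) = begin
  pos (suc n) * (u 0 * v (suc n) + c)
    ≡⟨ expand (pos n) (u 0) (v (suc n)) c ⟩
  (u 0 * (pos (suc n) * v (suc n)) + pos n * c) + c
    ≡⟨ cong (λ x → (u 0 * (pos (suc n) * v (suc n)) + x) + c) (𝓓-conv (∂ u) v n) ⟩
  (u 0 * (pos (suc n) * v (suc n)) + (conv (𝓓 (∂ u)) v n + conv (∂ u) (𝓓 v) n)) + c
    ≡⟨ arrange (u 0 * (pos (suc n) * v (suc n))) (conv (𝓓 (∂ u)) v n) (conv (∂ u) (𝓓 v) n) c (u 0) (v (suc n)) ⟩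
  ((0ℤ * u 0) * v (suc n) + (conv (𝓓 (∂ u)) v n + c)) + (u 0 * (pos (suc n) * v (suc n)) + conv (∂ u) (𝓓 v) n)
    ≡⟨ cong (λ x → ((0ℤ * u 0) * v (suc n) + x) + (u 0 * (pos (suc n) * v (suc n)) + conv (∂ u) (𝓓 v) n))
         (trans (conv-cong (𝓓-suc u) (λ _ → refl) n) (conv-+ (𝓓 (∂ u)) (∂ u) v n)) ⟨
  conv (𝓓 u) v (suc n) + conv u (𝓓 v) (suc n) ∎
  where
  open ≡-Reasoning
  c = conv (∂ u) v n
  expand : ∀ n a b c → (1ℤ + n) * (a * b + c) ≡ (a * ((1ℤ + n) * b) + n * c) + c
  expand = ℤ-Solver.solve-∀
  arrange : ∀ p q r c x y → (p + (q + r)) + c ≡ ((0ℤ * x) * y + (q + c)) + (p + r)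
  arrange = ℤ-Solver.solve-∀

conv-∂𝓓 : ∀ u v n → conv (∂ (𝓓 u)) v n + conv u (∂ (𝓓 v)) n ≡ pos (suc n) * conv u v (suc n)
conv-∂𝓓 u v n = sym (trans (𝓓-conv u v (suc n)) (cong₂ _+_
  (trans (cong (_+ conv (∂ (𝓓 u)) v n) (trans (cong (_* v (suc n)) (ℤₚ.*-zeroˡ (u 0))) (ℤₚ.*-zeroˡ (v (suc n))))) (ℤₚ.+-identityˡ (conv (∂ (𝓓 u)) v n)))
  (trans (conv-suc u (𝓓 v) n) (trans (cong (conv u (∂ (𝓓 v)) n +_) (trans (cong (u (suc n) *_) (ℤₚ.*-zeroˡ (v 0))) (ℤₚ.*-zeroʳ (u (suc n))))) (ℤₚ.+-identityʳ (conv u (∂ (𝓓 v)) n))))))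

infix 9 _!·_
_!·_ : ℕ → ℤ → ℤ
n !· x = pos (n !) * x

-- Passage from exponential to ordinary generating functions; `conv` is the Cauchy product.
⋆-factorial : ∀ n f h u v → (∀ k → f k ≡ k !· u k) → (∀ k → h k ≡ k !· v k) → (f ⋆ h) n ≡ n !· conv u v n
⋆-factorial zero f h u v p q = trans (cong₂ _*_ (trans (p 0) (ℤₚ.*-identityˡ (u 0))) (trans (q 0) (ℤₚ.*-identityˡ (v 0)))) (sym (ℤₚ.*-identityˡ _))
⋆-factorial (suc n) f h u v p q = begin
  (∂ f ⋆ h) n + (f ⋆ ∂ h) n
    ≡⟨ cong₂ _+_ (⋆-factorial n (∂ f) h (∂ (𝓓 u)) v (λ k → trans (p (suc k)) (shift k (u (suc k)))) q)
         (⋆-factorial n f (∂ h) u (∂ (𝓓 v)) p (λ k → trans (q (suc k)) (shift k (v (suc k))))) ⟩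
  n !· conv (∂ (𝓓 u)) v n + n !· conv u (∂ (𝓓 v)) n
    ≡⟨ trans (sym (ℤₚ.*-distribˡ-+ (pos (n !)) _ _)) (cong (n !·_) (conv-∂𝓓 u v n)) ⟩
  n !· (pos (suc n) * conv u v (suc n))
    ≡⟨ shift n (conv u v (suc n)) ⟨
  suc n !· conv u v (suc n) ∎
  where
  open ≡-Reasoning
  shift : ∀ k x → suc k !· x ≡ k !· (pos (suc k) * x)
  shift k x = trans (cong (_* x) (ℤₚ.pos-* (suc k) (k !))) (swap (pos (suc k)) (pos (k !)) x)
    where
    swap : ∀ a b c → (a * b) * c ≡ b * (a * c)
    swap = ℤ-Solver.solve-∀

∑-upTo : ∀ n (f : ℕ → ℤ) → ∑ (upTo (suc n)) f ≡ f 0 + ∑ (upTo n) (λ k → f (suc k))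
∑-upTo n f = cong (f 0 +_) (trans (cong (λ l → ∑ l f) (sym (Listₚ.map-upTo suc n))) (∑-map (upTo n) suc f))

conv-∑ : ∀ u v n → conv u v n ≡ (∑[ k ∈ upTo n ] u k * v (n ∸ k)) + u n * v 0
conv-∑ u v zero = sym (ℤₚ.+-identityˡ _)
conv-∑ u v (suc n) = trans (cong (u 0 * v (suc n) +_) (conv-∑ (∂ u) v n))
  (trans (sym (ℤₚ.+-assoc (u 0 * v (suc n)) (∑[ k ∈ upTo n ] u (suc k) * v (n ∸ k)) (u (suc n) * v 0))) (cong (_+ u (suc n) * v 0) (sym (∑-upTo n (λ k → u k * v (suc n ∸ k))))))

-- Polynomials in N as functionals

Terms : Set
Terms = List (ℤ × ℕ)

⟪_⟫ : Terms → (ℕ → ℤ) → ℤ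
⟪ p ⟫ φ = ∑ p (λ (a , e) → a * φ e)

-- Φ is a polynomial in N in which every power N^e has been replaced by φ(e). Taking φ = (N ^_)
-- recovers its value at N, taking an indicator extracts coefficients.
Representable : ((ℕ → ℤ) → ℤ) → Set
Representable Φ = Σ[ p ∈ Terms ] (∀ φ → Φ φ ≡ ⟪ p ⟫ φ)

rep-eval : ∀ e → Representable (λ φ → φ e)
rep-eval e = [ 1ℤ , e ] , λ φ → sym (trans (ℤₚ.+-identityʳ _) (ℤₚ.*-identityˡ (φ e)))

rep-+ : ∀ {Φ Ψ} → Representable Φ → Representable Ψ → Representable (λ φ → Φ φ + Ψ φ)
rep-+ (p , h) (q , k) = p ++ q , λ φ → trans (cong₂ _+_ (h φ) (k φ)) (sym (∑-++ p q _))

rep-* : ∀ c {Φ} → Representable Φ → Representable (λ φ → c * Φ φ)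
rep-* c (p , h) = map (λ (a , e) → c * a , e) p , λ φ → trans (cong (c *_) (h φ))
  (trans (∑-*ˡ p c _) (sym (trans (∑-map p _ _) (∑-cong p (λ (a , e) → ℤₚ.*-assoc c a (φ e))))))

rep-∑ : ∀ {A : Set} (xs : List A) {Φ : A → (ℕ → ℤ) → ℤ} → (∀ x → Representable (Φ x)) → Representable (λ φ → ∑[ x ∈ xs ] Φ x φ)
rep-∑ [] h = [] , λ φ → refl
rep-∑ (x ∷ xs) h = rep-+ (h x) (rep-∑ xs h)

rep-∘ : ∀ (s : ℕ → ℕ) {Φ} → Representable Φ → Representable (λ φ → Φ (λ e → φ (s e)))
rep-∘ s (p , h) = map (λ (a , e) → a , s e) p , λ φ → trans (h _) (sym (∑-map p _ _))

private
  dense : List ℤ → (ℕ → ℤ) → ℤ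
  dense [] φ = 0ℤ
  dense (a ∷ as) φ = a * φ 0 + dense as (λ e → φ (suc e))

  addTerm : ℤ → ℕ → List ℤ → List ℤ
  addTerm a zero [] = a ∷ []
  addTerm a zero (b ∷ bs) = (a + b) ∷ bs
  addTerm a (suc e) [] = 0ℤ ∷ addTerm a e []
  addTerm a (suc e) (b ∷ bs) = b ∷ addTerm a e bs

  dense-addTerm : ∀ a e bs φ → dense (addTerm a e bs) φ ≡ a * φ e + dense bs φ
  dense-addTerm a zero [] φ = refl
  dense-addTerm a zero (b ∷ bs) φ = trans (cong (_+ dense bs (λ e → φ (suc e))) (ℤₚ.*-distribʳ-+ (φ 0) a b)) (ℤₚ.+-assoc (a * φ 0) (b * φ 0) _)
  dense-addTerm a (suc e) [] φ = trans (cong₂ _+_ (ℤₚ.*-zeroˡ (φ 0)) (dense-addTerm a e [] _)) (ℤₚ.+-identityˡ _)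
  dense-addTerm a (suc e) (b ∷ bs) φ = trans (cong (b * φ 0 +_) (dense-addTerm a e bs _)) (swap (b * φ 0) (a * φ (suc e)) _)
    where
    swap : ∀ x y z → x + (y + z) ≡ y + (x + z)
    swap = ℤ-Solver.solve-∀

  toDense : Terms → List ℤ
  toDense [] = []
  toDense ((a , e) ∷ p) = addTerm a e (toDense p)

  dense-toDense : ∀ p φ → dense (toDense p) φ ≡ ⟪ p ⟫ φ
  dense-toDense [] φ = refl
  dense-toDense ((a , e) ∷ p) φ = trans (dense-addTerm a e (toDense p) φ) (cong (a * φ e +_) (dense-toDense p φ))

  -- Evaluation points start at N = 2, because the recursion also involves N - 1, where the weight
  -- is a power only for a positive number of colours.
  powers : ℕ → ℕ → ℤ
  powers K e = pos (suc (suc K)) ^ e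

  dense-* : ∀ as c φ → dense as (λ e → c * φ e) ≡ c * dense as φ
  dense-* [] c φ = sym (ℤₚ.*-zeroʳ c)
  dense-* (a ∷ as) c φ = trans (cong (a * (c * φ 0) +_) (dense-* as c _)) (factor a c (φ 0) _)
    where
    factor : ∀ a c x y → a * (c * x) + c * y ≡ c * (a * x + y)
    factor = ℤ-Solver.solve-∀

  small-multiple : ∀ a v → a + pos (suc (suc ℤ.∣ a ∣)) * v ≡ 0ℤ → a ≡ 0ℤ
  small-multiple a v h = ℤₚ.∣i∣≡0⇒i≡0 (go ℤ.∣ v ∣ (trans (cong ℤ.∣_∣ a≡) (trans (ℤₚ.∣-i∣≡∣i∣ (pos (suc (suc ℤ.∣ a ∣)) * v)) (ℤₚ.abs-* (pos (suc (suc ℤ.∣ a ∣))) v))))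
    where
    a≡ : a ≡ - (pos (suc (suc ℤ.∣ a ∣)) * v)
    a≡ = inverseˡ-unique a _ h
      where open import Algebra.Properties.Group (CommutativeRing.+-group ℤₚ.+-*-commutativeRing) using (inverseˡ-unique)
    go : ∀ w → ℤ.∣ a ∣ ≡ suc (suc ℤ.∣ a ∣) ℕ.* w → ℤ.∣ a ∣ ≡ 0
    go zero e = trans e (ℕₚ.*-zeroʳ ℤ.∣ a ∣)
    go (suc w) e = contradiction (ℕₚ.≤-trans (ℕₚ.≤-trans (ℕₚ.n≤1+n (suc ℤ.∣ a ∣)) (ℕₚ.m≤m*n (suc (suc ℤ.∣ a ∣)) (suc w))) (ℕₚ.≤-reflexive (sym e))) ℕₚ.1+n≰n

  -- The constant coefficient a is divisible by every K + 2; K = |a| gives a divisor exceeding |a|,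
  -- so a = 0. Then K + 2 is cancelled and the remaining coefficients follow.
  dense-zero : ∀ as → (∀ K → dense as (powers K) ≡ 0ℤ) → ∀ φ → dense as φ ≡ 0ℤ
  dense-zero [] h φ = refl
  dense-zero (a ∷ as) h φ = trans (cong₂ _+_ (trans (cong (_* φ 0) a≡0) (ℤₚ.*-zeroˡ (φ 0))) (dense-zero as rest _)) refl
    where
    h′ : ∀ K → a + pos (suc (suc K)) * dense as (powers K) ≡ 0ℤ
    h′ K = trans (cong₂ _+_ (sym (ℤₚ.*-identityʳ a)) (sym (dense-* as (pos (suc (suc K))) (powers K)))) (h K)
    a≡0 : a ≡ 0ℤ
    a≡0 = small-multiple a _ (h′ ℤ.∣ a ∣)
    rest : ∀ K → dense as (powers K) ≡ 0ℤ
    rest K = ℤₚ.*-cancelˡ-≡ (pos (suc (suc K))) (dense as (powers K)) 0ℤ (trans (sym (ℤₚ.+-identityˡ _))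
      (trans (cong (_+ pos (suc (suc K)) * dense as (powers K)) (sym a≡0)) (trans (h′ K) (sym (ℤₚ.*-zeroʳ (pos (suc (suc K))))))))

-- Values at infinitely many N determine the coefficients, and these determine the functional on
-- every φ.
polynomial-identity : ∀ {Φ Ψ} → Representable Φ → Representable Ψ →
  (∀ K → Φ (λ e → pos (suc (suc K)) ^ e) ≡ Ψ (λ e → pos (suc (suc K)) ^ e)) → ∀ φ → Φ φ ≡ Ψ φ
polynomial-identity {Φ} {Ψ} (p , h) (q , k) eq φ = ℤₚ.i-j≡0⇒i≡j (Φ φ) (Ψ φ) (trans (difference φ) (dense-zero (toDense (proj₁ r)) vanish φ))
  where
  r : Representable (λ φ → Φ φ + (- 1ℤ) * Ψ φ)
  r = rep-+ (p , h) (rep-* (- 1ℤ) (q , k))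
  difference : ∀ φ → Φ φ - Ψ φ ≡ dense (toDense (proj₁ r)) φ
  difference φ = trans (cong (Φ φ +_) (sym (ℤₚ.-1*i≡-i (Ψ φ)))) (trans (proj₂ r φ) (sym (dense-toDense (proj₁ r) φ)))
  vanish : ∀ K → dense (toDense (proj₁ r)) (powers K) ≡ 0ℤ
  vanish K = trans (sym (difference (powers K))) (ℤₚ.i≡j⇒i-j≡0 (eq K))

-- Second differences of powers

-- The functionals representing (N + 1)ᵉ and (N − 1)ᵉ.
T⁺ T⁻ : ℕ → (ℕ → ℤ) → ℤ
T⁺ zero φ = φ 0
T⁺ (suc e) φ = T⁺ e (λ x → φ (suc x)) + T⁺ e φ
T⁻ zero φ = φ 0
T⁻ (suc e) φ = T⁻ e (λ x → φ (suc x)) - T⁻ e φ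

rep-T⁺ : ∀ e → Representable (T⁺ e)
rep-T⁺ zero = rep-eval 0
rep-T⁺ (suc e) = rep-+ (rep-∘ suc (rep-T⁺ e)) (rep-T⁺ e)

rep-T⁻ : ∀ e → Representable (T⁻ e)
rep-T⁻ zero = rep-eval 0
rep-T⁻ (suc e) with rep-+ (rep-∘ suc (rep-T⁻ e)) (rep-* (- 1ℤ) (rep-T⁻ e))
... | p , h = p , λ φ → trans (cong (T⁻ e (λ x → φ (suc x)) +_) (sym (ℤₚ.-1*i≡-i _))) (h φ)

T-scale : ∀ (T : ℕ → (ℕ → ℤ) → ℤ) → (∀ e → Representable (T e)) → ∀ e c φ → T e (λ x → c * φ x) ≡ c * T e φ
T-scale T r e c φ with r e
... | p , h = trans (h _) (trans (∑-cong p (λ (a , x) → swap a c (φ x))) (trans (sym (∑-*ˡ p c _)) (cong (c *_) (sym (h φ)))))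
  where
  swap : ∀ a c x → a * (c * x) ≡ c * (a * x)
  swap = ℤ-Solver.solve-∀

T⁺-power : ∀ e N → T⁺ e (λ x → N ^ x) ≡ (1ℤ + N) ^ e
T⁺-power zero N = refl
T⁺-power (suc e) N = trans (cong₂ _+_ (trans (T-scale T⁺ rep-T⁺ e N (N ^_)) (cong (N *_) (T⁺-power e N))) (T⁺-power e N)) (factor N _)
  where
  factor : ∀ N x → N * x + x ≡ (1ℤ + N) * x
  factor = ℤ-Solver.solve-∀

T⁻-power : ∀ e N → T⁻ e (λ x → (1ℤ + N) ^ x) ≡ N ^ e
T⁻-power zero N = refl
T⁻-power (suc e) N = trans (cong₂ (λ a b → a - b) (trans (T-scale T⁻ rep-T⁻ e (1ℤ + N) ((1ℤ + N) ^_)) (cong ((1ℤ + N) *_) (T⁻-power e N))) (T⁻-power e N)) (factor N _)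
  where
  factor : ∀ N x → (1ℤ + N) * x - x ≡ N * x
  factor = ℤ-Solver.solve-∀

odd : ℕ → Bool
odd zero = false
odd (suc i) = not (odd i)

private
  -- The terms of even (b = `false`) or odd (b = `true`) index in the binomial expansion of (N +
  -- 1)^e.
  pascalSum : Bool → ℕ → ℕ → (ℕ → ℤ) → ℤ
  pascalSum b M e φ = ∑[ i ∈ upTo M ] ι (if b then odd i else not (odd i)) * (pos (e C i) * φ (e ∸ i))

  C-zero : ∀ {e i} → e < i → e C i ≡ 0
  C-zero {e} {i} lt = k>n⇒nCk≡0 lt

  head-split : ∀ b M e φ → pascalSum b (suc M) e φ ≡ ι (if b then false else true) * φ e + (∑[ i ∈ upTo M ] ι (if b then not (odd i) else odd i) * (pos (e C suc i) * φ (e ∸ suc i)))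
  head-split true M e φ = ∑-upTo M (λ i → ι (odd i) * (pos (e C i) * φ (e ∸ i)))
  head-split false M e φ = trans (∑-upTo M (λ i → ι (not (odd i)) * (pos (e C i) * φ (e ∸ i)))) (cong₂ _+_ (cong (1ℤ *_) (ℤₚ.*-identityˡ (φ e)))
    (∑-cong (upTo M) (λ i → cong (λ x → ι x * (pos (e C suc i) * φ (e ∸ suc i))) (Boolₚ.not-involutive (odd i)))))

  snoc : ∀ b M e φ → e < M → pascalSum b (suc M) e φ ≡ pascalSum b M e φ
  snoc b M e φ lt = trans (cong (λ l → ∑ l g) (upTo-∷ʳ M)) (trans (∑-++ (upTo M) [ M ] g) (trans (cong (∑ (upTo M) g +_)
      (trans (ℤₚ.+-identityʳ (g M)) (trans (cong (λ x → ι (if b then odd M else not (odd M)) * (pos x * φ (e ∸ M))) (C-zero lt))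
        (trans (cong (ι (if b then odd M else not (odd M)) *_) (ℤₚ.*-zeroˡ (φ (e ∸ M)))) (ℤₚ.*-zeroʳ (ι (if b then odd M else not (odd M))))))))
      (ℤₚ.+-identityʳ _)))
    where
    g : ℕ → ℤ
    g i = ι (if b then odd i else not (odd i)) * (pos (e C i) * φ (e ∸ i))
    upTo-∷ʳ : ∀ M → upTo (suc M) ≡ upTo M ++ [ M ]
    upTo-∷ʳ M = sym (Listₚ.upTo-∷ʳ M)

  pascal : ∀ b M e φ → e < M → pascalSum b M e (λ x → φ (suc x)) + pascalSum (not b) M e φ ≡ pascalSum b (suc M) (suc e) φ
  pascal b M e φ lt = begin
    pascalSum b M e (λ x → φ (suc x)) + pascalSum (not b) M e φ
      ≡⟨ cong (_+ pascalSum (not b) M e φ) (trans (sym (snoc b M e (λ x → φ (suc x)) lt)) (head-split b M e (λ x → φ (suc x)))) ⟩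
    (h + ∑ (upTo M) (λ i → w i * (pos (e C suc i) * φ (suc (e ∸ suc i))))) + pascalSum (not b) M e φ
      ≡⟨ cong₂ (λ x y → (h + x) + y)
           (∑-cong (upTo M) (λ i → cong (w i *_) (shift i)))
           (∑-cong (upTo M) (λ i → cong (λ x → ι x * (pos (e C i) * φ (e ∸ i))) (flip-parity b i))) ⟩
    (h + ∑ (upTo M) (λ i → w i * (pos (e C suc i) * φ (e ∸ i)))) + (∑[ i ∈ upTo M ] w i * (pos (e C i) * φ (e ∸ i)))
      ≡⟨ trans (ℤₚ.+-assoc h _ _) (cong (h +_) (trans (sym (∑-+ (upTo M) _ _)) (∑-cong (upTo M) (λ i →
           trans (collect (w i) (pos (e C suc i)) (pos (e C i)) (φ (e ∸ i)))
             (cong (λ x → w i * (pos x * φ (e ∸ i))) (nCk+nC[k+1]≡[n+1]C[k+1] e i)))))) ⟩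
    h + (∑[ i ∈ upTo M ] w i * (pos (suc e C suc i) * φ (e ∸ i)))
      ≡⟨ head-split b M (suc e) φ ⟨
    pascalSum b (suc M) (suc e) φ ∎
    where
    open ≡-Reasoning
    h : ℤ
    h = ι (if b then false else true) * φ (suc e)
    w : ℕ → ℤ
    w i = ι (if b then not (odd i) else odd i)
    flip-parity : ∀ b i → (if not b then odd i else not (odd i)) ≡ (if b then not (odd i) else odd i)
    flip-parity true i = refl
    flip-parity false i = refl
    collect : ∀ w a b x → w * (a * x) + w * (b * x) ≡ w * ((b + a) * x)
    collect = ℤ-Solver.solve-∀
    shift : ∀ i → pos (e C suc i) * φ (suc (e ∸ suc i)) ≡ pos (e C suc i) * φ (e ∸ i)
    shift i with i ℕₚ.<? e
    ... | yes l = cong (λ x → pos (e C suc i) * φ x) (sym (ℕₚ.+-∸-assoc 1 l))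
    ... | no g = trans (cong (λ x → pos x * φ (suc (e ∸ suc i))) (C-zero (s≤s (ℕₚ.≮⇒≥ g))))
      (trans (ℤₚ.*-zeroˡ (φ (suc (e ∸ suc i)))) (sym (trans (cong (λ x → pos x * φ (e ∸ i)) (C-zero (s≤s (ℕₚ.≮⇒≥ g)))) (ℤₚ.*-zeroˡ (φ (e ∸ i))))))

  -- With X = (N+1)^e and Y = (N-1)^e the sum for e + 1 is N(X + Y) + (X - Y), and the difference is
  -- N(X - Y) + (X + Y), so both are proved together.
  sum-difference : ∀ e φ → (T⁺ e φ + T⁻ e φ ≡ pos 2 * pascalSum false (suc e) e φ) × (T⁺ e φ - T⁻ e φ ≡ pos 2 * pascalSum true (suc e) e φ)
  sum-difference zero φ = base (φ 0) , base′ (φ 0)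
    where
    base : ∀ x → x + x ≡ pos 2 * (1ℤ * (1ℤ * x) + 0ℤ)
    base = ℤ-Solver.solve-∀
    base′ : ∀ x → x - x ≡ pos 2 * (0ℤ * (1ℤ * x) + 0ℤ)
    base′ = ℤ-Solver.solve-∀
  sum-difference (suc e) φ with sum-difference e φ | sum-difference e (λ x → φ (suc x))
  ... | a , b | a′ , b′ =
    trans (arrange (T⁺ e (λ x → φ (suc x))) (T⁺ e φ) (T⁻ e (λ x → φ (suc x))) (T⁻ e φ))
      (trans (cong₂ _+_ a′ b) (trans (sym (ℤₚ.*-distribˡ-+ (pos 2) (pascalSum false (suc e) e (λ x → φ (suc x))) (pascalSum true (suc e) e φ))) (cong (pos 2 *_) (pascal false (suc e) e φ ℕₚ.≤-refl)))) ,
    trans (arrange′ (T⁺ e (λ x → φ (suc x))) (T⁺ e φ) (T⁻ e (λ x → φ (suc x))) (T⁻ e φ))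
      (trans (cong₂ _+_ b′ a) (trans (sym (ℤₚ.*-distribˡ-+ (pos 2) (pascalSum true (suc e) e (λ x → φ (suc x))) (pascalSum false (suc e) e φ))) (cong (pos 2 *_) (pascal true (suc e) e φ ℕₚ.≤-refl))))
    where
    arrange : ∀ a b c d → (a + b) + (c - d) ≡ (a + c) + (b - d)
    arrange = ℤ-Solver.solve-∀
    arrange′ : ∀ a b c d → (a + b) - (c - d) ≡ (a - c) + (b + d)
    arrange′ = ℤ-Solver.solve-∀

-- The odd terms cancel in (N+1)^e + (N-1)^e. The term of index 0 is split off; the index i + 1 with
-- i odd runs over the even numbers from 2 on, the 2g* + 2 of the theorem.
second-difference : ∀ e φ → T⁺ e φ + T⁻ e φ ≡ pos 2 * (φ e + (∑[ i ∈ upTo e ] ι (odd i) * (pos (e C suc i) * φ (e ∸ suc i))))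
second-difference e φ = trans (proj₁ (sum-difference e φ)) (cong (pos 2 *_) (trans (head-split false e e φ) (cong (_+ (∑[ i ∈ upTo e ] ι (odd i) * (pos (e C suc i) * φ (e ∸ suc i)))) (ℤₚ.*-identityˡ (φ e)))))

-- The recursion

sum-of-indicators : ∀ {P : ℕ → Set} (d : ∀ e → Dec (P e)) xs → (∑[ e ∈ xs ] ⟨ d e ⟩) ≡ 0ℤ → ∀ {e} → e ∈ xs → ¬ P e
sum-of-indicators d xs h e∈ p = contradiction (trans (sym (as-count xs)) h) (positive xs e∈)
  where
  as-count : ∀ xs → (∑[ e ∈ xs ] ⟨ d e ⟩) ≡ pos (length (filterᵇ (λ e → ⌊ d e ⌋) xs))
  as-count [] = refl
  as-count (x ∷ xs) with d x
  ... | yes _ = cong (1ℤ +_) (as-count xs)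
  ... | no _ = trans (ℤₚ.+-identityˡ _) (as-count xs)
  positive : ∀ xs → _ ∈ xs → pos (length (filterᵇ (λ e → ⌊ d e ⌋) xs)) ≢ 0ℤ
  positive (x ∷ xs) e∈ with d x
  positive (x ∷ xs) e∈ | yes _ = λ ()
  positive (x ∷ xs) (here refl) | no ¬p = contradiction p ¬p
  positive (x ∷ xs) (there e∈) | no _ = positive xs e∈

pick-upTo : ∀ L a (f : ℕ → ℤ) → a < L → (∑[ x ∈ upTo L ] ⟨ x ℕₚ.≟ a ⟩ * f x) ≡ f a
pick-upTo (suc L) zero f lt = trans (∑-upTo L (λ x → ⟨ x ℕₚ.≟ 0 ⟩ * f x)) (trans (cong₂ _+_ (ℤₚ.*-identityˡ (f 0)) (∑-zero (upTo L) (λ _ → refl))) (ℤₚ.+-identityʳ (f 0)))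
pick-upTo (suc L) (suc a) f (s≤s lt) = trans (∑-upTo L (λ x → ⟨ x ℕₚ.≟ suc a ⟩ * f x)) (trans (ℤₚ.+-identityˡ _) (trans
  (∑-cong (upTo L) (λ x → cong (_* f (suc x)) (⟨⟩-cong (suc x ℕₚ.≟ suc a) (x ℕₚ.≟ a) ℕₚ.suc-injective (cong suc)))) (pick-upTo L a (λ x → f (suc x)) lt)))

pick-upTo-none : ∀ L a (f : ℕ → ℤ) → L ≤ a → (∑[ x ∈ upTo L ] ⟨ x ℕₚ.≟ a ⟩ * f x) ≡ 0ℤ
pick-upTo-none L a f le = ∑-zero (upTo L) (λ {x} x∈ → trans (cong (_* f x) (⟨⟩-no (x ℕₚ.≟ a) (λ { refl → ℕₚ.1+n≰n (ℕₚ.≤-trans (∈ₚ.∈-upTo⁻ x∈) le) }))) (ℤₚ.*-zeroˡ (f x)))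

pos-sum : ∀ {A : Set} (xs : List A) (f : A → ℕ) → pos (sum (map f xs)) ≡ ∑[ x ∈ xs ] pos (f x)
pos-sum [] f = refl
pos-sum (x ∷ xs) f = cong (pos (f x) +_) (pos-sum xs f)

ι-∧ : ∀ a b → ι (a ∧ b) ≡ ι a * ι b
ι-∧ true b = sym (ℤₚ.*-identityˡ (ι b))
ι-∧ false b = refl

ι-≡ᵇ : ∀ a b → ι (a ℕ.≡ᵇ b) ≡ ⟨ a ℕₚ.≟ b ⟩
ι-≡ᵇ a b = go (a ℕ.≡ᵇ b) refl
  where
  go : ∀ c → (a ℕ.≡ᵇ b) ≡ c → ι (a ℕ.≡ᵇ b) ≡ ⟨ a ℕₚ.≟ b ⟩
  go true e = trans (cong ι e) (sym (⟨⟩-yes (a ℕₚ.≟ b) (ℕₚ.≡ᵇ⇒≡ a b (≡⇒T e))))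
  go false e = trans (cong ι e) (sym (⟨⟩-no (a ℕₚ.≟ b) (λ p → contradiction (trans (sym (T⇒≡ (ℕₚ.≡⇒≡ᵇ a b p))) e) λ ())))

∑-vecs-filterᵇ : ∀ {A : Set} (p : A → Bool) (xs : List A) k (F : Vec A k → ℤ) →
  (∑[ v ∈ vecsOver xs k ] ι (all p (Vec.toList v)) * F v) ≡ ∑ (vecsOver (filterᵇ p xs) k) F
∑-vecs-filterᵇ p xs zero F = cong (_+ 0ℤ) (ℤₚ.*-identityˡ (F []))
∑-vecs-filterᵇ p xs (suc k) F = begin
  (∑[ v ∈ vecsOver xs (suc k) ] ι (all p (Vec.toList v)) * F v)
    ≡⟨ ∑-cons xs k _ ⟩
  (∑[ x ∈ xs ] ∑[ v ∈ vecsOver xs k ] ι (p x ∧ all p (Vec.toList v)) * F (x ∷ v))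
    ≡⟨ ∑-cong xs (λ x → trans (∑-cong (vecsOver xs k) (λ v → trans (cong (_* F (x ∷ v)) (ι-∧ (p x) (all p (Vec.toList v)))) (ℤₚ.*-assoc (ι (p x)) _ _)))
         (trans (sym (∑-*ˡ (vecsOver xs k) (ι (p x)) _)) (cong (ι (p x) *_) (∑-vecs-filterᵇ p xs k (λ v → F (x ∷ v)))))) ⟩
  (∑[ x ∈ xs ] ι (p x) * ∑ (vecsOver (filterᵇ p xs) k) (λ v → F (x ∷ v)))
    ≡⟨ ∑-filterᵇ p xs _ ⟨
  (∑[ x ∈ filterᵇ p xs ] ∑ (vecsOver (filterᵇ p xs) k) (λ v → F (x ∷ v)))
    ≡⟨ ∑-cons (filterᵇ p xs) k F ⟨
  ∑ (vecsOver (filterᵇ p xs) (suc k)) F ∎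
  where open ≡-Reasoning

∑⁴-exchange : ∀ {A B C D : Set} (as : List A) (bs : A → List B) (cs : List C) (ds : List D) w (X : A → B → C → D → ℤ) →
  (∑[ a ∈ as ] ∑[ b ∈ bs a ] w * (∑[ c ∈ cs ] ∑[ d ∈ ds ] X a b c d)) ≡
  w * (∑[ c ∈ cs ] ∑[ d ∈ ds ] ∑[ a ∈ as ] ∑[ b ∈ bs a ] X a b c d)
∑⁴-exchange as bs cs ds w X = begin
  (∑[ a ∈ as ] ∑[ b ∈ bs a ] w * (∑[ c ∈ cs ] ∑[ d ∈ ds ] X a b c d))
    ≡⟨ trans (∑-cong as (λ a → sym (∑-*ˡ (bs a) w _))) (sym (∑-*ˡ as w _)) ⟩
  w * (∑[ a ∈ as ] ∑[ b ∈ bs a ] ∑[ c ∈ cs ] ∑[ d ∈ ds ] X a b c d)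
    ≡⟨ cong (w *_) (trans (∑-cong as (λ a → trans (∑-swap (bs a) cs _) (∑-cong cs (λ c → ∑-swap (bs a) ds _))))
         (trans (∑-swap as cs _) (∑-cong cs (λ c → ∑-swap as ds _)))) ⟩
  w * (∑[ c ∈ cs ] ∑[ d ∈ ds ] ∑[ a ∈ as ] ∑[ b ∈ bs a ] X a b c d) ∎
  where open ≡-Reasoning

module _ (m′ : ℕ) where
  private
    m = suc m′

    deg : ℕ → List ℕ
    deg = degrees m′

    -- Index n stands for n + 1 star vertices. At φ = (N ^_) this is the coloured count of rooted
    -- connected tuples, a polynomial in N.
    E : ℕ → (ℕ → ℤ) → ℤ
    E n φ = ∑ (deg n) φ

    -- The coefficients of g_N and of ∂ g_N after the factorials are taken out.
    u A : ℤ → Seq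
    u N zero = 0ℤ
    u N (suc k) = E k (N ^_)
    A N k = pos (suc k) * E k (N ^_)

    g : ℕ → Seq
    g N = 𝓓 (connWeight N m)

    connWeight-E : ∀ K n → connWeight (suc K) m (suc n) ≡ n !· E n (pos (suc K) ^_)
    connWeight-E K n = trans (∑-cong∈ (connTuples m (suc n)) (λ {t} t∈ →
      colourWeight-degree K t (proj₁ (Enumerates.sound (connTuples-enumerates m (suc n)) t∈)))) (∑-degrees m′ n (pos (suc K) ^_))

    suc-! : ∀ k x → pos (suc k) * (k !· x) ≡ suc k !· x
    suc-! k x = trans (sym (ℤₚ.*-assoc (pos (suc k)) (pos (k !)) x)) (cong (_* x) (sym (ℤₚ.pos-* (suc k) (k !))))

    g-factorial : ∀ K k → g (suc K) k ≡ k !· u (pos (suc K)) k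
    g-factorial K zero = ℤₚ.*-zeroˡ (connWeight (suc K) m 0)
    g-factorial K (suc k) = trans (cong (pos (suc k) *_) (connWeight-E K k)) (suc-! k _)

    ∂g-factorial : ∀ K k → ∂ (g (suc K)) k ≡ k !· A (pos (suc K)) k
    ∂g-factorial K k = trans (cong (pos (suc k) *_) (connWeight-E K k)) (swap (pos (suc k)) (pos (k !)) _)
      where
      swap : ∀ a b c → a * (b * c) ≡ b * (a * c)
      swap = ℤ-Solver.solve-∀

    conv-A : ∀ N (v : Seq) n → v 0 ≡ 0ℤ → conv (A N) v n ≡ ∑[ k ∈ upTo n ] A N k * v (suc (n ∸ suc k))
    conv-A N v n v₀ = trans (conv-∑ (A N) v n) (trans (cong₂ _+_
        (∑-cong∈ (upTo n) (λ {k} k∈ → cong (λ x → A N k * v x) (ℕₚ.+-∸-assoc 1 (∈ₚ.∈-upTo⁻ k∈))))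
        (trans (cong (A N n *_) v₀) (ℤₚ.*-zeroʳ (A N n)))) (ℤₚ.+-identityʳ _))

  -- `connected-toda` at N = K + 2, read off at index n and divided by n!. The last term of the
  -- convolution is absent because g_N has no constant term.
  recursion-at : ∀ n K → let N = pos (suc (suc K)) in
    pos n * A N n + (∑[ k ∈ upTo n ] A N k * (E (n ∸ suc k) (N ^_) + E (n ∸ suc k) (N ^_))) ≡
    ∑[ k ∈ upTo n ] A N k * (E (n ∸ suc k) (pos (suc (suc (suc K))) ^_) + E (n ∸ suc k) (pos (suc K) ^_))
  recursion-at n K = ℤₚ.*-cancelˡ-≡ (pos (n !)) _ _ ⦃ nonZero ⦄ (begin
    pos (n !) * (pos n * A N n + (∑[ k ∈ upTo n ] A N k * (E (n ∸ suc k) (N ^_) + E (n ∸ suc k) (N ^_))))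
      ≡⟨ trans (ℤₚ.*-distribˡ-+ (pos (n !)) _ _) (cong₂ _+_
           (trans (swap (pos (n !)) (pos n) (A N n)) (cong (pos n *_) (sym (∂g-factorial (suc K) n))))
           (cong (n !·_) (sym (conv-A N (u N ⊹ u N) n refl)))) ⟩
    𝓓 (∂ g₁) n + n !· conv (A N) (u N ⊹ u N) n
      ≡⟨ cong (𝓓 (∂ g₁) n +_) (trans (⋆-comm (g₁ ⊹ g₁) (∂ g₁) n)
           (⋆-factorial n (∂ g₁) (g₁ ⊹ g₁) (A N) (u N ⊹ u N) (∂g-factorial (suc K)) (double (suc K) (suc K)))) ⟨
    𝓓 (∂ g₁) n + ((g₁ ⊹ g₁) ⋆ ∂ g₁) n
      ≡⟨ connected-toda m (suc K) n ⟩
    ((g (suc (suc (suc K))) ⊹ g (suc K)) ⋆ ∂ g₁) n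
      ≡⟨ trans (⋆-comm (g (suc (suc (suc K))) ⊹ g (suc K)) (∂ g₁) n)
           (⋆-factorial n (∂ g₁) (g (suc (suc (suc K))) ⊹ g (suc K)) (A N) (u N⁺ ⊹ u N⁻) (∂g-factorial (suc K)) (double (suc (suc K)) K)) ⟩
    n !· conv (A N) (u N⁺ ⊹ u N⁻) n
      ≡⟨ cong (n !·_) (conv-A N (u N⁺ ⊹ u N⁻) n refl) ⟩
    pos (n !) * (∑[ k ∈ upTo n ] A N k * (E (n ∸ suc k) (N⁺ ^_) + E (n ∸ suc k) (N⁻ ^_))) ∎)
    where
    open ≡-Reasoning
    N N⁺ N⁻ : ℤ
    N = pos (suc (suc K))
    N⁺ = pos (suc (suc (suc K)))
    N⁻ = pos (suc K)
    g₁ = g (suc (suc K))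
    nonZero : ℤ.NonZero (pos (n !))
    nonZero = ℕₚ._!≢0 n
    swap : ∀ a b c → a * (b * c) ≡ b * (a * c)
    swap = ℤ-Solver.solve-∀
    double : ∀ K L k → (g (suc K) ⊹ g (suc L)) k ≡ k !· (u (pos (suc K)) ⊹ u (pos (suc L))) k
    double K L k = trans (cong₂ _+_ (g-factorial K k) (g-factorial L k)) (sym (ℤₚ.*-distribˡ-+ (pos (k !)) _ _))

  private
    -- N^{e₁} times half the second difference of N^{e₂}, as a functional.
    W : ℕ → ℕ → (ℕ → ℤ) → ℤ
    W e₁ e₂ φ = ∑[ i ∈ upTo e₂ ] ι (odd i) * (pos (e₂ C suc i) * φ (e₁ ℕ.+ (e₂ ∸ suc i)))

    ∑∑ : ∀ n (F : ℕ → ℕ → ℤ) → ℕ → ℤ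
    ∑∑ n F k = ∑[ e₁ ∈ deg k ] ∑[ e₂ ∈ deg (n ∸ suc k) ] F e₁ e₂

    -- The two sides of `recursion-at` with N^e replaced by φ(e).
    Φ Ψ : ℕ → (ℕ → ℤ) → ℤ
    Φ n φ = pos n * (pos (suc n) * E n φ) + (∑[ k ∈ upTo n ] pos (suc k) * ∑∑ n (λ e₁ e₂ → pos 2 * φ (e₁ ℕ.+ e₂)) k)
    Ψ n φ = ∑[ k ∈ upTo n ] pos (suc k) * ∑∑ n (λ e₁ e₂ → T⁺ e₂ (λ x → φ (e₁ ℕ.+ x)) + T⁻ e₂ (λ x → φ (e₁ ℕ.+ x))) k

    rep-∑∑ : ∀ n {F : ℕ → ℕ → (ℕ → ℤ) → ℤ} → (∀ e₁ e₂ → Representable (F e₁ e₂)) →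
      Representable (λ φ → ∑[ k ∈ upTo n ] pos (suc k) * ∑∑ n (λ e₁ e₂ → F e₁ e₂ φ) k)
    rep-∑∑ n h = rep-∑ (upTo n) (λ k → rep-* (pos (suc k)) (rep-∑ (deg k) (λ e₁ → rep-∑ (deg (n ∸ suc k)) (h e₁))))

    functional-recursion : ∀ n φ → Φ n φ ≡ Ψ n φ
    functional-recursion n = polynomial-identity {Φ n} {Ψ n}
      (rep-+ (rep-* (pos n) (rep-* (pos (suc n)) (rep-∑ (deg n) rep-eval)))
        (rep-∑∑ n (λ e₁ e₂ → rep-* (pos 2) (rep-eval (e₁ ℕ.+ e₂)))))
      (rep-∑∑ n (λ e₁ e₂ → rep-+ (rep-∘ (e₁ ℕ.+_) (rep-T⁺ e₂)) (rep-∘ (e₁ ℕ.+_) (rep-T⁻ e₂))))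
      (λ K → trans (cong (pos n * A (pos (suc (suc K))) n +_) (∑-cong (upTo n) (λ k → left k (n ∸ suc k) (pos (suc (suc K))))))
        (trans (recursion-at n K) (∑-cong (upTo n) (λ k → sym (right k (n ∸ suc k) K)))))
      where
      open ≡-Reasoning
      product : ∀ k l (x y : ℕ → ℤ) → (∑[ e₁ ∈ deg k ] ∑[ e₂ ∈ deg l ] x e₁ * y e₂) ≡ E k x * E l y
      product k l x y = trans (∑-cong (deg k) (λ e₁ → sym (∑-*ˡ (deg l) (x e₁) y))) (sym (∑-*ʳ (deg k) (E l y) x))
      left : ∀ k l N → pos (suc k) * (∑[ e₁ ∈ deg k ] ∑[ e₂ ∈ deg l ] pos 2 * N ^ (e₁ ℕ.+ e₂)) ≡ A N k * (E l (N ^_) + E l (N ^_))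
      left k l N = trans (cong (pos (suc k) *_) (begin
          (∑[ e₁ ∈ deg k ] ∑[ e₂ ∈ deg l ] pos 2 * N ^ (e₁ ℕ.+ e₂))
            ≡⟨ ∑-cong (deg k) (λ e₁ → ∑-cong (deg l) (λ e₂ → trans (cong (pos 2 *_) (ℤₚ.^-distribˡ-+-* N e₁ e₂)) (two (N ^ e₁) (N ^ e₂)))) ⟩
          (∑[ e₁ ∈ deg k ] ∑[ e₂ ∈ deg l ] N ^ e₁ * (N ^ e₂ + N ^ e₂))
            ≡⟨ product k l (N ^_) (λ e → N ^ e + N ^ e) ⟩
          E k (N ^_) * E l (λ e → N ^ e + N ^ e)
            ≡⟨ cong (E k (N ^_) *_) (∑-+ (deg l) (N ^_) (N ^_)) ⟩
          E k (N ^_) * (E l (N ^_) + E l (N ^_)) ∎))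
        (sym (ℤₚ.*-assoc (pos (suc k)) (E k (N ^_)) _))
        where
        two : ∀ a b → pos 2 * (a * b) ≡ a * (b + b)
        two = ℤ-Solver.solve-∀
      right : ∀ k l K → let N = pos (suc (suc K)) in
        pos (suc k) * (∑[ e₁ ∈ deg k ] ∑[ e₂ ∈ deg l ] (T⁺ e₂ (λ x → N ^ (e₁ ℕ.+ x)) + T⁻ e₂ (λ x → N ^ (e₁ ℕ.+ x)))) ≡
        A N k * (E l (pos (suc (suc (suc K))) ^_) + E l (pos (suc K) ^_))
      right k l K = trans (cong (pos (suc k) *_) (begin
          (∑[ e₁ ∈ deg k ] ∑[ e₂ ∈ deg l ] (T⁺ e₂ (λ x → N ^ (e₁ ℕ.+ x)) + T⁻ e₂ (λ x → N ^ (e₁ ℕ.+ x))))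
            ≡⟨ ∑-cong (deg k) (λ e₁ → ∑-cong (deg l) (λ e₂ → trans (cong₂ _+_
                 (shifted T⁺ rep-T⁺ e₂ e₁ (T⁺-power e₂ N)) (shifted T⁻ rep-T⁻ e₂ e₁ (T⁻-power e₂ (pos (suc K))))) (sym (ℤₚ.*-distribˡ-+ (N ^ e₁) _ _)))) ⟩
          (∑[ e₁ ∈ deg k ] ∑[ e₂ ∈ deg l ] N ^ e₁ * (pos (suc (suc (suc K))) ^ e₂ + pos (suc K) ^ e₂))
            ≡⟨ product k l (N ^_) (λ e → pos (suc (suc (suc K))) ^ e + pos (suc K) ^ e) ⟩
          E k (N ^_) * E l (λ e → pos (suc (suc (suc K))) ^ e + pos (suc K) ^ e)
            ≡⟨ cong (E k (N ^_) *_) (∑-+ (deg l) _ _) ⟩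
          E k (N ^_) * (E l (pos (suc (suc (suc K))) ^_) + E l (pos (suc K) ^_)) ∎))
        (sym (ℤₚ.*-assoc (pos (suc k)) (E k (N ^_)) _))
        where
        N : ℤ
        N = pos (suc (suc K))
        shifted : ∀ (T : ℕ → (ℕ → ℤ) → ℤ) → (∀ e → Representable (T e)) → ∀ e₂ e₁ {y} → T e₂ (N ^_) ≡ y → T e₂ (λ x → N ^ (e₁ ℕ.+ x)) ≡ N ^ e₁ * y
        shifted T r e₂ e₁ h = trans (trans (proj₂ (r e₂) _) (trans (∑-cong (proj₁ (r e₂)) (λ (a , x) → cong (a *_) (ℤₚ.^-distribˡ-+-* N e₁ x))) (sym (proj₂ (r e₂) _))))
          (trans (T-scale T r e₂ (N ^ e₁) (N ^_)) (cong (N ^ e₁ *_) h))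

    -- The undifferenced terms 2 φ(e₁ + e₂) stand on both sides and are cancelled, leaving the
    -- second difference.
    reduced-recursion : ∀ n φ → pos n * (pos (suc n) * E n φ) ≡ pos 2 * (∑[ k ∈ upTo n ] pos (suc k) * ∑∑ n (λ e₁ e₂ → W e₁ e₂ φ) k)
    reduced-recursion n φ = RingProperties.+-cancelʳ ℤₚ.+-*-ring S _ _ (trans (functional-recursion n φ) (begin
      Ψ n φ
        ≡⟨ ∑-cong (upTo n) (λ k → cong (pos (suc k) *_) (trans (∑-cong (deg k) (λ e₁ → trans (∑-cong (deg (n ∸ suc k)) (λ e₂ →
             trans (second-difference e₂ (λ x → φ (e₁ ℕ.+ x))) (trans (ℤₚ.*-distribˡ-+ (pos 2) (φ (e₁ ℕ.+ e₂)) (W e₁ e₂ φ)) (ℤₚ.+-comm (pos 2 * φ (e₁ ℕ.+ e₂)) _))))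
             (∑-+ (deg (n ∸ suc k)) _ _))) (∑-+ (deg k) _ _))) ⟩
      (∑[ k ∈ upTo n ] pos (suc k) * (∑∑ n (λ e₁ e₂ → pos 2 * W e₁ e₂ φ) k + ∑∑ n (λ e₁ e₂ → pos 2 * φ (e₁ ℕ.+ e₂)) k))
        ≡⟨ trans (∑-cong (upTo n) (λ k → ℤₚ.*-distribˡ-+ (pos (suc k)) (∑∑ n (λ e₁ e₂ → pos 2 * W e₁ e₂ φ) k) (∑∑ n (λ e₁ e₂ → pos 2 * φ (e₁ ℕ.+ e₂)) k)))
             (∑-+ (upTo n) _ _) ⟩
      (∑[ k ∈ upTo n ] pos (suc k) * ∑∑ n (λ e₁ e₂ → pos 2 * W e₁ e₂ φ) k) + S
        ≡⟨ cong (_+ S) (trans (∑-cong (upTo n) (λ k → trans (cong (pos (suc k) *_) (trans (∑-cong (deg k) (λ e₁ → sym (∑-*ˡ (deg (n ∸ suc k)) (pos 2) _)))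
             (sym (∑-*ˡ (deg k) (pos 2) _)))) (swap (pos (suc k)) (pos 2) _))) (sym (∑-*ˡ (upTo n) (pos 2) _))) ⟩
      pos 2 * (∑[ k ∈ upTo n ] pos (suc k) * ∑∑ n (λ e₁ e₂ → W e₁ e₂ φ) k) + S ∎))
      where
      open ≡-Reasoning
      S = ∑[ k ∈ upTo n ] pos (suc k) * ∑∑ n (λ e₁ e₂ → pos 2 * φ (e₁ ℕ.+ e₂)) k
      swap : ∀ a b c → a * (b * c) ≡ b * (a * c)
      swap = ℤ-Solver.solve-∀

  -- Genus

  -- Euler's formula for s star vertices and e vertices and faces in total.
  Euler : ℕ → ℕ → ℕ → Set
  Euler s e g = s ℕ.+ e ℕ.+ 2 ℕ.* g ≡ s ℕ.* m ℕ.+ 2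

  Euler? : ∀ s e g → Dec (Euler s e g)
  Euler? s e g = (s ℕ.+ e ℕ.+ 2 ℕ.* g) ℕₚ.≟ (s ℕ.* m ℕ.+ 2)

  private
    module _ {s₁ s₂ e₁ g₁ g₂ x i : ℕ} (h₁ : Euler s₁ e₁ g₁) (h₂ : Euler s₂ (x ℕ.+ i) g₂) where
      -- Adding the two Euler formulas: joining pieces of genus g₁ and g₂ while losing i = 2g* + 2
      -- vertices and faces gives genus g₁ + g₂ + g*.
      total-Euler : (s₁ ℕ.+ s₂ ℕ.+ (e₁ ℕ.+ x)) ℕ.+ (i ℕ.+ 2 ℕ.* (g₁ ℕ.+ g₂)) ≡ (s₁ ℕ.+ s₂) ℕ.* m ℕ.+ 2 ℕ.+ 2
      total-Euler = trans (lhs s₁ s₂ e₁ x i g₁ g₂) (trans (cong₂ ℕ._+_ h₁ h₂) (rhs′ s₁ s₂ m))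
        where
        lhs : ∀ s₁ s₂ e₁ x i g₁ g₂ → (s₁ ℕ.+ s₂ ℕ.+ (e₁ ℕ.+ x)) ℕ.+ (i ℕ.+ 2 ℕ.* (g₁ ℕ.+ g₂)) ≡
          (s₁ ℕ.+ e₁ ℕ.+ 2 ℕ.* g₁) ℕ.+ (s₂ ℕ.+ (x ℕ.+ i) ℕ.+ 2 ℕ.* g₂)
        lhs = ℕ-Solver.solve-∀
        rhs′ : ∀ s₁ s₂ m → (s₁ ℕ.* m ℕ.+ 2) ℕ.+ (s₂ ℕ.* m ℕ.+ 2) ≡ (s₁ ℕ.+ s₂) ℕ.* m ℕ.+ 2 ℕ.+ 2
        rhs′ = ℕ-Solver.solve-∀

      Euler-glue⁻ : ∀ {g} → Euler (s₁ ℕ.+ s₂) (e₁ ℕ.+ x) g → i ℕ.+ 2 ℕ.* (g₁ ℕ.+ g₂) ≡ 2 ℕ.* g ℕ.+ 2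
      Euler-glue⁻ {g} h = ℕₚ.+-cancelˡ-≡ (s₁ ℕ.+ s₂ ℕ.+ (e₁ ℕ.+ x)) _ _
        (trans total-Euler (trans (cong (ℕ._+ 2) (sym h)) (ℕₚ.+-assoc (s₁ ℕ.+ s₂ ℕ.+ (e₁ ℕ.+ x)) (2 ℕ.* g) 2)))

      Euler-glue⁺ : ∀ {g} → i ℕ.+ 2 ℕ.* (g₁ ℕ.+ g₂) ≡ 2 ℕ.* g ℕ.+ 2 → Euler (s₁ ℕ.+ s₂) (e₁ ℕ.+ x) g
      Euler-glue⁺ {g} h = ℕₚ.+-cancelʳ-≡ 2 _ _ (trans (ℕₚ.+-assoc (s₁ ℕ.+ s₂ ℕ.+ (e₁ ℕ.+ x)) (2 ℕ.* g) 2)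
        (trans (cong ((s₁ ℕ.+ s₂ ℕ.+ (e₁ ℕ.+ x)) ℕ.+_) (sym h)) total-Euler))

    Euler-unique : ∀ {s e g g′} → Euler s e g → Euler s e g′ → g ≡ g′
    Euler-unique {s} {e} {g} {g′} h h′ = ℕₚ.*-cancelˡ-≡ g g′ 2 (ℕₚ.+-cancelˡ-≡ (s ℕ.+ e) _ _ (trans h (sym h′)))

    stars : ∀ {n k} → k < n → suc k ℕ.+ suc (n ∸ suc k) ≡ suc n
    stars {n} {k} lt = trans (cong suc (ℕₚ.+-suc k (n ∸ suc k))) (cong suc (ℕₚ.m+[n∸m]≡n lt))

    odd-half : ∀ i → odd i ≡ true → Σ[ j ∈ ℕ ] suc i ≡ 2 ℕ.* j ℕ.+ 2
    odd-half (suc zero) _ = 0 , refl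
    odd-half (suc (suc i)) h with odd-half i (trans (sym (Boolₚ.not-involutive (odd i))) h)
    ... | j , e = suc j , trans (cong (λ x → suc (suc x)) e) (step j)
      where
      step : ∀ j → suc (suc (2 ℕ.* j ℕ.+ 2)) ≡ 2 ℕ.* suc j ℕ.+ 2
      step = ℕ-Solver.solve-∀

    odd-double : ∀ j → odd (2 ℕ.* j ℕ.+ 1) ≡ true
    odd-double zero = refl
    odd-double (suc j) = trans (cong odd (step j)) (trans (Boolₚ.not-involutive _) (odd-double j))
      where
      step : ∀ j → 2 ℕ.* suc j ℕ.+ 1 ≡ suc (suc (2 ℕ.* j ℕ.+ 1))
      step = ℕ-Solver.solve-∀

    HasGenus : ℕ → ℕ → Set
    HasGenus n e = Σ[ g ∈ ℕ ] Euler (suc n) e g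

    hasGenus? : ∀ n e → Dec (HasGenus n e)
    hasGenus? n e with ℕₚ.anyUpTo? (Euler? (suc n) e) (suc (suc n ℕ.* m ℕ.+ 2))
    ... | yes (g , _ , h) = yes (g , h)
    ... | no ¬h = no (λ (g , h) → ¬h (g , s≤s (ℕₚ.≤-trans (ℕₚ.≤-trans (ℕₚ.m≤n*m g 2) (ℕₚ.m≤n+m (2 ℕ.* g) (suc n ℕ.+ e))) (ℕₚ.≤-reflexive h)) , h))

    -- All permutations of one point are trivial, giving m coloured vertices and one face; their
    -- number is read off from the weight at N = 2.
    one-star : ∀ (t : Tuple m 1) → AllV IsPerm t → degree t ≡ suc m
    one-star t ps = 2^-injective (degree t) (suc m) (trans (sym (colourWeight-degree 1 t ps))
      (trans (cong₂ _*_ (∏-one t) (Fix-one (prod t))) (ℤₚ.*-comm (pos 2 ^ m) (pos 2))))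
      where
      Fix-one : ∀ (σ : Vec (Fin 1) 1) → Fix 2 σ ≡ pos 2
      Fix-one (zero ∷ []) = trans (Fix-lift 2 []) (cong (pos 2 *_) (Fix-empty 2))
      ∏-one : ∀ {k} (t : Tuple k 1) → ∏Fix 2 t ≡ pos 2 ^ k
      ∏-one [] = refl
      ∏-one (σ ∷ t) = cong₂ _*_ (Fix-one σ) (∏-one t)

  -- That V − E + F is even and at most 2 for connected tuples is read off the
  -- recursion, which only produces monomials with this property.
  degrees-genus : ∀ n {e} → e ∈ deg n → HasGenus n e
  degrees-genus = <-rec _ step
    where
    open import Data.Nat.Induction using (<-rec)
    noGenus? : ∀ n e → Dec (¬ HasGenus n e)
    noGenus? n e = ¬? (hasGenus? n e)
    -- The indicator of failure. The recursion expresses its sum by smaller cases, all of whose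
    -- contributions vanish, and a vanishing sum of indicators leaves no failure.
    φ : ℕ → ℕ → ℤ
    φ n e = ⟨ noGenus? n e ⟩
    conclude : ∀ n → E n (φ n) ≡ 0ℤ → ∀ {e} → e ∈ deg n → HasGenus n e
    conclude n h {e} e∈ = decidable-stable (hasGenus? n e) (sum-of-indicators (noGenus? n) (deg n) h e∈)
    step : ∀ n → (∀ {k} → k < n → ∀ {e} → e ∈ deg k → HasGenus k e) → ∀ {e} → e ∈ deg n → HasGenus n e
    step zero _ = conclude 0 (trans (sym (ℤₚ.*-identityˡ (E 0 (φ 0)))) (trans (sym (∑-degrees m′ 0 (φ 0)))
      (∑-zero (connTuples m 1) (λ {t} t∈ → ⟨⟩-no (noGenus? 0 (degree t)) (λ ¬h → ¬h (subst (HasGenus 0)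
        (sym (one-star t (proj₁ (Enumerates.sound (connTuples-enumerates m 1) t∈)))) (0 , base m)))))))
      where
      base : ∀ m → 1 ℕ.+ suc m ℕ.+ 2 ℕ.* 0 ≡ 1 ℕ.* m ℕ.+ 2
      base = ℕ-Solver.solve-∀
    step (suc n) ih = conclude (suc n) (cancel (trans (reduced-recursion (suc n) (φ (suc n))) (trans (cong (pos 2 *_)
        (∑-zero (upTo (suc n)) (λ {k} k∈ → trans (cong (pos (suc k) *_) (∑-zero (deg k) (λ {e₁} e₁∈ → ∑-zero (deg (suc n ∸ suc k)) (λ {e₂} e₂∈ →
          vanish k (∈ₚ.∈-upTo⁻ k∈) e₁ e₂ (ih (∈ₚ.∈-upTo⁻ k∈) e₁∈) (ih (s≤s (ℕₚ.m∸n≤m n k)) e₂∈))))) (ℤₚ.*-zeroʳ (pos (suc k)))))) refl)))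
      where
      cancel : pos (suc n) * (pos (suc (suc n)) * E (suc n) (φ (suc n))) ≡ 0ℤ → E (suc n) (φ (suc n)) ≡ 0ℤ
      cancel h = ℤₚ.*-cancelˡ-≡ (pos (suc (suc n))) _ 0ℤ (trans (ℤₚ.*-cancelˡ-≡ (pos (suc n)) _ 0ℤ (trans h (sym (ℤₚ.*-zeroʳ (pos (suc n))))))
        (sym (ℤₚ.*-zeroʳ (pos (suc (suc n))))))
      vanish : ∀ k → k < suc n → ∀ e₁ e₂ → HasGenus k e₁ → HasGenus (suc n ∸ suc k) e₂ → W e₁ e₂ (φ (suc n)) ≡ 0ℤ
      vanish k lt e₁ e₂ (g₁ , h₁) (g₂ , h₂) = ∑-zero (upTo e₂) (λ {i} i∈ → go i (∈ₚ.∈-upTo⁻ i∈) (odd i) refl)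
        where
        go : ∀ i → i < e₂ → ∀ b → odd i ≡ b → ι (odd i) * (pos (e₂ C suc i) * φ (suc n) (e₁ ℕ.+ (e₂ ∸ suc i))) ≡ 0ℤ
        go i i< false o = trans (cong (λ b → ι b * (pos (e₂ C suc i) * φ (suc n) (e₁ ℕ.+ (e₂ ∸ suc i)))) o) refl
        go i i< true o with odd-half i o
        -- Here i + 1 = 2j + 2, so the degree produced has genus g₁ + g₂ + j.
        ... | j , eq = trans (cong (λ x → ι (odd i) * (pos (e₂ C suc i) * x)) (⟨⟩-no (noGenus? (suc n) (e₁ ℕ.+ (e₂ ∸ suc i))) (λ ¬h → ¬h
            (j ℕ.+ (g₁ ℕ.+ g₂) , subst (λ s → Euler s (e₁ ℕ.+ (e₂ ∸ suc i)) (j ℕ.+ (g₁ ℕ.+ g₂))) (stars lt)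
              (Euler-glue⁺ {suc k} {suc (suc n ∸ suc k)} {e₁} {g₁} {g₂} {e₂ ∸ suc i} {suc i} h₁ (subst (λ e → Euler (suc (suc n ∸ suc k)) e g₂) (sym (ℕₚ.m∸n+n≡m i<)) h₂)
                {j ℕ.+ (g₁ ℕ.+ g₂)} (trans (cong (ℕ._+ 2 ℕ.* (g₁ ℕ.+ g₂)) eq) (regroup j (g₁ ℕ.+ g₂))))))))
          (zero* (ι (odd i)) (pos (e₂ C suc i)))
          where
          regroup : ∀ j g → (2 ℕ.* j ℕ.+ 2) ℕ.+ 2 ℕ.* g ≡ 2 ℕ.* (j ℕ.+ g) ℕ.+ 2
          regroup = ℕ-Solver.solve-∀
          zero* : ∀ a b → a * (b * 0ℤ) ≡ 0ℤ
          zero* = ℤ-Solver.solve-∀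

  -- The labelled count is n! times a number of entries of `deg n`, so the division in the
  -- definition of the rooted count is exact.
  C-degrees : ∀ g n → pos (C[ m ] g , suc n) ≡ E n (λ e → ⟨ Euler? (suc n) e g ⟩)
  C-degrees g n = trans (cong pos (trans (cong (λ x → (x ℕ./ (n !)) ⦃ n ℕₚ.!≢0 ⦄) labelled) (m*n/n≡m rooted (n !) ⦃ n ℕₚ.!≢0 ⦄))) (sym rooted-eq)
    where
    open ≡-Reasoning
    rooted : ℕ
    rooted = length (filterᵇ (λ e → (suc n ℕ.+ e ℕ.+ 2 ℕ.* g) ℕ.≡ᵇ (suc n ℕ.* m ℕ.+ 2)) (deg n))
    rooted-eq : E n (λ e → ⟨ Euler? (suc n) e g ⟩) ≡ pos rooted
    rooted-eq = sym (trans (length-filterᵇ _ (deg n)) (∑-cong (deg n) (λ e → ι-≡ᵇ (suc n ℕ.+ e ℕ.+ 2 ℕ.* g) (suc n ℕ.* m ℕ.+ 2))))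
    labelled : labelledCount m g (suc n) ≡ rooted ℕ.* n !
    labelled = ℤₚ.+-injective (begin
      pos (labelledCount m g (suc n))
        ≡⟨ length-filterᵇ (isConstellation g) (allTuples m (suc n)) ⟩
      (∑[ t ∈ allTuples m (suc n) ] ι (all isPerm (Vec.toList t) ∧ isConnected t ∧ hasGenus g t))
        ≡⟨ ∑-cong (allTuples m (suc n)) (λ t → trans (ι-∧ (all isPerm (Vec.toList t)) _) (cong (ι (all isPerm (Vec.toList t)) *_) (ι-∧ (isConnected t) (hasGenus g t)))) ⟩
      (∑[ t ∈ allTuples m (suc n) ] ι (all isPerm (Vec.toList t)) * (ι (isConnected t) * ι (hasGenus g t)))
        ≡⟨ ∑-vecs-filterᵇ isPerm (vecsOver (allFin (suc n)) (suc n)) m (λ t → ι (isConnected t) * ι (hasGenus g t)) ⟩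
      (∑[ t ∈ permTuples m (suc n) ] ι (isConnected t) * ι (hasGenus g t))
        ≡⟨ ∑-filterᵇ isConnected (permTuples m (suc n)) (λ t → ι (hasGenus g t)) ⟨
      (∑[ t ∈ connTuples m (suc n) ] ι (hasGenus g t))
        ≡⟨ ∑-cong (connTuples m (suc n)) (λ t → trans (ι-≡ᵇ _ (suc n ℕ.* m ℕ.+ 2)) (cong (λ x → ⟨ (x ℕ.+ 2 ℕ.* g) ℕₚ.≟ (suc n ℕ.* m ℕ.+ 2) ⟩)
             (ℕₚ.+-assoc (suc n) (#coloredVertices t) (#faces t)))) ⟩
      (∑[ t ∈ connTuples m (suc n) ] ⟨ Euler? (suc n) (degree t) g ⟩)
        ≡⟨ ∑-degrees m′ n (λ e → ⟨ Euler? (suc n) e g ⟩) ⟩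
      pos (n !) * E n (λ e → ⟨ Euler? (suc n) e g ⟩)
        ≡⟨ trans (cong (pos (n !) *_) rooted-eq) (trans (ℤₚ.*-comm (pos (n !)) (pos rooted)) (sym (ℤₚ.pos-* rooted (n !)))) ⟩
      pos (rooted ℕ.* n !) ∎)

  private
    B : ℕ → ℕ → ℕ → ℕ → ℕ
    B g l g₁ g₂ = ((m′ ℕ.* suc l ℕ.+ 2) ∸ 2 ℕ.* g₂) C (2 ℕ.* ((g ∸ g₁) ∸ g₂) ℕ.+ 2)

    module _ (g k l n : ℕ) (sl : suc k ℕ.+ suc l ≡ suc n) {e₁ e₂ a b : ℕ} (h₁ : Euler (suc k) e₁ a) (h₂ : Euler (suc l) e₂ b) where
      φ : ℕ → ℤ
      φ e = ⟨ Euler? (suc n) e g ⟩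

      Euler-iff : ∀ i → i < e₂ → (Euler (suc n) (e₁ ℕ.+ (e₂ ∸ suc i)) g → suc i ℕ.+ 2 ℕ.* (a ℕ.+ b) ≡ 2 ℕ.* g ℕ.+ 2)
        × (suc i ℕ.+ 2 ℕ.* (a ℕ.+ b) ≡ 2 ℕ.* g ℕ.+ 2 → Euler (suc n) (e₁ ℕ.+ (e₂ ∸ suc i)) g)
      Euler-iff i i< =
        (λ h → Euler-glue⁻ {suc k} {suc l} {e₁} {a} {b} {e₂ ∸ suc i} {suc i} h₁ h₂′ {g} (subst (λ s → Euler s (e₁ ℕ.+ (e₂ ∸ suc i)) g) (sym sl) h)) ,
        (λ h → subst (λ s → Euler s (e₁ ℕ.+ (e₂ ∸ suc i)) g) sl (Euler-glue⁺ {suc k} {suc l} {e₁} {a} {b} {e₂ ∸ suc i} {suc i} h₁ h₂′ {g} h))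
        where
        h₂′ : Euler (suc l) ((e₂ ∸ suc i) ℕ.+ suc i) b
        h₂′ = subst (λ e → Euler (suc l) e b) (sym (ℕₚ.m∸n+n≡m i<)) h₂

      -- Euler's formula for the second piece: the upper index of the binomial coefficient is its
      -- number of coloured vertices and faces.
      e₂-formula : (m′ ℕ.* suc l ℕ.+ 2) ∸ 2 ℕ.* b ≡ e₂
      e₂-formula = trans (cong (_∸ 2 ℕ.* b) (sym e₂+2b)) (ℕₚ.m+n∸n≡m e₂ (2 ℕ.* b))
        where
        e₂+2b : e₂ ℕ.+ 2 ℕ.* b ≡ m′ ℕ.* suc l ℕ.+ 2
        e₂+2b = ℕₚ.+-cancelˡ-≡ (suc l) _ _ (trans (sym (ℕₚ.+-assoc (suc l) e₂ (2 ℕ.* b))) (trans h₂ (rearrange l m′)))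
          where
          rearrange : ∀ l m′ → suc l ℕ.* suc m′ ℕ.+ 2 ≡ suc l ℕ.+ (m′ ℕ.* suc l ℕ.+ 2)
          rearrange = ℕ-Solver.solve-∀

      genusSum : ℤ
      genusSum = ∑[ g₁ ∈ upTo (suc g) ] ∑[ g₂ ∈ upTo (suc (g ∸ g₁)) ] ⟨ Euler? (suc k) e₁ g₁ ⟩ * (⟨ Euler? (suc l) e₂ g₂ ⟩ * pos (B g l g₁ g₂))

      genusSum-pick : genusSum ≡ ∑[ g₁ ∈ upTo (suc g) ] ⟨ g₁ ℕₚ.≟ a ⟩ * (∑[ g₂ ∈ upTo (suc (g ∸ g₁)) ] ⟨ g₂ ℕₚ.≟ b ⟩ * pos (B g l g₁ g₂))
      genusSum-pick = ∑-cong (upTo (suc g)) (λ g₁ → trans (sym (∑-*ˡ (upTo (suc (g ∸ g₁))) ⟨ Euler? (suc k) e₁ g₁ ⟩ _)) (cong₂ _*_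
        (⟨⟩-cong (Euler? (suc k) e₁ g₁) (g₁ ℕₚ.≟ a) (λ h → Euler-unique {suc k} {e₁} {g₁} {a} h h₁) (λ { refl → h₁ }))
        (∑-cong (upTo (suc (g ∸ g₁))) (λ g₂ → cong (_* pos (B g l g₁ g₂)) (⟨⟩-cong (Euler? (suc l) e₂ g₂) (g₂ ℕₚ.≟ b) (λ h → Euler-unique {suc l} {e₂} {g₂} {b} h h₂) (λ { refl → h₂ }))))))

      -- The degrees determine the genera a and b, so at most one pair (g₁, g₂) contributes on the
      -- right, and at most the index i + 1 = 2(g - a - b) + 2 on the left. If a + b > g both sides
      -- vanish.
      W-genus : W e₁ e₂ φ ≡ genusSum
      W-genus with (a ℕ.+ b) ℕₚ.≤? g
      ... | yes le = trans W-value (sym (trans genusSum-pick (trans (pick-upTo (suc g) a _ (s≤s (ℕₚ.≤-trans (ℕₚ.m≤m+n a b) le)))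
              (trans (pick-upTo (suc (g ∸ a)) b _ (s≤s (ℕₚ.≤-trans (ℕₚ.≤-reflexive (sym (ℕₚ.m+n∸m≡n a b))) (ℕₚ.∸-monoˡ-≤ a le))))
                (cong (λ x → pos (x C (2 ℕ.* h ℕ.+ 2))) e₂-formula)))))
        where
        open ≡-Reasoning
        h : ℕ
        h = (g ∸ a) ∸ b
        g≡ : h ℕ.+ (a ℕ.+ b) ≡ g
        g≡ = trans (cong (ℕ._+ (a ℕ.+ b)) (ℕₚ.∸-+-assoc g a b)) (ℕₚ.m∸n+n≡m le)
        arith : 2 ℕ.* g ℕ.+ 2 ≡ suc (2 ℕ.* h ℕ.+ 1) ℕ.+ 2 ℕ.* (a ℕ.+ b)
        arith = trans (cong (λ x → 2 ℕ.* x ℕ.+ 2) (sym g≡)) (ring h (a ℕ.+ b))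
          where
          ring : ∀ h s → 2 ℕ.* (h ℕ.+ s) ℕ.+ 2 ≡ suc (2 ℕ.* h ℕ.+ 1) ℕ.+ 2 ℕ.* s
          ring = ℕ-Solver.solve-∀
        suc-h : suc (2 ℕ.* h ℕ.+ 1) ≡ 2 ℕ.* h ℕ.+ 2
        suc-h = sym (ℕₚ.+-suc (2 ℕ.* h) 1)
        W-value : W e₁ e₂ φ ≡ pos (e₂ C (2 ℕ.* h ℕ.+ 2))
        W-value = trans (∑-cong∈ (upTo e₂) (λ {i} i∈ → trans (cong (λ x → ι (odd i) * (pos (e₂ C suc i) * x))
            (⟨⟩-cong (Euler? (suc n) (e₁ ℕ.+ (e₂ ∸ suc i)) g) (i ℕₚ.≟ (2 ℕ.* h ℕ.+ 1))
              (λ eu → ℕₚ.suc-injective (ℕₚ.+-cancelʳ-≡ (2 ℕ.* (a ℕ.+ b)) _ _ (trans (proj₁ (Euler-iff i (∈ₚ.∈-upTo⁻ i∈)) eu) arith)))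
              (λ { refl → proj₂ (Euler-iff i (∈ₚ.∈-upTo⁻ i∈)) (sym arith) }))) (rotate (ι (odd i)) (pos (e₂ C suc i)) _)))
          final
          where
          rotate : ∀ x y z → x * (y * z) ≡ z * (x * y)
          rotate = ℤ-Solver.solve-∀
          f : ℕ → ℤ
          f i = ι (odd i) * pos (e₂ C suc i)
          final : (∑[ i ∈ upTo e₂ ] ⟨ i ℕₚ.≟ (2 ℕ.* h ℕ.+ 1) ⟩ * f i) ≡ pos (e₂ C (2 ℕ.* h ℕ.+ 2))
          final with (2 ℕ.* h ℕ.+ 1) ℕₚ.<? e₂
          ... | yes lt = trans (pick-upTo e₂ (2 ℕ.* h ℕ.+ 1) f lt) (trans (cong₂ (λ o x → ι o * pos (e₂ C x)) (odd-double h) suc-h) (ℤₚ.*-identityˡ _))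
          ... | no ge = trans (pick-upTo-none e₂ (2 ℕ.* h ℕ.+ 1) f (ℕₚ.≮⇒≥ ge))
            (sym (cong pos (k>n⇒nCk≡0 (ℕₚ.≤-trans (s≤s (ℕₚ.≮⇒≥ ge)) (ℕₚ.≤-reflexive suc-h)))))
      ... | no gt = trans W-zero (sym (trans genusSum-pick (outer (a ℕₚ.≤? g))))
        where
        g< : g < a ℕ.+ b
        g< = ℕₚ.≰⇒> gt
        W-zero : W e₁ e₂ φ ≡ 0ℤ
        W-zero = ∑-zero (upTo e₂) (λ {i} i∈ → trans (cong (λ x → ι (odd i) * (pos (e₂ C suc i) * x))
            (⟨⟩-no (Euler? (suc n) (e₁ ℕ.+ (e₂ ∸ suc i)) g) (λ eu → too-big i (proj₁ (Euler-iff i (∈ₚ.∈-upTo⁻ i∈)) eu)))) (zero* (ι (odd i)) (pos (e₂ C suc i))))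
          where
          zero* : ∀ x y → x * (y * 0ℤ) ≡ 0ℤ
          zero* = ℤ-Solver.solve-∀
          too-big : ∀ i → suc i ℕ.+ 2 ℕ.* (a ℕ.+ b) ≢ 2 ℕ.* g ℕ.+ 2
          too-big i e = ℕₚ.1+n≰n (ℕₚ.≤-trans (s≤s (ℕₚ.≤-trans (ℕₚ.*-monoʳ-≤ 2 g<) (ℕₚ.m≤n+m (2 ℕ.* (a ℕ.+ b)) i))) (ℕₚ.≤-reflexive (trans e (ring g))))
            where
            ring : ∀ g → 2 ℕ.* g ℕ.+ 2 ≡ 2 ℕ.* suc g
            ring = ℕ-Solver.solve-∀
        outer : Dec (a ≤ g) → (∑[ g₁ ∈ upTo (suc g) ] ⟨ g₁ ℕₚ.≟ a ⟩ * (∑[ g₂ ∈ upTo (suc (g ∸ g₁)) ] ⟨ g₂ ℕₚ.≟ b ⟩ * pos (B g l g₁ g₂))) ≡ 0ℤ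
        outer (yes le) = trans (pick-upTo (suc g) a _ (s≤s le)) (pick-upTo-none (suc (g ∸ a)) b _
          (ℕₚ.+-cancelˡ-≤ a _ _ (ℕₚ.≤-trans (ℕₚ.≤-reflexive (trans (ℕₚ.+-suc a (g ∸ a)) (cong suc (ℕₚ.m+[n∸m]≡n le)))) g<)))
        outer (no gt′) = pick-upTo-none (suc g) a _ (ℕₚ.≰⇒> gt′)

  rhs-degrees : ∀ g n → pos (rhs m g (suc n)) ≡ ∑[ k ∈ upTo n ] pos (suc k) * ∑∑ n (λ e₁ e₂ → W e₁ e₂ (λ e → ⟨ Euler? (suc n) e g ⟩)) k
  rhs-degrees g n = trans (pos-sum (upTo n) _) (∑-cong∈ (upTo n) (λ {k} k∈ → summand k (∈ₚ.∈-upTo⁻ k∈)))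
    where
    open ≡-Reasoning
    summand : ∀ k → k < n → pos (sum (map (λ g₁ → sum (map (λ g₂ →
        suc k ℕ.* ((((m ∸ 1) ℕ.* (n ∸ k) ℕ.+ 2) ∸ 2 ℕ.* g₂) C (2 ℕ.* ((g ∸ g₁) ∸ g₂) ℕ.+ 2)) ℕ.* (C[ m ] g₁ , suc k) ℕ.* (C[ m ] g₂ , (n ∸ k)))
        (upTo (suc (g ∸ g₁))))) (upTo (suc g)))) ≡
      pos (suc k) * ∑∑ n (λ e₁ e₂ → W e₁ e₂ (λ e → ⟨ Euler? (suc n) e g ⟩)) k
    summand k lt = begin
      _ ≡⟨ trans (pos-sum (upTo (suc g)) _) (∑-cong (upTo (suc g)) (λ g₁ → trans (pos-sum (upTo (suc (g ∸ g₁))) _) (∑-cong (upTo (suc (g ∸ g₁))) (λ g₂ → term g₁ g₂)))) ⟩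
      (∑[ g₁ ∈ upTo (suc g) ] ∑[ g₂ ∈ upTo (suc (g ∸ g₁)) ] pos (suc k) * (∑[ e₁ ∈ deg k ] ∑[ e₂ ∈ deg l ] X g₁ g₂ e₁ e₂))
        ≡⟨ ∑⁴-exchange (upTo (suc g)) (λ g₁ → upTo (suc (g ∸ g₁))) (deg k) (deg l) (pos (suc k)) X ⟩
      pos (suc k) * (∑[ e₁ ∈ deg k ] ∑[ e₂ ∈ deg l ] ∑[ g₁ ∈ upTo (suc g) ] ∑[ g₂ ∈ upTo (suc (g ∸ g₁)) ] X g₁ g₂ e₁ e₂)
        ≡⟨ cong (pos (suc k) *_) (∑-cong∈ (deg k) (λ {e₁} e₁∈ → ∑-cong∈ (deg l) (λ {e₂} e₂∈ →
             let (a , h₁) = degrees-genus k e₁∈ ; (b , h₂) = degrees-genus l e₂∈ in sym (W-genus g k l n (stars lt) {e₁} {e₂} {a} {b} h₁ h₂)))) ⟩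
      pos (suc k) * ∑∑ n (λ e₁ e₂ → W e₁ e₂ (λ e → ⟨ Euler? (suc n) e g ⟩)) k ∎
      where
      l : ℕ
      l = n ∸ suc k
      n∸k : n ∸ k ≡ suc l
      n∸k = ℕₚ.+-∸-assoc 1 lt
      X : ℕ → ℕ → ℕ → ℕ → ℤ
      X g₁ g₂ e₁ e₂ = ⟨ Euler? (suc k) e₁ g₁ ⟩ * (⟨ Euler? (suc l) e₂ g₂ ⟩ * pos (B g l g₁ g₂))
      term : ∀ g₁ g₂ → pos (suc k ℕ.* (((m′ ℕ.* (n ∸ k) ℕ.+ 2) ∸ 2 ℕ.* g₂) C (2 ℕ.* ((g ∸ g₁) ∸ g₂) ℕ.+ 2)) ℕ.* (C[ m ] g₁ , suc k) ℕ.* (C[ m ] g₂ , (n ∸ k))) ≡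
        pos (suc k) * (∑[ e₁ ∈ deg k ] ∑[ e₂ ∈ deg l ] X g₁ g₂ e₁ e₂)
      term g₁ g₂ = begin
        _ ≡⟨ cong (λ x → pos (suc k ℕ.* (((m′ ℕ.* x ℕ.+ 2) ∸ 2 ℕ.* g₂) C (2 ℕ.* ((g ∸ g₁) ∸ g₂) ℕ.+ 2)) ℕ.* (C[ m ] g₁ , suc k) ℕ.* (C[ m ] g₂ , x))) n∸k ⟩
        pos (suc k ℕ.* B g l g₁ g₂ ℕ.* (C[ m ] g₁ , suc k) ℕ.* (C[ m ] g₂ , suc l))
          ≡⟨ trans (ℤₚ.pos-* (suc k ℕ.* B g l g₁ g₂ ℕ.* (C[ m ] g₁ , suc k)) _) (cong (_* pos (C[ m ] g₂ , suc l))
               (trans (ℤₚ.pos-* (suc k ℕ.* B g l g₁ g₂) _) (cong (_* pos (C[ m ] g₁ , suc k)) (ℤₚ.pos-* (suc k) (B g l g₁ g₂))))) ⟩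
        ((pos (suc k) * pos (B g l g₁ g₂)) * pos (C[ m ] g₁ , suc k)) * pos (C[ m ] g₂ , suc l)
          ≡⟨ cong₂ (λ x y → ((pos (suc k) * pos (B g l g₁ g₂)) * x) * y) (C-degrees g₁ k) (C-degrees g₂ l) ⟩
        ((pos (suc k) * pos (B g l g₁ g₂)) * E k (λ e → ⟨ Euler? (suc k) e g₁ ⟩)) * E l (λ e → ⟨ Euler? (suc l) e g₂ ⟩)
          ≡⟨ rearrange (pos (suc k)) (pos (B g l g₁ g₂)) _ _ ⟩
        pos (suc k) * (E k (λ e → ⟨ Euler? (suc k) e g₁ ⟩) * (E l (λ e → ⟨ Euler? (suc l) e g₂ ⟩) * pos (B g l g₁ g₂)))
          ≡⟨ cong (pos (suc k) *_) (trans (∑-*ʳ (deg k) _ _) (∑-cong (deg k) (λ e₁ → trans (cong (⟨ Euler? (suc k) e₁ g₁ ⟩ *_) (∑-*ʳ (deg l) (pos (B g l g₁ g₂)) _))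
               (∑-*ˡ (deg l) ⟨ Euler? (suc k) e₁ g₁ ⟩ _)))) ⟩
        pos (suc k) * (∑[ e₁ ∈ deg k ] ∑[ e₂ ∈ deg l ] X g₁ g₂ e₁ e₂) ∎
        where
        rearrange : ∀ a b c d → ((a * b) * c) * d ≡ a * (c * (d * b))
        rearrange = ℤ-Solver.solve-∀

  -- Both sides are doubled, since the functional recursion carries n (n + 1) on the left and a
  -- factor 2 on the right.
  recursion : ∀ g n → (suc n C 2) ℕ.* (C[ m ] g , suc n) ≡ rhs m g (suc n)
  recursion g n = ℕₚ.*-cancelˡ-≡ _ _ 2 (ℤₚ.+-injective (begin
    pos (2 ℕ.* ((suc n C 2) ℕ.* (C[ m ] g , suc n)))
      ≡⟨ trans (cong pos (sym (ℕₚ.*-assoc 2 (suc n C 2) (C[ m ] g , suc n)))) (cong (λ x → pos (x ℕ.* (C[ m ] g , suc n))) twice-choose-2) ⟩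
    pos (n ℕ.* suc n ℕ.* (C[ m ] g , suc n))
      ≡⟨ trans (ℤₚ.pos-* (n ℕ.* suc n) _) (trans (cong (_* pos (C[ m ] g , suc n)) (ℤₚ.pos-* n (suc n))) (ℤₚ.*-assoc (pos n) (pos (suc n)) _)) ⟩
    pos n * (pos (suc n) * pos (C[ m ] g , suc n))
      ≡⟨ cong (λ x → pos n * (pos (suc n) * x)) (C-degrees g n) ⟩
    pos n * (pos (suc n) * E n (λ e → ⟨ Euler? (suc n) e g ⟩))
      ≡⟨ reduced-recursion n (λ e → ⟨ Euler? (suc n) e g ⟩) ⟩
    pos 2 * (∑[ k ∈ upTo n ] pos (suc k) * ∑∑ n (λ e₁ e₂ → W e₁ e₂ (λ e → ⟨ Euler? (suc n) e g ⟩)) k)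
      ≡⟨ cong (pos 2 *_) (rhs-degrees g n) ⟨
    pos 2 * pos (rhs m g (suc n))
      ≡⟨ ℤₚ.pos-* 2 (rhs m g (suc n)) ⟨
    pos (2 ℕ.* rhs m g (suc n)) ∎))
    where
    open ≡-Reasoning
    -- The case i = 1 of `absorb`, with suc n added on both sides in place of a subtraction.
    twice-choose-2 : 2 ℕ.* (suc n C 2) ≡ n ℕ.* suc n
    twice-choose-2 = ℕₚ.+-cancelʳ-≡ (suc n) _ _ (trans (cong (2 ℕ.* (suc n C 2) ℕ.+_) (sym (trans (ℕₚ.*-identityˡ (suc n C 1)) (nC1≡n (suc n)))))
      (trans (absorb 1 (suc n)) (trans (cong (suc n ℕ.*_) (nC1≡n (suc n))) (ℕₚ.+-comm (suc n) (n ℕ.* suc n)))))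

theorem2 : (m : ℕ) → 1 ≤ m → (g n : ℕ) → 1 ≤ n →
    (n C 2) ℕ.* (C[ m ] g , n) ≡ rhs m g n
theorem2 (suc m′) _ g (suc n) _ = recursion m′ g n
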